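{- Let $q$ be a prime power, $d\geqslant 2$ an integer, and $H$ a fixed hyperplane of $\mathbb{F}_q^{2d+1}$. Let $X_1$ be the set of $(d+1)$-dimensional subspaces of $\mathbb{F}_q^{2d+1}$ not contained in $H$, $X_2$ the set of $(d-1)$-dimensional subspaces of $H$, and let $\tilde{J}_q(2d+1,d)$ be the graph with vertex set $X=X_1\cup X_2$ in which $x,y$ are adjacent iff $\dim x+\dim y-2\dim(x\cap y)=2$. Let $0<t<d$ and let $Y$ be a nonempty subset of $X$ with width $w\leqslant d-t$. Then $|Y|\leqslant\binom{2d+1-t}{d-t}_q$, and equality holds if and only if $Y=\{x\in X_2: u\subseteq x\}$ for some subspace $u$ of $H$ with $\dim u=t-1$.
   Context: The graph $\tilde{J}_q(2d+1,d)$ (the twisted Grassmann graph) is connected with diameter $d$. For a nonempty subset $Y\subseteq X$ with characteristic vector $\chi$, the width is $w=\max\{i:\chi^{\mathsf{T}}A_i\chi\neq0\}$, where $A_i$ is the adjacency matrix of the distance-$i$ graph (path-length distance); equivalently $w$ is the maximum graph distance between two elements of $Y$. $\binom{m}{n}_q$ denotes the Gaussian binomial coefficient, the number of $n$-dimensional subspaces of $\mathbb{F}_q^m$. -}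

module Defs where

open import Level using (0ℓ)
open import Data.Nat using (ℕ; zero; suc; _+_; _*_; _^_; _∸_)
open import Data.Fin using (Fin)
open import Data.List using (List; []; _∷_; length)
open import Data.Product using (Σ; ∃; _×_; _,_)
open import Data.Sum using (_⊎_)
open import Data.Unit using (⊤)
open import Data.Empty using (⊥)
open import Relation.Nullary using (¬_)
open import Relation.Binary.PropositionalEquality using (_≡_)
open import Algebra.Structures using (IsCommutativeRing)

-- A finite field with q elements, realised on the carrier Fin q.
-- (Every finite field of order q is isomorphic to one of this form, and
-- such a field exists iff q is a prime power; so quantifying over all
-- such records is "q a prime power, F = F_q".)

record FiniteField (q : ℕ) : Set where
  field
    _+F_ _*F_ : Fin q → Fin q → Fin q
    -F_       : Fin q → Fin q
    0F 1F     : Fin q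
    isCommutativeRing : IsCommutativeRing _≡_ _+F_ _*F_ -F_ 0F 1F
    0≢1       : ¬ (0F ≡ 1F)
    inv       : (a : Fin q) → ¬ (a ≡ 0F) → Σ (Fin q) λ b → a *F b ≡ 1F

module LinAlg {q : ℕ} (F : FiniteField q) where
  open FiniteField F

  Vect : ℕ → Set
  Vect n = Fin n → Fin q

  _⊕_ : ∀ {n} → Vect n → Vect n → Vect n
  (u ⊕ v) i = u i +F v i

  _⊙_ : ∀ {n} → Fin q → Vect n → Vect n
  (c ⊙ v) i = c *F v i

  ⊖_ : ∀ {n} → Vect n → Vect n
  (⊖ v) i = -F (v i)

  IsZero : ∀ {n} → Vect n → Set
  IsZero v = ∀ i → v i ≡ 0F

  InSpan : ∀ {n} → List (Vect n) → Vect n → Set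
  InSpan []       v = IsZero v
  InSpan (b ∷ bs) v = Σ (Fin q) λ c → InSpan bs (v ⊕ (⊖ (c ⊙ b)))

  LinIndep : ∀ {n} → List (Vect n) → Set
  LinIndep []       = ⊤
  LinIndep (b ∷ bs) = ¬ InSpan bs b × LinIndep bs

  record Subspace (n : ℕ) : Set where
    constructor sub
    field
      basis : List (Vect n)
      indep : LinIndep basis

  open Subspace public

  dim : ∀ {n} → Subspace n → ℕ
  dim x = length (basis x)

  _∈S_ : ∀ {n} → Vect n → Subspace n → Set
  v ∈S x = InSpan (basis x) v

  _⊆S_ : ∀ {n} → Subspace n → Subspace n → Set
  x ⊆S y = ∀ v → v ∈S x → v ∈S y

  _≈S_ : ∀ {n} → Subspace n → Subspace n → Set
  x ≈S y = x ⊆S y × y ⊆S x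

  DimMeet : ∀ {n} → Subspace n → Subspace n → ℕ → Set
  DimMeet x y k = Σ (List (Vect _)) λ b → LinIndep b × length b ≡ k ×
    (∀ v → (InSpan b v → v ∈S x × v ∈S y) × (v ∈S x × v ∈S y → InSpan b v))

  module Twisted (d : ℕ) (H : Subspace (suc (2 * d))) where

    N : ℕ
    N = suc (2 * d)

    InX₁ : Subspace N → Set
    InX₁ x = dim x ≡ suc d × ¬ (x ⊆S H)

    InX₂ : Subspace N → Set
    InX₂ x = dim x ≡ d ∸ 1 × x ⊆S H

    InX : Subspace N → Set
    InX x = InX₁ x ⊎ InX₂ x

    Adj : Subspace N → Subspace N → Set
    Adj x y = InX x × InX y × ∃ λ k → DimMeet x y k × dim x + dim y ≡ 2 + 2 * k

    data WithinDist : ℕ → Subspace N → Subspace N → Set where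
      here : ∀ {m x y} → x ≈S y → WithinDist m x y
      step : ∀ {m x y z} → Adj x z → WithinDist m z y → WithinDist (suc m) x y

-- Gaussian binomial coefficient [n choose k]_q via the q-Pascal rule
-- [n+1, k+1] = [n, k] + q^(k+1) [n, k+1]

gauss : ℕ → ℕ → ℕ → ℕ
gauss q n       zero    = 1
gauss q zero    (suc k) = 0
gauss q (suc n) (suc k) = gauss q n k + q ^ suc k * gauss q n (suc k)

{-# OPTIONS --safe #-}
module Submission where

-- Write mm x y = d − ∂(x, y) and Φₛ(x, y) = [mm x y, s]_q.  The adjacency operator A of the graph
-- satisfies A Φₛ = θₛ Φₛ + [d−s+1]² Φₛ₋₁ with θ₀ > θ₁ > … > θ_d, so certain combinations Eⱼ of
-- Φ₀, …, Φⱼ are eigenkernels of A; they are idempotent up to a positive factor, hence positive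
-- semidefinite.  A quadrature argument gives K = Σ μⱼ Eⱼ, over j ∈ {0, t+1, …, d} and with all
-- μⱼ > 0, that vanishes at the distances 1, …, d−t.  Summing K over Y × Y yields the bound.
--
-- In the case of equality Eⱼ annihilates the characteristic vector of Y for j > t.  The same
-- quadrature then determines the number of neighbours in Y of each x ∈ Y, and shows that more than
-- half of Y is at distance d−t from x.  Any z ∈ Y at distance d−t from x confines the neighbours y
-- of x in Y: x ∩ z ⊆ y or y ⊆ (x ∩ y) + z.  Two such z with different x ∩ z (or different x + z)
-- leave too few neighbours, and comparing the members of Y through common z's gives the structure.

open import Defs

-- The obstacle is that vertices come in two kinds, so intersections are counted separately for each
-- combination of kinds. All four counts nevertheless give one rule, the three-term operator `tri`,
-- with the parameters of the Grassmann graph of d-subspaces of a (2d+1)-space. For two members of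
-- X₁ the reason is visible: the covers of x ∩ H inside H, which are not vertices, would contribute
-- exactly as much as the hyperplanes of x ∩ H, which take their place. From then on every kernel is
-- a function of the single number `mm`. The quadrature works because two vanishing patterns match:
-- `ψ s` annihilates every eigenkernel of index above s, and as a function it is zero below s.
-- Testing against ψ t, ..., ψ d is therefore triangular in the chosen nodes and sees only the
-- values mm ≥ t, which are those that occur in Y. In the equality case the serious rival is the
-- family of all (d + 1)-spaces inside a space of dimension 2d + 1 - t. Their number is exactly the
-- bound, but those contained in H are not vertices, so the rival falls short. All identities stay
-- in ℤ; denominators are replaced by positive common factors.

module TwistedGrassmann where

  open import Level using (0ℓ)
  open import Algebra.Bundles using (CommutativeRing)
  import Algebra.Properties.Ring as RingProperties
  import Algebra.Properties.CommutativeSemigroup as CommutativeSemigroupProperties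
  open import Data.Nat as ℕ using (ℕ; zero; suc; _∸_; z≤n; s≤s)
  import Data.Nat.Properties as ℕ
  open import Data.Nat.Tactic.RingSolver using () renaming (solve-∀ to solveℕ)
  open import Data.Integer using (ℤ; +_; -[1+_]; -_; _+_; _*_; _-_; _≤_; _<_; 0ℤ; 1ℤ; +≤+; +<+; positive; nonNegative; ≢-nonZero; drop‿+≤+)
  import Data.Integer.Properties as ℤ
  open import Data.Integer.Tactic.RingSolver using (solve-∀)
  open import Data.Fin using (Fin; zero; suc)
  import Data.Fin.Properties as Fin
  open import Data.List using (List; []; _∷_; length; map; concatMap; filter; _++_; allFin)
  open import Data.List.Properties using (length-++; length-map; length-tabulate)
  open import Data.List.Membership.Propositional using (_∈_)
  open import Data.List.Membership.Propositional.Properties using (∈-allFin; ∈-filter⁺; ∈-filter⁻; ∈-++⁺ˡ)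
  open import Data.List.Relation.Binary.Pointwise as Pw using (Pointwise; []; _∷_)
  open import Data.List.Relation.Unary.Any as Any using (Any; here; there)
  import Data.List.Relation.Unary.Any.Properties as Any
  open import Data.List.Relation.Unary.All as All using (All; []; _∷_)
  import Data.List.Relation.Unary.All.Properties as All
  open import Data.List.Relation.Unary.AllPairs as AllPairs using (AllPairs; []; _∷_)
  import Data.List.Relation.Unary.AllPairs.Properties as AllPairs
  open import Data.List.Relation.Unary.Unique.Propositional.Properties using (allFin⁺)
  open import Data.Product using (Σ; _×_; _,_; proj₁; proj₂)
  open import Data.Sum using (_⊎_; inj₁; inj₂)
  open import Data.Unit using (⊤; tt)
  open import Data.Empty using (⊥; ⊥-elim)
  open import Function.Bundles using (_⇔_; mk⇔; Equivalence)
  open import Relation.Binary using (tri<; tri≈; tri>)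
  open import Relation.Binary.PropositionalEquality using (_≡_; _≢_; refl; sym; trans; cong; cong₂; subst; subst₂; module ≡-Reasoning)
  open import Relation.Nullary using (¬_; Dec; yes; no; contradiction)
  open import Relation.Nullary.Decidable using (_×-dec_; _⊎-dec_; ¬?; map′)

  -- Finite sums

  module _ {A : Set} where

    ∑ : List A → (A → ℤ) → ℤ
    ∑ []       f = 0ℤ
    ∑ (x ∷ xs) f = f x + ∑ xs f

    ∑-cong∈ : ∀ xs {f g : A → ℤ} → (∀ x → x ∈ xs → f x ≡ g x) → ∑ xs f ≡ ∑ xs g
    ∑-cong∈ []       e = refl
    ∑-cong∈ (x ∷ xs) e = cong₂ _+_ (e x (here refl)) (∑-cong∈ xs λ y y∈ → e y (there y∈))

    ∑-cong : ∀ xs {f g : A → ℤ} → (∀ x → f x ≡ g x) → ∑ xs f ≡ ∑ xs g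
    ∑-cong xs e = ∑-cong∈ xs λ x _ → e x

    ∑-0 : ∀ (xs : List A) → ∑ xs (λ _ → 0ℤ) ≡ 0ℤ
    ∑-0 []       = refl
    ∑-0 (x ∷ xs) = trans (ℤ.+-identityˡ _) (∑-0 xs)

    ∑-+ : ∀ xs (f g : A → ℤ) → ∑ xs (λ x → f x + g x) ≡ ∑ xs f + ∑ xs g
    ∑-+ []       f g = refl
    ∑-+ (x ∷ xs) f g = trans (cong (λ s → (f x + g x) + s) (∑-+ xs f g)) (interchange (f x) (g x) _ _)
      where
      interchange : ∀ a b c d → (a + b) + (c + d) ≡ (a + c) + (b + d)
      interchange = solve-∀

    ∑-*ˡ : ∀ xs c (f : A → ℤ) → ∑ xs (λ x → c * f x) ≡ c * ∑ xs f
    ∑-*ˡ []       c f = sym (ℤ.*-zeroʳ c)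
    ∑-*ˡ (x ∷ xs) c f = trans (cong (λ s → c * f x + s) (∑-*ˡ xs c f)) (sym (ℤ.*-distribˡ-+ c (f x) _))

    ∑-*ʳ : ∀ xs c (f : A → ℤ) → ∑ xs (λ x → f x * c) ≡ ∑ xs f * c
    ∑-*ʳ xs c f = trans (∑-cong xs λ x → ℤ.*-comm (f x) c) (trans (∑-*ˡ xs c f) (ℤ.*-comm c _))

    ∑-const : ∀ (xs : List A) c → ∑ xs (λ _ → c) ≡ + length xs * c
    ∑-const []       c = sym (ℤ.*-zeroˡ c)
    ∑-const (x ∷ xs) c = trans (cong (λ s → c + s) (∑-const xs c)) (sym (ℤ.suc-* (+ length xs) c))

    ∑-1 : ∀ (xs : List A) → ∑ xs (λ _ → 1ℤ) ≡ + length xs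
    ∑-1 xs = trans (∑-const xs 1ℤ) (ℤ.*-identityʳ _)

    ∑-- : ∀ xs (f g : A → ℤ) → ∑ xs (λ x → f x - g x) ≡ ∑ xs f - ∑ xs g
    ∑-- []       f g = refl
    ∑-- (x ∷ xs) f g = trans (cong (λ s → (f x - g x) + s) (∑-- xs f g)) (interchange (f x) (g x) _ _)
      where
      interchange : ∀ a b c d → (a - b) + (c - d) ≡ (a + c) - (b + d)
      interchange = solve-∀

    ∑-mono : ∀ xs {f g : A → ℤ} → (∀ x → x ∈ xs → f x ≤ g x) → ∑ xs f ≤ ∑ xs g
    ∑-mono []       e = ℤ.≤-refl
    ∑-mono (x ∷ xs) e = ℤ.+-mono-≤ (e x (here refl)) (∑-mono xs λ y y∈ → e y (there y∈))

    ∑-nonneg : ∀ xs {f : A → ℤ} → (∀ x → x ∈ xs → 0ℤ ≤ f x) → 0ℤ ≤ ∑ xs f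
    ∑-nonneg xs e = subst (_≤ ∑ xs _) (∑-0 xs) (∑-mono xs e)

    +-zeros : ∀ {a b} → 0ℤ ≤ a → 0ℤ ≤ b → a + b ≡ 0ℤ → a ≡ 0ℤ × b ≡ 0ℤ
    +-zeros {+ zero}  {+ b}     _ _ e = refl , trans (sym (ℤ.+-identityˡ (+ b))) e
    +-zeros {+ suc a} {+ b}     _ _ ()

    ∑-nonneg-0 : ∀ xs {f : A → ℤ} → (∀ x → x ∈ xs → 0ℤ ≤ f x) → ∑ xs f ≡ 0ℤ → ∀ x → x ∈ xs → f x ≡ 0ℤ
    ∑-nonneg-0 (y ∷ xs) p e x (here refl) =
      proj₁ (+-zeros (p y (here refl)) (∑-nonneg xs λ z z∈ → p z (there z∈)) e)
    ∑-nonneg-0 (y ∷ xs) p e x (there x∈) = ∑-nonneg-0 xs (λ z z∈ → p z (there z∈))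
      (proj₂ (+-zeros (p y (here refl)) (∑-nonneg xs λ z z∈ → p z (there z∈)) e)) x x∈

  ∑-swap : ∀ {A B : Set} (xs : List A) (ys : List B) (f : A → B → ℤ) →
    ∑ xs (λ x → ∑ ys (f x)) ≡ ∑ ys (λ y → ∑ xs (λ x → f x y))
  ∑-swap []       ys f = sym (∑-0 ys)
  ∑-swap (x ∷ xs) ys f = trans (cong (λ s → ∑ ys (f x) + s) (∑-swap xs ys f)) (sym (∑-+ ys (f x) _))

  ⟦_⟧ : {P : Set} → Dec P → ℤ
  ⟦ yes _ ⟧ = 1ℤ
  ⟦ no _ ⟧  = 0ℤ

  ⟦⟧-cong : {P Q : Set} (p : Dec P) (q : Dec Q) → (P → Q) → (Q → P) → ⟦ p ⟧ ≡ ⟦ q ⟧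
  ⟦⟧-cong (yes p) (yes q) f g = refl
  ⟦⟧-cong (yes p) (no ¬q) f g = contradiction (f p) ¬q
  ⟦⟧-cong (no ¬p) (yes q) f g = contradiction (g q) ¬p
  ⟦⟧-cong (no ¬p) (no ¬q) f g = refl

  ⟦⟧-yes : {P : Set} (p : Dec P) → P → ⟦ p ⟧ ≡ 1ℤ
  ⟦⟧-yes (yes _) _ = refl
  ⟦⟧-yes (no ¬p) p = contradiction p ¬p

  ⟦⟧-no : {P : Set} (p : Dec P) → ¬ P → ⟦ p ⟧ ≡ 0ℤ
  ⟦⟧-no (yes p) ¬p = contradiction p ¬p
  ⟦⟧-no (no _) _ = refl

  ⟦⟧-× : {P Q : Set} (p : Dec P) (q : Dec Q) → ⟦ p ×-dec q ⟧ ≡ ⟦ p ⟧ * ⟦ q ⟧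
  ⟦⟧-× (yes _) (yes _) = refl
  ⟦⟧-× (yes _) (no _)  = refl
  ⟦⟧-× (no _)  (yes _) = refl
  ⟦⟧-× (no _)  (no _)  = refl

  ⟦⟧-mono : {P Q : Set} (p : Dec P) (q : Dec Q) → (P → Q) → ⟦ p ⟧ ≤ ⟦ q ⟧
  ⟦⟧-mono (yes p) (yes q) f = ℤ.≤-refl
  ⟦⟧-mono (yes p) (no ¬q) f = contradiction (f p) ¬q
  ⟦⟧-mono (no _)  (yes _) f = +≤+ ℕ.z≤n
  ⟦⟧-mono (no _)  (no _)  f = ℤ.≤-refl

  ⟦⟧-nonneg : {P : Set} (p : Dec P) → 0ℤ ≤ ⟦ p ⟧
  ⟦⟧-nonneg (yes _) = +≤+ ℕ.z≤n
  ⟦⟧-nonneg (no _)  = ℤ.≤-refl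

  ⟦⟧≤1 : {P : Set} (p : Dec P) → ⟦ p ⟧ ≤ 1ℤ
  ⟦⟧≤1 (yes _) = ℤ.≤-refl
  ⟦⟧≤1 (no _)  = +≤+ ℕ.z≤n

  ⟦⟧*-cong : {P : Set} (p : Dec P) {a b : ℤ} → (P → a ≡ b) → ⟦ p ⟧ * a ≡ ⟦ p ⟧ * b
  ⟦⟧*-cong (yes p) e = cong (1ℤ *_) (e p)
  ⟦⟧*-cong (no _) {a} {b} e = trans (ℤ.*-zeroˡ a) (sym (ℤ.*-zeroˡ b))

  ⟦⟧*-mono : {P : Set} (p : Dec P) {a b : ℤ} → (P → a ≤ b) → ⟦ p ⟧ * a ≤ ⟦ p ⟧ * b
  ⟦⟧*-mono (yes p) {a} {b} e = subst (λ u → u ≤ 1ℤ * b) (sym (ℤ.*-identityˡ a)) (subst (a ≤_) (sym (ℤ.*-identityˡ b)) (e p))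
  ⟦⟧*-mono (no _) {a} {b} e = ℤ.≤-reflexive (trans (ℤ.*-zeroˡ a) (sym (ℤ.*-zeroˡ b)))

  ∑-⟦⟧-cong : {A : Set} {P : A → Set} (P? : ∀ x → Dec (P x)) (xs : List A) {f g : A → ℤ} →
    (∀ x → P x → f x ≡ g x) → ∑ xs (λ x → ⟦ P? x ⟧ * f x) ≡ ∑ xs (λ x → ⟦ P? x ⟧ * g x)
  ∑-⟦⟧-cong P? xs e = ∑-cong xs λ x → ⟦⟧*-cong (P? x) (e x)

  -- Prepared for intersection dimensions: over the covers or the hyperplanes of a space, the
  -- dimension of the intersection with a fixed y takes only two values, one of them on a subfamily
  -- that can be counted.
  ∑-⟦⟧-split : {A : Set} {P Q : A → Set} (P? : ∀ x → Dec (P x)) (Q? : ∀ x → Dec (Q x)) (xs : List A) (f : A → ℤ) (a b : ℤ) →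
    (∀ x → Q x → P x) → (∀ x → P x → Q x → f x ≡ a) → (∀ x → P x → ¬ Q x → f x ≡ b) →
    ∑ xs (λ x → ⟦ P? x ⟧ * f x) ≡ ∑ xs (λ x → ⟦ Q? x ⟧) * a + (∑ xs (λ x → ⟦ P? x ⟧) - ∑ xs (λ x → ⟦ Q? x ⟧)) * b
  ∑-⟦⟧-split P? Q? xs f a b Q⇒P ea eb = begin
    ∑ xs (λ x → ⟦ P? x ⟧ * f x)
      ≡⟨ ∑-cong xs pointwise ⟩
    ∑ xs (λ x → ⟦ Q? x ⟧ * a + (⟦ P? x ⟧ - ⟦ Q? x ⟧) * b)
      ≡⟨ ∑-+ xs _ _ ⟩
    ∑ xs (λ x → ⟦ Q? x ⟧ * a) + ∑ xs (λ x → (⟦ P? x ⟧ - ⟦ Q? x ⟧) * b)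
      ≡⟨ cong₂ _+_ (∑-*ʳ xs a _) (trans (∑-*ʳ xs b _) (cong (_* b) (∑-- xs _ _))) ⟩
    ∑ xs (λ x → ⟦ Q? x ⟧) * a + (∑ xs (λ x → ⟦ P? x ⟧) - ∑ xs (λ x → ⟦ Q? x ⟧)) * b ∎
    where
    open ≡-Reasoning
    h1 : ∀ a b → 1ℤ * a ≡ 1ℤ * a + (1ℤ - 1ℤ) * b
    h1 = solve-∀
    h2 : ∀ a b → 1ℤ * b ≡ 0ℤ * a + (1ℤ - 0ℤ) * b
    h2 = solve-∀
    h3 : ∀ a b c → 0ℤ * c ≡ 0ℤ * a + (0ℤ - 0ℤ) * b
    h3 = solve-∀
    pointwise : ∀ x → ⟦ P? x ⟧ * f x ≡ ⟦ Q? x ⟧ * a + (⟦ P? x ⟧ - ⟦ Q? x ⟧) * b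
    pointwise x with P? x | Q? x
    ... | yes p | yes q = trans (cong (1ℤ *_) (ea x p q)) (h1 a b)
    ... | yes p | no ¬q = trans (cong (1ℤ *_) (eb x p ¬q)) (h2 a b)
    ... | no ¬p | yes q = contradiction (Q⇒P x q) ¬p
    ... | no ¬p | no ¬q = h3 a b (f x)

  -- Sums over lists of representatives of an equivalence.

  module Classes {A : Set} (_≈_ : A → A → Set) (≈-sym : ∀ {a b} → a ≈ b → b ≈ a)
    (≈-trans : ∀ {a b c} → a ≈ b → b ≈ c → a ≈ c) (_≟_ : ∀ a b → Dec (a ≈ b)) where

    Uniq : List A → Set
    Uniq = AllPairs (λ a b → ¬ (a ≈ b))

    Hits : A → List A → Set
    Hits a = Any (a ≈_)

    private
      miss-0 : ∀ a xs (f : A → ℤ) → All (λ x → ¬ (a ≈ x)) xs → ∑ xs (λ x → ⟦ a ≟ x ⟧ * f x) ≡ 0ℤ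
      miss-0 a [] f [] = refl
      miss-0 a (x ∷ xs) f (p ∷ ps) =
        trans (cong₂ _+_ (trans (cong (_* f x) (⟦⟧-no (a ≟ x) p)) (ℤ.*-zeroˡ (f x))) (miss-0 a xs f ps)) refl

    ∑-pick : ∀ a xs (f : A → ℤ) → Uniq xs → Hits a xs → (∀ {b} → a ≈ b → f a ≡ f b) →
      ∑ xs (λ x → ⟦ a ≟ x ⟧ * f x) ≡ f a
    ∑-pick a (x ∷ xs) f (u ∷ us) (here a≈x) fr = begin
      ⟦ a ≟ x ⟧ * f x + ∑ xs (λ y → ⟦ a ≟ y ⟧ * f y)
        ≡⟨ cong₂ _+_ (trans (cong (_* f x) (⟦⟧-yes (a ≟ x) a≈x)) (ℤ.*-identityˡ (f x)))
             (miss-0 a xs f (All.map (λ n a≈y → n (≈-trans (≈-sym a≈x) a≈y)) u)) ⟩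
      f x + 0ℤ ≡⟨ ℤ.+-identityʳ (f x) ⟩
      f x ≡⟨ sym (fr a≈x) ⟩
      f a ∎
      where open ≡-Reasoning
    ∑-pick a (x ∷ xs) f (u ∷ us) (there p) fr with a ≟ x
    ... | yes a≈x = contradiction p (λ q → absurd q u)
      where
      absurd : ∀ {ys} → Hits a ys → All (λ y → ¬ (x ≈ y)) ys → ⊥
      absurd (here e)  (n ∷ _)  = n (≈-trans (≈-sym a≈x) e)
      absurd (there q) (_ ∷ ns) = absurd q ns
    ... | no _ = trans (cong (_+ ∑ xs (λ y → ⟦ a ≟ y ⟧ * f y)) (ℤ.*-zeroˡ (f x)))
                   (trans (ℤ.+-identityˡ _) (∑-pick a xs f us p fr))

    hits? : ∀ a xs → Dec (Hits a xs)
    hits? a [] = no λ ()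
    hits? a (x ∷ xs) with a ≟ x | hits? a xs
    ... | yes p | _     = yes (here p)
    ... | no _  | yes q = yes (there q)
    ... | no ¬p | no ¬q = no λ { (here p) → ¬p p ; (there q) → ¬q q }

    ¬hits⇒All : ∀ a xs → ¬ Hits a xs → All (λ x → ¬ (a ≈ x)) xs
    ¬hits⇒All a [] n = []
    ¬hits⇒All a (x ∷ xs) n = (λ e → n (here e)) ∷ ¬hits⇒All a xs λ q → n (there q)

    ∑-hits : ∀ a xs → Uniq xs → ∑ xs (λ x → ⟦ a ≟ x ⟧) ≡ ⟦ hits? a xs ⟧
    ∑-hits a xs u with hits? a xs
    ... | yes h = trans (∑-cong xs λ x → sym (ℤ.*-identityʳ _)) (∑-pick a xs (λ _ → 1ℤ) u h λ _ → refl)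
    ... | no ¬h = trans (∑-cong xs λ x → sym (ℤ.*-identityʳ _)) (miss-0 a xs (λ _ → 1ℤ) (¬hits⇒All a xs ¬h))

    ∈⇒hits : ∀ {a xs} → a ≈ a → a ∈ xs → Hits a xs
    ∈⇒hits r (here refl) = here r
    ∈⇒hits r (there p)   = there (∈⇒hits r p)

    module _ {Q : A → Set} (Q? : ∀ x → Dec (Q x)) where

      ∑-unique : ∀ a xs (f : A → ℤ) → Uniq xs → Hits a xs → (∀ {b} → a ≈ b → f a ≡ f b) →
        (∀ x → Q x → a ≈ x) → (∀ x → a ≈ x → Q x) → ∑ xs (λ x → ⟦ Q? x ⟧ * f x) ≡ f a
      ∑-unique a xs f u h fr to from =
        trans (∑-cong xs λ x → cong (_* f x) (⟦⟧-cong (Q? x) (a ≟ x) (to x) (from x))) (∑-pick a xs f u h fr)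

      private
        -- Both sides evaluate the double sum of `⟦ x ≟ y ⟧ * f y`: each x meets exactly one member
        -- of `ys`, and each y meets at most one member of `xs`.
        double : ∀ xs ys (f : A → ℤ) → Uniq ys → (∀ x → x ∈ xs → Hits x ys) →
          (∀ {a b} → a ≈ b → f a ≡ f b) →
          Uniq xs → ∑ xs f ≡ ∑ ys (λ y → ⟦ hits? y xs ⟧ * f y)
        double xs ys f uy hy fr ux = begin
          ∑ xs f ≡⟨ ∑-cong∈ xs (λ x x∈ → sym (∑-pick x ys f uy (hy x x∈) fr)) ⟩
          ∑ xs (λ x → ∑ ys (λ y → ⟦ x ≟ y ⟧ * f y)) ≡⟨ ∑-swap xs ys _ ⟩
          ∑ ys (λ y → ∑ xs (λ x → ⟦ x ≟ y ⟧ * f y)) ≡⟨ ∑-cong ys (λ y → ∑-*ʳ xs (f y) _) ⟩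
          ∑ ys (λ y → ∑ xs (λ x → ⟦ x ≟ y ⟧) * f y)
            ≡⟨ ∑-cong ys (λ y → cong (_* f y) (trans (∑-cong xs λ x → ⟦⟧-cong (x ≟ y) (y ≟ x) ≈-sym ≈-sym) (∑-hits y xs ux))) ⟩
          ∑ ys (λ y → ⟦ hits? y xs ⟧ * f y) ∎
          where open ≡-Reasoning

        hits-Q : (∀ {a b} → a ≈ b → Q a → Q b) → ∀ {y} xs → (∀ x → x ∈ xs → Q x) → Hits y xs → Q y
        hits-Q Qr (x ∷ xs) q (here e)  = Qr (≈-sym e) (q x (here refl))
        hits-Q Qr (x ∷ xs) q (there p) = hits-Q Qr xs (λ z z∈ → q z (there z∈)) p

      ∑-reindex : ∀ xs ys (f : A → ℤ) → Uniq xs → Uniq ys → (∀ {a b} → a ≈ b → f a ≡ f b) →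
        (∀ {a b} → a ≈ b → Q a → Q b) →
        (∀ x → x ∈ xs → Hits x ys × Q x) → (∀ y → Q y → Hits y xs) →
        ∑ ys (λ y → ⟦ Q? y ⟧ * f y) ≡ ∑ xs f
      ∑-reindex xs ys f ux uy fr Qr xq qx = trans
        (∑-cong ys λ y → cong (_* f y) (⟦⟧-cong (Q? y) (hits? y xs) (qx y) (hits-Q Qr xs λ x x∈ → proj₂ (xq x x∈))))
        (sym (double xs ys f uy (λ x x∈ → proj₁ (xq x x∈)) fr ux))

      length≤∑ : ∀ xs ys → Uniq xs → Uniq ys → (∀ {a b} → a ≈ b → Q a → Q b) →
        (∀ x → x ∈ xs → Hits x ys × Q x) → + length xs ≤ ∑ ys (λ y → ⟦ Q? y ⟧)
      length≤∑ xs ys ux uy Qr xq = subst (_≤ ∑ ys (λ y → ⟦ Q? y ⟧))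
        (trans (sym (double xs ys (λ _ → 1ℤ) uy (λ x x∈ → proj₁ (xq x x∈)) (λ _ → refl) ux)) (∑-1 xs))
        (∑-mono ys λ y _ → subst (_≤ ⟦ Q? y ⟧) (sym (ℤ.*-identityʳ _))
          (⟦⟧-mono (hits? y xs) (Q? y) (hits-Q Qr xs λ x x∈ → proj₂ (xq x x∈))))

      -- The indicator of `Q` minus that of being hit is nonnegative and sums to zero, so it
      -- vanishes everywhere. This turns equality of sizes into equality of families when Y is
      -- compared with the whole star of u.
      length≡∑⇒hits : ∀ xs ys → Uniq xs → Uniq ys → (∀ {a b} → a ≈ b → Q a → Q b) →
        (∀ x → x ∈ xs → Hits x ys × Q x) → + length xs ≡ ∑ ys (λ y → ⟦ Q? y ⟧) →
        ∀ y → y ∈ ys → Q y → Hits y xs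
      length≡∑⇒hits xs ys ux uy Qr xq e y y∈ qy with hits? y xs in eq
      ... | yes h = h
      ... | no ¬h = contradiction (trans (sym diff≡1) diff≡0) λ ()
        where
        le : ∀ z → ⟦ hits? z xs ⟧ ≤ ⟦ Q? z ⟧
        le z = ⟦⟧-mono (hits? z xs) (Q? z) (hits-Q Qr xs λ x x∈ → proj₂ (xq x x∈))
        total : ∑ ys (λ z → ⟦ Q? z ⟧ - ⟦ hits? z xs ⟧) ≡ 0ℤ
        total = trans (∑-- ys _ _) (trans (cong (λ s → ∑ ys (λ z → ⟦ Q? z ⟧) - s)
          (trans (∑-cong ys λ z → sym (ℤ.*-identityʳ _))
            (trans (sym (double xs ys (λ _ → 1ℤ) uy (λ x x∈ → proj₁ (xq x x∈)) (λ _ → refl) ux)) (trans (∑-1 xs) e))))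
          (ℤ.+-inverseʳ (∑ ys (λ z → ⟦ Q? z ⟧))))
        diff≡0 : ⟦ Q? y ⟧ - ⟦ hits? y xs ⟧ ≡ 0ℤ
        diff≡0 = ∑-nonneg-0 ys (λ z _ → ℤ.i≤j⇒0≤j-i (le z)) total y y∈
        diff≡1 : ⟦ Q? y ⟧ - ⟦ hits? y xs ⟧ ≡ 1ℤ
        diff≡1 = cong₂ _-_ (⟦⟧-yes (Q? y) qy) (⟦⟧-no (hits? y xs) ¬h)

  -- Subspaces of a finite vector space

  module _ {A B C : Set} (f : A → B → C) where

    prodMap : List A → List B → List C
    prodMap xs ys = concatMap (λ x → map (f x) ys) xs

    length-prodMap : ∀ xs ys → length (prodMap xs ys) ≡ length xs ℕ.* length ys
    length-prodMap []       ys = refl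
    length-prodMap (x ∷ xs) ys = trans (length-++ (map (f x) ys)) (cong₂ ℕ._+_ (length-map (f x) ys) (length-prodMap xs ys))

    Any-prodMap : ∀ {P : C → Set} {xs ys} {x} → x ∈ xs → Any (λ y → P (f x y)) ys → Any P (prodMap xs ys)
    Any-prodMap {P} x∈ p = Any.concat⁺ (Any.map⁺ (Any.map (λ { refl → Any.map⁺ p }) x∈))

    All-prodMap : ∀ {P : C → Set} xs ys → (∀ x y → y ∈ ys → P (f x y)) → All P (prodMap xs ys)
    All-prodMap []       ys h = []
    All-prodMap (x ∷ xs) ys h = All.++⁺ (All.map⁺ (All.tabulate λ {y} y∈ → h x y y∈)) (All-prodMap xs ys h)

    Unique-prodMap : ∀ {_≈_ : C → C → Set} {_~_ : B → B → Set} {xs ys} →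
      (∀ {x x′ y y′} → f x y ≈ f x′ y′ → x ≡ x′ × y ~ y′) →
      AllPairs _≢_ xs → AllPairs (λ a b → ¬ (a ~ b)) ys → AllPairs (λ a b → ¬ (a ≈ b)) (prodMap xs ys)
    Unique-prodMap inj []       uy = []
    Unique-prodMap inj (n ∷ ux) uy = AllPairs.++⁺
      (AllPairs.map⁺ (AllPairs.map (λ ¬r e → ¬r (proj₂ (inj e))) uy))
      (Unique-prodMap inj ux uy)
      (All.map⁺ (All.tabulate λ _ → All.concat⁺ (All.map⁺ (All.map (λ x≢ → All.map⁺ (All.tabulate λ _ e → x≢ (proj₁ (inj e)))) n))))

  module Spaces {q : ℕ} (F : FiniteField q) where
    open FiniteField F
    open LinAlg F public

    private
      ring : CommutativeRing 0ℓ 0ℓ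
      ring = record { isCommutativeRing = isCommutativeRing }
      module R = CommutativeRing ring
      open RingProperties R.ring using (-‿distribˡ-*; -‿distribʳ-*; -‿+-comm; -1*x≈-x; -0#≈0#)
      open CommutativeSemigroupProperties R.+-commutativeSemigroup using (interchange; xy∙z≈xz∙y)

    infix 4 _≐_
    _≐_ : ∀ {n} → Vect n → Vect n → Set
    u ≐ v = ∀ i → u i ≡ v i

    _≐?_ : ∀ {n} (u v : Vect n) → Dec (u ≐ v)
    u ≐? v = Fin.all? λ i → u i Fin.≟ v i

    0V : ∀ {n} → Vect n
    0V _ = 0F

    _-V_ : ∀ {n} → Vect n → Vect n → Vect n
    u -V v = u ⊕ (⊖ v)

    private
      sub-+ : ∀ u v c e b → (u +F v) +F (-F ((c +F e) *F b)) ≡ (u +F (-F (c *F b))) +F (v +F (-F (e *F b)))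
      sub-+ u v c e b = trans (cong (λ z → (u +F v) +F z) (trans (cong -F_ (R.distribʳ b c e)) (sym (-‿+-comm (c *F b) (e *F b)))))
        (interchange u v (-F (c *F b)) (-F (e *F b)))
      sub-* : ∀ a v c b → (a *F v) +F (-F ((a *F c) *F b)) ≡ a *F (v +F (-F (c *F b)))
      sub-* a v c b = trans (cong (λ z → (a *F v) +F z) (trans (cong -F_ (R.*-assoc a c b)) (-‿distribʳ-* a (c *F b))))
        (sym (R.distribˡ a v (-F (c *F b))))
      neg-* : ∀ v → -F v ≡ (-F 1F) *F v
      neg-* v = sym (-1*x≈-x v)
      sub-0 : ∀ v b → v +F (-F (0F *F b)) ≡ v
      sub-0 v b = trans (cong (λ z → v +F (-F z)) (R.zeroˡ b)) (trans (cong (v +F_) -0#≈0#) (R.+-identityʳ v))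
      sub-1 : ∀ b → b +F (-F (1F *F b)) ≡ 0F
      sub-1 b = trans (cong (λ z → b +F (-F z)) (R.*-identityˡ b)) (R.-‿inverseʳ b)
      sub-sub : ∀ v w x → (v +F (-F (w +F x))) ≡ (v +F (-F x)) +F (-F w)
      sub-sub v w x = trans (cong (v +F_) (sym (-‿+-comm w x))) (trans (sym (R.+-assoc v (-F w) (-F x))) (xy∙z≈xz∙y v (-F w) (-F x)))
      +-sub : ∀ w x → (w +F x) +F (-F x) ≡ w
      +-sub w x = trans (R.+-assoc w x _) (trans (cong (w +F_) (R.-‿inverseʳ x)) (R.+-identityʳ w))
      sub-+-cancel : ∀ v x → (v +F (-F x)) +F x ≡ v
      sub-+-cancel v x = trans (R.+-assoc v _ x) (trans (cong (v +F_) (R.-‿inverseˡ x)) (R.+-identityʳ v))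
      sub-zero : ∀ v → v +F (-F 0F) ≡ v
      sub-zero v = trans (cong (λ z → v +F (-F z)) (sym (R.zeroˡ 0F))) (sub-0 v 0F)
      +-subʳ : ∀ w x → w +F (x +F (-F w)) ≡ x
      +-subʳ w x = trans (R.+-comm w _) (sub-+-cancel x w)

    module _ {n : ℕ} where

      span-resp : ∀ (bs : List (Vect n)) {u v} → u ≐ v → InSpan bs u → InSpan bs v
      span-resp []       e z i = trans (sym (e i)) (z i)
      span-resp (b ∷ bs) e (c , p) = c , span-resp bs (λ i → cong (_+F (-F (c *F b i))) (e i)) p

      span-⊕ : ∀ (bs : List (Vect n)) {u v} → InSpan bs u → InSpan bs v → InSpan bs (u ⊕ v)
      span-⊕ [] p r i = trans (cong₂ _+F_ (p i) (r i)) (R.+-identityʳ 0F)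
      span-⊕ (b ∷ bs) {u} {v} (c , p) (e , r) =
        c +F e , span-resp bs (λ i → sym (sub-+ (u i) (v i) c e (b i))) (span-⊕ bs p r)

      span-⊙ : ∀ (bs : List (Vect n)) a {v} → InSpan bs v → InSpan bs (a ⊙ v)
      span-⊙ [] a p i = trans (cong (a *F_) (p i)) (R.zeroʳ a)
      span-⊙ (b ∷ bs) a {v} (c , p) = a *F c , span-resp bs (λ i → sym (sub-* a (v i) c (b i))) (span-⊙ bs a p)

      span-⊖ : ∀ (bs : List (Vect n)) {v} → InSpan bs v → InSpan bs (⊖ v)
      span-⊖ bs {v} p = span-resp bs (λ i → sym (neg-* (v i))) (span-⊙ bs (-F 1F) p)

      span-- : ∀ (bs : List (Vect n)) {u v} → InSpan bs u → InSpan bs v → InSpan bs (u -V v)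
      span-- bs p r = span-⊕ bs p (span-⊖ bs r)

      span-there : ∀ (b : Vect n) bs {v} → InSpan bs v → InSpan (b ∷ bs) v
      span-there b bs {v} p = 0F , span-resp bs (λ i → sym (sub-0 (v i) (b i))) p

      span-0 : ∀ (bs : List (Vect n)) → InSpan bs 0V
      span-0 []       = λ _ → refl
      span-0 (b ∷ bs) = span-there b bs (span-0 bs)

      span-here : ∀ (b : Vect n) bs → InSpan (b ∷ bs) b
      span-here b bs = 1F , span-resp bs (λ i → sym (sub-1 (b i))) (span-0 bs)

      span-∈ : ∀ {b : Vect n} {bs} → b ∈ bs → InSpan bs b
      span-∈ {b} {_ ∷ bs} (here refl) = span-here b bs
      span-∈ {b} {c ∷ bs} (there p)   = span-there c bs (span-∈ p)

      span-least : ∀ (bs : List (Vect n)) cs → All (InSpan cs) bs → ∀ {v} → InSpan bs v → InSpan cs v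
      span-least []       cs []       p = span-resp cs (λ i → sym (p i)) (span-0 cs)
      span-least (b ∷ bs) cs (r ∷ rs) {v} (c , p) =
        span-resp cs (λ i → sub-+-cancel (v i) _) (span-⊕ cs (span-least bs cs rs p) (span-⊙ cs c r))

      span-? : ∀ (bs : List (Vect n)) v → Dec (InSpan bs v)
      span-? []       v = Fin.all? λ i → v i Fin.≟ 0F
      span-? (b ∷ bs) v = Fin.any? λ c → span-? bs (v -V (c ⊙ b))

      span-++⁻ : ∀ (es : List (Vect n)) bs {v} → InSpan (es ++ bs) v → Σ (Vect n) λ w → InSpan es w × InSpan bs (v -V w)
      span-++⁻ []       bs {v} p = 0V , (λ _ → refl) , span-resp bs (λ i → sym (sub-zero (v i))) p
      span-++⁻ (e ∷ es) bs {v} (c , p) with span-++⁻ es bs p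
      ... | w , pw , pv = w ⊕ (c ⊙ e) , (c , span-resp es (λ i → sym (+-sub (w i) (c *F e i))) pw) ,
        span-resp bs (λ i → sym (sub-sub (v i) (w i) (c *F e i))) pv

      span-++⁺ʳ : ∀ (es : List (Vect n)) {bs v} → InSpan bs v → InSpan (es ++ bs) v
      span-++⁺ʳ []       p = p
      span-++⁺ʳ (e ∷ es) p = span-there e _ (span-++⁺ʳ es p)

      span-++⁺ˡ : ∀ (es : List (Vect n)) bs {v} → InSpan es v → InSpan (es ++ bs) v
      span-++⁺ˡ es bs = span-least es (es ++ bs) (All.tabulate λ e∈ → span-∈ (∈-++⁺ˡ e∈))

      -- Lists the vectors of the span. For an independent list there are no repetitions, so a
      -- subspace has q^dim vectors and all comparisons of dimensions reduce to counting.
      E : List (Vect n) → List (Vect n)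
      E []       = 0V ∷ []
      E (b ∷ bs) = prodMap (λ c w → w ⊕ (c ⊙ b)) (allFin q) (E bs)

      private module V = Classes (_≐_ {n}) (λ e i → sym (e i)) (λ e f i → trans (e i) (f i)) _≐?_

      length-E : ∀ bs → length (E bs) ≡ q ℕ.^ length bs
      length-E []       = refl
      length-E (b ∷ bs) = trans (length-prodMap _ (allFin q) (E bs))
        (cong₂ ℕ._*_ (length-tabulate {n = q} (λ z → z)) (length-E bs))

      E-sound : ∀ bs → All (InSpan bs) (E bs)
      E-sound []       = (λ _ → refl) ∷ []
      E-sound (b ∷ bs) = All-prodMap _ (allFin q) (E bs) λ c w w∈ →
        c , span-resp bs (λ i → sym (+-sub (w i) (c *F b i))) (All.lookup (E-sound bs) w∈)

      E-complete : ∀ bs {v} → InSpan bs v → V.Hits v (E bs)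
      E-complete []       p = here p
      E-complete (b ∷ bs) {v} (c , p) = Any-prodMap _ (∈-allFin c)
        (Any.map (λ {w} e i → trans (sym (sub-+-cancel (v i) (c *F b i))) (cong (_+F (c *F b i)) (e i))) (E-complete bs p))

      private
        scale-cancel : ∀ bs {b : Vect n} → ¬ InSpan bs b → ∀ a → InSpan bs (a ⊙ b) → a ≡ 0F
        scale-cancel bs {b} ¬p a p with a Fin.≟ 0F
        ... | yes e = e
        ... | no a≢0 with inv a a≢0
        ...   | a⁻¹ , e = contradiction (span-resp bs (λ i → trans (sym (R.*-assoc a⁻¹ a (b i)))
                  (trans (cong (_*F b i) (trans (R.*-comm a⁻¹ a) e)) (R.*-identityˡ (b i)))) (span-⊙ bs a⁻¹ p)) ¬p

        diff-0 : ∀ a b → a +F (-F b) ≡ 0F → a ≡ b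
        diff-0 a b e = trans (sym (sub-+-cancel a b)) (trans (cong (_+F b) e) (R.+-identityˡ b))

        cancelʳ : ∀ w w′ x → w +F x ≡ w′ +F x → w ≡ w′
        cancelʳ w w′ x e = trans (sym (+-sub w x)) (trans (cong (_+F (-F x)) e) (+-sub w′ x))

        coef-diff : ∀ w w′ c c′ b → w +F (c *F b) ≡ w′ +F (c′ *F b) → w′ +F (-F w) ≡ (c +F (-F c′)) *F b
        coef-diff w w′ c c′ b e = begin
          w′ +F (-F w) ≡⟨ cong (_+F (-F w)) (sym (+-sub w′ (c′ *F b))) ⟩
          ((w′ +F (c′ *F b)) +F (-F (c′ *F b))) +F (-F w) ≡⟨ cong (λ z → (z +F (-F (c′ *F b))) +F (-F w)) (sym e) ⟩
          ((w +F (c *F b)) +F (-F (c′ *F b))) +F (-F w)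
            ≡⟨ cong (_+F (-F w)) (R.+-assoc w (c *F b) (-F (c′ *F b))) ⟩
          (w +F ((c *F b) +F (-F (c′ *F b)))) +F (-F w)
            ≡⟨ cong (_+F (-F w)) (R.+-comm w _) ⟩
          (((c *F b) +F (-F (c′ *F b))) +F w) +F (-F w) ≡⟨ +-sub _ w ⟩
          (c *F b) +F (-F (c′ *F b)) ≡⟨ trans (cong ((c *F b) +F_) (-‿distribˡ-* c′ b)) (sym (R.distribʳ b c (-F c′))) ⟩
          (c +F (-F c′)) *F b ∎
          where open ≡-Reasoning

      -- If w + c b = w′ + c′ b with c ≠ c′, then (c - c′) b lies in the span of `bs`, and dividing
      -- by c - c′ puts b there, against independence.
      E-unique : ∀ bs → LinIndep bs → V.Uniq (E bs)
      E-unique []       _ = [] ∷ []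
      E-unique (b ∷ bs) (¬p , ind) = AllPairs.concat⁺
        (All.map⁺ (All.tabulate λ {c} _ → AllPairs.map⁺ (AllPairs.map (λ {w} {w′} w≢ e → w≢ λ i → cancelʳ (w i) (w′ i) (c *F b i) (e i)) (E-unique bs ind))))
        (AllPairs.map⁺ (AllPairs.map (λ {c} {c′} c≢ → All.map⁺ (All.tabulate λ {w} w∈ → All.map⁺ (All.tabulate λ {w′} w′∈ e →
            c≢ (diff-0 c c′ (scale-cancel bs ¬p (c +F (-F c′)) (span-resp bs (λ i → coef-diff (w i) (w′ i) c c′ (b i) (e i))
              (span-- bs (All.lookup (E-sound bs) w′∈) (All.lookup (E-sound bs) w∈))))))))
          (allFin⁺ q)))

      abstract
        _∈S?_ : ∀ v (x : Subspace n) → Dec (v ∈S x)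
        v ∈S? x = span-? (basis x) v

      ⊆-refl : ∀ {x : Subspace n} → x ⊆S x
      ⊆-refl v p = p

      ⊆-trans : ∀ {x y z : Subspace n} → x ⊆S y → y ⊆S z → x ⊆S z
      ⊆-trans p r v v∈ = r v (p v v∈)

      All⇒⊆ : ∀ {x y : Subspace n} → All (_∈S y) (basis x) → x ⊆S y
      All⇒⊆ {x} {y} a v = span-least (basis x) (basis y) a

      ⊆⇒All : ∀ {x y : Subspace n} → x ⊆S y → All (_∈S y) (basis x)
      ⊆⇒All p = All.tabulate λ b∈ → p _ (span-∈ b∈)

      abstract
        _⊆?_ : ∀ (x y : Subspace n) → Dec (x ⊆S y)
        x ⊆? y = map′ (All⇒⊆ {x} {y}) (⊆⇒All {x} {y}) (All.all? (λ v → v ∈S? y) (basis x))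

      ≈-refl : ∀ {x : Subspace n} → x ≈S x
      ≈-refl {x} = ⊆-refl {x} , ⊆-refl {x}

      ≈-sym : ∀ {x y : Subspace n} → x ≈S y → y ≈S x
      ≈-sym (p , r) = r , p

      ≈-trans : ∀ {x y z : Subspace n} → x ≈S y → y ≈S z → x ≈S z
      ≈-trans {x} {y} {z} (p , r) (p′ , r′) = ⊆-trans {x} {y} {z} p p′ , ⊆-trans {z} {y} {x} r′ r

      _≈?_ : ∀ (x y : Subspace n) → Dec (x ≈S y)
      x ≈? y = (x ⊆? y) ×-dec (y ⊆? x)

      adjoin : ∀ v (x : Subspace n) → ¬ (v ∈S x) → Subspace n
      adjoin v x v∉ = sub (v ∷ basis x) (v∉ , indep x)

      adjoin-⊆ : ∀ {v x v∉} y → v ∈S y → x ⊆S y → adjoin v x v∉ ⊆S y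
      adjoin-⊆ {v} {x} {v∉} y v∈ x⊆ = All⇒⊆ {adjoin v x v∉} {y} (v∈ ∷ ⊆⇒All {x} {y} x⊆)

      ⊆-adjoin : ∀ {v x v∉} → x ⊆S adjoin v x v∉
      ⊆-adjoin {v} {x} w = span-there v (basis x)

      0S : Subspace n
      0S = sub [] tt

      0S-⊆ : ∀ x → 0S ⊆S x
      0S-⊆ x = All⇒⊆ {0S} {x} []

      1<q : 1 ℕ.< q
      1<q = two-elements 0F 1F 0≢1
        where
        two-elements : ∀ {k} (a b : Fin k) → ¬ (a ≡ b) → 1 ℕ.< k
        two-elements {suc zero}    zero zero a≢b = contradiction refl a≢b
        two-elements {suc (suc k)} _    _    _   = s≤s (s≤s z≤n)

      ^-cancel-≤ : ∀ a b → q ℕ.^ a ℕ.≤ q ℕ.^ b → a ℕ.≤ b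
      ^-cancel-≤ a b le with a ℕ.≤? b
      ... | yes p = p
      ... | no ¬p = contradiction (ℕ.^-monoʳ-< q 1<q (ℕ.≰⇒> ¬p)) (ℕ.≤⇒≯ le)

      Q⊤? : ∀ (v : Vect n) → Dec ⊤
      Q⊤? _ = yes tt

      inj-length : ∀ xs ys → V.Uniq xs → V.Uniq ys → (∀ v → v ∈ xs → V.Hits v ys) → length xs ℕ.≤ length ys
      inj-length xs ys ux uy h = drop‿+≤+ (subst (+ length xs ≤_) (∑-1 ys)
        (V.length≤∑ Q⊤? xs ys ux uy (λ _ t → t) λ v v∈ → h v v∈ , tt))

      -- The q^dim vectors of x inject into those of y; comparing powers of q takes the place of the
      -- exchange lemma.
      dim-mono : ∀ {x y : Subspace n} → x ⊆S y → dim x ℕ.≤ dim y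
      dim-mono {x} {y} p = ^-cancel-≤ (dim x) (dim y) (subst₂ ℕ._≤_ (length-E (basis x)) (length-E (basis y))
        (inj-length (E (basis x)) (E (basis y)) (E-unique _ (indep x)) (E-unique _ (indep y))
          λ v v∈ → E-complete (basis y) (p v (All.lookup (E-sound (basis x)) v∈))))

      dim-≈ : ∀ {x y : Subspace n} → x ≈S y → dim x ≡ dim y
      dim-≈ {x} {y} (p , r) = ℕ.≤-antisym (dim-mono {x} {y} p) (dim-mono {y} {x} r)

      ⊆-dim⇒⊇ : ∀ {x y : Subspace n} → x ⊆S y → dim y ℕ.≤ dim x → y ⊆S x
      ⊆-dim⇒⊇ {x} {y} p le v v∈ with v ∈S? x
      ... | yes r = r
      ... | no v∉ = contradiction le (ℕ.<⇒≱ (dim-mono {adjoin v x v∉} {y} (adjoin-⊆ {v} {x} {v∉} y v∈ p)))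

      -- `basis≡` keeps the basis of x as a tail, so `new` spans a complement of x. In `modular`
      -- this complement of x ⋀ y in y is transplanted onto x.
      record Extension (x : Subspace n) (vs : List (Vect n)) : Set where
        field
          space  : Subspace n
          new    : List (Vect n)
          basis≡ : basis space ≡ new ++ basis x
          ⊇vs    : All (_∈S space) vs
          ⊇x     : x ⊆S space
          least  : ∀ z → x ⊆S z → All (_∈S z) vs → space ⊆S z

      extend : ∀ x vs → Extension x vs
      extend x [] = record { space = x ; new = [] ; basis≡ = refl ; ⊇vs = [] ; ⊇x = ⊆-refl {x} ; least = λ z p _ → p }
      extend x (v ∷ vs) with extend x vs
      ... | e with v ∈S? Extension.space e
      ...   | yes v∈ = record { space = space ; new = new ; basis≡ = basis≡ ; ⊇vs = v∈ ∷ ⊇vs ; ⊇x = ⊇x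
                              ; least = λ z p a → least z p (All.tail a) }
        where open Extension e
      ...   | no v∉ = record
        { space = adjoin v space v∉ ; new = v ∷ new ; basis≡ = cong (v ∷_) basis≡
        ; ⊇vs = span-here v (basis space) ∷ All.map (λ {w} p → ⊆-adjoin {v} {space} {v∉} w p) ⊇vs
        ; ⊇x = λ w p → ⊆-adjoin {v} {space} {v∉} w (⊇x w p)
        ; least = λ z p a → adjoin-⊆ {v} {space} {v∉} z (All.head a) (least z p (All.tail a)) }
        where open Extension e

      infixr 7 _⋀_
      infixr 6 _⋁_

      abstract
        _⋁_ : Subspace n → Subspace n → Subspace n
        x ⋁ y = Extension.space (extend x (basis y))

        ⋁-upperˡ : ∀ x y → x ⊆S (x ⋁ y)
        ⋁-upperˡ x y = Extension.⊇x (extend x (basis y))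

        ⋁-upperʳ : ∀ x y → y ⊆S (x ⋁ y)
        ⋁-upperʳ x y = All⇒⊆ {y} {x ⋁ y} (Extension.⊇vs (extend x (basis y)))

        ⋁-least : ∀ {x y} z → x ⊆S z → y ⊆S z → (x ⋁ y) ⊆S z
        ⋁-least {x} {y} z p r = Extension.least (extend x (basis y)) z p (⊆⇒All {y} {z} r)

      prune : List (Vect n) → Subspace n
      prune vs = Extension.space (extend 0S vs)

      private
        common? : ∀ (x y : Subspace n) v → Dec (v ∈S x × v ∈S y)
        common? x y v = (v ∈S? x) ×-dec (v ∈S? y)

      abstract
        -- No linear system is solved: the finitely many vectors of x that lie in y are enumerated,
        -- and a basis is extracted from them.
        _⋀_ : Subspace n → Subspace n → Subspace n
        x ⋀ y = prune (filter (common? x y) (E (basis x)))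

        ⋀-lowerˡ : ∀ x y → (x ⋀ y) ⊆S x
        ⋀-lowerˡ x y = Extension.least (extend 0S _) x (0S-⊆ x)
          (All.tabulate λ v∈ → proj₁ (proj₂ (∈-filter⁻ (common? x y) {xs = E (basis x)} v∈)))

        ⋀-lowerʳ : ∀ x y → (x ⋀ y) ⊆S y
        ⋀-lowerʳ x y = Extension.least (extend 0S _) y (0S-⊆ y)
          (All.tabulate λ v∈ → proj₂ (proj₂ (∈-filter⁻ (common? x y) {xs = E (basis x)} v∈)))

        ∈-⋀ : ∀ x y {v} → v ∈S x → v ∈S y → v ∈S (x ⋀ y)
        ∈-⋀ x y {v} p r = go (E-complete (basis x) p) λ w∈ → w∈
          where
          go : ∀ {ws} → V.Hits v ws → (∀ {w} → w ∈ ws → w ∈ E (basis x)) → v ∈S (x ⋀ y)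
          go (here {w} e) f = span-resp (basis (x ⋀ y)) (λ i → sym (e i))
            (All.lookup (Extension.⊇vs (extend 0S (filter (common? x y) (E (basis x)))))
              (∈-filter⁺ (common? x y) (f (here refl)) (span-resp (basis x) e p , span-resp (basis y) e r)))
          go (there h) f = go h λ w∈ → f (there w∈)

      ⋀-greatest : ∀ {x y} z → z ⊆S x → z ⊆S y → z ⊆S (x ⋀ y)
      ⋀-greatest {x} {y} z p r v v∈ = ∈-⋀ x y (p v v∈) (r v v∈)

      private
        -- Suppose e = w + (e - w) with w in the span of `es` and e - w in x. Then e - w lies in y
        -- as well, hence in x ⋀ y, so e depends on `es` and x ⋀ y.
        indep-over : ∀ (x y : Subspace n) es → LinIndep (es ++ basis (x ⋀ y)) → All (_∈S y) es → LinIndep (es ++ basis x)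
        indep-over x y []       _ _ = indep x
        indep-over x y (e ∷ es) (e∉ , li) (e∈ ∷ es∈) = ¬span , indep-over x y es li es∈
          where
          ¬span : ¬ InSpan (es ++ basis x) e
          ¬span p with span-++⁻ es (basis x) p
          ... | w , w∈es , e-w∈x = e∉ (span-resp (es ++ basis (x ⋀ y)) (λ i → +-subʳ (w i) (e i))
                  (span-⊕ (es ++ basis (x ⋀ y)) (span-++⁺ˡ es (basis (x ⋀ y)) w∈es)
                    (span-++⁺ʳ es (∈-⋀ x y e-w∈x (span-- (basis y) e∈ (span-least es (basis y) es∈ w∈es))))))

      -- The vectors `new` that extend a basis of x ⋀ y to one of y also extend the basis of x to a
      -- basis of the join, namely that of `J`. Both differences of dimensions equal `length new`.
      modular : ∀ x y → dim x ℕ.+ dim y ≡ dim (x ⋀ y) ℕ.+ dim (x ⋁ y)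
      modular x y = begin
        dim x ℕ.+ dim y                        ≡⟨ cong (λ k → dim x ℕ.+ k) dim-y ⟩
        dim x ℕ.+ (length new ℕ.+ dim (x ⋀ y))   ≡⟨ ℕ.+-comm (dim x) _ ⟩
        length new ℕ.+ dim (x ⋀ y) ℕ.+ dim x     ≡⟨ cong (ℕ._+ dim x) (ℕ.+-comm (length new) _) ⟩
        dim (x ⋀ y) ℕ.+ length new ℕ.+ dim x     ≡⟨ ℕ.+-assoc (dim (x ⋀ y)) _ _ ⟩
        dim (x ⋀ y) ℕ.+ (length new ℕ.+ dim x)   ≡⟨ cong (λ k → dim (x ⋀ y) ℕ.+ k) (sym (length-++ new)) ⟩
        dim (x ⋀ y) ℕ.+ dim J                  ≡⟨ cong (λ k → dim (x ⋀ y) ℕ.+ k) (dim-≈ {J} {x ⋁ y} (J⊆ , ⊆J)) ⟩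
        dim (x ⋀ y) ℕ.+ dim (x ⋁ y)            ∎
        where
        open ≡-Reasoning
        open Extension (extend (x ⋀ y) (basis y))
        space≈y : space ≈S y
        space≈y = least y (⋀-lowerʳ x y) (⊆⇒All {y} {y} (⊆-refl {y})) , All⇒⊆ {y} {space} ⊇vs
        dim-y : dim y ≡ length new ℕ.+ dim (x ⋀ y)
        dim-y = trans (sym (dim-≈ {space} {y} space≈y)) (trans (cong length basis≡) (length-++ new))
        new∈y : All (_∈S y) new
        new∈y = All.tabulate λ e∈ → proj₁ space≈y _ (subst (λ bs → InSpan bs _) (sym basis≡) (span-∈ (∈-++⁺ˡ e∈)))
        J : Subspace n
        J = sub (new ++ basis x) (indep-over x y new (subst LinIndep basis≡ (indep space)) new∈y)
        J⊆ : J ⊆S (x ⋁ y)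
        J⊆ = All⇒⊆ {J} {x ⋁ y} (All.++⁺ (All.map (λ {w} p → ⋁-upperʳ x y w p) new∈y) (⊆⇒All {x} {x ⋁ y} (⋁-upperˡ x y)))
        ⊆J : (x ⋁ y) ⊆S J
        ⊆J = ⋁-least {x} {y} J (λ w p → span-++⁺ʳ new p) λ w p →
          span-least (new ++ basis (x ⋀ y)) (new ++ basis x)
            (All.++⁺ (All.tabulate λ e∈ → span-∈ (∈-++⁺ˡ e∈))
                     (All.tabulate λ e∈ → span-++⁺ʳ new (⋀-lowerˡ x y _ (span-∈ e∈))))
            (subst (λ bs → InSpan bs w) basis≡ (proj₂ space≈y w p))

      private module S = Classes (_≈S_ {n}) (λ {x} {y} → ≈-sym {x} {y}) (λ {x} {y} {z} → ≈-trans {x} {y} {z}) _≈?_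

      nub : List (Subspace n) → List (Subspace n)
      nub []       = []
      nub (x ∷ xs) with S.hits? x (nub xs)
      ... | yes _ = nub xs
      ... | no _  = x ∷ nub xs

      nub-unique : ∀ xs → S.Uniq (nub xs)
      nub-unique []       = []
      nub-unique (x ∷ xs) with S.hits? x (nub xs)
      ... | yes _ = nub-unique xs
      ... | no ¬h = S.¬hits⇒All x (nub xs) ¬h ∷ nub-unique xs

      nub-hits : ∀ a xs → S.Hits a xs → S.Hits a (nub xs)
      nub-hits a (x ∷ xs) h with S.hits? x (nub xs) | h
      ... | yes r | here e  = Any.map (λ {y} → ≈-trans {a} {x} {y} e) r
      ... | yes r | there p = nub-hits a xs p
      ... | no _  | here e  = here e
      ... | no _  | there p = there (nub-hits a xs p)

    vectors : ∀ n → List (Vect n)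
    vectors zero    = (λ ()) ∷ []
    vectors (suc n) = prodMap (λ c w → λ { zero → c ; (suc i) → w i }) (allFin q) (vectors n)

    vectors-complete : ∀ n (v : Vect n) → Any (v ≐_) (vectors n)
    vectors-complete zero    v = here λ ()
    vectors-complete (suc n) v = Any-prodMap _ (∈-allFin (v zero))
      (Any.map (λ e → λ { zero → refl ; (suc i) → e i }) (vectors-complete n (λ i → v (suc i))))

    vectors-unique : ∀ n → AllPairs (λ u v → ¬ (u ≐ v)) (vectors n)
    vectors-unique zero    = [] ∷ []
    vectors-unique (suc n) = Unique-prodMap _ (λ e → e zero , λ i → e (suc i)) (allFin⁺ q) (vectors-unique n)

    length-vectors : ∀ n → length (vectors n) ≡ q ℕ.^ n
    length-vectors zero    = refl
    length-vectors (suc n) = trans (length-prodMap _ (allFin q) (vectors n))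
      (cong₂ ℕ._*_ (length-tabulate {n = q} (λ z → z)) (length-vectors n))

    module _ {n : ℕ} where
      private
        module V = Classes (_≐_ {n}) (λ e i → sym (e i)) (λ e f i → trans (e i) (f i)) _≐?_
        module S = Classes (_≈S_ {n}) (λ {x} {y} → ≈-sym {n} {x} {y}) (λ {x} {y} {z} → ≈-trans {n} {x} {y} {z}) _≈?_

      1S : Subspace n
      1S = prune (vectors n)

      ∈-1S : ∀ (v : Vect n) → v ∈S 1S
      ∈-1S v = go (vectors-complete n v) λ w∈ → w∈
        where
        go : ∀ {ws} → Any (v ≐_) ws → (∀ {w} → w ∈ ws → w ∈ vectors n) → v ∈S 1S
        go (here e)  f = span-resp (basis 1S) (λ i → sym (e i)) (All.lookup (Extension.⊇vs (extend 0S (vectors n))) (f (here refl)))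
        go (there h) f = go h λ w∈ → f (there w∈)

      ⊆-1S : ∀ (x : Subspace n) → x ⊆S 1S
      ⊆-1S x v _ = ∈-1S v

      dim-1S : dim 1S ≡ n
      dim-1S = ℕ.≤-antisym
        (^-cancel-≤ {n} _ _ (subst₂ ℕ._≤_ (length-E (basis 1S)) (length-vectors n)
          (inj-length (E (basis 1S)) (vectors n) (E-unique _ (indep 1S)) (vectors-unique n) λ v _ → vectors-complete n v)))
        (^-cancel-≤ {n} _ _ (subst₂ ℕ._≤_ (length-vectors n) (length-E (basis 1S))
          (inj-length (vectors n) (E (basis 1S)) (vectors-unique n) (E-unique _ (indep 1S)) λ v _ → E-complete (basis 1S) (∈-1S v))))

      private
        lists : ℕ → List (List (Vect n))
        lists zero    = [] ∷ []
        lists (suc k) = prodMap _∷_ (vectors n) (lists k)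

        spans : ℕ → List (Subspace n)
        spans zero    = map prune (lists zero)
        spans (suc k) = map prune (lists (suc k)) ++ spans k

        span-pointwise : ∀ {bs cs : List (Vect n)} → Pointwise _≐_ bs cs → ∀ {v} → InSpan bs v → InSpan cs v
        span-pointwise [] p = p
        span-pointwise {b ∷ bs} {c ∷ cs} (e ∷ es) {v} (a , p) =
          a , span-resp cs (λ i → cong (λ z → v i +F (-F (a *F z))) (e i)) (span-pointwise es p)

        lists-complete : ∀ (bs : List (Vect n)) → Any (Pointwise _≐_ bs) (lists (length bs))
        lists-complete []       = here []
        lists-complete (b ∷ bs) = go (vectors-complete n b) λ w∈ → w∈
          where
          go : ∀ {ws} → Any (b ≐_) ws → (∀ {w} → w ∈ ws → w ∈ vectors n) → Any (Pointwise _≐_ (b ∷ bs)) (lists (suc (length bs)))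
          go (here e)  f = Any-prodMap _∷_ (f (here refl)) (Any.map (e ∷_) (lists-complete bs))
          go (there h) f = go h λ w∈ → f (there w∈)

        ≈-prune : ∀ (x : Subspace n) cs → Pointwise _≐_ (basis x) cs → x ≈S prune cs
        ≈-prune x cs e =
          (λ v p → span-least cs (basis (prune cs)) (Extension.⊇vs (extend 0S cs)) (span-pointwise e p)) ,
          Extension.least (extend 0S cs) x (0S-⊆ x)
            (All.tabulate λ c∈ → span-pointwise (Pw.symmetric (λ e i → sym (e i)) e) (span-∈ c∈))

        spans-complete : ∀ x k → dim x ℕ.≤ k → S.Hits x (spans k)
        spans-complete x zero le = subst (λ k → S.Hits x (map prune (lists k))) (ℕ.n≤0⇒n≡0 le)
          (Any.map⁺ (Any.map (λ {cs} → ≈-prune x cs) (lists-complete (basis x))))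
        spans-complete x (suc k) le with dim x ℕ.≟ suc k
        ... | yes e = Any.++⁺ˡ (subst (λ k → S.Hits x (map prune (lists k))) e
                (Any.map⁺ (Any.map (λ {cs} → ≈-prune x cs) (lists-complete (basis x)))))
        ... | no ne = Any.++⁺ʳ (map prune (lists (suc k))) (spans-complete x k (ℕ.≤-pred (ℕ.≤∧≢⇒< le ne)))

      abstract
        -- One representative for each class of `≈S`: every basis occurs, up to pointwise equality,
        -- among the lists of at most n vectors; `prune` makes every such list independent, and
        -- `nub` removes repeated classes.
        subspaces : List (Subspace n)
        subspaces = nub (spans n)

        subspaces-complete : ∀ x → S.Hits x subspaces
        subspaces-complete x = nub-hits x (spans n) (spans-complete x n (subst (dim x ℕ.≤_) dim-1S (dim-mono {n} {x} {1S} (⊆-1S x))))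

        subspaces-unique : S.Uniq subspaces
        subspaces-unique = nub-unique (spans n)

  -- Spectral bound and quadrature

  pos*pos : ∀ {a b} → 0ℤ < a → 0ℤ < b → 0ℤ < a * b
  pos*pos {+ suc a} {+ suc b} _ _        = +<+ (s≤s z≤n)
  pos*pos {+ suc a} {+ zero}  _ (+<+ ())
  pos*pos {+ zero}            (+<+ ()) _

  nonneg*nonneg : ∀ {a b} → 0ℤ ≤ a → 0ℤ ≤ b → 0ℤ ≤ a * b
  nonneg*nonneg {+ a} {+ b} _ _ = subst (0ℤ ≤_) (ℤ.pos-* a b) (+≤+ z≤n)

  cancel-pos : ∀ {a b} → 0ℤ < a → 0ℤ < b * a → 0ℤ < b
  cancel-pos {+ suc a} {+ suc b}   _ _ = +<+ (s≤s z≤n)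
  cancel-pos {+ suc a} { -[1+ b ]} _ ()
  cancel-pos {+ suc a} {+ zero}    _ (+<+ ())
  cancel-pos {+ zero}              (+<+ ()) _

  cancel-≤ : ∀ c {a b} → 0ℤ < c → c * a ≤ c * b → a ≤ b
  cancel-≤ c {a} {b} p = ℤ.*-cancelˡ-≤-pos a b c {{positive p}}

  cancel-< : ∀ c {a b} → 0ℤ < c → c * a < c * b → a < b
  cancel-< c {a} {b} p = ℤ.*-cancelˡ-<-nonNeg c {{nonNegative (ℤ.<⇒≤ p)}}

  cancel-≡ : ∀ c {a b} → 0ℤ < c → c * a ≡ c * b → a ≡ b
  cancel-≡ c {a} {b} p = ℤ.*-cancelˡ-≡ c a b {{≢-nonZero {c} λ c≡0 → ℤ.<-irrefl (sym c≡0) p}}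

  scale-< : ∀ c {a b} → 0ℤ < c → a < b → c * a < c * b
  scale-< c p = ℤ.*-monoˡ-<-pos c {{positive p}}

  scale-≤ : ∀ c {a b} → 0ℤ ≤ c → a ≤ b → c * a ≤ c * b
  scale-≤ c p = ℤ.*-monoˡ-≤-nonNeg c {{nonNegative p}}

  <⇒0<- : ∀ {a b} → a < b → 0ℤ < b - a
  <⇒0<- {a} {b} p = subst (λ u → u < b - a) (ℤ.+-inverseʳ a) (ℤ.+-monoˡ-< (- a) p)

  0<-⇒< : ∀ {a b} → 0ℤ < b - a → a < b
  0<-⇒< {a} {b} p = subst₂ _<_ (ℤ.+-identityˡ a) (sub-add b a) (ℤ.+-monoˡ-< a p)
    where
    sub-add : ∀ b a → b - a + a ≡ b
    sub-add = solve-∀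

  square-nonneg : ∀ a → 0ℤ ≤ a * a
  square-nonneg (+ zero)  = +≤+ z≤n
  square-nonneg (+ suc a) = +≤+ z≤n
  square-nonneg -[1+ a ]  = +≤+ z≤n

  square-0 : ∀ a → a * a ≡ 0ℤ → a ≡ 0ℤ
  square-0 (+ zero) _ = refl

  ∑< : ℕ → (ℕ → ℤ) → ℤ
  ∑< zero    f = 0ℤ
  ∑< (suc n) f = ∑< n f + f n

  ∑<-cong : ∀ n {f g} → (∀ i → i ℕ.< n → f i ≡ g i) → ∑< n f ≡ ∑< n g
  ∑<-cong zero    e = refl
  ∑<-cong (suc n) e = cong₂ _+_ (∑<-cong n λ i p → e i (ℕ.m≤n⇒m≤1+n p)) (e n ℕ.≤-refl)

  ∑<-0 : ∀ n f → (∀ i → i ℕ.< n → f i ≡ 0ℤ) → ∑< n f ≡ 0ℤ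
  ∑<-0 zero    f e = refl
  ∑<-0 (suc n) f e = cong₂ _+_ (∑<-0 n f λ i p → e i (ℕ.m≤n⇒m≤1+n p)) (e n ℕ.≤-refl)

  ∑<-*ˡ : ∀ n c f → ∑< n (λ i → c * f i) ≡ c * ∑< n f
  ∑<-*ˡ zero    c f = sym (ℤ.*-zeroʳ c)
  ∑<-*ˡ (suc n) c f = trans (cong (λ s → s + c * f n) (∑<-*ˡ n c f)) (sym (ℤ.*-distribˡ-+ c _ (f n)))

  ∑<-mono-< : ∀ n {f g} → (∀ i → i ℕ.≤ n → f i < g i) → ∑< (suc n) f < ∑< (suc n) g
  ∑<-mono-< zero    {f} {g} e = ℤ.+-monoʳ-< 0ℤ (e 0 z≤n)
  ∑<-mono-< (suc n) e = ℤ.+-mono-< (∑<-mono-< n λ i p → e i (ℕ.m≤n⇒m≤1+n p)) (e (suc n) ℕ.≤-refl)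

  ∑<-single : ∀ n j f → j ℕ.< n → (∀ i → i ℕ.< n → i ≢ j → f i ≡ 0ℤ) → ∑< n f ≡ f j
  ∑<-single (suc n) j f j<n e with j ℕ.≟ n
  ... | yes refl = trans (cong (λ s → s + f n) (∑<-0 n f λ i p → e i (ℕ.m≤n⇒m≤1+n p) (ℕ.<⇒≢ p))) (ℤ.+-identityˡ (f n))
  ... | no j≢n = trans (cong (λ s → ∑< n f + s) (e n ℕ.≤-refl (λ n≡j → j≢n (sym n≡j))))
    (trans (ℤ.+-identityʳ _) (∑<-single n j f (ℕ.≤∧≢⇒< (ℕ.≤-pred j<n) j≢n) λ i p → e i (ℕ.m≤n⇒m≤1+n p)))

  ∑<-extend : ∀ n k f → (∀ i → n ℕ.≤ i → f i ≡ 0ℤ) → ∑< (k ℕ.+ n) f ≡ ∑< n f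
  ∑<-extend n zero    f e = refl
  ∑<-extend n (suc k) f e = trans (cong (λ s → ∑< (k ℕ.+ n) f + s) (e (k ℕ.+ n) (ℕ.m≤n+m n k)))
    (trans (ℤ.+-identityʳ _) (∑<-extend n k f e))

  ∑<-head : ∀ n f → ∑< (suc n) f ≡ f 0 + ∑< n (λ i → f (suc i))
  ∑<-head zero    f = trans (ℤ.+-identityˡ (f 0)) (sym (ℤ.+-identityʳ (f 0)))
  ∑<-head (suc n) f = trans (cong (λ s → s + f (suc n)) (∑<-head n f)) (ℤ.+-assoc (f 0) _ _)

  ∑<-nonneg-0 : ∀ n f → (∀ i → i ℕ.< n → 0ℤ ≤ f i) → 0ℤ ≤ ∑< n f × (∑< n f ≡ 0ℤ → ∀ i → i ℕ.< n → f i ≡ 0ℤ)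
  ∑<-nonneg-0 zero    f p = ℤ.≤-refl , λ _ i ()
  ∑<-nonneg-0 (suc n) f p with ∑<-nonneg-0 n f (λ i q → p i (ℕ.m≤n⇒m≤1+n q))
  ... | nn , zz = ℤ.+-mono-≤ nn (p n ℕ.≤-refl) , λ e i i<n → go (+-zeros {A = ℕ} nn (p n ℕ.≤-refl) e) i i<n
    where
    go : ∑< n f ≡ 0ℤ × f n ≡ 0ℤ → ∀ i → i ℕ.< suc n → f i ≡ 0ℤ
    go (e₁ , e₂) i i<n with i ℕ.≟ n
    ... | yes refl = e₂
    ... | no i≢n   = zz e₁ i (ℕ.≤∧≢⇒< (ℕ.≤-pred i<n) i≢n)

  ∑-∑< : ∀ {A : Set} (xs : List A) n (f : A → ℕ → ℤ) → ∑ xs (λ x → ∑< n (f x)) ≡ ∑< n (λ i → ∑ xs (λ x → f x i))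
  ∑-∑< xs zero    f = ∑-0 xs
  ∑-∑< xs (suc n) f = trans (∑-+ xs _ _) (cong (λ s → s + ∑ xs (λ x → f x n)) (∑-∑< xs n f))

  abstract
    -- Forward substitution without division. Each new row multiplies the unknowns found so far, and
    -- the common scale C, by its own pivot `cc`; positive pivots keep the scale positive.
    triangular : ∀ (c : ℕ → ℕ → ℤ) (F : ℕ → ℤ) n → (∀ k → k ℕ.≤ n → 0ℤ < c k k) →
      Σ ℤ λ C → Σ (ℕ → ℤ) λ μ → 0ℤ < C × (∀ k → k ℕ.≤ n → ∑< (suc k) (λ i → μ i * c k i) ≡ C * F k)
    triangular c F zero pos = c 0 0 , (λ _ → F 0) , pos 0 z≤n , λ { zero _ → lem (F 0) (c 0 0) ; (suc k) () }
      where
      lem : ∀ f c → 0ℤ + f * c ≡ c * f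
      lem = solve-∀
    triangular c F (suc n) pos with triangular c F n (λ k p → pos k (ℕ.m≤n⇒m≤1+n p))
    ... | C , μ , C>0 , eqs = cc * C , μ′ , pos*pos (pos (suc n) ℕ.≤-refl) C>0 , eqs′
      where
      cc S : ℤ
      cc = c (suc n) (suc n)
      S  = ∑< (suc n) (λ i → μ i * c (suc n) i)
      choose : ∀ i → Dec (i ℕ.≤ n) → ℤ
      choose i (yes _) = cc * μ i
      -- With this value the new row reads cc S + (C F - S) cc = (cc C) F, as required for the
      -- enlarged scale.
      choose i (no _)  = C * F (suc n) - S
      μ′ : ℕ → ℤ
      μ′ i = choose i (i ℕ.≤? n)
      old : ∀ i → i ℕ.≤ n → μ′ i ≡ cc * μ i
      old i p with i ℕ.≤? n
      ... | yes _ = refl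
      ... | no ¬p = contradiction p ¬p
      new : μ′ (suc n) ≡ C * F (suc n) - S
      new with suc n ℕ.≤? n
      ... | yes p = contradiction p ℕ.1+n≰n
      ... | no _  = refl
      front : ∀ k m → m ℕ.≤ suc n → ∑< m (λ i → μ′ i * c k i) ≡ cc * ∑< m (λ i → μ i * c k i)
      front k m m≤ = trans (∑<-cong m λ i p → trans (cong (_* c k i) (old i (ℕ.≤-pred (ℕ.≤-trans p m≤)))) (ℤ.*-assoc cc (μ i) (c k i)))
        (∑<-*ˡ m cc _)
      lem : ∀ cc S C f → cc * S + (C * f - S) * cc ≡ cc * C * f
      lem = solve-∀
      by-cases : ∀ k → k ℕ.≤ suc n → Dec (k ℕ.≤ n) → ∑< (suc k) (λ i → μ′ i * c k i) ≡ cc * C * F k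
      by-cases k k≤ (yes p) = trans (front k (suc k) (s≤s p)) (trans (cong (cc *_) (eqs k p)) (sym (ℤ.*-assoc cc C (F k))))
      by-cases k k≤ (no ¬p) with ℕ.≤-antisym k≤ (ℕ.≰⇒> ¬p)
      ... | refl = trans (cong₂ _+_ (front (suc n) (suc n) ℕ.≤-refl) (cong (_* cc) new)) (lem cc S C (F (suc n)))
      eqs′ : ∀ k → k ℕ.≤ suc n → ∑< (suc k) (λ i → μ′ i * c k i) ≡ cc * C * F k
      eqs′ k k≤ = by-cases k k≤ (k ℕ.≤? n)

  module _ {A : Set} (xs : List A) (v : A → ℕ) (g h : ℕ → ℤ) (s : ℕ)
    (g-low : ∀ m → m ℕ.< s → g m ≡ 0ℤ) (h-high : ∀ w → w ∈ xs → s ℕ.< v w → h (v w) ≡ 0ℤ) where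

    private
      pointwise : ∀ w → w ∈ xs → g (v w) * h (v w) ≡ ⟦ v w ℕ.≟ s ⟧ * (g s * h s)
      pointwise w w∈ with v w ℕ.≟ s
      ... | yes eq = trans (cong (λ m → g m * h m) eq) (sym (ℤ.*-identityˡ _))
      ... | no ne with ℕ.<-cmp (v w) s
      ...   | tri< lt _ _ = trans (cong (_* h (v w)) (g-low (v w) lt)) (trans (ℤ.*-zeroˡ (h (v w))) (sym (ℤ.*-zeroˡ (g s * h s))))
      ...   | tri≈ _ eq _ = contradiction eq ne
      ...   | tri> _ _ gt = trans (cong (g (v w) *_) (h-high w w∈ gt)) (trans (ℤ.*-zeroʳ (g (v w))) (sym (ℤ.*-zeroˡ (g s * h s))))

      count>0 : ∀ z L → z ∈ L → v z ≡ s → 0ℤ < ∑ L (λ w → ⟦ v w ℕ.≟ s ⟧)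
      count>0 z (_ ∷ L) (here refl) vz = subst (λ u → 0ℤ < u + ∑ L (λ w → ⟦ v w ℕ.≟ s ⟧)) (sym (⟦⟧-yes (v z ℕ.≟ s) vz))
        (ℤ.+-mono-<-≤ {0ℤ} {1ℤ} {0ℤ} (+<+ (s≤s z≤n)) (∑-nonneg L λ w _ → ⟦⟧-nonneg (v w ℕ.≟ s)))
      count>0 z (w ∷ L) (there p) vz = ℤ.+-mono-≤-< {0ℤ} {⟦ v w ℕ.≟ s ⟧} {0ℤ} (⟦⟧-nonneg (v w ℕ.≟ s)) (count>0 z L p vz)

    -- The products vanish off the level s, below it because of g and above it because of h. The
    -- total is therefore the number of elements on the level times g s h s, and z witnesses that
    -- this number is positive.
    level-0 : 0ℤ < g s → ∑ xs (λ w → g (v w) * h (v w)) ≡ 0ℤ → ∀ z → z ∈ xs → v z ≡ s → h s ≡ 0ℤ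
    level-0 gs>0 total z z∈ vz = cancel-≡ (g s) gs>0 (trans (cancel-≡ (∑ xs (λ w → ⟦ v w ℕ.≟ s ⟧)) (count>0 z xs z∈ vz)
      (trans (sym (∑-*ʳ xs (g s * h s) (λ w → ⟦ v w ℕ.≟ s ⟧))) (trans (sym (∑-cong∈ xs pointwise)) (trans total (sym (ℤ.*-zeroʳ (∑ xs (λ w → ⟦ v w ℕ.≟ s ⟧))))))))
      (sym (ℤ.*-zeroʳ (g s))))

  -- Eigenkernels of the adjacency operator.

  module Spectral
    {C : Set} (P : C → Set) (XS : List C) (XS-P : ∀ z → z ∈ XS → P z)
    (d : ℕ) (mm : C → C → ℕ) (mm-sym : ∀ x y → P x → P y → mm x y ≡ mm y x) (mm-refl : ∀ x → P x → mm x x ≡ d)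
    (mm≤d : ∀ x y → P x → P y → mm x y ℕ.≤ d)
    (XS-complete : ∀ z → P z → Σ C λ z′ → z′ ∈ XS × (∀ x → P x → mm x z′ ≡ mm x z))
    (ψ : ℕ → ℕ → ℤ) (ψ-low : ∀ s m → m ℕ.< s → ψ s m ≡ 0ℤ) (ψ-diag : ∀ s → s ℕ.≤ d → 0ℤ < ψ s s)
    (ψ₀ : ∀ m → ψ 0 m ≡ ψ 0 0) (ψd>0 : ∀ s → s ℕ.≤ d → 0ℤ < ψ s d)
    (ψ-id : ∀ (F : ℕ → ℤ) x y → P x → P y → ∑ XS (λ z → ψ d (mm x z) * F (mm z y)) ≡ F (mm x y))
    (θ : ℕ → ℤ) (θ-dec : ∀ i s → i ℕ.< s → s ℕ.≤ d → θ s < θ i)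
    -- This growth of the diagonal values `ψ s d` serves twice: for the positivity of `π`, and for
    -- the positivity of the quadrature weights.
    (gap : ∀ i s → i ℕ.≤ s → s ℕ.< d → ψ s d < (θ i - θ (suc s)) * ψ (suc s) d)
    (A : (C → ℤ) → C → ℤ)
    (A-cong : ∀ f g x → P x → (∀ z → P z → f z ≡ g z) → A f x ≡ A g x)
    (A-+ : ∀ f g x → A (λ z → f z + g z) x ≡ A f x + A g x)
    (A-* : ∀ f c x → A (λ z → f z * c) x ≡ A f x * c)
    (A-0 : ∀ x → A (λ _ → 0ℤ) x ≡ 0ℤ)
    (A-ψ₀ : ∀ x y → P x → P y → A (λ z → ψ 0 (mm z y)) x ≡ θ 0 * ψ 0 (mm x y))
    (A-ψ : ∀ s x y → s ℕ.< d → P x → P y → A (λ z → ψ (suc s) (mm z y)) x ≡ θ (suc s) * ψ (suc s) (mm x y) + ψ s (mm x y))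
    where

    A-∑ : ∀ {B : Set} (L : List B) (c : B → ℤ) (f : B → C → ℤ) x →
      A (λ z → ∑ L (λ b → f b z * c b)) x ≡ ∑ L (λ b → A (f b) x * c b)
    A-∑ []      c f x = A-0 x
    A-∑ (b ∷ L) c f x = trans (A-+ _ _ x) (cong₂ _+_ (A-* (f b) (c b) x) (A-∑ L c f x))

    -- e j s is the product of the θ j − θ u over u < s, so it vanishes for s > j: the kernel γ j involves ψ 0, …, ψ j only.
    e : ℕ → ℕ → ℤ
    e j zero    = 1ℤ
    e j (suc s) = e j s * (θ j - θ s)

    Γ : ℕ → ℕ → ℕ → ℤ
    Γ j n m = ∑< n (λ s → ψ s m * e j s)

    γ : ℕ → ℕ → ℤ
    γ j = Γ j (suc d)

    e-0 : ∀ j s → j ℕ.< s → e j s ≡ 0ℤ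
    e-0 j (suc s) (s≤s j≤s) with j ℕ.≟ s
    ... | yes refl = trans (cong (e j s *_) (ℤ.+-inverseʳ (θ j))) (ℤ.*-zeroʳ (e j s))
    ... | no j≢s = trans (cong (_* (θ j - θ s)) (e-0 j s (ℕ.≤∧≢⇒< j≤s j≢s))) (ℤ.*-zeroˡ (θ j - θ s))

    private
      -- The sum telescopes: `ψ s` receives θ s e j s from its own term and e j (s + 1) from the
      -- next one, together θ j e j s. What remains is a boundary term with the factor
      -- `e j (suc n)`, which is zero for n = d.
      A-Γ : ∀ j n x y → n ℕ.≤ d → P x → P y →
        A (λ z → Γ j (suc n) (mm z y)) x ≡ θ j * Γ j (suc n) (mm x y) - e j (suc n) * ψ n (mm x y)
      A-Γ j zero x y n≤d px py = trans (A-+ _ _ x) (trans (cong₂ _+_ (A-0 x) (trans (A-* _ 1ℤ x) (cong (_* 1ℤ) (A-ψ₀ x y px py))))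
        (lem (θ 0) (θ j) (ψ 0 (mm x y))))
        where
        lem : ∀ a b p → 0ℤ + a * p * 1ℤ ≡ b * (0ℤ + p * 1ℤ) - 1ℤ * (b - a) * p
        lem = solve-∀
      A-Γ j (suc n) x y n<d px py = trans (A-+ _ _ x)
        (trans (cong₂ _+_ (A-Γ j n x y (ℕ.<⇒≤ n<d) px py) (trans (A-* _ (e j (suc n)) x) (cong (_* e j (suc n)) (A-ψ n x y n<d px py))))
        (lem (θ j) (Γ j (suc n) (mm x y)) (e j (suc n)) (ψ n (mm x y)) (θ (suc n)) (ψ (suc n) (mm x y))))
        where
        lem : ∀ b G ee p a p′ → b * G - ee * p + (a * p′ + p) * ee ≡ b * (G + p′ * ee) - ee * (b - a) * p′
        lem = solve-∀

    A-γ : ∀ j x y → j ℕ.≤ d → P x → P y → A (λ z → γ j (mm z y)) x ≡ θ j * γ j (mm x y)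
    A-γ j x y j≤d px py = trans (A-Γ j d x y ℕ.≤-refl px py)
      (trans (cong (λ u → θ j * γ j (mm x y) - u * ψ d (mm x y)) (e-0 j (suc d) (s≤s j≤d))) (lem (θ j * γ j (mm x y)) (ψ d (mm x y))))
      where
      lem : ∀ a p → a - 0ℤ * p ≡ a
      lem = solve-∀

    -- For s + k = d this is the eigenvalue of the kernel `ψ s` on `γ j`: read downwards from the
    -- identity kernel `ψ d`, the recursion for A says that `ψ s` is the product of the operators A
    -- - θ u over s < u ≤ d.
    φ : ℕ → ℕ → ℕ → ℤ
    φ s zero    j = 1ℤ
    φ s (suc k) j = (θ j - θ (suc s)) * φ (suc s) k j

    φ-0 : ∀ s k j → s ℕ.< j → j ℕ.≤ s ℕ.+ k → φ s k j ≡ 0ℤ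
    φ-0 s zero    j s<j j≤ = contradiction (subst (j ℕ.≤_) (ℕ.+-identityʳ s) j≤) (ℕ.<⇒≱ s<j)
    φ-0 s (suc k) j s<j j≤ with j ℕ.≟ suc s
    ... | yes refl = trans (cong (_* φ (suc s) k j) (ℤ.+-inverseʳ (θ j))) (ℤ.*-zeroˡ (φ (suc s) k j))
    ... | no j≢ = trans (cong ((θ j - θ (suc s)) *_) (φ-0 (suc s) k j (ℕ.≤∧≢⇒< s<j (λ p → j≢ (sym p))) (subst (j ℕ.≤_) (ℕ.+-suc s k) j≤)))
      (ℤ.*-zeroʳ (θ j - θ (suc s)))

    φ>0 : ∀ s k j → j ℕ.≤ s → s ℕ.+ k ℕ.≤ d → 0ℤ < φ s k j
    φ>0 s zero    j j≤s _  = +<+ (s≤s z≤n)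
    φ>0 s (suc k) j j≤s le = pos*pos (<⇒0<- (θ-dec j (suc s) (s≤s j≤s) (ℕ.≤-trans (ℕ.m≤m+n (suc s) k) le′))) (φ>0 (suc s) k j (ℕ.m≤n⇒m≤1+n j≤s) le′)
      where
      le′ : suc s ℕ.+ k ℕ.≤ d
      le′ = subst (ℕ._≤ d) (ℕ.+-suc s k) le

    ∑-step : ∀ s x (F : C → ℤ) → s ℕ.< d → P x →
      A (λ z → ∑ XS (λ w → ψ (suc s) (mm z w) * F w)) x ≡
      θ (suc s) * ∑ XS (λ w → ψ (suc s) (mm x w) * F w) + ∑ XS (λ w → ψ s (mm x w) * F w)
    ∑-step s x F s<d px = begin
      A (λ z → ∑ XS (λ w → ψ (suc s) (mm z w) * F w)) x
        ≡⟨ A-∑ XS F (λ w z → ψ (suc s) (mm z w)) x ⟩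
      ∑ XS (λ w → A (λ z → ψ (suc s) (mm z w)) x * F w)
        ≡⟨ ∑-cong∈ XS (λ w w∈ → trans (cong (_* F w) (A-ψ s x w s<d px (XS-P w w∈))) (lem (θ (suc s)) (ψ (suc s) (mm x w)) (ψ s (mm x w)) (F w))) ⟩
      ∑ XS (λ w → θ (suc s) * (ψ (suc s) (mm x w) * F w) + ψ s (mm x w) * F w)
        ≡⟨ trans (∑-+ XS _ _) (cong (λ u → u + ∑ XS (λ w → ψ s (mm x w) * F w)) (∑-*ˡ XS (θ (suc s)) _)) ⟩
      θ (suc s) * ∑ XS (λ w → ψ (suc s) (mm x w) * F w) + ∑ XS (λ w → ψ s (mm x w) * F w) ∎
      where
      open ≡-Reasoning
      lem : ∀ a p p′ f → (a * p + p′) * f ≡ a * (p * f) + p′ * f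
      lem = solve-∀

    -- Apply A to the product of `ψ (suc s)` and `γ j` in two ways. By induction the product is a
    -- multiple of `γ j`, so A multiplies it by θ j; by the recursion A gives θ (suc s) times the
    -- product plus the product of `ψ s` and `γ j`. The difference supplies the next factor of `φ`.
    ψ-γ : ∀ k s j x y → s ℕ.+ k ≡ d → j ℕ.≤ d → P x → P y →
      ∑ XS (λ z → ψ s (mm x z) * γ j (mm z y)) ≡ φ s k j * γ j (mm x y)
    ψ-γ zero s j x y eq j≤d px py =
      trans (cong (λ u → ∑ XS (λ z → ψ u (mm x z) * γ j (mm z y))) (trans (sym (ℕ.+-identityʳ s)) eq))
        (trans (ψ-id (γ j) x y px py) (sym (ℤ.*-identityˡ _)))
    ψ-γ (suc k) s j x y eq j≤d px py = lem (θ j) (θ (suc s)) f′ g _ (trans (sym lhs) rhs)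
      where
      open ≡-Reasoning
      s<d : s ℕ.< d
      s<d = subst (s ℕ.<_) eq (subst (s ℕ.<_) (sym (ℕ.+-suc s k)) (s≤s (ℕ.m≤m+n s k)))
      f′ = φ (suc s) k j
      g  = γ j (mm x y)
      IH : ∀ z → P z → ∑ XS (λ w → ψ (suc s) (mm z w) * γ j (mm w y)) ≡ γ j (mm z y) * f′
      IH z pz = trans (ψ-γ k (suc s) j z y (trans (sym (ℕ.+-suc s k)) eq) j≤d pz py) (ℤ.*-comm f′ _)
      lhs : A (λ z → ∑ XS (λ w → ψ (suc s) (mm z w) * γ j (mm w y))) x ≡ θ j * g * f′
      lhs = trans (A-cong _ _ x px IH) (trans (A-* _ f′ x) (cong (_* f′) (A-γ j x y j≤d px py)))
      rhs : A (λ z → ∑ XS (λ w → ψ (suc s) (mm z w) * γ j (mm w y))) x ≡ θ (suc s) * (g * f′) + ∑ XS (λ w → ψ s (mm x w) * γ j (mm w y))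
      rhs = trans (∑-step s x (λ w → γ j (mm w y)) s<d px) (cong (λ u → θ (suc s) * u + ∑ XS (λ w → ψ s (mm x w) * γ j (mm w y))) (IH x px))
      lem : ∀ a b f g T → a * g * f ≡ b * (g * f) + T → T ≡ (a - b) * f * g
      lem a b f g T h = trans (l1 (b * (g * f)) T) (trans (cong (λ u → u - b * (g * f)) (sym h)) (l2 a b f g))
        where
        l1 : ∀ u T → T ≡ u + T - u
        l1 = solve-∀
        l2 : ∀ a b f g → a * g * f - b * (g * f) ≡ (a - b) * f * g
        l2 = solve-∀

    sg : ℕ → ℤ
    sg zero    = 1ℤ
    sg (suc n) = - sg n

    -- The top coefficient `e j j` is a product of j negative factors; the sign makes it positive,
    -- and with it the kernel semidefinite.
    γ′ : ℕ → ℕ → ℤ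
    γ′ j m = sg j * γ j m

    sg-e : ℕ → ℕ → ℤ
    sg-e j s = sg s * e j s

    sg-e-suc : ∀ j s → sg-e j (suc s) ≡ sg-e j s * (θ s - θ j)
    sg-e-suc j s = lem (sg s) (e j s) (θ j) (θ s)
      where
      lem : ∀ a b c d → - a * (b * (c - d)) ≡ a * b * (d - c)
      lem = solve-∀

    sg-e>0 : ∀ j s → j ℕ.≤ d → s ℕ.≤ j → 0ℤ < sg-e j s
    sg-e>0 j zero    _   _   = +<+ (s≤s z≤n)
    sg-e>0 j (suc s) j≤d s<j = subst (0ℤ <_) (sym (sg-e-suc j s)) (pos*pos (sg-e>0 j s j≤d (ℕ.<⇒≤ s<j)) (<⇒0<- (θ-dec s j s<j j≤d)))

    ω : ℕ → ℤ
    ω j = sg-e j j * φ j (d ∸ j) j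

    ω>0 : ∀ j → j ℕ.≤ d → 0ℤ < ω j
    ω>0 j j≤d = pos*pos (sg-e>0 j j j≤d ℕ.≤-refl) (φ>0 j _ j ℕ.≤-refl (ℕ.≤-reflexive (ℕ.m+[n∸m]≡n j≤d)))

    -- When the left factor is expanded in the `ψ s`, only s = j survives: `e j s` vanishes for s >
    -- j and the eigenvalue `φ s (d ∸ s) j` for s < j. The surviving term has the positive
    -- eigenvalue `ω j`.
    γ′-γ′ : ∀ j x y → j ℕ.≤ d → P x → P y → ∑ XS (λ z → γ′ j (mm x z) * γ′ j (mm z y)) ≡ ω j * γ′ j (mm x y)
    γ′-γ′ j x y j≤d px py = begin
      ∑ XS (λ z → γ′ j (mm x z) * γ′ j (mm z y))
        ≡⟨ ∑-cong XS (λ z → trans (l1 (sg j) (γ j (mm x z)) (γ j (mm z y)))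
             (cong ((sg j * sg j) *_) (trans (ℤ.*-comm (γ j (mm x z)) _) (sym (∑<-*ˡ (suc d) (γ j (mm z y)) _))))) ⟩
      ∑ XS (λ z → (sg j * sg j) * ∑< (suc d) (λ s → γ j (mm z y) * (ψ s (mm x z) * e j s)))
        ≡⟨ trans (∑-*ˡ XS (sg j * sg j) _) (cong ((sg j * sg j) *_) (∑-∑< XS (suc d) _)) ⟩
      (sg j * sg j) * ∑< (suc d) (λ s → ∑ XS (λ z → γ j (mm z y) * (ψ s (mm x z) * e j s)))
        ≡⟨ cong ((sg j * sg j) *_) (∑<-cong (suc d) term) ⟩
      (sg j * sg j) * ∑< (suc d) (λ s → e j s * φ s (d ∸ s) j * γ j (mm x y))
        ≡⟨ cong ((sg j * sg j) *_) (∑<-single (suc d) j _ (s≤s j≤d) other) ⟩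
      (sg j * sg j) * (e j j * φ j (d ∸ j) j * γ j (mm x y))
        ≡⟨ l2 (sg j) (e j j) (φ j (d ∸ j) j) (γ j (mm x y)) ⟩
      ω j * γ′ j (mm x y) ∎
      where
      open ≡-Reasoning
      l1 : ∀ a b c → a * b * (a * c) ≡ a * a * (b * c)
      l1 = solve-∀
      l2 : ∀ a b c g → a * a * (b * c * g) ≡ a * b * c * (a * g)
      l2 = solve-∀
      l3 : ∀ a b c → a * (b * c) ≡ c * (b * a)
      l3 = solve-∀
      term : ∀ s → s ℕ.< suc d → ∑ XS (λ z → γ j (mm z y) * (ψ s (mm x z) * e j s)) ≡ e j s * φ s (d ∸ s) j * γ j (mm x y)
      term s (s≤s s≤d) = trans (∑-cong XS λ z → l3 (γ j (mm z y)) (ψ s (mm x z)) (e j s))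
        (trans (∑-*ˡ XS (e j s) _) (trans (cong (e j s *_) (ψ-γ (d ∸ s) s j x y (ℕ.m+[n∸m]≡n s≤d) j≤d px py)) (sym (ℤ.*-assoc (e j s) _ _))))
      other : ∀ s → s ℕ.< suc d → s ≢ j → e j s * φ s (d ∸ s) j * γ j (mm x y) ≡ 0ℤ
      other s (s≤s s≤d) s≢j with ℕ.<-cmp s j
      ... | tri< s<j _ _ = trans (cong (λ u → e j s * u * γ j (mm x y)) (φ-0 s (d ∸ s) j s<j (subst (j ℕ.≤_) (sym (ℕ.m+[n∸m]≡n s≤d)) j≤d)))
            (trans (cong (_* γ j (mm x y)) (ℤ.*-zeroʳ (e j s))) (ℤ.*-zeroˡ (γ j (mm x y))))
      ... | tri≈ _ s≡j _ = contradiction s≡j s≢j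
      ... | tri> _ _ j<s = trans (cong (λ u → u * φ s (d ∸ s) j * γ j (mm x y)) (e-0 j s j<s))
            (trans (cong (_* γ j (mm x y)) (ℤ.*-zeroˡ (φ s (d ∸ s) j))) (ℤ.*-zeroˡ (γ j (mm x y))))

    π : ℕ → ℤ
    π j = γ′ j d

    private
      -- the terms of the sum defining γ j d alternate in sign and grow in absolute value
      partial : ∀ j s → j ℕ.≤ d → s ℕ.≤ j →
        0ℤ < sg s * Γ j (suc s) d × sg s * Γ j (suc s) d ≤ sg-e j s * ψ s d
      partial j zero j≤d _ = subst (0ℤ <_) (sym (lem (ψ 0 d))) (ψd>0 0 z≤n) , ℤ.≤-reflexive (trans (lem (ψ 0 d)) (sym (ℤ.*-identityˡ _)))
        where
        lem : ∀ p → 1ℤ * (0ℤ + p * 1ℤ) ≡ p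
        lem = solve-∀
      partial j (suc s) j≤d s<j with partial j s j≤d (ℕ.<⇒≤ s<j)
      ... | lo , hi = subst (0ℤ <_) (sym split) (<⇒0<- (ℤ.≤-<-trans hi grow)) ,
          subst (_≤ sg-e j (suc s) * ψ (suc s) d) (sym split) (subst₂ _≤_ refl (ℤ.+-identityʳ _) (ℤ.+-monoʳ-≤ (sg-e j (suc s) * ψ (suc s) d) (ℤ.neg-mono-≤ (ℤ.<⇒≤ lo))))
        where
        lem : ∀ a G p ee → - a * (G + p * ee) ≡ (- a * ee) * p - a * G
        lem = solve-∀
        split : sg (suc s) * Γ j (suc (suc s)) d ≡ sg-e j (suc s) * ψ (suc s) d - sg s * Γ j (suc s) d
        split = lem (sg s) (Γ j (suc s) d) (ψ (suc s) d) (e j (suc s))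
        s<d : s ℕ.< d
        s<d = ℕ.<-≤-trans s<j j≤d
        θ≤ : θ j ≤ θ (suc s)
        θ≤ with suc s ℕ.≟ j
        ... | yes refl = ℤ.≤-refl
        ... | no ne = ℤ.<⇒≤ (θ-dec (suc s) j (ℕ.≤∧≢⇒< s<j ne) j≤d)
        step : ψ s d < (θ s - θ j) * ψ (suc s) d
        step = ℤ.<-≤-trans (gap s s ℕ.≤-refl s<d) (subst₂ _≤_ (ℤ.*-comm (ψ (suc s) d) _) (ℤ.*-comm (ψ (suc s) d) _)
          (scale-≤ (ψ (suc s) d) (ℤ.<⇒≤ (ψd>0 (suc s) s<d)) (ℤ.+-monoʳ-≤ (θ s) (ℤ.neg-mono-≤ θ≤))))
        grow : sg-e j s * ψ s d < sg-e j (suc s) * ψ (suc s) d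
        grow = subst (sg-e j s * ψ s d <_) (trans (sym (ℤ.*-assoc (sg-e j s) (θ s - θ j) (ψ (suc s) d))) (cong (_* ψ (suc s) d) (sym (sg-e-suc j s))))
          (scale-< (sg-e j s) (sg-e>0 j s j≤d (ℕ.<⇒≤ s<j)) step)

      Γ-full : ∀ j m → j ℕ.≤ d → γ j m ≡ Γ j (suc j) m
      Γ-full j m j≤d = trans (cong (λ n → Γ j n m) (sym (trans (ℕ.+-suc (d ∸ j) j) (cong suc (ℕ.m∸n+n≡m j≤d)))))
        (∑<-extend (suc j) (d ∸ j) _ λ s j<s → trans (cong (ψ s m *_) (e-0 j s j<s)) (ℤ.*-zeroʳ (ψ s m)))

    π>0 : ∀ j → j ℕ.≤ d → 0ℤ < π j
    π>0 j j≤d = subst (λ u → 0ℤ < sg j * u) (sym (Γ-full j d j≤d)) (proj₁ (partial j j j≤d ℕ.≤-refl))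

    γ′₀ : ∀ m → γ′ 0 m ≡ ψ 0 0
    γ′₀ m = trans (cong (1ℤ *_) (Γ-full 0 m z≤n)) (trans (lem (ψ 0 m)) (ψ₀ m))
      where
      lem : ∀ p → 1ℤ * (0ℤ + p * 1ℤ) ≡ p
      lem = solve-∀

    ψ-γ′ : ∀ k s j x y → s ℕ.+ k ≡ d → j ℕ.≤ d → P x → P y →
      ∑ XS (λ z → ψ s (mm x z) * γ′ j (mm z y)) ≡ φ s k j * γ′ j (mm x y)
    ψ-γ′ k s j x y eq j≤d px py = trans (∑-cong XS λ z → l (ψ s (mm x z)) (sg j) (γ j (mm z y)))
      (trans (∑-*ˡ XS (sg j) _) (trans (cong (sg j *_) (ψ-γ k s j x y eq j≤d px py)) (sym (l (φ s k j) (sg j) (γ j (mm x y))))))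
      where
      l : ∀ a b c → a * (b * c) ≡ b * (a * c)
      l = solve-∀

    -- The kernel `γ′ 0` is constant, so summing a row of `ψ s` amounts to reading off its
    -- eigenvalue on `γ′ 0`.
    row-sum : ∀ k s x → s ℕ.+ k ≡ d → P x → ∑ XS (λ z → ψ s (mm x z)) ≡ φ s k 0
    row-sum k s x eq px = cancel-≡ (ψ 0 0) (ψ-diag 0 z≤n)
      (trans (ℤ.*-comm (ψ 0 0) _) (trans (sym (∑-*ʳ XS (ψ 0 0) _))
        (trans (∑-cong XS λ z → cong (ψ s (mm x z) *_) (sym (γ′₀ (mm z x))))
          (trans (ψ-γ′ k s 0 x x eq z≤n px px) (trans (cong (φ s k 0 *_) (γ′₀ (mm x x))) (ℤ.*-comm _ (ψ 0 0)))))))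

    -- The top step of the recursion, with `ψ d` acting as the identity: the kernel `ψ (d − 1)` is A
    -- - θ d.
    ψ-pred : ∀ s (F : ℕ → ℤ) x y → suc s ≡ d → P x → P y →
      ∑ XS (λ z → ψ s (mm x z) * F (mm z y)) ≡ A (λ z → F (mm z y)) x - θ d * F (mm x y)
    ψ-pred s F x y refl px py = lem _ (θ d * F (mm x y)) _ (trans (A-cong _ _ x px λ z pz → sym (ψ-id F z y pz py))
        (trans (∑-step s x (λ w → F (mm w y)) ℕ.≤-refl px) (cong (λ u → θ d * u + ∑ XS (λ z → ψ s (mm x z) * F (mm z y))) (ψ-id F x y px py))))
      where
      lem : ∀ a b T → a ≡ b + T → T ≡ a - b
      lem a b T refl = l b T
        where
        l : ∀ b T → T ≡ b + T - b
        l = solve-∀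

    -- Quadratic forms of a family.

    module _ (Y : List C) (Y-P : ∀ y → y ∈ Y → P y) where

      pairSum : (ℕ → ℤ) → ℤ
      pairSum f = ∑ Y (λ x → ∑ Y (λ y → f (mm x y)))

      -- The kernel is symmetric and, up to `ω j`, equal to its own square, so its quadratic form at
      -- the family is a sum of squares over all vertices. Nonnegativity follows, and if the form is
      -- zero then so is every single row sum.
      γ′-square : ∀ j → j ℕ.≤ d → ω j * pairSum (γ′ j) ≡ ∑ XS (λ z → ∑ Y (λ y → γ′ j (mm z y)) * ∑ Y (λ y → γ′ j (mm z y)))
      γ′-square j j≤d = begin
        ω j * pairSum (γ′ j)
          ≡⟨ trans (sym (∑-*ˡ Y (ω j) _)) (∑-cong Y λ x → sym (∑-*ˡ Y (ω j) _)) ⟩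
        ∑ Y (λ x → ∑ Y (λ y → ω j * γ′ j (mm x y)))
          ≡⟨ ∑-cong∈ Y (λ x x∈ → ∑-cong∈ Y λ y y∈ → sym (γ′-γ′ j x y j≤d (Y-P x x∈) (Y-P y y∈))) ⟩
        ∑ Y (λ x → ∑ Y (λ y → ∑ XS (λ z → γ′ j (mm x z) * γ′ j (mm z y))))
          ≡⟨ ∑-cong Y (λ x → ∑-swap Y XS _) ⟩
        ∑ Y (λ x → ∑ XS (λ z → ∑ Y (λ y → γ′ j (mm x z) * γ′ j (mm z y))))
          ≡⟨ ∑-swap Y XS _ ⟩
        ∑ XS (λ z → ∑ Y (λ x → ∑ Y (λ y → γ′ j (mm x z) * γ′ j (mm z y))))
          ≡⟨ ∑-cong∈ XS (λ z z∈ → trans (∑-cong Y λ x → ∑-*ˡ Y (γ′ j (mm x z)) _) (trans (∑-*ʳ Y _ _)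
               (cong (_* ∑ Y (λ y → γ′ j (mm z y))) (∑-cong∈ Y λ x x∈ → cong (γ′ j) (mm-sym x z (Y-P x x∈) (XS-P z z∈)))))) ⟩
        ∑ XS (λ z → ∑ Y (λ y → γ′ j (mm z y)) * ∑ Y (λ y → γ′ j (mm z y))) ∎
        where open ≡-Reasoning

      γ′-psd : ∀ j → j ℕ.≤ d → 0ℤ ≤ pairSum (γ′ j)
      γ′-psd j j≤d = cancel-≤ (ω j) (ω>0 j j≤d) (subst₂ _≤_ (sym (ℤ.*-zeroʳ (ω j))) (sym (γ′-square j j≤d)) (∑-nonneg XS λ z _ → square-nonneg (∑ Y (λ y → γ′ j (mm z y)))))

      γ′-null : ∀ j → j ℕ.≤ d → pairSum (γ′ j) ≡ 0ℤ → ∀ x → P x → ∑ Y (λ y → γ′ j (mm x y)) ≡ 0ℤ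
      γ′-null j j≤d e₀ x px with XS-complete x px
      ... | z , z∈ , mm≡ = trans (∑-cong∈ Y λ y y∈ → cong (γ′ j) (trans (mm-sym x y px (Y-P y y∈))
              (trans (sym (mm≡ y (Y-P y y∈))) (mm-sym y z (Y-P y y∈) (XS-P z z∈)))))
            (square-0 _ (∑-nonneg-0 XS (λ w _ → square-nonneg (∑ Y (λ y → γ′ j (mm w y)))) (trans (sym (γ′-square j j≤d)) (trans (cong (ω j *_) e₀) (ℤ.*-zeroʳ (ω j)))) z z∈))

    -- Quadrature on the values `mm` ≥ t.

    module Quadrature (t r : ℕ) (t+r : t ℕ.+ r ≡ d) where

      -- the nodes are 0, t + 1, …, d
      node : ℕ → ℕ
      node zero    = 0
      node (suc i) = t ℕ.+ suc i

      node≤ : ∀ i k → i ℕ.≤ k → node i ℕ.≤ t ℕ.+ k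
      node≤ zero    k _ = z≤n
      node≤ (suc i) k p = ℕ.+-monoʳ-≤ t p

      node≤d : ∀ i → i ℕ.≤ r → node i ℕ.≤ d
      node≤d i p = subst (node i ℕ.≤_) t+r (node≤ i r p)

      -- The diagonal entry of the product of the kernels `ψ (t + k)` and `γ′ (node i)`: an
      -- eigenvalue times the diagonal value `π`, the same at every vertex.
      coef : ℕ → ℕ → ℤ
      coef k i = π (node i) * φ (t ℕ.+ k) (r ∸ k) (node i)

      t+k+ : ∀ k → k ℕ.≤ r → t ℕ.+ k ℕ.+ (r ∸ k) ≡ d
      t+k+ k p = trans (ℕ.+-assoc t k _) (trans (cong (t ℕ.+_) (ℕ.m+[n∸m]≡n p)) t+r)

      coef>0 : ∀ k i → i ℕ.≤ k → k ℕ.≤ r → 0ℤ < coef k i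
      coef>0 k i i≤k k≤r = pos*pos (π>0 (node i) (node≤d i (ℕ.≤-trans i≤k k≤r)))
        (φ>0 (t ℕ.+ k) (r ∸ k) (node i) (node≤ i k i≤k) (ℕ.≤-reflexive (t+k+ k k≤r)))

      -- `ψ (t + k)` annihilates the eigenkernels of index above t + k, and the nodes after the k-th
      -- are such indices. Leaving out the indices 1, ..., t is what makes the system triangular.
      coef-0 : ∀ k i → k ℕ.< i → i ℕ.≤ r → coef k i ≡ 0ℤ
      coef-0 k (suc i) k<i i≤r = trans (cong (π (node (suc i)) *_)
        (φ-0 (t ℕ.+ k) (r ∸ k) (node (suc i)) (ℕ.+-monoʳ-< t k<i) (subst (node (suc i) ℕ.≤_) (sym (t+k+ k (ℕ.≤-trans (ℕ.<⇒≤ k<i) i≤r))) (node≤d (suc i) i≤r))))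
        (ℤ.*-zeroʳ (π (node (suc i))))

      coef-suc : ∀ k i → suc k ℕ.≤ r → coef k i ≡ (θ (node i) - θ (suc (t ℕ.+ k))) * coef (suc k) i
      coef-suc k i k<r = trans (cong (λ u → π (node i) * φ (t ℕ.+ k) u (node i)) (ℕ.+-∸-assoc 1 k<r))
        (trans (lem (π (node i)) (θ (node i) - θ (suc (t ℕ.+ k))) (φ (suc (t ℕ.+ k)) (r ∸ suc k) (node i)))
          (cong (λ u → (θ (node i) - θ (suc (t ℕ.+ k))) * (π (node i) * φ u (r ∸ suc k) (node i))) (sym (ℕ.+-suc t k))))
        where
        lem : ∀ a b c → a * (b * c) ≡ b * (a * c)
        lem = solve-∀

      module _ (F : ℕ → ℤ) where

        private solution = triangular coef F r (λ k k≤r → coef>0 k k ℕ.≤-refl k≤r)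

        C₀ : ℤ
        C₀ = proj₁ solution

        μ : ℕ → ℤ
        μ = proj₁ (proj₂ solution)

        C₀>0 : 0ℤ < C₀
        C₀>0 = proj₁ (proj₂ (proj₂ solution))

        μ-eq : ∀ k → k ℕ.≤ r → ∑< (suc k) (λ i → μ i * coef k i) ≡ C₀ * F k
        μ-eq = proj₂ (proj₂ (proj₂ solution))

        -- The weights `μ` are chosen to prescribe the diagonal entries of the products of K with ψ
        -- t, ..., ψ d, up to the common scale `C₀`.
        K : ℕ → ℤ
        K m = ∑< (suc r) (λ i → μ i * γ′ (node i) m)

        K-trace : ∀ k x → k ℕ.≤ r → P x → ∑ XS (λ z → ψ (t ℕ.+ k) (mm x z) * K (mm z x)) ≡ C₀ * F k
        K-trace k x k≤r px = begin
          ∑ XS (λ z → ψ (t ℕ.+ k) (mm x z) * K (mm z x))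
            ≡⟨ ∑-cong XS (λ z → sym (∑<-*ˡ (suc r) (ψ (t ℕ.+ k) (mm x z)) _)) ⟩
          ∑ XS (λ z → ∑< (suc r) (λ i → ψ (t ℕ.+ k) (mm x z) * (μ i * γ′ (node i) (mm z x))))
            ≡⟨ ∑-∑< XS (suc r) _ ⟩
          ∑< (suc r) (λ i → ∑ XS (λ z → ψ (t ℕ.+ k) (mm x z) * (μ i * γ′ (node i) (mm z x))))
            ≡⟨ ∑<-cong (suc r) (λ i i≤r → term i (ℕ.≤-pred i≤r)) ⟩
          ∑< (suc r) (λ i → μ i * coef k i)
            ≡⟨ truncate ⟩
          ∑< (suc k) (λ i → μ i * coef k i)
            ≡⟨ μ-eq k k≤r ⟩
          C₀ * F k ∎
          where
          open ≡-Reasoning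
          l : ∀ a b c → a * (b * c) ≡ b * (a * c)
          l = solve-∀
          term : ∀ i → i ℕ.≤ r → ∑ XS (λ z → ψ (t ℕ.+ k) (mm x z) * (μ i * γ′ (node i) (mm z x))) ≡ μ i * coef k i
          term i i≤r = trans (∑-cong XS λ z → l (ψ (t ℕ.+ k) (mm x z)) (μ i) _) (trans (∑-*ˡ XS (μ i) _)
            (cong (μ i *_) (trans (ψ-γ′ (r ∸ k) (t ℕ.+ k) (node i) x x (t+k+ k k≤r) (node≤d i i≤r) px px)
              (trans (cong (λ m → φ (t ℕ.+ k) (r ∸ k) (node i) * γ′ (node i) m) (mm-refl x px)) (ℤ.*-comm _ (π (node i)))))))
          truncate : ∑< (suc r) (λ i → μ i * coef k i) ≡ ∑< (suc k) (λ i → μ i * coef k i)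
          truncate = go (r ∸ k) (ℕ.m∸n+n≡m k≤r)
            where
            go : ∀ j → j ℕ.+ k ≡ r → ∑< (suc r) (λ i → μ i * coef k i) ≡ ∑< (suc k) (λ i → μ i * coef k i)
            go j refl = cut j ℕ.≤-refl
              where
              cut : ∀ j′ → j′ ℕ.+ k ℕ.≤ r → ∑< (suc (j′ ℕ.+ k)) (λ i → μ i * coef k i) ≡ ∑< (suc k) (λ i → μ i * coef k i)
              cut zero     _ = refl
              cut (suc j′) p = trans (cong₂ _+_ (cut j′ (ℕ.<⇒≤ p))
                (trans (cong (μ (suc j′ ℕ.+ k) *_) (coef-0 k (suc j′ ℕ.+ k) (s≤s (ℕ.m≤n+m k j′)) p)) (ℤ.*-zeroʳ (μ (suc j′ ℕ.+ k))))) (ℤ.+-identityʳ _)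

        module _ (f : ℕ → ℤ) (x : C) (px : P x)
          (F≡ : ∀ k → k ℕ.≤ r → F k ≡ ∑ XS (λ z → ψ (t ℕ.+ k) (mm x z) * f (mm z x))) where

          private
            D : ℕ → ℤ
            D m = K m - C₀ * f m

            D-trace : ∀ k → k ℕ.≤ r → ∑ XS (λ z → ψ (t ℕ.+ k) (mm x z) * D (mm x z)) ≡ 0ℤ
            D-trace k k≤r = begin
              ∑ XS (λ z → ψ (t ℕ.+ k) (mm x z) * D (mm x z))
                ≡⟨ ∑-cong∈ XS (λ z z∈ → trans (cong (λ m → ψ (t ℕ.+ k) (mm x z) * D m) (mm-sym x z px (XS-P z z∈)))
                     (l (ψ (t ℕ.+ k) (mm x z)) (K (mm z x)) C₀ (f (mm z x)))) ⟩
              ∑ XS (λ z → ψ (t ℕ.+ k) (mm x z) * K (mm z x) - C₀ * (ψ (t ℕ.+ k) (mm x z) * f (mm z x)))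
                ≡⟨ trans (∑-- XS _ _) (cong₂ _-_ (K-trace k x k≤r px) (trans (∑-*ˡ XS C₀ _) (cong (C₀ *_) (sym (F≡ k k≤r))))) ⟩
              C₀ * F k - C₀ * F k ≡⟨ ℤ.+-inverseʳ (C₀ * F k) ⟩
              0ℤ ∎
              where
              open ≡-Reasoning
              l : ∀ p K c f → p * (K - c * f) ≡ p * K - c * (p * f)
              l = solve-∀

            -- downward induction on mm x z: only the elements with mm x z ≡ t + k contribute to D-trace k
            D-0 : ∀ j n → j ℕ.< n → ∀ k → j ℕ.+ k ≡ r → ∀ z → z ∈ XS → mm x z ≡ t ℕ.+ k → D (t ℕ.+ k) ≡ 0ℤ
            D-0 j (suc n) (s≤s j≤n) k j+k = level-0 XS (mm x) (ψ (t ℕ.+ k)) D (t ℕ.+ k) (ψ-low (t ℕ.+ k)) higher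
                (ψ-diag (t ℕ.+ k) (subst (t ℕ.+ k ℕ.≤_) t+r (ℕ.+-monoʳ-≤ t k≤r))) (D-trace k k≤r)
              where
              k≤r : k ℕ.≤ r
              k≤r = subst (k ℕ.≤_) j+k (ℕ.m≤n+m k j)
              higher : ∀ w → w ∈ XS → t ℕ.+ k ℕ.< mm x w → D (mm x w) ≡ 0ℤ
              higher w w∈ gt = subst (λ m → D m ≡ 0ℤ) t+k′ (D-0 (r ∸ k′) n
                  (ℕ.<-≤-trans (ℕ.+-cancelʳ-< k (r ∸ k′) j (subst (r ∸ k′ ℕ.+ k ℕ.<_) (trans (ℕ.m∸n+n≡m k′≤r) (sym j+k)) (ℕ.+-monoʳ-< (r ∸ k′) k<k′))) j≤n)
                  k′ (ℕ.m∸n+n≡m k′≤r) w w∈ (sym t+k′))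
                where
                k′ = mm x w ∸ t
                t≤ : t ℕ.≤ mm x w
                t≤ = ℕ.≤-trans (ℕ.m≤m+n t k) (ℕ.<⇒≤ gt)
                t+k′ : t ℕ.+ k′ ≡ mm x w
                t+k′ = ℕ.m+[n∸m]≡n t≤
                k<k′ : k ℕ.< k′
                k<k′ = ℕ.+-cancelˡ-< t k k′ (subst (t ℕ.+ k ℕ.<_) (sym t+k′) gt)
                k′≤r : k′ ℕ.≤ r
                k′≤r = ℕ.+-cancelˡ-≤ t k′ r (subst₂ ℕ._≤_ (sym t+k′) (sym t+r) (mm≤d x w px (XS-P w w∈)))

          -- K and C₀ f have the same traces against ψ t, ..., ψ d. As `ψ (t + k)` is zero below t +
          -- k and positive there, these traces determine a function of `mm` at all values ≥ t that
          -- occur, from the top value downwards.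
          K≡ : ∀ z → P z → t ℕ.≤ mm x z → K (mm x z) ≡ C₀ * f (mm x z)
          K≡ z pz t≤ with XS-complete z pz
          ... | z′ , z′∈ , mm≡ = lem (K (mm x z)) (C₀ * f (mm x z)) (subst (λ m → D m ≡ 0ℤ) t+k
                (D-0 (r ∸ k) _ ℕ.≤-refl k (ℕ.m∸n+n≡m k≤r) z′ z′∈ (trans (mm≡ x px) (sym t+k))))
            where
            k = mm x z ∸ t
            t+k : t ℕ.+ k ≡ mm x z
            t+k = ℕ.m+[n∸m]≡n t≤
            k≤r : k ℕ.≤ r
            k≤r = ℕ.+-cancelˡ-≤ t k r (subst₂ ℕ._≤_ (sym t+k) (sym t+r) (mm≤d x z px pz))
            lem : ∀ a b → a - b ≡ 0ℤ → a ≡ b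
            lem = ℤ.i-j≡0⇒i≡j

      -- The right-hand side that belongs to f = `ψ d`. Since `ψ d` is the identity kernel, its
      -- trace against `ψ (t + k)` is the diagonal value of the latter.
      ψ-at : ℕ → ℤ
      ψ-at k = ψ (t ℕ.+ k) d

      -- Compare consecutive rows. Passing from row k to row k + 1 divides the coefficient of an old
      -- weight by θ (node i) - θ (t + k + 1), and the right-hand side by a quotient that `gap`
      -- shows to be smaller. Hence the old weights, positive by induction, do not exhaust the
      -- right-hand side of the new row, and the new weight has to be positive.
      μ>0 : ∀ k → k ℕ.≤ r → ∀ i → i ℕ.≤ k → 0ℤ < μ ψ-at i
      μ>0 zero    k≤r .0 z≤n = cancel-pos (coef>0 0 0 z≤n z≤n)
        (subst (0ℤ <_) (sym (trans (sym (ℤ.+-identityˡ _)) (μ-eq ψ-at 0 z≤n))) (pos*pos (C₀>0 ψ-at) (ψd>0 (t ℕ.+ 0) (subst (t ℕ.+ 0 ℕ.≤_) t+r (ℕ.+-monoʳ-≤ t z≤n)))))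
      μ>0 (suc k) k<r i i≤ with i ℕ.≟ suc k
      ... | no ne = μ>0 k (ℕ.<⇒≤ k<r) i (ℕ.≤-pred (ℕ.≤∧≢⇒< i≤ ne))
      ... | yes refl = cancel-pos (coef>0 (suc k) (suc k) ℕ.≤-refl k<r)
        (subst (0ℤ <_) (trans (cong (_- S) (sym (μ-eq ψ-at (suc k) k<r))) (lem S _)) (<⇒0<- S<))
        where
        s = t ℕ.+ k
        S = ∑< (suc k) (λ i → μ ψ-at i * coef (suc k) i)
        lem : ∀ a b → a + b - a ≡ b
        lem = solve-∀
        s<d : s ℕ.< d
        s<d = subst (s ℕ.<_) t+r (ℕ.+-monoʳ-< t k<r)
        step : ∀ i → i ℕ.≤ k → ψ s d * (μ ψ-at i * coef (suc k) i) < ψ (suc s) d * (μ ψ-at i * coef k i)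
        step i i≤k = subst₂ _<_ (ℤ.*-comm (μ ψ-at i * coef (suc k) i) (ψ s d))
          (trans (l (μ ψ-at i) (coef (suc k) i) (θ (node i) - θ (suc s)) (ψ (suc s) d)) (cong (λ u → ψ (suc s) d * (μ ψ-at i * u)) (sym (coef-suc k i k<r))))
          (scale-< (μ ψ-at i * coef (suc k) i) (pos*pos (μ>0 k (ℕ.<⇒≤ k<r) i i≤k) (coef>0 (suc k) i (ℕ.m≤n⇒m≤1+n i≤k) k<r))
            (gap (node i) s (node≤ i k i≤k) s<d))
          where
          l : ∀ m c g p → m * c * (g * p) ≡ p * (m * (g * c))
          l = solve-∀
        -- The termwise comparison is summed over i ≤ k, row k evaluates the larger side, and the
        -- factor `ψ s d` is cancelled.
        S< : S < C₀ ψ-at * ψ-at (suc k)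
        S< = cancel-< (ψ s d) (ψd>0 s (ℕ.<⇒≤ s<d)) (subst₂ _<_ (∑<-*ˡ (suc k) (ψ s d) _)
          (trans (∑<-*ˡ (suc k) (ψ (suc s) d) _) (trans (cong (ψ (suc s) d *_) (μ-eq ψ-at k (ℕ.<⇒≤ k<r)))
            (trans (l′ (ψ (suc s) d) (C₀ ψ-at) (ψ s d)) (cong (λ u → ψ s d * (C₀ ψ-at * ψ u d)) (sym (ℕ.+-suc t k))))))
          (∑<-mono-< k step))
          where
          l′ : ∀ a c b → a * (c * b) ≡ b * (c * a)
          l′ = solve-∀

      -- The bound and the design identity.

      module _ (Y : List C) (Y-P : ∀ y → y ∈ Y → P y) (Y-t : ∀ x y → x ∈ Y → y ∈ Y → t ℕ.≤ mm x y) where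

        private
          ℓ : ℤ
          ℓ = + length Y

          pairSum-K : ∀ F → pairSum Y Y-P (K F) ≡ ∑< (suc r) (λ i → μ F i * pairSum Y Y-P (γ′ (node i)))
          pairSum-K F = trans (∑-cong Y λ x → trans (∑-∑< Y (suc r) _) (∑<-cong (suc r) λ i _ → ∑-*ˡ Y (μ F i) _))
            (trans (∑-∑< Y (suc r) _) (∑<-cong (suc r) λ i _ → ∑-*ˡ Y (μ F i) _))

          pairSum-γ′₀ : pairSum Y Y-P (γ′ 0) ≡ ψ 0 0 * ℓ * ℓ
          pairSum-γ′₀ = trans (∑-cong Y λ x → trans (∑-cong Y λ y → γ′₀ (mm x y)) (∑-const Y (ψ 0 0))) (trans (∑-const Y _) (l ℓ (ψ 0 0)))
            where
            l : ∀ a b → a * (a * b) ≡ b * a * a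
            l = solve-∀

          -- Row 0 of the system contains the node 0 only, where the eigenkernel is constant.
          first-eq : ∀ F → μ F 0 * ψ 0 0 * φ t r 0 ≡ C₀ F * F 0
          first-eq F = trans (trans (ℤ.*-assoc (μ F 0) (ψ 0 0) _) (trans (cong₂ (λ a b → μ F 0 * (a * φ b r 0)) (sym (γ′₀ d)) (sym (ℕ.+-identityʳ t)))
            (sym (ℤ.+-identityˡ _)))) (μ-eq F 0 z≤n)

        module _ (Y-id : ∀ x → x ∈ Y → ∑ Y (λ y → ψ d (mm x y)) ≡ 1ℤ) (M : ℤ) (φM : φ t r 0 ≡ ψ t d * M) where

          private
            rest : ℤ
            rest = ∑< r (λ i → μ ψ-at (suc i) * pairSum Y Y-P (γ′ (t ℕ.+ suc i)))

            rest-terms : ∀ i → i ℕ.< r → 0ℤ ≤ μ ψ-at (suc i) * pairSum Y Y-P (γ′ (t ℕ.+ suc i))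
            rest-terms i i<r = nonneg*nonneg (ℤ.<⇒≤ (μ>0 (suc i) i<r (suc i) ℕ.≤-refl)) (γ′-psd Y Y-P (t ℕ.+ suc i) (node≤d (suc i) i<r))

            t≤d : t ℕ.≤ d
            t≤d = subst (t ℕ.≤_) t+r (ℕ.m≤m+n t r)

            μ₀M : μ ψ-at 0 * ψ 0 0 * M ≡ C₀ ψ-at
            μ₀M = cancel-≡ (ψ t d) (ψd>0 t t≤d) (trans (l (ψ t d) (μ ψ-at 0 * ψ 0 0) M) (trans (cong (μ ψ-at 0 * ψ 0 0 *_) (sym φM))
              (trans (first-eq ψ-at) (trans (cong (λ u → C₀ ψ-at * ψ u d) (ℕ.+-identityʳ t)) (ℤ.*-comm _ (ψ t d))))))
              where
              l : ∀ a b c → a * (b * c) ≡ b * (a * c)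
              l = solve-∀

            -- On Y × Y the kernel K is C₀ times the identity, so its sum there is C₀ ℓ. In the
            -- expansion by nodes the constant kernel contributes a multiple of ℓ², and `rest`
            -- collects semidefinite kernels with positive weights.
            total : C₀ ψ-at * ℓ ≡ μ ψ-at 0 * (ψ 0 0 * ℓ * ℓ) + rest
            total = begin
              C₀ ψ-at * ℓ
                ≡⟨ cong (C₀ ψ-at *_) (sym (∑-1 Y)) ⟩
              C₀ ψ-at * ∑ Y (λ _ → 1ℤ)
                ≡⟨ trans (cong (C₀ ψ-at *_) (∑-cong∈ Y λ x x∈ → sym (Y-id x x∈))) (trans (sym (∑-*ˡ Y (C₀ ψ-at) _)) (∑-cong Y λ x → sym (∑-*ˡ Y (C₀ ψ-at) _))) ⟩
              ∑ Y (λ x → ∑ Y (λ y → C₀ ψ-at * ψ d (mm x y)))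
                ≡⟨ ∑-cong∈ Y (λ x x∈ → ∑-cong∈ Y λ y y∈ → sym (K≡ ψ-at (ψ d) x (Y-P x x∈) (F≡ x (Y-P x x∈)) y (Y-P y y∈) (Y-t x y x∈ y∈))) ⟩
              pairSum Y Y-P (K ψ-at)
                ≡⟨ trans (pairSum-K ψ-at) (∑<-head r _) ⟩
              μ ψ-at 0 * pairSum Y Y-P (γ′ 0) + rest
                ≡⟨ cong (λ u → μ ψ-at 0 * u + rest) pairSum-γ′₀ ⟩
              μ ψ-at 0 * (ψ 0 0 * ℓ * ℓ) + rest ∎
              where
              open ≡-Reasoning
              F≡ : ∀ x → P x → ∀ k → k ℕ.≤ r → ψ-at k ≡ ∑ XS (λ z → ψ (t ℕ.+ k) (mm x z) * ψ d (mm z x))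
              F≡ x px k k≤r = sym (trans (∑-cong∈ XS λ z z∈ → trans (ℤ.*-comm (ψ (t ℕ.+ k) (mm x z)) _)
                (cong₂ (λ a b → ψ d a * ψ (t ℕ.+ k) b) (mm-sym z x (XS-P z z∈) px) (mm-sym x z px (XS-P z z∈))))
                (trans (ψ-id (ψ (t ℕ.+ k)) x x px px) (cong (ψ (t ℕ.+ k)) (mm-refl x px))))

            -- Multiplying `total` by M replaces the weight of the node 0 by C₀, since μ₀ ψ₀₀ M =
            -- C₀. With `rest` ≥ 0 this reads ℓ² ≤ M ℓ, and ℓ = M forces `rest` to vanish.
            scaled : C₀ ψ-at * (M * ℓ) ≡ C₀ ψ-at * (ℓ * ℓ) + M * rest
            scaled = trans (l₁ (C₀ ψ-at) M ℓ) (trans (cong (M *_) total) (trans (l₂ M (μ ψ-at 0) (ψ 0 0) ℓ rest) (cong (λ u → u * (ℓ * ℓ) + M * rest) μ₀M)))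
              where
              l₁ : ∀ c m l → c * (m * l) ≡ m * (c * l)
              l₁ = solve-∀
              l₂ : ∀ m u p l s → m * (u * (p * l * l) + s) ≡ u * p * m * (l * l) + m * s
              l₂ = solve-∀

            M>0 : 0ℤ < M
            M>0 = cancel-pos (ψd>0 t t≤d) (subst (0ℤ <_) (trans φM (ℤ.*-comm (ψ t d) M)) (φ>0 t r 0 z≤n (ℕ.≤-reflexive t+r)))

          bound : ℓ ≤ M
          bound with length Y in eq
          ... | zero  = ℤ.<⇒≤ M>0
          ... | suc n = cancel-≤ (+ suc n) (+<+ (s≤s z≤n)) (subst (λ u → u * u ≤ u * M) (cong +_ eq)
                (subst (ℓ * ℓ ≤_) (ℤ.*-comm M ℓ) (cancel-≤ (C₀ ψ-at) (C₀>0 ψ-at) (subst (C₀ ψ-at * (ℓ * ℓ) ≤_) (sym scaled)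
                  (subst (_≤ C₀ ψ-at * (ℓ * ℓ) + M * rest) (ℤ.+-identityʳ _) (ℤ.+-monoʳ-≤ (C₀ ψ-at * (ℓ * ℓ))
                    (nonneg*nonneg (ℤ.<⇒≤ M>0) (proj₁ (∑<-nonneg-0 r _ rest-terms)))))))))

          tight : ℓ ≡ M → ∀ i → i ℕ.< r → ∀ x → P x → ∑ Y (λ y → γ′ (t ℕ.+ suc i) (mm x y)) ≡ 0ℤ
          tight eq i i<r = γ′-null Y Y-P (t ℕ.+ suc i) (node≤d (suc i) i<r)
            (cancel-≡ (μ ψ-at (suc i)) (μ>0 (suc i) i<r (suc i) ℕ.≤-refl)
              (trans (proj₂ (∑<-nonneg-0 r _ rest-terms) rest-0 i i<r) (sym (ℤ.*-zeroʳ (μ ψ-at (suc i))))))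
            where
            rest-0 : rest ≡ 0ℤ
            rest-0 = cancel-≡ M M>0 (trans (lem (C₀ ψ-at * (ℓ * ℓ)) (M * rest) (trans (sym scaled) (cong (λ u → C₀ ψ-at * (u * ℓ)) (sym eq)))) (sym (ℤ.*-zeroʳ M)))
              where
              l : ∀ a b → b ≡ a + b - a
              l = solve-∀
              lem : ∀ a b → a + b ≡ a → b ≡ 0ℤ
              lem a b h = trans (l a b) (trans (cong (_- a) h) (ℤ.+-inverseʳ a))

        -- For an arbitrary f the weights may have any sign, but by hypothesis the nodes above t
        -- contribute nothing to sums over Y. Only the node 0 is left, and `first-eq` ties its
        -- weight to `F 0`. In effect Y, seen from one of its own members, is distributed over the
        -- values of `mm` as the weights `ψ t` prescribe.
        design : (∀ i → i ℕ.< r → ∀ x → P x → ∑ Y (λ y → γ′ (t ℕ.+ suc i) (mm x y)) ≡ 0ℤ) →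
          ∀ x → x ∈ Y → (f : ℕ → ℤ) →
          φ t r 0 * ∑ Y (λ y → f (mm x y)) ≡ ℓ * ∑ XS (λ z → ψ t (mm x z) * f (mm z x))
        design null x x∈ f = cancel-≡ (C₀ F) (C₀>0 F) (begin
          C₀ F * (φ t r 0 * ∑ Y (λ y → f (mm x y)))
            ≡⟨ trans (l₁ (C₀ F) (φ t r 0) _) (cong (φ t r 0 *_) (sym (∑-*ˡ Y (C₀ F) _))) ⟩
          φ t r 0 * ∑ Y (λ y → C₀ F * f (mm x y))
            ≡⟨ cong (φ t r 0 *_) (∑-cong∈ Y λ y y∈ → sym (K≡ F f x px (λ _ _ → refl) y (Y-P y y∈) (Y-t x y x∈ y∈))) ⟩
          φ t r 0 * ∑ Y (λ y → K F (mm x y))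
            ≡⟨ cong (φ t r 0 *_) (trans (∑-∑< Y (suc r) _) (trans (∑<-cong (suc r) λ i _ → ∑-*ˡ Y (μ F i) _) (∑<-head r _))) ⟩
          φ t r 0 * (μ F 0 * ∑ Y (λ y → γ′ 0 (mm x y)) + ∑< r (λ i → μ F (suc i) * ∑ Y (λ y → γ′ (t ℕ.+ suc i) (mm x y))))
            ≡⟨ cong (φ t r 0 *_) (cong₂ _+_ (cong (μ F 0 *_) (trans (∑-cong Y λ y → γ′₀ (mm x y)) (∑-const Y (ψ 0 0))))
                 (∑<-0 r _ λ i i<r → trans (cong (μ F (suc i) *_) (null i i<r x px)) (ℤ.*-zeroʳ (μ F (suc i))))) ⟩
          φ t r 0 * (μ F 0 * (ℓ * ψ 0 0) + 0ℤ)
            ≡⟨ l₂ (φ t r 0) (μ F 0) ℓ (ψ 0 0) ⟩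
          ℓ * (μ F 0 * ψ 0 0 * φ t r 0)
            ≡⟨ trans (cong (ℓ *_) (first-eq F)) (l₁ ℓ (C₀ F) (F 0)) ⟩
          C₀ F * (ℓ * F 0)
            ≡⟨ cong (λ u → C₀ F * (ℓ * ∑ XS (λ z → ψ u (mm x z) * f (mm z x)))) (ℕ.+-identityʳ t) ⟩
          C₀ F * (ℓ * ∑ XS (λ z → ψ t (mm x z) * f (mm z x))) ∎)
          where
          open ≡-Reasoning
          px = Y-P x x∈
          F : ℕ → ℤ
          F k = ∑ XS (λ z → ψ (t ℕ.+ k) (mm x z) * f (mm z x))
          l₁ : ∀ a b c → a * (b * c) ≡ b * (a * c)
          l₁ = solve-∀
          l₂ : ∀ p u l k → p * (u * (l * k) + 0ℤ) ≡ l * (u * k * p)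
          l₂ = solve-∀

  -- Gaussian binomial coefficients

  module QNumbers (q : ℕ) (1<q : 1 ℕ.< q) where

    -- With p = q - 1 each power of q is 1 + p [n], and brackets of sums are polynomials in p and
    -- brackets of the summands. Identities between q-numbers thus become polynomial identities in
    -- independent atoms.
    p : ℤ
    p = + q - 1ℤ

    abstract
      [_] : ℕ → ℤ
      [ zero ]  = 0ℤ
      [ suc n ] = 1ℤ + (1ℤ + p) * [ n ]

      [0] : [ 0 ] ≡ 0ℤ
      [0] = refl

      [suc] : ∀ n → [ suc n ] ≡ 1ℤ + (1ℤ + p) * [ n ]
      [suc] n = refl

    private
      q≡ : + q ≡ 1ℤ + p
      q≡ = lem (+ q)
        where
        lem : ∀ a → a ≡ 1ℤ + (a - 1ℤ)
        lem = solve-∀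

    q^ : ℕ → ℤ
    q^ n = 1ℤ + p * [ n ]

    pow : ∀ n → + (q ℕ.^ n) ≡ q^ n
    pow zero    = sym (trans (cong (λ u → 1ℤ + p * u) [0]) (lem p))
      where
      lem : ∀ p → 1ℤ + p * 0ℤ ≡ 1ℤ
      lem = solve-∀
    pow (suc n) = trans (ℤ.pos-* q (q ℕ.^ n)) (trans (cong₂ _*_ q≡ (pow n)) (trans (lem p [ n ]) (cong (λ u → 1ℤ + p * u) (sym ([suc] n)))))
      where
      lem : ∀ p b → (1ℤ + p) * (1ℤ + p * b) ≡ 1ℤ + p * (1ℤ + (1ℤ + p) * b)
      lem = solve-∀

    [1] : [ 1 ] ≡ 1ℤ
    [1] = trans ([suc] 0) (trans (cong (λ u → 1ℤ + (1ℤ + p) * u) [0]) (lem p))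
      where
      lem : ∀ p → 1ℤ + (1ℤ + p) * 0ℤ ≡ 1ℤ
      lem = solve-∀

    [+] : ∀ m n → [ m ℕ.+ n ] ≡ [ m ] + q^ m * [ n ]
    [+] zero    n = sym (trans (cong (λ u → u + (1ℤ + p * u) * [ n ]) [0]) (lem p [ n ]))
      where
      lem : ∀ p b → 0ℤ + (1ℤ + p * 0ℤ) * b ≡ b
      lem = solve-∀
    [+] (suc m) n = trans ([suc] (m ℕ.+ n)) (trans (cong (λ u → 1ℤ + (1ℤ + p) * u) ([+] m n)) (trans (lem p [ m ] [ n ])
        (cong (λ u → u + (1ℤ + p * u) * [ n ]) (sym ([suc] m)))))
      where
      lem : ∀ p a b → 1ℤ + (1ℤ + p) * (a + (1ℤ + p * a) * b) ≡ (1ℤ + (1ℤ + p) * a) + (1ℤ + p * (1ℤ + (1ℤ + p) * a)) * b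
      lem = solve-∀

    q^+ : ∀ m n → q^ (m ℕ.+ n) ≡ q^ m * q^ n
    q^+ m n = trans (cong (λ u → 1ℤ + p * u) ([+] m n)) (lem p [ m ] [ n ])
      where
      lem : ∀ p a b → 1ℤ + p * (a + (1ℤ + p * a) * b) ≡ (1ℤ + p * a) * (1ℤ + p * b)
      lem = solve-∀

    p>0 : 0ℤ < p
    p>0 = <⇒0<- (+<+ 1<q)

    1≤p : 1ℤ ≤ p
    1≤p = ℤ.i<j⇒suc[i]≤j p>0

    q^>0 : ∀ n → 0ℤ < q^ n
    q^>0 n = subst (0ℤ <_) (pow n) (+<+ (ℕ.m^n>0 q {{ℕ.>-nonZero (ℕ.<-trans (s≤s z≤n) 1<q)}} n))

    []≥0 : ∀ n → 0ℤ ≤ [ n ]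
    []≥0 zero    = ℤ.≤-reflexive (sym [0])
    []≥0 (suc n) = subst (0ℤ ≤_) (sym ([suc] n)) (ℤ.+-mono-≤ {0ℤ} {1ℤ} {0ℤ} (+≤+ z≤n)
      (subst (_≤ (1ℤ + p) * [ n ]) (ℤ.*-zeroʳ (1ℤ + p)) (scale-≤ (1ℤ + p) (ℤ.<⇒≤ (subst (0ℤ <_) q≡ (+<+ (ℕ.<-trans (s≤s z≤n) 1<q)))) ([]≥0 n))))

    []>0 : ∀ n → 0ℤ < [ suc n ]
    []>0 n = subst (0ℤ <_) (sym ([+] 1 n)) (ℤ.+-mono-<-≤ {0ℤ} {[ 1 ]} {0ℤ} (subst (0ℤ <_) (sym [1]) (+<+ (s≤s z≤n)))
      (subst (_≤ q^ 1 * [ n ]) (ℤ.*-zeroʳ (q^ 1)) (scale-≤ (q^ 1) (ℤ.<⇒≤ (q^>0 1)) ([]≥0 n))))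

    []-mono : ∀ m k → [ m ] ≤ [ m ℕ.+ k ]
    []-mono m k = subst ([ m ] ≤_) (sym ([+] m k)) (subst (_≤ [ m ] + q^ m * [ k ]) (ℤ.+-identityʳ [ m ])
      (ℤ.+-monoʳ-≤ [ m ] (subst (_≤ q^ m * [ k ]) (ℤ.*-zeroʳ (q^ m)) (scale-≤ (q^ m) (ℤ.<⇒≤ (q^>0 m)) ([]≥0 k)))))

    []-mono-≤ : ∀ {m n} → m ℕ.≤ n → [ m ] ≤ [ n ]
    []-mono-≤ {m} {n} le = subst (λ u → [ m ] ≤ [ u ]) (ℕ.m+[n∸m]≡n le) ([]-mono m (n ∸ m))

    []<q^ : ∀ n → [ n ] < q^ n
    []<q^ n = ℤ.<-≤-trans (subst (_< 1ℤ + [ n ]) (ℤ.+-identityˡ [ n ]) (ℤ.+-monoˡ-< [ n ] {0ℤ} {1ℤ} (+<+ (s≤s z≤n))))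
      (ℤ.+-monoʳ-≤ 1ℤ (subst (_≤ p * [ n ]) (ℤ.*-identityˡ [ n ]) (subst₂ _≤_ (ℤ.*-comm [ n ] 1ℤ) (ℤ.*-comm [ n ] p) (scale-≤ [ n ] ([]≥0 n) 1≤p))))

    g : ℕ → ℕ → ℤ
    g s m = + gauss q m s

    g-0 : ∀ m → g 0 m ≡ 1ℤ
    g-0 zero    = refl
    g-0 (suc m) = refl

    pascal : ∀ s m → g (suc s) (suc m) ≡ g s m + q^ (suc s) * g (suc s) m
    pascal s m = cong (λ u → g s m + u) (trans (ℤ.pos-* (q ℕ.^ suc s) (gauss q m (suc s))) (cong (_* g (suc s) m) (pow (suc s))))

    g-low : ∀ s m → m ℕ.< s → g s m ≡ 0ℤ
    g-low (suc s) zero    _         = refl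
    g-low (suc s) (suc m) (s≤s m<s) = trans (pascal s m) (trans (cong₂ (λ a b → a + q^ (suc s) * b) (g-low s m m<s) (g-low (suc s) m (ℕ.m≤n⇒m≤1+n m<s))) (lem (q^ (suc s))))
      where
      lem : ∀ a → 0ℤ + a * 0ℤ ≡ 0ℤ
      lem = solve-∀

    g-diag : ∀ s → g s s ≡ 1ℤ
    g-diag zero    = refl
    g-diag (suc s) = trans (pascal s s) (trans (cong₂ (λ a b → a + q^ (suc s) * b) (g-diag s) (g-low (suc s) s ℕ.≤-refl)) (lem (q^ (suc s))))
      where
      lem : ∀ a → 1ℤ + a * 0ℤ ≡ 1ℤ
      lem = solve-∀

    g≥0 : ∀ s m → 0ℤ ≤ g s m
    g≥0 s m = +≤+ z≤n

    g>0 : ∀ s k → 0ℤ < g s (s ℕ.+ k)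
    g>0 zero    k = subst (0ℤ <_) (sym (g-0 k)) (+<+ (s≤s z≤n))
    g>0 (suc s) k = subst (0ℤ <_) (sym (pascal s (s ℕ.+ k))) (ℤ.+-mono-<-≤ {0ℤ} {g s (s ℕ.+ k)} {0ℤ} (g>0 s k)
      (subst (_≤ q^ (suc s) * g (suc s) (s ℕ.+ k)) (ℤ.*-zeroʳ (q^ (suc s))) (scale-≤ (q^ (suc s)) (ℤ.<⇒≤ (q^>0 (suc s))) (g≥0 (suc s) (s ℕ.+ k)))))

    absorb : ∀ s m → [ suc s ] * g (suc s) (suc m) ≡ [ suc m ] * g s m
    absorb zero zero = cong ([ 1 ] *_) (g-diag 1)
    absorb (suc s) zero = trans (cong ([ suc (suc s) ] *_) (g-low (suc (suc s)) 1 (s≤s (s≤s z≤n)))) (trans (ℤ.*-zeroʳ [ suc (suc s) ]) (sym (ℤ.*-zeroʳ [ 1 ])))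
    absorb zero (suc m) = begin
      [ 1 ] * g 1 (suc (suc m)) ≡⟨ cong ([ 1 ] *_) (pascal 0 (suc m)) ⟩
      [ 1 ] * (1ℤ + q^ 1 * g 1 (suc m)) ≡⟨ lem [ 1 ] (q^ 1) (g 1 (suc m)) ⟩
      [ 1 ] + q^ 1 * ([ 1 ] * g 1 (suc m)) ≡⟨ cong (λ u → [ 1 ] + q^ 1 * u) (absorb zero m) ⟩
      [ 1 ] + q^ 1 * ([ suc m ] * g 0 m) ≡⟨ cong (λ u → [ 1 ] + q^ 1 * ([ suc m ] * u)) (g-0 m) ⟩
      [ 1 ] + q^ 1 * ([ suc m ] * 1ℤ) ≡⟨ cong (λ u → [ 1 ] + q^ 1 * u) (ℤ.*-identityʳ [ suc m ]) ⟩
      [ 1 ] + q^ 1 * [ suc m ] ≡⟨ sym ([+] 1 (suc m)) ⟩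
      [ suc (suc m) ] ≡⟨ sym (ℤ.*-identityʳ [ suc (suc m) ]) ⟩
      [ suc (suc m) ] * 1ℤ ∎
      where
      open ≡-Reasoning
      lem : ∀ a b c → a * (1ℤ + b * c) ≡ a + b * (a * c)
      lem = solve-∀
    absorb (suc s) (suc m) = begin
      [ suc (suc s) ] * g (suc (suc s)) (suc (suc m)) ≡⟨ cong ([ suc (suc s) ] *_) (pascal (suc s) (suc m)) ⟩
      [ suc (suc s) ] * (gm + q^ (suc (suc s)) * g (suc (suc s)) (suc m)) ≡⟨ l₁ [ suc (suc s) ] gm (q^ (suc (suc s))) (g (suc (suc s)) (suc m)) ⟩
      [ suc (suc s) ] * gm + q^ (suc (suc s)) * ([ suc (suc s) ] * g (suc (suc s)) (suc m)) ≡⟨ cong (λ u → [ suc (suc s) ] * gm + q^ (suc (suc s)) * u) (absorb (suc s) m) ⟩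
      [ suc (suc s) ] * gm + q^ (suc (suc s)) * (bm * y) ≡⟨ cong₂ (λ a b → a * gm + b * (bm * y)) ([suc] (suc s)) (trans (cong (λ u → 1ℤ + p * u) ([suc] (suc s))) (l₂ p bs)) ⟩
      (1ℤ + (1ℤ + p) * bs) * gm + (1ℤ + p) * (1ℤ + p * bs) * (bm * y) ≡⟨ l₃ p bs gm bm y ⟩
      gm + (1ℤ + p) * (bs * gm) + (1ℤ + p) * (bm * (q^ (suc s) * y)) ≡⟨ cong (λ u → gm + (1ℤ + p) * u + (1ℤ + p) * (bm * (q^ (suc s) * y))) (absorb s m) ⟩
      gm + (1ℤ + p) * (bm * x) + (1ℤ + p) * (bm * (q^ (suc s) * y)) ≡⟨ cong (λ u → u + (1ℤ + p) * (bm * x) + (1ℤ + p) * (bm * (q^ (suc s) * y))) (pascal s m) ⟩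
      (x + q^ (suc s) * y) + (1ℤ + p) * (bm * x) + (1ℤ + p) * (bm * (q^ (suc s) * y)) ≡⟨ l₄ p x (q^ (suc s) * y) bm ⟩
      (1ℤ + (1ℤ + p) * bm) * (x + q^ (suc s) * y) ≡⟨ cong₂ _*_ (sym ([suc] (suc m))) (sym (pascal s m)) ⟩
      [ suc (suc m) ] * g (suc s) (suc m) ∎
      where
      open ≡-Reasoning
      gm = g (suc s) (suc m)
      x = g s m
      y = g (suc s) m
      bs = [ suc s ]
      bm = [ suc m ]
      l₁ : ∀ a g b c → a * (g + b * c) ≡ a * g + b * (a * c)
      l₁ = solve-∀
      l₂ : ∀ p b → 1ℤ + p * (1ℤ + (1ℤ + p) * b) ≡ (1ℤ + p) * (1ℤ + p * b)
      l₂ = solve-∀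
      l₃ : ∀ p bs gm bm y → (1ℤ + (1ℤ + p) * bs) * gm + (1ℤ + p) * (1ℤ + p * bs) * (bm * y) ≡ gm + (1ℤ + p) * (bs * gm) + (1ℤ + p) * (bm * ((1ℤ + p * bs) * y))
      l₃ = solve-∀
      l₄ : ∀ p x y b → (x + y) + (1ℤ + p) * (b * x) + (1ℤ + p) * (b * y) ≡ (1ℤ + (1ℤ + p) * b) * (x + y)
      l₄ = solve-∀

    -- The ratio of neighbouring entries of one row: subtracting the Pascal rule from `absorb`
    -- leaves both sides multiplied by q^(s+1), which is cancelled.
    shift : ∀ s u → [ suc s ] * g (suc s) (s ℕ.+ u) ≡ [ u ] * g s (s ℕ.+ u)
    shift s u = cancel-≡ (q^ (suc s)) (q^>0 (suc s)) (begin
      q^ (suc s) * ([ suc s ] * y) ≡⟨ l₁ (q^ (suc s)) [ suc s ] y x ⟩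
      [ suc s ] * (x + q^ (suc s) * y) - [ suc s ] * x ≡⟨ cong (λ v → [ suc s ] * v - [ suc s ] * x) (sym (pascal s (s ℕ.+ u))) ⟩
      [ suc s ] * g (suc s) (suc (s ℕ.+ u)) - [ suc s ] * x ≡⟨ cong (_- [ suc s ] * x) (absorb s (s ℕ.+ u)) ⟩
      [ suc s ℕ.+ u ] * x - [ suc s ] * x ≡⟨ cong (λ v → v * x - [ suc s ] * x) ([+] (suc s) u) ⟩
      ([ suc s ] + q^ (suc s) * [ u ]) * x - [ suc s ] * x ≡⟨ l₂ [ suc s ] (q^ (suc s)) [ u ] x ⟩
      q^ (suc s) * ([ u ] * x) ∎)
      where
      open ≡-Reasoning
      x = g s (s ℕ.+ u)
      y = g (suc s) (s ℕ.+ u)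
      l₁ : ∀ a b y x → a * (b * y) ≡ b * (x + a * y) - b * x
      l₁ = solve-∀
      l₂ : ∀ a b c x → (a + b * c) * x - a * x ≡ b * (c * x)
      l₂ = solve-∀

    -- The companion of `pascal`, with the power of q attached to the other summand; it comes from
    -- `absorb` and `shift` after multiplication by [s + 1].
    g-step : ∀ s u → g (suc s) (suc (s ℕ.+ u)) - g (suc s) (s ℕ.+ u) ≡ q^ u * g s (s ℕ.+ u)
    g-step s u = cancel-≡ [ suc s ] ([]>0 s) (begin
      [ suc s ] * (g (suc s) (suc (s ℕ.+ u)) - g (suc s) (s ℕ.+ u)) ≡⟨ l₁ [ suc s ] (g (suc s) (suc (s ℕ.+ u))) (g (suc s) (s ℕ.+ u)) ⟩
      [ suc s ] * g (suc s) (suc (s ℕ.+ u)) - [ suc s ] * g (suc s) (s ℕ.+ u) ≡⟨ cong₂ _-_ (absorb s (s ℕ.+ u)) (shift s u) ⟩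
      [ suc s ℕ.+ u ] * x - [ u ] * x ≡⟨ cong (λ v → v * x - [ u ] * x) (trans (cong [_] (ℕ.+-comm (suc s) u)) ([+] u (suc s))) ⟩
      ([ u ] + q^ u * [ suc s ]) * x - [ u ] * x ≡⟨ l₂ [ u ] (q^ u) [ suc s ] x ⟩
      [ suc s ] * (q^ u * x) ∎)
      where
      open ≡-Reasoning
      x = g s (s ℕ.+ u)
      l₁ : ∀ a b c → a * (b - c) ≡ a * b - a * c
      l₁ = solve-∀
      l₂ : ∀ a b c x → (a + b * c) * x - a * x ≡ c * (b * x)
      l₂ = solve-∀

    g-1 : ∀ m → g 1 m ≡ [ m ]
    g-1 zero    = sym [0]
    g-1 (suc m) = trans (sym (ℤ.*-identityˡ (g 1 (suc m)))) (trans (cong (_* g 1 (suc m)) (sym [1])) (trans (absorb 0 m) (trans (cong ([ suc m ] *_) (g-0 m)) (ℤ.*-identityʳ [ suc m ]))))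

    g-pred : ∀ m → g m (suc m) ≡ [ suc m ]
    g-pred m = sym (trans (trans (sym (ℤ.*-identityʳ [ suc m ])) (cong ([ suc m ] *_) (sym (trans (cong (g (suc m)) (ℕ.+-comm m 1)) (g-diag (suc m))))))
      (trans (shift m 1) (trans (cong (_* g m (m ℕ.+ 1)) [1]) (trans (ℤ.*-identityˡ _) (cong (g m) (ℕ.+-comm m 1))))))

    g-sym : ∀ a b → g a (a ℕ.+ b) ≡ g b (a ℕ.+ b)
    g-sym zero    b = trans (g-0 b) (sym (g-diag b))
    g-sym (suc a) b = cancel-≡ [ suc a ] ([]>0 a) (begin
      [ suc a ] * g (suc a) (suc a ℕ.+ b) ≡⟨ cong (λ n → [ suc a ] * g (suc a) n) (sym (ℕ.+-suc a b)) ⟩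
      [ suc a ] * g (suc a) (a ℕ.+ suc b) ≡⟨ shift a (suc b) ⟩
      [ suc b ] * g a (a ℕ.+ suc b) ≡⟨ cong ([ suc b ] *_) (g-sym a (suc b)) ⟩
      [ suc b ] * g (suc b) (a ℕ.+ suc b) ≡⟨ cong (λ n → [ suc b ] * g (suc b) n) (trans (ℕ.+-suc a b) (trans (cong suc (ℕ.+-comm a b)) (sym (ℕ.+-suc b a)))) ⟩
      [ suc b ] * g (suc b) (b ℕ.+ suc a) ≡⟨ shift b (suc a) ⟩
      [ suc a ] * g b (b ℕ.+ suc a) ≡⟨ cong (λ n → [ suc a ] * g b n) (ℕ.+-comm b (suc a)) ⟩
      [ suc a ] * g b (suc a ℕ.+ b) ∎)
      where open ≡-Reasoning

    -- [a] is smaller than q^a, and q^a [b] is a summand of [a + b].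
    [*]≤[+] : ∀ a b → [ a ] * [ b ] ≤ [ a ℕ.+ b ]
    [*]≤[+] a b = ℤ.≤-trans (subst₂ _≤_ (ℤ.*-comm [ b ] [ a ]) (ℤ.*-comm [ b ] (q^ a)) (scale-≤ [ b ] ([]≥0 b) (ℤ.<⇒≤ ([]<q^ a))))
      (subst (q^ a * [ b ] ≤_) (sym ([+] a b)) (subst (_≤ [ a ] + q^ a * [ b ]) (ℤ.+-identityˡ _) (ℤ.+-monoˡ-≤ (q^ a * [ b ]) ([]≥0 a))))

    -- Intersection numbers and eigenvalues.

    module Parameters (d : ℕ) where

      valency : ℤ
      valency = (1ℤ + p) * [ d ] * [ suc d ]

      -- intersection numbers of the graph: among the neighbours of a vertex at distance i, cᵢ are closer and bᵢ farther
      cᵢ bᵢ : ℕ → ℤ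
      cᵢ i = [ i ] * [ i ]
      bᵢ i = (1ℤ + p) * (q^ i * q^ i) * [ d ∸ i ] * [ suc d ∸ i ]

      -- The action of A on functions of `mm` at a vertex at distance i, where m = d - i: closer
      -- neighbours raise `mm`, farther ones lower it. At m = 0 the coefficient `bᵢ i` is zero, so
      -- the truncated `m ∸ 1` does no harm.
      tri : ℕ → ℕ → (ℕ → ℤ) → ℤ
      tri i m F = cᵢ i * F (suc m) + bᵢ i * F (m ∸ 1) + (valency - bᵢ i - cᵢ i) * F m

      -- The eigenvalues of the Grassmann graph of d-subspaces in dimension n = 2d + 1, in the form
      -- valency - [s] [n + 1 - s].
      θ : ℕ → ℤ
      θ s = valency - [ s ] * [ 2 ℕ.* d ℕ.+ 2 ∸ s ]

      fac : ℕ → ℤ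
      fac zero    = 1ℤ
      fac (suc k) = [ suc k ] * [ suc k ] * fac k

      -- `fac (d ∸ s)` absorbs the coefficient [d - s]² of the recursion: in this scaling A ψ (s +
      -- 1) = θ (s + 1) ψ (s + 1) + ψ s, and `ψ d` is the identity kernel.
      ψ : ℕ → ℕ → ℤ
      ψ s m = fac (d ∸ s) * g s m

      fac>0 : ∀ k → 0ℤ < fac k
      fac>0 zero    = +<+ (s≤s z≤n)
      fac>0 (suc k) = pos*pos (pos*pos ([]>0 k) ([]>0 k)) (fac>0 k)

      -- stated without subtraction: s = i + u, and v stands for 2d + 2 − s − i
      θ-gap : ∀ i u v → 2 ℕ.* d ℕ.+ 2 ≡ i ℕ.+ u ℕ.+ (i ℕ.+ v) → θ i - θ (i ℕ.+ u) ≡ q^ i * ([ u ] * [ v ])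
      θ-gap i u v eq = trans (cong₂ (λ a b → (valency - [ i ] * [ a ]) - (valency - [ i ℕ.+ u ] * [ b ])) e₁ e₂)
        (trans (cong₂ (λ a b → (valency - [ i ] * a) - (valency - [ i ℕ.+ u ] * b)) (trans ([+] (i ℕ.+ u) v) (cong (λ w → [ i ℕ.+ u ] + w * [ v ]) (q^+ i u))) ([+] i v))
          (trans (cong (λ w → (valency - [ i ] * (w + q^ i * q^ u * [ v ])) - (valency - w * ([ i ] + q^ i * [ v ]))) ([+] i u)) (lem valency p [ i ] [ u ] [ v ])))
        where
        e₂ : 2 ℕ.* d ℕ.+ 2 ∸ (i ℕ.+ u) ≡ i ℕ.+ v
        e₂ = trans (cong (_∸ (i ℕ.+ u)) eq) (ℕ.m+n∸m≡n (i ℕ.+ u) (i ℕ.+ v))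
        e₁ : 2 ℕ.* d ℕ.+ 2 ∸ i ≡ i ℕ.+ u ℕ.+ v
        e₁ = trans (cong (_∸ i) (trans eq (trans (sym (ℕ.+-assoc (i ℕ.+ u) i v)) (trans (cong (ℕ._+ v) (ℕ.+-comm (i ℕ.+ u) i)) (ℕ.+-assoc i (i ℕ.+ u) v))))) (ℕ.m+n∸m≡n i _)
        lem : ∀ k p i u v → (k - i * ((i + (1ℤ + p * i) * u) + (1ℤ + p * i) * (1ℤ + p * u) * v)) - (k - (i + (1ℤ + p * i) * u) * (i + (1ℤ + p * i) * v)) ≡ (1ℤ + p * i) * (u * v)
        lem = solve-∀

      private
        2d+2 : ∀ i u → i ℕ.+ u ℕ.≤ d → 2 ℕ.* d ℕ.+ 2 ≡ i ℕ.+ u ℕ.+ (i ℕ.+ (2 ℕ.+ u ℕ.+ 2 ℕ.* (d ∸ (i ℕ.+ u))))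
        2d+2 i u le = trans (cong (λ w → 2 ℕ.* w ℕ.+ 2) (sym (ℕ.m+[n∸m]≡n le))) (lem i u (d ∸ (i ℕ.+ u)))
          where
          lem : ∀ i u w → 2 ℕ.* (i ℕ.+ u ℕ.+ w) ℕ.+ 2 ≡ i ℕ.+ u ℕ.+ (i ℕ.+ (2 ℕ.+ u ℕ.+ 2 ℕ.* w))
          lem = solveℕ

      θ-dec : ∀ i s → i ℕ.< s → s ℕ.≤ d → θ s < θ i
      θ-dec i s i<s s≤d = subst (λ w → θ w < θ i) i+u (0<-⇒< (subst (0ℤ <_) (sym (θ-gap i (suc u) _ (2d+2 i (suc u) (subst (ℕ._≤ d) (sym i+u) s≤d))))
          (pos*pos (q^>0 i) (pos*pos ([]>0 u) ([]>0 _)))))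
        where
        u = s ∸ suc i
        i+u : i ℕ.+ suc u ≡ s
        i+u = trans (ℕ.+-suc i u) (ℕ.m+[n∸m]≡n i<s)

      ψ-pred-d : ∀ s k → s ℕ.+ suc k ≡ d → ψ s d ≡ [ suc k ] * [ suc s ] * ψ (suc s) d
      ψ-pred-d s k refl = trans (cong₂ (λ a b → fac a * b) (ℕ.m+n∸m≡n s (suc k)) refl)
        (trans (l₁ [ suc k ] (fac k) (g s (s ℕ.+ suc k))) (trans (cong (λ w → [ suc k ] * fac k * w) (sym (shift s (suc k))))
          (trans (l₂ [ suc k ] (fac k) [ suc s ] (g (suc s) (s ℕ.+ suc k)))
            (cong (λ w → [ suc k ] * [ suc s ] * (fac w * g (suc s) (s ℕ.+ suc k))) (sym (trans (cong (_∸ suc s) (ℕ.+-suc s k)) (ℕ.m+n∸m≡n s k)))))))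
        where
        l₁ : ∀ a f x → a * a * f * x ≡ a * f * (a * x)
        l₁ = solve-∀
        l₂ : ∀ a f b x → a * f * (b * x) ≡ a * b * (f * x)
        l₂ = solve-∀

      gap : ∀ i s → i ℕ.≤ s → s ℕ.< d → ψ s d < (θ i - θ (suc s)) * ψ (suc s) d
      gap i s i≤s s<d = subst₂ _<_ (sym (ψ-pred-d s k s+k)) (cong (_* ψ (suc s) d) (sym gap≡))
          (subst₂ _<_ (ℤ.*-comm (ψ (suc s) d) _) (ℤ.*-comm (ψ (suc s) d) _) (scale-< (ψ (suc s) d) ψ>0 main))
        where
        k = d ∸ suc s
        s+k : s ℕ.+ suc k ≡ d
        s+k = trans (ℕ.+-suc s k) (ℕ.m+[n∸m]≡n s<d)
        u = s ∸ i
        i+u : i ℕ.+ suc u ≡ suc s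
        i+u = trans (ℕ.+-suc i u) (cong suc (ℕ.m+[n∸m]≡n i≤s))
        v = 2 ℕ.+ suc u ℕ.+ 2 ℕ.* (d ∸ (i ℕ.+ suc u))
        gap≡ : θ i - θ (suc s) ≡ q^ i * ([ suc u ] * [ v ])
        gap≡ = trans (cong (λ w → θ i - θ w) (sym i+u)) (θ-gap i (suc u) v (2d+2 i (suc u) (subst (ℕ._≤ d) (sym i+u) s<d)))
        ψ>0 : 0ℤ < ψ (suc s) d
        ψ>0 = pos*pos (fac>0 (d ∸ suc s)) (subst (λ w → 0ℤ < g (suc s) w) (trans (sym (ℕ.+-suc s k)) s+k) (g>0 (suc s) k))
        -- [s+1] < q^i ([u+1] + 1) and [k+1] ([u+1] + 1) ≤ [u+1] [v] since [v] ≥ [k+2] ≥ 2 [k+1]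
        s-bound : [ suc s ] < q^ i * ([ suc u ] + 1ℤ)
        s-bound = subst₂ _<_ (sym (trans (cong [_] (sym i+u)) ([+] i (suc u)))) (l (q^ i) [ suc u ]) (ℤ.+-monoˡ-< (q^ i * [ suc u ]) ([]<q^ i))
          where
          l : ∀ a b → a + a * b ≡ a * (b + 1ℤ)
          l = solve-∀
        1≤u : 1ℤ ≤ [ suc u ]
        1≤u = ℤ.i<j⇒suc[i]≤j ([]>0 u)
        v-bound : [ suc k ] + [ suc k ] ≤ [ v ]
        v-bound = ℤ.≤-trans (subst (_≤ [ suc (suc k) ]) refl (subst (λ w → [ suc k ] + [ suc k ] ≤ w) (sym ([suc] (suc k))) half))
          ([]-mono-≤ {suc (suc k)} {v} (ℕ.≤-trans (ℕ.≤-reflexive (cong (λ w → suc (suc (d ∸ w))) (sym i+u))) (s≤s (s≤s (ℕ.≤-trans (ℕ.m≤m+n _ _) (ℕ.m≤n+m _ (suc u)))))))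
          where
          half : [ suc k ] + [ suc k ] ≤ 1ℤ + (1ℤ + p) * [ suc k ]
          half = subst₂ _≤_ (l₁ [ suc k ]) (l₂ p [ suc k ]) (ℤ.+-mono-≤ {0ℤ} {1ℤ} (+≤+ z≤n) (ℤ.+-monoʳ-≤ [ suc k ] (scale-≤ [ suc k ] ([]≥0 (suc k)) 1≤p)))
            where
            l₁ : ∀ a → 0ℤ + (a + a * 1ℤ) ≡ a + a
            l₁ = solve-∀
            l₂ : ∀ p a → 1ℤ + (a + a * p) ≡ 1ℤ + (1ℤ + p) * a
            l₂ = solve-∀
        main : [ suc k ] * [ suc s ] < q^ i * ([ suc u ] * [ v ])
        main = ℤ.<-≤-trans (scale-< [ suc k ] ([]>0 k) s-bound)
          (subst (_≤ q^ i * ([ suc u ] * [ v ])) (l₁ (q^ i) [ suc k ] ([ suc u ] + 1ℤ)) (scale-≤ (q^ i) (ℤ.<⇒≤ (q^>0 i))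
            (ℤ.≤-trans (subst ([ suc k ] * ([ suc u ] + 1ℤ) ≤_) (l₂ [ suc k ] [ suc u ]) (scale-≤ [ suc k ] ([]≥0 (suc k)) (ℤ.+-monoʳ-≤ [ suc u ] 1≤u)))
              (scale-≤ [ suc u ] ([]≥0 (suc u)) v-bound))))
          where
          l₁ : ∀ a b c → a * (b * c) ≡ b * (a * c)
          l₁ = solve-∀
          l₂ : ∀ a b → a * (b + b) ≡ b * (a + a)
          l₂ = solve-∀

      private
        b-term : ∀ s a → (1ℤ + p) * ([ s ℕ.+ a ] * (g (suc s) (s ℕ.+ a) - g (suc s) (s ℕ.+ a ∸ 1))) ≡ q^ a * ([ a ] * g s (s ℕ.+ a))
        b-term s zero = trans (cong₂ (λ x y → (1ℤ + p) * ([ s ℕ.+ 0 ] * (x - y))) (g-low (suc s) (s ℕ.+ 0) (ℕ.≤-reflexive (cong suc (ℕ.+-identityʳ s))))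
            (g-low (suc s) (s ℕ.+ 0 ∸ 1) (s≤s (ℕ.≤-trans (ℕ.m∸n≤m (s ℕ.+ 0) 1) (ℕ.≤-reflexive (ℕ.+-identityʳ s))))))
          (trans (l₁ p [ s ℕ.+ 0 ]) (sym (trans (cong (λ w → q^ 0 * (w * g s (s ℕ.+ 0))) [0]) (l₂ (q^ 0) (g s (s ℕ.+ 0))))))
          where
          l₁ : ∀ p a → (1ℤ + p) * (a * (0ℤ - 0ℤ)) ≡ 0ℤ
          l₁ = solve-∀
          l₂ : ∀ a b → a * (0ℤ * b) ≡ 0ℤ
          l₂ = solve-∀
        b-term s (suc a) = begin
          (1ℤ + p) * ([ s ℕ.+ suc a ] * (g (suc s) (s ℕ.+ suc a) - g (suc s) (s ℕ.+ suc a ∸ 1)))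
            ≡⟨ cong (λ w → (1ℤ + p) * ([ w ] * (g (suc s) w - g (suc s) (w ∸ 1)))) (ℕ.+-suc s a) ⟩
          (1ℤ + p) * ([ suc (s ℕ.+ a) ] * (g (suc s) (suc (s ℕ.+ a)) - g (suc s) (s ℕ.+ a)))
            ≡⟨ cong (λ w → (1ℤ + p) * ([ suc (s ℕ.+ a) ] * w)) (g-step s a) ⟩
          (1ℤ + p) * ([ suc (s ℕ.+ a) ] * (q^ a * g s (s ℕ.+ a)))
            ≡⟨ l₁ p [ suc (s ℕ.+ a) ] [ a ] (g s (s ℕ.+ a)) ⟩
          (1ℤ + p * (1ℤ + (1ℤ + p) * [ a ])) * ([ suc (s ℕ.+ a) ] * g s (s ℕ.+ a))
            ≡⟨ cong₂ (λ x y → (1ℤ + p * x) * y) (sym ([suc] a)) (sym (absorb s (s ℕ.+ a))) ⟩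
          q^ (suc a) * ([ suc s ] * g (suc s) (suc (s ℕ.+ a)))
            ≡⟨ cong (λ w → q^ (suc a) * ([ suc s ] * g (suc s) w)) (sym (ℕ.+-suc s a)) ⟩
          q^ (suc a) * ([ suc s ] * g (suc s) (s ℕ.+ suc a))
            ≡⟨ cong (q^ (suc a) *_) (shift s (suc a)) ⟩
          q^ (suc a) * ([ suc a ] * g s (s ℕ.+ suc a)) ∎
          where
          open ≡-Reasoning
          l₁ : ∀ p m a x → (1ℤ + p) * (m * ((1ℤ + p * a) * x)) ≡ (1ℤ + p * (1ℤ + (1ℤ + p) * a)) * (m * x)
          l₁ = solve-∀

      tri-g₀ : ∀ i m → tri i m (g 0) ≡ θ 0 * g 0 m
      tri-g₀ i m = trans (cong₂ (λ x y → cᵢ i * 1ℤ + bᵢ i * x + (valency - bᵢ i - cᵢ i) * y) (g-0 (m ∸ 1)) (g-0 m))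
        (trans (l (cᵢ i) (bᵢ i) valency [ 2 ℕ.* d ℕ.+ 2 ]) (cong₂ (λ x y → (valency - x * [ 2 ℕ.* d ℕ.+ 2 ]) * y) (sym [0]) (sym (g-0 m))))
        where
        l : ∀ c b k e → c * 1ℤ + b * 1ℤ + (k - b - c) * 1ℤ ≡ (k - 0ℤ * e) * 1ℤ
        l = solve-∀

      -- Written with differences of `g (suc s)`, the closer and the farther neighbours contribute
      -- multiples of `g s`, by `g-step` and `b-term`. For d = i + s + a, what remains to be checked
      -- is the polynomial identity `l₃` in p, [i], [a] and [s + a + 1].
      tri-g : ∀ s i m → i ℕ.+ m ≡ d → s ℕ.< d → tri i m (g (suc s)) ≡ θ (suc s) * g (suc s) m + [ d ∸ s ] * [ d ∸ s ] * g s m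
      tri-g s i m eq s<d with s ℕ.≤? m
      ... | no s≰m = trans (cong₂ (λ x y → cᵢ i * x + bᵢ i * y + (valency - bᵢ i - cᵢ i) * g (suc s) m) (g-low (suc s) (suc m) (s≤s m<s)) (g-low (suc s) (m ∸ 1) (s≤s (ℕ.≤-trans (ℕ.m∸n≤m m 1) (ℕ.<⇒≤ m<s)))))
          (trans (cong (λ x → cᵢ i * 0ℤ + bᵢ i * 0ℤ + (valency - bᵢ i - cᵢ i) * x) z)
            (trans (l (cᵢ i) (bᵢ i) valency (θ (suc s)) ([ d ∸ s ] * [ d ∸ s ])) (cong₂ (λ x y → θ (suc s) * x + [ d ∸ s ] * [ d ∸ s ] * y) (sym z) (sym (g-low s m m<s)))))
        where
        m<s = ℕ.≰⇒> s≰m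
        z : g (suc s) m ≡ 0ℤ
        z = g-low (suc s) m (ℕ.m≤n⇒m≤1+n m<s)
        l : ∀ c b k t e → c * 0ℤ + b * 0ℤ + (k - b - c) * 0ℤ ≡ t * 0ℤ + e * 0ℤ
        l = solve-∀
      ... | yes s≤m = subst (λ w → tri i w (g (suc s)) ≡ θ (suc s) * g (suc s) w + [ d ∸ s ] * [ d ∸ s ] * g s w) s+a (begin
          cᵢ i * G₊ + bᵢ i * G₋ + (valency - bᵢ i - cᵢ i) * G
            ≡⟨ l₁ (cᵢ i) (bᵢ i) valency G₊ G₋ G ⟩
          cᵢ i * (G₊ - G) - bᵢ i * (G - G₋) + valency * G
            ≡⟨ cong (λ w → cᵢ i * (G₊ - G) - w * (G - G₋) + valency * G) b≡ ⟩
          cᵢ i * (G₊ - G) - (1ℤ + p) * (q^ i * q^ i) * [ s ℕ.+ a ] * [ suc (s ℕ.+ a) ] * (G - G₋) + valency * G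
            ≡⟨ l₂ (cᵢ i) (G₊ - G) p (q^ i) [ s ℕ.+ a ] [ suc (s ℕ.+ a) ] (G - G₋) (valency * G) ⟩
          cᵢ i * (G₊ - G) - q^ i * q^ i * [ suc (s ℕ.+ a) ] * ((1ℤ + p) * ([ s ℕ.+ a ] * (G - G₋))) + valency * G
            ≡⟨ cong₂ (λ x y → cᵢ i * x - q^ i * q^ i * [ suc (s ℕ.+ a) ] * y + valency * G) (g-step s a) (b-term s a) ⟩
          cᵢ i * (q^ a * g′) - q^ i * q^ i * [ suc (s ℕ.+ a) ] * (q^ a * ([ a ] * g′)) + valency * G
            ≡⟨ l₃ p [ i ] [ a ] [ suc (s ℕ.+ a) ] g′ (valency * G) ⟩
          valency * G - ([ i ] + q^ i * ([ i ] + q^ i * ([ a ] + q^ a * [ suc (s ℕ.+ a) ]))) * ([ a ] * g′) + ([ a ] + q^ a * [ i ]) * ([ a ] + q^ a * [ i ]) * g′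
            ≡⟨ cong₂ (λ x y → valency * G - x * ([ a ] * g′) + y * y * g′) (sym big) (sym ([+] a i)) ⟩
          valency * G - [ i ℕ.+ (i ℕ.+ (a ℕ.+ suc (s ℕ.+ a))) ] * ([ a ] * g′) + [ a ℕ.+ i ] * [ a ℕ.+ i ] * g′
            ≡⟨ cong₂ (λ x y → valency * G - [ x ] * y + [ a ℕ.+ i ] * [ a ℕ.+ i ] * g′) e₁ (sym (shift s a)) ⟩
          valency * G - [ 2 ℕ.* d ℕ.+ 2 ∸ suc s ] * ([ suc s ] * G) + [ a ℕ.+ i ] * [ a ℕ.+ i ] * g′
            ≡⟨ cong (λ x → valency * G - [ 2 ℕ.* d ℕ.+ 2 ∸ suc s ] * ([ suc s ] * G) + [ x ] * [ x ] * g′) e₂ ⟩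
          valency * G - [ 2 ℕ.* d ℕ.+ 2 ∸ suc s ] * ([ suc s ] * G) + [ d ∸ s ] * [ d ∸ s ] * g′
            ≡⟨ l₄ valency G [ 2 ℕ.* d ℕ.+ 2 ∸ suc s ] [ suc s ] ([ d ∸ s ] * [ d ∸ s ] * g′) ⟩
          θ (suc s) * G + [ d ∸ s ] * [ d ∸ s ] * g′ ∎)
        where
        open ≡-Reasoning
        a = m ∸ s
        s+a : s ℕ.+ a ≡ m
        s+a = ℕ.m+[n∸m]≡n s≤m
        d≡ : i ℕ.+ (s ℕ.+ a) ≡ d
        d≡ = trans (cong (i ℕ.+_) s+a) eq
        G₊ = g (suc s) (suc (s ℕ.+ a))
        G₋ = g (suc s) (s ℕ.+ a ∸ 1)
        G = g (suc s) (s ℕ.+ a)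
        g′ = g s (s ℕ.+ a)
        b≡ : bᵢ i ≡ (1ℤ + p) * (q^ i * q^ i) * [ s ℕ.+ a ] * [ suc (s ℕ.+ a) ]
        b≡ = cong₂ (λ x y → (1ℤ + p) * (q^ i * q^ i) * [ x ] * [ y ]) (trans (cong (_∸ i) (sym d≡)) (ℕ.m+n∸m≡n i _))
          (trans (cong (λ w → suc w ∸ i) (sym d≡)) (trans (cong (_∸ i) (sym (ℕ.+-suc i (s ℕ.+ a)))) (ℕ.m+n∸m≡n i _)))
        big : [ i ℕ.+ (i ℕ.+ (a ℕ.+ suc (s ℕ.+ a))) ] ≡ [ i ] + q^ i * ([ i ] + q^ i * ([ a ] + q^ a * [ suc (s ℕ.+ a) ]))
        big = trans ([+] i _) (cong (λ w → [ i ] + q^ i * w) (trans ([+] i _) (cong (λ w → [ i ] + q^ i * w) ([+] a (suc (s ℕ.+ a))))))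
        e₁ : i ℕ.+ (i ℕ.+ (a ℕ.+ suc (s ℕ.+ a))) ≡ 2 ℕ.* d ℕ.+ 2 ∸ suc s
        e₁ = sym (trans (cong (λ w → 2 ℕ.* w ℕ.+ 2 ∸ suc s) (sym d≡)) (trans (cong (_∸ suc s) (l i s a)) (ℕ.m+n∸m≡n (suc s) _)))
          where
          l : ∀ i s a → 2 ℕ.* (i ℕ.+ (s ℕ.+ a)) ℕ.+ 2 ≡ suc s ℕ.+ (i ℕ.+ (i ℕ.+ (a ℕ.+ suc (s ℕ.+ a))))
          l = solveℕ
        e₂ : a ℕ.+ i ≡ d ∸ s
        e₂ = sym (trans (cong (_∸ s) (trans (sym d≡) (l i s a))) (ℕ.m+n∸m≡n s _))
          where
          l : ∀ i s a → i ℕ.+ (s ℕ.+ a) ≡ s ℕ.+ (a ℕ.+ i)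
          l = solveℕ
        l₁ : ∀ c b k x y z → c * x + b * y + (k - b - c) * z ≡ c * (x - z) - b * (z - y) + k * z
        l₁ = solve-∀
        l₂ : ∀ c x p i m m′ z k → c * x - (1ℤ + p) * (i * i) * m * m′ * z + k ≡ c * x - i * i * m′ * ((1ℤ + p) * (m * z)) + k
        l₂ = solve-∀
        l₃ : ∀ p i a m g k → i * i * ((1ℤ + p * a) * g) - (1ℤ + p * i) * (1ℤ + p * i) * m * ((1ℤ + p * a) * (a * g)) + k ≡
          k - (i + (1ℤ + p * i) * (i + (1ℤ + p * i) * (a + (1ℤ + p * a) * m))) * (a * g) + (a + (1ℤ + p * a) * i) * (a + (1ℤ + p * a) * i) * g
        l₃ = solve-∀
        l₄ : ∀ k G b s e → k * G - b * (s * G) + e ≡ (k - s * b) * G + e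
        l₄ = solve-∀

      tri-scale : ∀ i m c (F : ℕ → ℤ) → tri i m (λ n → c * F n) ≡ c * tri i m F
      tri-scale i m c F = l (cᵢ i) (bᵢ i) valency c (F (suc m)) (F (m ∸ 1)) (F m)
        where
        l : ∀ x b k c u v w → x * (c * u) + b * (c * v) + (k - b - x) * (c * w) ≡ c * (x * u + b * v + (k - b - x) * w)
        l = solve-∀

      tri-ψ₀ : ∀ i m → tri i m (ψ 0) ≡ θ 0 * ψ 0 m
      tri-ψ₀ i m = trans (tri-scale i m (fac d) (g 0)) (trans (cong (fac d *_) (tri-g₀ i m)) (l (fac d) (θ 0) (g 0 m)))
        where
        l : ∀ a b c → a * (b * c) ≡ b * (a * c)
        l = solve-∀

      tri-ψ : ∀ s i m → i ℕ.+ m ≡ d → s ℕ.< d → tri i m (ψ (suc s)) ≡ θ (suc s) * ψ (suc s) m + ψ s m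
      tri-ψ s i m eq s<d = trans (tri-scale i m (fac (d ∸ suc s)) (g (suc s))) (trans (cong (fac (d ∸ suc s) *_) (tri-g s i m eq s<d))
        (trans (l (fac (d ∸ suc s)) (θ (suc s)) (g (suc s) m) [ d ∸ s ] (g s m)) (cong (λ w → θ (suc s) * ψ (suc s) m + w * g s m) (sym fac≡))))
        where
        l : ∀ f t x b y → f * (t * x + b * b * y) ≡ t * (f * x) + b * b * f * y
        l = solve-∀
        fac≡ : fac (d ∸ s) ≡ [ d ∸ s ] * [ d ∸ s ] * fac (d ∸ suc s)
        fac≡ = trans (cong fac e) (cong (λ w → [ w ] * [ w ] * fac (d ∸ suc s)) (sym e))
          where
          e : d ∸ s ≡ suc (d ∸ suc s)
          e = ℕ.+-∸-assoc 1 s<d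

  -- Counting subspaces

  module Counting {q : ℕ} (F : FiniteField q) (n : ℕ) where
    open Spaces F
    open QNumbers q (1<q {n})

    private
      Sub : Set
      Sub = Subspace n
      module V = Classes (_≐_ {n}) (λ e i → sym (e i)) (λ e f i → trans (e i) (f i)) _≐?_

    module S = Classes (_≈S_ {n}) (λ {x} {y} → ≈-sym {n} {x} {y}) (λ {x} {y} {z} → ≈-trans {n} {x} {y} {z}) _≈?_

    ∑S : (Sub → ℤ) → ℤ
    ∑S = ∑ subspaces

    ⋀-cong : ∀ {x x′ y y′ : Sub} → x ≈S x′ → y ≈S y′ → (x ⋀ y) ≈S (x′ ⋀ y′)
    ⋀-cong {x} {x′} {y} {y′} (p , p′) (r , r′) =
      ⋀-greatest {x = x′} {y′} (x ⋀ y) (λ v v∈ → p v (⋀-lowerˡ x y v v∈)) (λ v v∈ → r v (⋀-lowerʳ x y v v∈)) ,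
      ⋀-greatest {x = x} {y} (x′ ⋀ y′) (λ v v∈ → p′ v (⋀-lowerˡ x′ y′ v v∈)) (λ v v∈ → r′ v (⋀-lowerʳ x′ y′ v v∈))

    ⋀-mono : ∀ {x x′ y y′ : Sub} → x ⊆S x′ → y ⊆S y′ → (x ⋀ y) ⊆S (x′ ⋀ y′)
    ⋀-mono {x} {x′} {y} {y′} p r =
      ⋀-greatest {x = x′} {y′} (x ⋀ y) (λ v v∈ → p v (⋀-lowerˡ x y v v∈)) (λ v v∈ → r v (⋀-lowerʳ x y v v∈))

    ⋀-comm : ∀ (x y : Sub) → (x ⋀ y) ≈S (y ⋀ x)
    ⋀-comm x y = ⋀-greatest {x = y} {x} (x ⋀ y) (⋀-lowerʳ x y) (⋀-lowerˡ x y) , ⋀-greatest {x = x} {y} (y ⋀ x) (⋀-lowerʳ y x) (⋀-lowerˡ y x)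

    Between : Sub → Sub → ℕ → Sub → Set
    Between R x k z = (R ⊆S z × z ⊆S x) × dim z ≡ dim R ℕ.+ k

    Between? : ∀ R x k z → Dec (Between R x k z)
    Between? R x k z = ((R ⊆? z) ×-dec (z ⊆? x)) ×-dec (dim z ℕ.≟ dim R ℕ.+ k)

    Between-resp : ∀ {R x k a b} → a ≈S b → Between R x k a → Between R x k b
    Between-resp {a = a} {b} (a⊆b , b⊆a) ((R⊆a , a⊆x) , da) =
      ((λ v v∈ → a⊆b v (R⊆a v v∈)) , λ v v∈ → a⊆x v (b⊆a v v∈)) , trans (sym (dim-≈ {x = a} {b} (a⊆b , b⊆a))) da

    private
      vec-count : ∀ (z x : Sub) → z ⊆S x → ∑ (E (basis x)) (λ v → ⟦ v ∈S? z ⟧) ≡ q^ (dim z)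
      vec-count z x z⊆x = trans (∑-cong (E (basis x)) λ v → sym (ℤ.*-identityʳ ⟦ v ∈S? z ⟧))
        (trans (V.∑-reindex (λ v → v ∈S? z) (E (basis z)) (E (basis x)) (λ _ → 1ℤ)
                 (E-unique _ (indep z)) (E-unique _ (indep x)) (λ _ → refl) (λ e p → span-resp (basis z) e p)
                 (λ v v∈ → E-complete (basis x) (z⊆x v (All.lookup (E-sound (basis z)) v∈)) , All.lookup (E-sound (basis z)) v∈)
                 (λ v p → E-complete (basis z) p))
          (trans (∑-1 (E (basis z))) (trans (cong +_ (length-E (basis z))) (pow (dim z)))))

      through : ∀ R x v → R ⊆S x → v ∈S x → ¬ (v ∈S R) →
        ∑S (λ z → ⟦ Between? R x 1 z ⟧ * ⟦ v ∈S? z ⟧) ≡ 1ℤ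
      through R x v R⊆x v∈x v∉R = trans (∑-cong subspaces λ z → sym (trans (ℤ.*-identityʳ _) (⟦⟧-× (Between? R x 1 z) (v ∈S? z))))
        (S.∑-unique (λ z → Between? R x 1 z ×-dec (v ∈S? z)) a subspaces (λ _ → 1ℤ) subspaces-unique (subspaces-complete a) (λ _ → refl) to from)
        where
        a = adjoin v R v∉R
        to : ∀ z → Between R x 1 z × v ∈S z → a ≈S z
        to z (((R⊆z , z⊆x) , dz) , v∈z) = a⊆z , ⊆-dim⇒⊇ {x = a} {z} a⊆z (ℕ.≤-reflexive (trans dz (ℕ.+-comm (dim R) 1)))
          where a⊆z = adjoin-⊆ {v = v} {R} {v∉R} z v∈z R⊆z
        from : ∀ z → a ≈S z → Between R x 1 z × v ∈S z
        from z (a⊆z , z⊆a) = (((λ w w∈ → a⊆z w (⊆-adjoin {v = v} {R} {v∉R} w w∈)) , λ w w∈ → adjoin-⊆ {v = v} {R} {v∉R} x v∈x R⊆x w (z⊆a w w∈)) ,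
          trans (sym (dim-≈ {x = a} {z} (a⊆z , z⊆a))) (ℕ.+-comm 1 (dim R))) , a⊆z v (span-here v (basis R))

    -- Pairs of a cover z and a vector v of x lying in z are counted twice. A vector of R lies in
    -- all N covers, any other vector of x in exactly one, so N q^(dim R + 1) = q^(dim R) N + q^(dim
    -- x) - q^(dim R).
    points : ∀ R x u → R ⊆S x → dim x ≡ dim R ℕ.+ u → ∑S (λ z → ⟦ Between? R x 1 z ⟧) ≡ [ u ]
    points R x u R⊆x dx = cancel-≡ (q^ (dim R) * p) (pos*pos (q^>0 (dim R)) p>0) (solve-for N (q^ (dim R)) p [ u ] count)
      where
      open ≡-Reasoning
      L = E (basis x)
      N : ℤ
      N = ∑S (λ z → ⟦ Between? R x 1 z ⟧)
      T : Vect n → ℤ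
      T v = ∑S (λ z → ⟦ Between? R x 1 z ⟧ * ⟦ v ∈S? z ⟧)
      T≡ : ∀ v → v ∈ L → T v ≡ ⟦ v ∈S? R ⟧ * N + (1ℤ - ⟦ v ∈S? R ⟧)
      T≡ v v∈ with v ∈S? R
      ... | yes v∈R = trans (∑-cong subspaces λ z → trans (⟦⟧*-cong (Between? R x 1 z) {⟦ v ∈S? z ⟧} {1ℤ} λ { ((R⊆z , _) , _) → ⟦⟧-yes (v ∈S? z) (R⊆z v v∈R) }) (ℤ.*-identityʳ ⟦ Between? R x 1 z ⟧)) (l N)
        where
        l : ∀ a → a ≡ 1ℤ * a + (1ℤ - 1ℤ)
        l = solve-∀
      ... | no v∉R = trans (through R x v R⊆x (All.lookup (E-sound (basis x)) v∈) v∉R) (l N)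
        where
        l : ∀ a → 1ℤ ≡ 0ℤ * a + (1ℤ - 0ℤ)
        l = solve-∀
      lhs : ∑ L T ≡ N * q^ (suc (dim R))
      lhs = begin
        ∑ L T ≡⟨ ∑-swap L subspaces _ ⟩
        ∑S (λ z → ∑ L (λ v → ⟦ Between? R x 1 z ⟧ * ⟦ v ∈S? z ⟧)) ≡⟨ ∑-cong subspaces (λ z → ∑-*ˡ L ⟦ Between? R x 1 z ⟧ _) ⟩
        ∑S (λ z → ⟦ Between? R x 1 z ⟧ * ∑ L (λ v → ⟦ v ∈S? z ⟧))
          ≡⟨ ∑-⟦⟧-cong (Between? R x 1) subspaces (λ { z ((_ , z⊆x) , dz) → trans (vec-count z x z⊆x) (cong q^ (trans dz (ℕ.+-comm (dim R) 1))) }) ⟩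
        ∑S (λ z → ⟦ Between? R x 1 z ⟧ * q^ (suc (dim R))) ≡⟨ ∑-*ʳ subspaces (q^ (suc (dim R))) _ ⟩
        N * q^ (suc (dim R)) ∎
      rhs : ∑ L T ≡ q^ (dim R) * N + (q^ (dim x) - q^ (dim R))
      rhs = begin
        ∑ L T ≡⟨ ∑-cong∈ L T≡ ⟩
        ∑ L (λ v → ⟦ v ∈S? R ⟧ * N + (1ℤ - ⟦ v ∈S? R ⟧)) ≡⟨ ∑-+ L _ _ ⟩
        ∑ L (λ v → ⟦ v ∈S? R ⟧ * N) + ∑ L (λ v → 1ℤ - ⟦ v ∈S? R ⟧)
          ≡⟨ cong₂ _+_ (trans (∑-*ʳ L N _) (cong (_* N) (vec-count R x R⊆x)))
               (trans (∑-- L _ _) (cong₂ _-_ (trans (∑-1 L) (trans (cong +_ (length-E (basis x))) (pow (dim x)))) (vec-count R x R⊆x))) ⟩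
        q^ (dim R) * N + (q^ (dim x) - q^ (dim R)) ∎
      q^suc : q^ (suc (dim R)) ≡ (1ℤ + p) * q^ (dim R)
      q^suc = trans (q^+ 1 (dim R)) (cong (_* q^ (dim R)) (trans (cong (λ w → 1ℤ + p * w) [1]) (cong (λ w → 1ℤ + w) (ℤ.*-identityʳ p))))
      count : N * ((1ℤ + p) * q^ (dim R)) ≡ q^ (dim R) * N + (q^ (dim R) * (1ℤ + p * [ u ]) - q^ (dim R))
      count = trans (cong (N *_) (sym q^suc)) (trans (sym lhs) (trans rhs (cong (λ w → q^ (dim R) * N + (w - q^ (dim R))) (trans (cong q^ dx) (q^+ (dim R) u)))))
      solve-for : ∀ N a p u → N * ((1ℤ + p) * a) ≡ a * N + (a * (1ℤ + p * u) - a) → a * p * N ≡ a * p * u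
      solve-for N a p u h = trans (l₁ N a p) (trans (cong (_- a * N) h) (l₂ N a p u))
        where
        l₁ : ∀ N a p → a * p * N ≡ N * ((1ℤ + p) * a) - a * N
        l₁ = solve-∀
        l₂ : ∀ N a p u → a * N + (a * (1ℤ + p * u) - a) - a * N ≡ a * p * u
        l₂ = solve-∀

    -- Flags R ⊂ w ⊆ z with w a cover of R are counted twice: each z of relative dimension k + 1 has
    -- [k + 1] choices of w, each w has by induction `g k (u − 1)` choices of z, and `absorb`
    -- relates the two counts.
    count : ∀ k R x u → R ⊆S x → dim x ≡ dim R ℕ.+ u → ∑S (λ z → ⟦ Between? R x k z ⟧) ≡ g k u
    count zero R x u R⊆x dx = trans (∑-cong subspaces λ z → sym (ℤ.*-identityʳ ⟦ Between? R x 0 z ⟧))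
      (trans (S.∑-unique (Between? R x 0) R subspaces (λ _ → 1ℤ) subspaces-unique (subspaces-complete R) (λ _ → refl) to from) (sym (g-0 u)))
      where
      to : ∀ z → Between R x 0 z → R ≈S z
      to z ((R⊆z , _) , dz) = R⊆z , ⊆-dim⇒⊇ {x = R} {z} R⊆z (ℕ.≤-reflexive (trans dz (ℕ.+-identityʳ (dim R))))
      from : ∀ z → R ≈S z → Between R x 0 z
      from z (R⊆z , z⊆R) = (R⊆z , λ v v∈ → R⊆x v (z⊆R v v∈)) , trans (sym (dim-≈ {x = R} {z} (R⊆z , z⊆R))) (sym (ℕ.+-identityʳ (dim R)))
    count (suc k) R x u R⊆x dx = cancel-≡ [ suc k ] ([]>0 k) (begin
      [ suc k ] * ∑S (λ z → ⟦ Between? R x (suc k) z ⟧)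
        ≡⟨ trans (ℤ.*-comm [ suc k ] _) (sym (∑-*ʳ subspaces [ suc k ] _)) ⟩
      ∑S (λ z → ⟦ Between? R x (suc k) z ⟧ * [ suc k ])
        ≡⟨ ∑-⟦⟧-cong (Between? R x (suc k)) subspaces (λ { z ((R⊆z , _) , dz) → sym (points R z (suc k) R⊆z dz) }) ⟩
      ∑S (λ z → ⟦ Between? R x (suc k) z ⟧ * ∑S (λ w → ⟦ Between? R z 1 w ⟧))
        ≡⟨ ∑-cong subspaces (λ z → sym (∑-*ˡ subspaces ⟦ Between? R x (suc k) z ⟧ _)) ⟩
      ∑S (λ z → ∑S (λ w → ⟦ Between? R x (suc k) z ⟧ * ⟦ Between? R z 1 w ⟧))
        ≡⟨ ∑-swap subspaces subspaces _ ⟩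
      ∑S (λ w → ∑S (λ z → ⟦ Between? R x (suc k) z ⟧ * ⟦ Between? R z 1 w ⟧))
        ≡⟨ ∑-cong subspaces (λ w → trans (∑-cong subspaces λ z → exchange w z) (∑-*ˡ subspaces ⟦ Between? R x 1 w ⟧ _)) ⟩
      ∑S (λ w → ⟦ Between? R x 1 w ⟧ * ∑S (λ z → ⟦ Between? w x k z ⟧))
        ≡⟨ last u dx ⟩
      [ suc k ] * g (suc k) u ∎)
      where
      open ≡-Reasoning
      exchange : ∀ w z → ⟦ Between? R x (suc k) z ⟧ * ⟦ Between? R z 1 w ⟧ ≡ ⟦ Between? R x 1 w ⟧ * ⟦ Between? w x k z ⟧
      exchange w z = trans (sym (⟦⟧-× (Between? R x (suc k) z) (Between? R z 1 w))) (trans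
        (⟦⟧-cong (Between? R x (suc k) z ×-dec Between? R z 1 w) (Between? R x 1 w ×-dec Between? w x k z)
          (λ { (((R⊆z , z⊆x) , dz) , ((R⊆w , w⊆z) , dw)) → ((R⊆w , λ v v∈ → z⊆x v (w⊆z v v∈)) , dw) , ((w⊆z , z⊆x) , trans dz (sym (trans (cong (ℕ._+ k) dw) (ℕ.+-assoc (dim R) 1 k)))) })
          (λ { (((R⊆w , w⊆x) , dw) , ((w⊆z , z⊆x) , dz)) → (((λ v v∈ → w⊆z v (R⊆w v v∈)) , z⊆x) , trans dz (trans (cong (ℕ._+ k) dw) (ℕ.+-assoc (dim R) 1 k))) , ((R⊆w , w⊆z) , dw) }))
        (⟦⟧-× (Between? R x 1 w) (Between? w x k z)))
      last : ∀ u → dim x ≡ dim R ℕ.+ u → ∑S (λ w → ⟦ Between? R x 1 w ⟧ * ∑S (λ z → ⟦ Between? w x k z ⟧)) ≡ [ suc k ] * g (suc k) u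
      last zero dx = trans (∑-cong subspaces λ w → trans (⟦⟧*-cong (Between? R x 1 w) {b = 0ℤ} λ { ((_ , w⊆x) , dw) → contradiction (dim-mono {x = w} {x} w⊆x) (ℕ.<⇒≱ (ℕ.≤-reflexive (trans (cong suc (trans dx (ℕ.+-identityʳ (dim R)))) (sym (trans dw (ℕ.+-comm (dim R) 1)))))) }) (ℤ.*-zeroʳ ⟦ Between? R x 1 w ⟧))
        (trans (∑-0 subspaces) (sym (ℤ.*-zeroʳ [ suc k ])))
      last (suc u) dx = trans (∑-⟦⟧-cong (Between? R x 1) subspaces (λ { w ((_ , w⊆x) , dw) → count k w x u w⊆x (trans dx (sym (trans (cong (ℕ._+ u) dw) (ℕ.+-assoc (dim R) 1 u)))) }))
        (trans (∑-*ʳ subspaces (g k u) _) (trans (cong (_* g k u) (points R x (suc u) R⊆x dx)) (sym (absorb k u))))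

    Coatom : Sub → Sub → Sub → Set
    Coatom R x h = (R ⊆S h × h ⊆S x) × suc (dim h) ≡ dim x

    Coatom? : ∀ R x h → Dec (Coatom R x h)
    Coatom? R x h = ((R ⊆? h) ×-dec (h ⊆? x)) ×-dec (suc (dim h) ℕ.≟ dim x)

    coatoms : ∀ R x u → R ⊆S x → dim x ≡ dim R ℕ.+ u → ∑S (λ h → ⟦ Coatom? R x h ⟧) ≡ [ u ]
    coatoms R x zero R⊆x dx = trans (∑-cong subspaces λ h → ⟦⟧-no (Coatom? R x h) λ { ((R⊆h , _) , dh) →
        ℕ.<⇒≱ (ℕ.≤-reflexive (trans dh (trans dx (ℕ.+-identityʳ (dim R))))) (dim-mono {x = R} {h} R⊆h) }) (trans (∑-0 subspaces) (sym [0]))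
    coatoms R x (suc u) R⊆x dx = trans (∑-cong subspaces λ h → ⟦⟧-cong (Coatom? R x h) (Between? R x u h)
        (λ { (i , dh) → i , ℕ.suc-injective (trans dh (trans dx (ℕ.+-suc (dim R) u))) })
        (λ { (i , dh) → i , trans (cong suc dh) (trans (sym (ℕ.+-suc (dim R) u)) (sym dx)) }))
      (trans (count u R x (suc u) R⊆x dx) (g-pred u))

    -- Here z and h have the same join with y, so by the modular law the extra dimension of z goes
    -- into the intersection. In `cover-⊈` it goes into the join instead.
    cover-⊆ : ∀ (h z y : Sub) → h ⊆S z → dim z ≡ suc (dim h) → z ⊆S (h ⋁ y) → dim (z ⋀ y) ≡ suc (dim (h ⋀ y))
    cover-⊆ h z y h⊆z dz z⊆ = ℕ.+-cancelʳ-≡ (dim (h ⋁ y)) _ _ (begin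
      dim (z ⋀ y) ℕ.+ dim (h ⋁ y) ≡⟨ cong (dim (z ⋀ y) ℕ.+_) (dim-≈ {x = h ⋁ y} {z ⋁ y} (to , from)) ⟩
      dim (z ⋀ y) ℕ.+ dim (z ⋁ y) ≡⟨ sym (modular z y) ⟩
      dim z ℕ.+ dim y             ≡⟨ cong (ℕ._+ dim y) dz ⟩
      suc (dim h ℕ.+ dim y)       ≡⟨ cong suc (modular h y) ⟩
      suc (dim (h ⋀ y)) ℕ.+ dim (h ⋁ y) ∎)
      where
      open ≡-Reasoning
      to : (h ⋁ y) ⊆S (z ⋁ y)
      to = ⋁-least {x = h} {y} (z ⋁ y) (λ v v∈ → ⋁-upperˡ z y v (h⊆z v v∈)) (⋁-upperʳ z y)
      from : (z ⋁ y) ⊆S (h ⋁ y)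
      from = ⋁-least {x = z} {y} (h ⋁ y) z⊆ (⋁-upperʳ h y)

    cover-⊈ : ∀ (h z y : Sub) → h ⊆S z → dim z ≡ suc (dim h) → ¬ (z ⊆S (h ⋁ y)) → dim (z ⋀ y) ≡ dim (h ⋀ y)
    cover-⊈ h z y h⊆z dz z⊈ = ℕ.≤-antisym (ℕ.+-cancelʳ-≤ (suc (dim (h ⋁ y))) _ _ (begin
      dim (z ⋀ y) ℕ.+ suc (dim (h ⋁ y)) ≤⟨ ℕ.+-monoʳ-≤ (dim (z ⋀ y)) bigger ⟩
      dim (z ⋀ y) ℕ.+ dim (z ⋁ y) ≡⟨ sym (modular z y) ⟩
      dim z ℕ.+ dim y             ≡⟨ cong (ℕ._+ dim y) dz ⟩
      suc (dim h ℕ.+ dim y)       ≡⟨ cong suc (modular h y) ⟩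
      suc (dim (h ⋀ y) ℕ.+ dim (h ⋁ y)) ≡⟨ sym (ℕ.+-suc (dim (h ⋀ y)) _) ⟩
      dim (h ⋀ y) ℕ.+ suc (dim (h ⋁ y)) ∎))
      (dim-mono {x = h ⋀ y} {z ⋀ y} (⋀-mono {h} {z} {y} {y} h⊆z (⊆-refl {x = y})))
      where
      open ℕ.≤-Reasoning
      to : (h ⋁ y) ⊆S (z ⋁ y)
      to = ⋁-least {x = h} {y} (z ⋁ y) (λ v v∈ → ⋁-upperˡ z y v (h⊆z v v∈)) (⋁-upperʳ z y)
      bigger : dim (h ⋁ y) ℕ.< dim (z ⋁ y)
      bigger with dim (z ⋁ y) ℕ.≤? dim (h ⋁ y)
      ... | yes le = contradiction (λ v v∈ → ⊆-dim⇒⊇ {x = h ⋁ y} {z ⋁ y} to le v (⋁-upperˡ z y v v∈)) z⊈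
      ... | no nle = ℕ.≰⇒> nle

    ⋀-inside : ∀ (z y S : Sub) → z ⊆S S → (z ⋀ y) ≈S (z ⋀ (y ⋀ S))
    ⋀-inside z y S z⊆S = ⋀-greatest {x = z} {y ⋀ S} (z ⋀ y) (⋀-lowerˡ z y)
        (⋀-greatest {x = y} {S} (z ⋀ y) (⋀-lowerʳ z y) (λ v v∈ → z⊆S v (⋀-lowerˡ z y v v∈))) ,
      ⋀-mono {z} {z} {y ⋀ S} {y} (⊆-refl {x = z}) (⋀-lowerˡ y S)

    -- Inside S only y ⋀ S matters. The covers whose intersection with y grows are those below h ⋁
    -- (y ⋀ S), a space of dimension a above h, so there are [a] of them.
    up-sum : ∀ h S y (f : ℕ → ℤ) u a → h ⊆S S → dim S ≡ dim h ℕ.+ u → dim (y ⋀ S) ≡ dim (h ⋀ y) ℕ.+ a →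
      ∑S (λ z → ⟦ Between? h S 1 z ⟧ * f (dim (z ⋀ y))) ≡ [ a ] * f (suc (dim (h ⋀ y))) + ([ u ] - [ a ]) * f (dim (h ⋀ y))
    up-sum h S y f u a h⊆S dS dy = trans
      (∑-⟦⟧-split (Between? h S 1) (Between? h S′ 1) subspaces (λ z → f (dim (z ⋀ y))) (f (suc (dim (h ⋀ y)))) (f (dim (h ⋀ y)))
        (λ { z ((h⊆z , z⊆S′) , dz) → (h⊆z , λ v v∈ → S′⊆S v (z⊆S′ v v∈)) , dz }) inside outside)
      (cong₂ (λ b c → b * f (suc (dim (h ⋀ y))) + (c - b) * f (dim (h ⋀ y))) (points h S′ a (⋁-upperˡ h y′) dS′) (points h S u h⊆S dS))
      where
      y′ = y ⋀ S
      S′ = h ⋁ y′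
      S′⊆S : S′ ⊆S S
      S′⊆S = ⋁-least {x = h} {y′} S h⊆S (⋀-lowerʳ y S)
      e≡ : dim (h ⋀ y) ≡ dim (h ⋀ y′)
      e≡ = dim-≈ {x = h ⋀ y} {h ⋀ y′} (⋀-inside h y S h⊆S)
      dS′ : dim S′ ≡ dim h ℕ.+ a
      dS′ = ℕ.+-cancelˡ-≡ (dim (h ⋀ y′)) _ _ (trans (sym (modular h y′)) (trans (cong (dim h ℕ.+_) (trans dy (cong (ℕ._+ a) e≡)))
        (trans (sym (ℕ.+-assoc (dim h) _ a)) (trans (cong (ℕ._+ a) (ℕ.+-comm (dim h) _)) (ℕ.+-assoc (dim (h ⋀ y′)) (dim h) a)))))
      inside : ∀ z → Between h S 1 z → Between h S′ 1 z → f (dim (z ⋀ y)) ≡ f (suc (dim (h ⋀ y)))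
      inside z ((h⊆z , z⊆S) , dz) ((_ , z⊆S′) , _) = cong f (trans (dim-≈ {x = z ⋀ y} {z ⋀ y′} (⋀-inside z y S z⊆S))
        (trans (cover-⊆ h z y′ h⊆z (trans dz (ℕ.+-comm (dim h) 1)) z⊆S′) (cong suc (sym e≡))))
      outside : ∀ z → Between h S 1 z → ¬ Between h S′ 1 z → f (dim (z ⋀ y)) ≡ f (dim (h ⋀ y))
      outside z ((h⊆z , z⊆S) , dz) ¬b = cong f (trans (dim-≈ {x = z ⋀ y} {z ⋀ y′} (⋀-inside z y S z⊆S))
        (trans (cover-⊈ h z y′ h⊆z (trans dz (ℕ.+-comm (dim h) 1)) (λ z⊆S′ → ¬b ((h⊆z , z⊆S′) , dz))) (sym e≡)))

    coatom-⊇ : ∀ (x h y : Sub) → h ⊆S x → (x ⋀ y) ⊆S h → dim (h ⋀ y) ≡ dim (x ⋀ y)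
    coatom-⊇ x h y h⊆x m⊆h = dim-≈ {x = h ⋀ y} {x ⋀ y} (⋀-mono {h} {x} {y} {y} h⊆x (⊆-refl {x = y}) , ⋀-greatest {x = h} {y} (x ⋀ y) m⊆h (⋀-lowerʳ x y))

    coatom-⊉ : ∀ (x h y : Sub) → h ⊆S x → suc (dim h) ≡ dim x → ¬ ((x ⋀ y) ⊆S h) → suc (dim (h ⋀ y)) ≡ dim (x ⋀ y)
    coatom-⊉ x h y h⊆x dh m⊈h = ℕ.+-cancelʳ-≡ (dim h) _ _ (sym (begin
      dim m ℕ.+ dim h ≡⟨ ℕ.+-comm (dim m) (dim h) ⟩
      dim h ℕ.+ dim m ≡⟨ modular h m ⟩
      dim (h ⋀ m) ℕ.+ dim (h ⋁ m) ≡⟨ cong₂ ℕ._+_ (dim-≈ {x = h ⋀ m} {h ⋀ y} meet≈) dj ⟩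
      dim (h ⋀ y) ℕ.+ suc (dim h) ≡⟨ ℕ.+-suc (dim (h ⋀ y)) (dim h) ⟩
      suc (dim (h ⋀ y)) ℕ.+ dim h ∎))
      where
      open ≡-Reasoning
      m = x ⋀ y
      meet≈ : (h ⋀ m) ≈S (h ⋀ y)
      meet≈ = ⋀-mono {h} {h} {m} {y} (⊆-refl {x = h}) (⋀-lowerʳ x y) ,
        ⋀-greatest {x = h} {m} (h ⋀ y) (⋀-lowerˡ h y) (⋀-mono {h} {x} {y} {y} h⊆x (⊆-refl {x = y}))
      dj : dim (h ⋁ m) ≡ suc (dim h)
      dj with dim (h ⋁ m) ℕ.≤? dim h
      ... | yes le = contradiction (λ v v∈ → ⊆-dim⇒⊇ {x = h} {h ⋁ m} (⋁-upperˡ h m) le v (⋁-upperʳ h m v v∈)) m⊈h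
      ... | no nle = ℕ.≤-antisym (subst (dim (h ⋁ m) ℕ.≤_) (sym dh) (dim-mono {x = h ⋁ m} {x} (⋁-least {x = h} {m} x h⊆x (⋀-lowerˡ x y)))) (ℕ.≰⇒> nle)

    -- A hyperplane of x keeps the whole intersection with y if it contains x ⋀ y, and loses one
    -- dimension otherwise. If x ⋀ y is zero, then a = dim x and the truncated value of f has
    -- coefficient zero.
    down-sum : ∀ x y (f : ℕ → ℤ) a → dim x ≡ dim (x ⋀ y) ℕ.+ a →
      ∑S (λ h → ⟦ Coatom? 0S x h ⟧ * f (dim (h ⋀ y))) ≡ [ a ] * f (dim (x ⋀ y)) + ([ dim x ] - [ a ]) * f (dim (x ⋀ y) ∸ 1)
    down-sum x y f a dx = trans
      (∑-⟦⟧-split (Coatom? 0S x) (Coatom? (x ⋀ y) x) subspaces (λ h → f (dim (h ⋀ y))) (f (dim (x ⋀ y))) (f (dim (x ⋀ y) ∸ 1))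
        (λ { h ((_ , h⊆x) , dh) → (0S-⊆ h , h⊆x) , dh })
        (λ { h ((_ , h⊆x) , dh) ((m⊆h , _) , _) → cong f (coatom-⊇ x h y h⊆x m⊆h) })
        (λ { h ((_ , h⊆x) , dh) ¬c → cong (λ e → f (e ∸ 1)) (coatom-⊉ x h y h⊆x dh λ m⊆h → ¬c ((m⊆h , h⊆x) , dh)) }))
      (cong₂ (λ b c → b * f (dim (x ⋀ y)) + (c - b) * f (dim (x ⋀ y) ∸ 1)) (coatoms (x ⋀ y) x a (⋀-lowerˡ x y) dx) (coatoms 0S x (dim x) (0S-⊆ x) refl))

  -- The twisted Grassmann graph

  module _ {A : Set} (L : List A) (c : A → ℤ) where

    linear₁-+ : ∀ (f g : A → ℤ) → ∑ L (λ z → c z * (f z + g z)) ≡ ∑ L (λ z → c z * f z) + ∑ L (λ z → c z * g z)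
    linear₁-+ f g = trans (∑-cong L λ z → ℤ.*-distribˡ-+ (c z) (f z) (g z)) (∑-+ L (λ z → c z * f z) (λ z → c z * g z))

    linear₁-* : ∀ (f : A → ℤ) k → ∑ L (λ z → c z * (f z * k)) ≡ ∑ L (λ z → c z * f z) * k
    linear₁-* f k = trans (∑-cong L λ z → sym (ℤ.*-assoc (c z) (f z) k)) (∑-*ʳ L k (λ z → c z * f z))

  module Graph {q : ℕ} (F : FiniteField q) (d : ℕ) (0<d : 0 ℕ.< d)
    (H : LinAlg.Subspace F (suc (2 ℕ.* d))) (dim-H : LinAlg.dim F H ≡ 2 ℕ.* d) where

    open Spaces F public
    open Twisted d H public
    open Counting F N public
    open QNumbers q (1<q {N}) public
    open Parameters d public

    Sub : Set
    Sub = Subspace N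

    suc-pred-d : suc (d ∸ 1) ≡ d
    suc-pred-d = ℕ.m+[n∸m]≡n 0<d

    abstract
      InX? : ∀ x → Dec (InX x)
      InX? x = ((dim x ℕ.≟ suc d) ×-dec ¬? (x ⊆? H)) ⊎-dec ((dim x ℕ.≟ d ∸ 1) ×-dec (x ⊆? H))

    InX-resp : ∀ {x y} → x ≈S y → InX x → InX y
    InX-resp {x} {y} x≈y (inj₁ (dx , x⊈H)) = inj₁ (trans (sym (dim-≈ {x = x} {y} x≈y)) dx , λ y⊆H → x⊈H λ v v∈ → y⊆H v (proj₁ x≈y v v∈))
    InX-resp {x} {y} x≈y (inj₂ (dx , x⊆H)) = inj₂ (trans (sym (dim-≈ {x = x} {y} x≈y)) dx , λ v v∈ → x⊆H v (proj₂ x≈y v v∈))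

    -- Chosen so that dim x + 2 σ x = d + 1 for vertices of both kinds. Half of dim x + dim y - 2
    -- dim (x ∩ y) is then d + 1 - σ x - σ y - dim (x ∩ y), which gives `mm` its uniform formula.
    σ : Sub → ℕ
    σ x with x ⊆? H
    ... | yes _ = 1
    ... | no _  = 0

    σ₁ : ∀ x → ¬ (x ⊆S H) → σ x ≡ 0
    σ₁ x x⊈H with x ⊆? H
    ... | yes x⊆H = contradiction x⊆H x⊈H
    ... | no _    = refl

    σ₂ : ∀ x → x ⊆S H → σ x ≡ 1
    σ₂ x x⊆H with x ⊆? H
    ... | yes _   = refl
    ... | no x⊈H = contradiction x⊆H x⊈H

    -- mm x y is d minus the distance of x and y.
    mm : Sub → Sub → ℕ
    mm x y = (dim (x ⋀ y) ℕ.+ σ x ℕ.+ σ y) ∸ 1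

    mm₁₁ : ∀ x y → ¬ (x ⊆S H) → ¬ (y ⊆S H) → mm x y ≡ dim (x ⋀ y) ∸ 1
    mm₁₁ x y nx ny = cong (_∸ 1) (trans (cong₂ (λ a b → dim (x ⋀ y) ℕ.+ a ℕ.+ b) (σ₁ x nx) (σ₁ y ny)) (trans (ℕ.+-identityʳ _) (ℕ.+-identityʳ _)))

    mm₁₂ : ∀ x y → ¬ (x ⊆S H) → y ⊆S H → mm x y ≡ dim (x ⋀ y)
    mm₁₂ x y nx py = cong (_∸ 1) (trans (cong₂ (λ a b → dim (x ⋀ y) ℕ.+ a ℕ.+ b) (σ₁ x nx) (σ₂ y py)) (trans (ℕ.+-comm _ 1) (cong suc (ℕ.+-identityʳ _))))

    mm₂₁ : ∀ x y → x ⊆S H → ¬ (y ⊆S H) → mm x y ≡ dim (x ⋀ y)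
    mm₂₁ x y px ny = cong (_∸ 1) (trans (cong₂ (λ a b → dim (x ⋀ y) ℕ.+ a ℕ.+ b) (σ₂ x px) (σ₁ y ny)) (trans (ℕ.+-identityʳ _) (ℕ.+-comm _ 1)))

    mm₂₂ : ∀ x y → x ⊆S H → y ⊆S H → mm x y ≡ suc (dim (x ⋀ y))
    mm₂₂ x y px py = cong (_∸ 1) (trans (cong₂ (λ a b → dim (x ⋀ y) ℕ.+ a ℕ.+ b) (σ₂ x px) (σ₂ y py)) (trans (ℕ.+-comm _ 1) (cong suc (ℕ.+-comm _ 1))))

    mm-sym : ∀ x y → mm x y ≡ mm y x
    mm-sym x y = cong (_∸ 1) (trans (ℕ.+-assoc (dim (x ⋀ y)) (σ x) (σ y)) (trans (cong₂ ℕ._+_ (dim-≈ {x = x ⋀ y} {y ⋀ x} (⋀-comm x y)) (ℕ.+-comm (σ x) (σ y))) (sym (ℕ.+-assoc (dim (y ⋀ x)) (σ y) (σ x)))))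

    σ-cong : ∀ {x y} → x ≈S y → σ x ≡ σ y
    σ-cong {x} {y} (p , r) with x ⊆? H
    ... | yes x⊆H = sym (σ₂ y λ v v∈ → x⊆H v (r v v∈))
    ... | no x⊈H  = sym (σ₁ y λ y⊆H → x⊈H λ v v∈ → y⊆H v (p v v∈))

    mm-congˡ : ∀ {x x′} y → x ≈S x′ → mm x y ≡ mm x′ y
    mm-congˡ {x} {x′} y e = cong₂ (λ a b → (a ℕ.+ b ℕ.+ σ y) ∸ 1) (dim-≈ {x = x ⋀ y} {x′ ⋀ y} (⋀-cong {x} {x′} {y} {y} e (≈-refl {x = y}))) (σ-cong {x} {x′} e)

    mm-congʳ : ∀ x {y y′} → y ≈S y′ → mm x y ≡ mm x y′
    mm-congʳ x {y} {y′} e = trans (mm-sym x y) (trans (mm-congˡ {y} {y′} x e) (mm-sym y′ x))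

    ⋀-dimˡ : ∀ (x y : Sub) → dim (x ⋀ y) ℕ.≤ dim x
    ⋀-dimˡ x y = dim-mono {x = x ⋀ y} {x} (⋀-lowerˡ x y)

    ⋀-dimʳ : ∀ (x y : Sub) → dim (x ⋀ y) ℕ.≤ dim y
    ⋀-dimʳ x y = dim-mono {x = x ⋀ y} {y} (⋀-lowerʳ x y)

    dim≤N : ∀ (x : Sub) → dim x ℕ.≤ N
    dim≤N x = subst (dim x ℕ.≤_) dim-1S (dim-mono {x = x} {1S} (⊆-1S x))

    meet-H : ∀ x → ¬ (x ⊆S H) → dim x ≡ suc (dim (x ⋀ H))
    meet-H x x⊈H = ℕ.+-cancelʳ-≡ (2 ℕ.* d) _ _ (trans (cong (dim x ℕ.+_) (sym dim-H)) (trans (modular x H) (trans (cong (dim (x ⋀ H) ℕ.+_) join) (ℕ.+-suc _ (2 ℕ.* d)))))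
      where
      join : dim (x ⋁ H) ≡ N
      join = ℕ.≤-antisym (dim≤N (x ⋁ H)) (bigger (dim (x ⋁ H) ℕ.≤? dim H))
        where
        bigger : Dec (dim (x ⋁ H) ℕ.≤ dim H) → N ℕ.≤ dim (x ⋁ H)
        bigger (yes le) = contradiction (λ v v∈ → ⊆-dim⇒⊇ {x = H} {x ⋁ H} (⋁-upperʳ x H) le v (⋁-upperˡ x H v v∈)) x⊈H
        bigger (no nle) = subst (λ k → suc k ℕ.≤ dim (x ⋁ H)) dim-H (ℕ.≰⇒> nle)

    meet-⊆H : ∀ x → x ⊆S H → dim (x ⋀ H) ≡ dim x
    meet-⊆H x x⊆H = dim-≈ {x = x ⋀ H} {x} (⋀-lowerˡ x H , ⋀-greatest {x = x} {H} x (⊆-refl {x = x}) x⊆H)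

    -- Two (d + 1)-spaces do not fit disjointly into dimension 2d + 1. Hence the truncated
    -- subtraction in `mm` is exact also for two members of X₁.
    meet₁₁>0 : ∀ x y → dim x ≡ suc d → dim y ≡ suc d → 0 ℕ.< dim (x ⋀ y)
    meet₁₁>0 x y dx dy = ℕ.+-cancelʳ-≤ N 1 (dim (x ⋀ y)) (ℕ.≤-trans (ℕ.≤-reflexive (trans (lem d) (sym (cong₂ ℕ._+_ dx dy))))
      (ℕ.≤-trans (ℕ.≤-reflexive (modular x y)) (ℕ.+-monoʳ-≤ (dim (x ⋀ y)) (dim≤N (x ⋁ y)))))
      where
      lem : ∀ d → 1 ℕ.+ suc (2 ℕ.* d) ≡ suc d ℕ.+ suc d
      lem = solveℕ

    mm-refl : ∀ x → InX x → mm x x ≡ d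
    mm-refl x (inj₁ (dx , x⊈H)) = trans (mm₁₁ x x x⊈H x⊈H) (cong (_∸ 1) (trans (dim-≈ {x = x ⋀ x} {x} (⋀-lowerˡ x x , ⋀-greatest {x = x} {x} x (⊆-refl {x = x}) (⊆-refl {x = x}))) dx))
    mm-refl x (inj₂ (dx , x⊆H)) = trans (mm₂₂ x x x⊆H x⊆H) (trans (cong suc (trans (dim-≈ {x = x ⋀ x} {x} (⋀-lowerˡ x x , ⋀-greatest {x = x} {x} x (⊆-refl {x = x}) (⊆-refl {x = x}))) dx)) suc-pred-d)

    mm≤d : ∀ x y → InX x → InX y → mm x y ℕ.≤ d
    mm≤d x y (inj₁ (dx , nx)) (inj₁ (dy , ny)) = subst (ℕ._≤ d) (sym (mm₁₁ x y nx ny)) (ℕ.∸-monoˡ-≤ 1 (ℕ.≤-trans (⋀-dimˡ x y) (ℕ.≤-reflexive dx)))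
    mm≤d x y (inj₁ (dx , nx)) (inj₂ (dy , py)) = subst (ℕ._≤ d) (sym (mm₁₂ x y nx py)) (ℕ.≤-trans (⋀-dimʳ x y) (ℕ.≤-trans (ℕ.≤-reflexive dy) (ℕ.m∸n≤m d 1)))
    mm≤d x y (inj₂ (dx , px)) (inj₁ (dy , ny)) = subst (ℕ._≤ d) (sym (mm₂₁ x y px ny)) (ℕ.≤-trans (⋀-dimˡ x y) (ℕ.≤-trans (ℕ.≤-reflexive dx) (ℕ.m∸n≤m d 1)))
    mm≤d x y (inj₂ (dx , px)) (inj₂ (dy , py)) = subst (ℕ._≤ d) (sym (mm₂₂ x y px py)) (ℕ.≤-trans (s≤s (ℕ.≤-trans (⋀-dimˡ x y) (ℕ.≤-reflexive dx))) (ℕ.≤-reflexive suc-pred-d))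

    private
      full-meet : ∀ (x y : Sub) → dim x ℕ.≤ dim (x ⋀ y) → dim y ℕ.≤ dim (x ⋀ y) → x ≈S y
      full-meet x y lx ly =
        (λ v v∈ → ⋀-lowerʳ x y v (⊆-dim⇒⊇ {x = x ⋀ y} {x} (⋀-lowerˡ x y) lx v v∈)) ,
        (λ v v∈ → ⋀-lowerˡ x y v (⊆-dim⇒⊇ {x = x ⋀ y} {y} (⋀-lowerʳ x y) ly v v∈))

      pred-d<d : d ∸ 1 ℕ.< d
      pred-d<d = ℕ.≤-reflexive suc-pred-d

    mm≡d⇒≈ : ∀ x y → InX x → InX y → mm x y ≡ d → x ≈S y
    mm≡d⇒≈ x y (inj₁ (dx , nx)) (inj₁ (dy , ny)) e = full-meet x y (ℕ.≤-reflexive (trans dx (sym full))) (ℕ.≤-reflexive (trans dy (sym full)))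
      where
      full : dim (x ⋀ y) ≡ suc d
      full = trans (sym (ℕ.m+[n∸m]≡n (meet₁₁>0 x y dx dy))) (cong suc (trans (sym (mm₁₁ x y nx ny)) e))
    mm≡d⇒≈ x y (inj₁ (dx , nx)) (inj₂ (dy , py)) e = contradiction (subst₂ ℕ._≤_ (trans (sym (mm₁₂ x y nx py)) e) dy (⋀-dimʳ x y)) (ℕ.<⇒≱ pred-d<d)
    mm≡d⇒≈ x y (inj₂ (dx , px)) (inj₁ (dy , ny)) e = contradiction (subst₂ ℕ._≤_ (trans (sym (mm₂₁ x y px ny)) e) dx (⋀-dimˡ x y)) (ℕ.<⇒≱ pred-d<d)
    mm≡d⇒≈ x y (inj₂ (dx , px)) (inj₂ (dy , py)) e = full-meet x y (ℕ.≤-reflexive (trans dx (sym full))) (ℕ.≤-reflexive (trans dy (sym full)))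
      where
      full : dim (x ⋀ y) ≡ d ∸ 1
      full = ℕ.suc-injective (trans (sym (mm₂₂ x y px py)) (trans e (sym suc-pred-d)))

    -- Below d the function `ψ d` is zero, and `mm` reaches d for equal spaces only; the scaling
    -- makes the diagonal value 1.
    ψd : ∀ x y → InX x → InX y → ψ d (mm x y) ≡ ⟦ x ≈? y ⟧
    ψd x y px py with x ≈? y
    ... | yes e = trans (cong (ψ d) (trans (mm-congˡ {x} {y} y e) (mm-refl y py))) (trans (cong (λ k → fac k * g d d) (ℕ.n∸n≡0 d)) (trans (ℤ.*-identityˡ (g d d)) (g-diag d)))
    ... | no ne = trans (cong (fac (d ∸ d) *_) (g-low d (mm x y) (ℕ.≤∧≢⇒< (mm≤d x y px py) λ e → ne (mm≡d⇒≈ x y px py e)))) (ℤ.*-zeroʳ (fac (d ∸ d)))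

    XS : List Sub
    XS = filter InX? subspaces

    XS-InX : ∀ z → z ∈ XS → InX z
    XS-InX z z∈ = proj₂ (∈-filter⁻ InX? {xs = subspaces} z∈)

    XS-unique : S.Uniq XS
    XS-unique = AllPairs.filter⁺ InX? subspaces-unique

    XS-hits : ∀ x → InX x → S.Hits x XS
    XS-hits x px = go subspaces (subspaces-complete x)
      where
      go : ∀ L → S.Hits x L → S.Hits x (filter InX? L)
      go (y ∷ L) h with InX? y | h
      ... | yes _  | here e  = here e
      ... | yes _  | there r = there (go L r)
      ... | no ¬py | here e  = contradiction (InX-resp {x} {y} e px) ¬py
      ... | no _   | there r = go L r

    XS-complete : ∀ z → InX z → Σ Sub λ z′ → z′ ∈ XS × (∀ x → InX x → mm x z′ ≡ mm x z)
    XS-complete z pz = go XS (XS-hits z pz) λ w∈ → w∈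
      where
      go : ∀ L → S.Hits z L → (∀ {w} → w ∈ L → w ∈ XS) → Σ Sub λ z′ → z′ ∈ XS × (∀ x → InX x → mm x z′ ≡ mm x z)
      go (w ∷ L) (here e)  f = w , f (here refl) , λ x _ → mm-congʳ x {w} {z} (≈-sym {x = z} {w} e)
      go (w ∷ L) (there h) f = go L h λ u∈ → f (there u∈)

    ψ-id : ∀ (f : ℕ → ℤ) x y → InX x → InX y → ∑ XS (λ z → ψ d (mm x z) * f (mm z y)) ≡ f (mm x y)
    ψ-id f x y px py = trans (∑-cong∈ XS λ z z∈ → cong (_* f (mm z y)) (ψd x z px (XS-InX z z∈)))
      (S.∑-pick x XS (λ z → f (mm z y)) XS-unique (XS-hits x px) (λ {b} e → cong f (mm-congˡ {x} {b} y e)))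

    -- The adjacency operator.

    Up : Sub → Sub → Set
    Up h z = Between h 1S 1 z × ¬ (z ⊆S H)

    Up? : ∀ h z → Dec (Up h z)
    Up? h z = Between? h 1S 1 z ×-dec ¬? (z ⊆? H)

    -- For x ∈ X₂ the neighbours in X₁ are the members z of X₁ that contain x; `in-up∑` reaches each
    -- of them once, through w = z ∩ H. For x ∈ X₁ the neighbours in X₂ are the hyperplanes of x ∩
    -- H, collected by `co∑ (x ⋀ H)`.
    up∑ in∑ co∑ co-up∑ co-in∑ in-up∑ : Sub → (Sub → ℤ) → ℤ
    up∑ h f    = ∑S (λ z → ⟦ Up? h z ⟧ * f z)
    in∑ h f    = ∑S (λ z → ⟦ Between? h H 1 z ⟧ * f z)
    co∑ x f    = ∑S (λ h → ⟦ Coatom? 0S x h ⟧ * f h)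
    co-up∑ x f = ∑S (λ h → ⟦ Coatom? 0S x h ⟧ * up∑ h f)
    co-in∑ x f = ∑S (λ h → ⟦ Coatom? 0S x h ⟧ * in∑ h f)
    in-up∑ x f = ∑S (λ w → ⟦ Between? x H 1 w ⟧ * up∑ w f)

    -- A is the adjacency operator, written through the coatoms of x; the subtracted term removes the walks that return to x.
    A₁ A₂ A : (Sub → ℤ) → Sub → ℤ
    A₁ f x = co-up∑ x f - f x * [ suc d ] + co∑ (x ⋀ H) f
    A₂ f x = co-in∑ x f - f x * [ d ∸ 1 ] + in-up∑ x f
    A f x with x ⊆? H
    ... | yes _ = A₂ f x
    ... | no _  = A₁ f x

    A≡A₁ : ∀ f x → ¬ (x ⊆S H) → A f x ≡ A₁ f x
    A≡A₁ f x nx with x ⊆? H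
    ... | yes px = contradiction px nx
    ... | no _   = refl

    A≡A₂ : ∀ f x → x ⊆S H → A f x ≡ A₂ f x
    A≡A₂ f x px with x ⊆? H
    ... | yes _ = refl
    ... | no nx = contradiction px nx

    private
      nested-+ : ∀ {c : Sub → ℤ} {e : Sub → Sub → ℤ} (f g : Sub → ℤ) →
        ∑S (λ h → c h * ∑S (λ z → e h z * (f z + g z))) ≡ ∑S (λ h → c h * ∑S (λ z → e h z * f z)) + ∑S (λ h → c h * ∑S (λ z → e h z * g z))
      nested-+ {c} {e} f g = trans (∑-cong subspaces λ h → cong (c h *_) (linear₁-+ subspaces (e h) f g)) (linear₁-+ subspaces c (λ h → ∑S (λ z → e h z * f z)) (λ h → ∑S (λ z → e h z * g z)))

      nested-* : ∀ {c : Sub → ℤ} {e : Sub → Sub → ℤ} (f : Sub → ℤ) k →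
        ∑S (λ h → c h * ∑S (λ z → e h z * (f z * k))) ≡ ∑S (λ h → c h * ∑S (λ z → e h z * f z)) * k
      nested-* {c} {e} f k = trans (∑-cong subspaces λ h → cong (c h *_) (linear₁-* subspaces (e h) f k)) (linear₁-* subspaces c (λ h → ∑S (λ z → e h z * f z)) k)

      sum-+ : ∀ a b f g k c e → a + b - (f + g) * k + (c + e) ≡ (a - f * k + c) + (b - g * k + e)
      sum-+ = solve-∀

      sum-* : ∀ a f k b c → a * k - f * k * b + c * k ≡ (a - f * b + c) * k
      sum-* = solve-∀

    A-+ : ∀ (f g : Sub → ℤ) x → A (λ z → f z + g z) x ≡ A f x + A g x
    A-+ f g x with x ⊆? H
    ... | yes _ = trans (cong₂ (λ a b → a - (f x + g x) * [ d ∸ 1 ] + b)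
        (nested-+ {λ h → ⟦ Coatom? 0S x h ⟧} {λ h z → ⟦ Between? h H 1 z ⟧} f g) (nested-+ {λ w → ⟦ Between? x H 1 w ⟧} {λ w z → ⟦ Up? w z ⟧} f g))
      (sum-+ (co-in∑ x f) (co-in∑ x g) (f x) (g x) [ d ∸ 1 ] (in-up∑ x f) (in-up∑ x g))
    ... | no _ = trans (cong₂ (λ a b → a - (f x + g x) * [ suc d ] + b)
        (nested-+ {λ h → ⟦ Coatom? 0S x h ⟧} {λ h z → ⟦ Up? h z ⟧} f g) (linear₁-+ subspaces (λ y → ⟦ Coatom? 0S (x ⋀ H) y ⟧) f g))
      (sum-+ (co-up∑ x f) (co-up∑ x g) (f x) (g x) [ suc d ] (co∑ (x ⋀ H) f) (co∑ (x ⋀ H) g))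

    A-* : ∀ (f : Sub → ℤ) k x → A (λ z → f z * k) x ≡ A f x * k
    A-* f k x with x ⊆? H
    ... | yes _ = trans (cong₂ (λ a b → a - f x * k * [ d ∸ 1 ] + b)
        (nested-* {λ h → ⟦ Coatom? 0S x h ⟧} {λ h z → ⟦ Between? h H 1 z ⟧} f k) (nested-* {λ w → ⟦ Between? x H 1 w ⟧} {λ w z → ⟦ Up? w z ⟧} f k))
      (sum-* (co-in∑ x f) (f x) k [ d ∸ 1 ] (in-up∑ x f))
    ... | no _ = trans (cong₂ (λ a b → a - f x * k * [ suc d ] + b)
        (nested-* {λ h → ⟦ Coatom? 0S x h ⟧} {λ h z → ⟦ Up? h z ⟧} f k) (linear₁-* subspaces (λ y → ⟦ Coatom? 0S (x ⋀ H) y ⟧) f k))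
      (sum-* (co-up∑ x f) (f x) k [ suc d ] (co∑ (x ⋀ H) f))

    A-0 : ∀ x → A (λ _ → 0ℤ) x ≡ 0ℤ
    A-0 x = trans (A-* (λ _ → 0ℤ) 0ℤ x) (ℤ.*-zeroʳ (A (λ _ → 0ℤ) x))

    coatom-up₁ : ∀ x h z → dim x ≡ suc d → Coatom 0S x h → Up h z → InX z
    coatom-up₁ x h z dx (_ , dh) ((_ , dz) , nz) = inj₁ (trans dz (trans (ℕ.+-comm (dim h) 1) (trans dh dx)) , nz)

    coatom-down₁ : ∀ x y → dim x ≡ suc d → ¬ (x ⊆S H) → Coatom 0S (x ⋀ H) y → InX₂ y
    coatom-down₁ x y dx nx ((_ , y⊆) , dy) =
      cong (_∸ 1) (trans dy (ℕ.suc-injective (trans (sym (meet-H x nx)) dx))) , λ v v∈ → ⋀-lowerʳ x H v (y⊆ v v∈)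

    coatom-up₂ : ∀ x h z → dim x ≡ d ∸ 1 → Coatom 0S x h → Between h H 1 z → InX₂ z
    coatom-up₂ x h z dx (_ , dh) ((_ , z⊆H) , dz) = trans dz (trans (ℕ.+-comm (dim h) 1) (trans dh dx)) , z⊆H

    up-up₂ : ∀ x w z → dim x ≡ d ∸ 1 → Between x H 1 w → Up w z → InX z
    up-up₂ x w z dx (_ , dw) ((_ , dz) , nz) = inj₁ (trans dz (trans (ℕ.+-comm (dim w) 1) (cong suc (trans dw (trans (ℕ.+-comm (dim x) 1) (trans (cong suc dx) suc-pred-d))))) , nz)

    A-cong : ∀ (f g : Sub → ℤ) x → InX x → (∀ z → InX z → f z ≡ g z) → A f x ≡ A g x
    A-cong f g x (inj₁ (dx , nx)) e = trans (A≡A₁ f x nx) (trans (cong₂ _+_ (cong₂ (λ a b → a - b * [ suc d ])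
        (∑-⟦⟧-cong (Coatom? 0S x) subspaces λ h ch → ∑-⟦⟧-cong (Up? h) subspaces λ z u → e z (coatom-up₁ x h z dx ch u)) (e x (inj₁ (dx , nx))))
        (∑-⟦⟧-cong (Coatom? 0S (x ⋀ H)) subspaces λ y c → e y (inj₂ (coatom-down₁ x y dx nx c)))) (sym (A≡A₁ g x nx)))
    A-cong f g x (inj₂ (dx , px)) e = trans (A≡A₂ f x px) (trans (cong₂ _+_ (cong₂ (λ a b → a - b * [ d ∸ 1 ])
        (∑-⟦⟧-cong (Coatom? 0S x) subspaces λ h ch → ∑-⟦⟧-cong (Between? h H 1) subspaces λ z u → e z (inj₂ (coatom-up₂ x h z dx ch u))) (e x (inj₂ (dx , px))))
        (∑-⟦⟧-cong (Between? x H 1) subspaces λ w c → ∑-⟦⟧-cong (Up? w) subspaces λ z u → e z (up-up₂ x w z dx c u))) (sym (A≡A₂ g x px)))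

    -- The adjacency operator on functions of `mm`, for the four combinations of kinds.

    gen : (ℕ → ℤ) → ℕ → ℕ → ℕ → ℤ
    gen f u D e = [ D ∸ e ] * f (suc e) + ([ u ] - [ D ∸ e ]) * f e

    down : (ℕ → ℤ) → ℕ → ℕ → ℤ
    down f D e = [ D ∸ e ] * f e + ([ D ] - [ D ∸ e ]) * f (e ∸ 1)

    up-gen : ∀ (h S y : Sub) (f : ℕ → ℤ) u → h ⊆S S → dim S ≡ dim h ℕ.+ u →
      ∑S (λ z → ⟦ Between? h S 1 z ⟧ * f (dim (z ⋀ y))) ≡ gen f u (dim (y ⋀ S)) (dim (h ⋀ y))
    up-gen h S y f u h⊆S dS = up-sum h S y f u _ h⊆S dS (sym (ℕ.m+[n∸m]≡n
      (dim-mono {x = h ⋀ y} {y ⋀ S} (⋀-greatest {x = y} {S} (h ⋀ y) (⋀-lowerʳ h y) (λ v v∈ → h⊆S v (⋀-lowerˡ h y v v∈))))))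

    down-gen : ∀ x y (f : ℕ → ℤ) → ∑S (λ h → ⟦ Coatom? 0S x h ⟧ * f (dim (h ⋀ y))) ≡ down f (dim x) (dim (x ⋀ y))
    down-gen x y f = down-sum x y f _ (sym (ℕ.m+[n∸m]≡n (⋀-dimˡ x y)))

    private
      meet-1S : ∀ (y : Sub) → dim (y ⋀ 1S) ≡ dim y
      meet-1S y = dim-≈ {x = y ⋀ 1S} {y} (⋀-lowerˡ y 1S , ⋀-greatest {x = y} {1S} y (⊆-refl {x = y}) (⊆-1S y))

    up-1S : ∀ (h y : Sub) (f : ℕ → ℤ) u → N ≡ dim h ℕ.+ u →
      ∑S (λ z → ⟦ Between? h 1S 1 z ⟧ * f (dim (z ⋀ y))) ≡ gen f u (dim y) (dim (h ⋀ y))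
    up-1S h y f u e = trans (up-gen h 1S y f u (⊆-1S h) (trans dim-1S e)) (cong (λ D → gen f u D (dim (h ⋀ y))) (meet-1S y))

    Up-split : ∀ h (f : Sub → ℤ) → ∑S (λ z → ⟦ Up? h z ⟧ * f z) ≡ ∑S (λ z → ⟦ Between? h 1S 1 z ⟧ * f z) - ∑S (λ z → ⟦ Between? h H 1 z ⟧ * f z)
    Up-split h f = trans (∑-cong subspaces pointwise) (∑-- subspaces _ _)
      where
      l₁ : ∀ a → 1ℤ * a ≡ 1ℤ * a - 0ℤ * a
      l₁ = solve-∀
      l₂ : ∀ a → 0ℤ * a ≡ 1ℤ * a - 1ℤ * a
      l₂ = solve-∀
      l₃ : ∀ a → 0ℤ * a ≡ 0ℤ * a - 0ℤ * a
      l₃ = solve-∀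
      pointwise : ∀ z → ⟦ Up? h z ⟧ * f z ≡ ⟦ Between? h 1S 1 z ⟧ * f z - ⟦ Between? h H 1 z ⟧ * f z
      pointwise z = go (Between? h 1S 1 z) (z ⊆? H)
        where
        go : Dec (Between h 1S 1 z) → Dec (z ⊆S H) → ⟦ Up? h z ⟧ * f z ≡ ⟦ Between? h 1S 1 z ⟧ * f z - ⟦ Between? h H 1 z ⟧ * f z
        go (yes b@((h⊆z , _) , dz)) (yes z⊆H) = trans (cong (_* f z) (⟦⟧-no (Up? h z) λ { (_ , n) → n z⊆H })) (trans (l₂ (f z))
          (sym (cong₂ (λ a c → a * f z - c * f z) (⟦⟧-yes (Between? h 1S 1 z) b) (⟦⟧-yes (Between? h H 1 z) ((h⊆z , z⊆H) , dz)))))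
        go (yes b) (no z⊈H) = trans (cong (_* f z) (⟦⟧-yes (Up? h z) (b , z⊈H))) (trans (l₁ (f z))
          (sym (cong₂ (λ a c → a * f z - c * f z) (⟦⟧-yes (Between? h 1S 1 z) b) (⟦⟧-no (Between? h H 1 z) λ { ((_ , z⊆H) , _) → z⊈H z⊆H }))))
        go (no ¬b) _ = trans (cong (_* f z) (⟦⟧-no (Up? h z) λ { (b , _) → ¬b b })) (trans (l₃ (f z))
          (sym (cong₂ (λ a c → a * f z - c * f z) (⟦⟧-no (Between? h 1S 1 z) ¬b) (⟦⟧-no (Between? h H 1 z) λ { ((h⊆z , _) , dz) → ¬b ((h⊆z , ⊆-1S z) , dz) }))))

    private
      2d≡ : ∀ k u → k ℕ.+ u ≡ d ℕ.+ d → dim H ≡ k ℕ.+ u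
      2d≡ k u e = trans dim-H (trans (cong (d ℕ.+_) (ℕ.+-identityʳ d)) (sym e))

      N≡ : ∀ k u → k ℕ.+ u ≡ suc (d ℕ.+ d) → N ≡ k ℕ.+ u
      N≡ k u e = trans (cong (λ w → suc (d ℕ.+ w)) (ℕ.+-identityʳ d)) (sym e)

      -- x ⋀ H is the only coatom of x inside H, hence the only one with covers inside H to be discarded
      first₁ : ∀ x y (f : ℕ → ℤ) → dim x ≡ suc d → ¬ (x ⊆S H) →
        ∑S (λ h → ⟦ Coatom? 0S x h ⟧ * ∑S (λ z → ⟦ Up? h z ⟧ * f (dim (z ⋀ y)))) ≡
        down (gen f (suc d) (dim y)) (suc d) (dim (x ⋀ y)) - gen f d (dim (y ⋀ H)) (dim ((x ⋀ H) ⋀ y))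
      first₁ x y f dx nx = begin
        ∑S (λ h → ⟦ Coatom? 0S x h ⟧ * ∑S (λ z → ⟦ Up? h z ⟧ * f (dim (z ⋀ y))))
          ≡⟨ ∑-⟦⟧-cong (Coatom? 0S x) subspaces inner ⟩
        ∑S (λ h → ⟦ Coatom? 0S x h ⟧ * (gen f (suc d) (dim y) (dim (h ⋀ y)) - ⟦ h ⊆? H ⟧ * G h))
          ≡⟨ trans (∑-cong subspaces λ h → l ⟦ Coatom? 0S x h ⟧ (gen f (suc d) (dim y) (dim (h ⋀ y))) ⟦ h ⊆? H ⟧ (G h)) (∑-- subspaces _ _) ⟩
        ∑S (λ h → ⟦ Coatom? 0S x h ⟧ * gen f (suc d) (dim y) (dim (h ⋀ y))) - ∑S (λ h → ⟦ Coatom? 0S x h ⟧ * ⟦ h ⊆? H ⟧ * G h)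
          ≡⟨ cong₂ _-_ (trans (down-gen x y (gen f (suc d) (dim y))) (cong (λ D → down (gen f (suc d) (dim y)) D (dim (x ⋀ y))) dx)) special ⟩
        down (gen f (suc d) (dim y)) (suc d) (dim (x ⋀ y)) - G W ∎
        where
        open ≡-Reasoning
        W = x ⋀ H
        dW : dim W ≡ d
        dW = ℕ.suc-injective (trans (sym (meet-H x nx)) dx)
        G : Sub → ℤ
        G h = gen f d (dim (y ⋀ H)) (dim (h ⋀ y))
        l : ∀ c a b g → c * (a - b * g) ≡ c * a - c * b * g
        l = solve-∀
        inner : ∀ h → Coatom 0S x h → ∑S (λ z → ⟦ Up? h z ⟧ * f (dim (z ⋀ y))) ≡ gen f (suc d) (dim y) (dim (h ⋀ y)) - ⟦ h ⊆? H ⟧ * G h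
        inner h (_ , dh) = trans (Up-split h _) (cong₂ _-_ (up-1S h y f (suc d) (N≡ (dim h) (suc d) (trans (cong (ℕ._+ suc d) dh′) (ℕ.+-suc d d)))) (inH (h ⊆? H)))
          where
          dh′ : dim h ≡ d
          dh′ = ℕ.suc-injective (trans dh dx)
          inH : (D : Dec (h ⊆S H)) → ∑S (λ z → ⟦ Between? h H 1 z ⟧ * f (dim (z ⋀ y))) ≡ ⟦ D ⟧ * G h
          inH (yes h⊆H) = trans (up-gen h H y f d h⊆H (2d≡ (dim h) d (cong (ℕ._+ d) dh′))) (sym (ℤ.*-identityˡ (G h)))
          inH (no h⊈H) = trans (∑-cong subspaces λ z → trans (cong (_* f (dim (z ⋀ y))) (⟦⟧-no (Between? h H 1 z) λ { ((h⊆z , z⊆H) , _) → h⊈H λ v v∈ → z⊆H v (h⊆z v v∈) })) (ℤ.*-zeroˡ (f (dim (z ⋀ y)))))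
            (trans (∑-0 subspaces) (sym (ℤ.*-zeroˡ (G h))))
        special : ∑S (λ h → ⟦ Coatom? 0S x h ⟧ * ⟦ h ⊆? H ⟧ * G h) ≡ G W
        special = trans (∑-cong subspaces λ h → cong (_* G h) (sym (⟦⟧-× (Coatom? 0S x h) (h ⊆? H))))
          (S.∑-unique (λ h → Coatom? 0S x h ×-dec (h ⊆? H)) W subspaces G subspaces-unique (subspaces-complete W)
            (λ {b} e → cong (gen f d (dim (y ⋀ H))) (dim-≈ {x = W ⋀ y} {b ⋀ y} (⋀-cong {W} {b} {y} {y} e (≈-refl {x = y})))) to from)
          where
          to : ∀ h → Coatom 0S x h × h ⊆S H → W ≈S h
          to h (((_ , h⊆x) , dh) , h⊆H) = ⊆-dim⇒⊇ {x = h} {W} h⊆W (ℕ.≤-reflexive (trans dW (ℕ.suc-injective (sym (trans dh dx))))) , h⊆W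
            where
            h⊆W : h ⊆S W
            h⊆W = ⋀-greatest {x = x} {H} h h⊆x h⊆H
          from : ∀ h → W ≈S h → Coatom 0S x h × h ⊆S H
          from h (W⊆h , h⊆W) = ((0S-⊆ h , λ v v∈ → ⋀-lowerˡ x H v (h⊆W v v∈)) , trans (cong suc (trans (sym (dim-≈ {x = W} {h} (W⊆h , h⊆W))) dW)) (sym dx)) , λ v v∈ → ⋀-lowerʳ x H v (h⊆W v v∈)

    private
      -- Here x = [d - m] and y = [m], while D0, D1 and i1 stand for [d], [d + 1] and [d - m + 1].
      -- Giving their values as equations lets `refl` eliminate them, which leaves a polynomial
      -- identity in independent variables. The other three identities are stated in the same way.
      s₁₁ : ∀ p x y D0 D1 i1 a b c → D0 ≡ x + (1ℤ + p * x) * y → D1 ≡ x + (1ℤ + p * x) * (1ℤ + (1ℤ + p) * y) → i1 ≡ 1ℤ + (1ℤ + p) * x →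
        x * (x * a + (D1 - x) * b) + (D1 - x) * (i1 * b + (D1 - i1) * c) - b * D1 ≡
        x * x * a + (1ℤ + p) * ((1ℤ + p * x) * (1ℤ + p * x)) * y * (1ℤ + (1ℤ + p) * y) * c + ((1ℤ + p) * D0 * D1 - (1ℤ + p) * ((1ℤ + p * x) * (1ℤ + p * x)) * y * (1ℤ + (1ℤ + p) * y) - x * x) * b
      s₁₁ p x y _ _ _ a b c refl refl refl = l p x y a b c
        where
        l : ∀ p x y a b c → x * (x * a + ((x + (1ℤ + p * x) * (1ℤ + (1ℤ + p) * y)) - x) * b) + ((x + (1ℤ + p * x) * (1ℤ + (1ℤ + p) * y)) - x) * ((1ℤ + (1ℤ + p) * x) * b + ((x + (1ℤ + p * x) * (1ℤ + (1ℤ + p) * y)) - (1ℤ + (1ℤ + p) * x)) * c) - b * (x + (1ℤ + p * x) * (1ℤ + (1ℤ + p) * y)) ≡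
          x * x * a + (1ℤ + p) * ((1ℤ + p * x) * (1ℤ + p * x)) * y * (1ℤ + (1ℤ + p) * y) * c + ((1ℤ + p) * (x + (1ℤ + p * x) * y) * (x + (1ℤ + p * x) * (1ℤ + (1ℤ + p) * y)) - (1ℤ + p) * ((1ℤ + p * x) * (1ℤ + p * x)) * y * (1ℤ + (1ℤ + p) * y) - x * x) * b
        l = solve-∀

    tri-vals : ∀ m (f : ℕ → ℤ) → m ℕ.≤ d → tri (d ∸ m) m f ≡
      [ d ∸ m ] * [ d ∸ m ] * f (suc m) + (1ℤ + p) * (q^ (d ∸ m) * q^ (d ∸ m)) * [ m ] * (1ℤ + (1ℤ + p) * [ m ]) * f (m ∸ 1) +
      ((1ℤ + p) * [ d ] * [ suc d ] - (1ℤ + p) * (q^ (d ∸ m) * q^ (d ∸ m)) * [ m ] * (1ℤ + (1ℤ + p) * [ m ]) - [ d ∸ m ] * [ d ∸ m ]) * f m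
    tri-vals m f m≤d = cong (λ b → [ d ∸ m ] * [ d ∸ m ] * f (suc m) + b * f (m ∸ 1) + ((1ℤ + p) * [ d ] * [ suc d ] - b - [ d ∸ m ] * [ d ∸ m ]) * f m)
      (cong₂ (λ a b → (1ℤ + p) * (q^ (d ∸ m) * q^ (d ∸ m)) * [ a ] * b) (ℕ.m∸[m∸n]≡n m≤d)
        (trans (cong [_] (trans (ℕ.+-∸-assoc 1 (ℕ.m∸n≤m d m)) (cong suc (ℕ.m∸[m∸n]≡n m≤d)))) ([suc] m)))

    [d] : ∀ m → m ℕ.≤ d → [ d ] ≡ [ d ∸ m ] + q^ (d ∸ m) * [ m ]
    [d] m m≤d = trans (cong [_] (sym (ℕ.m∸n+n≡m m≤d))) ([+] (d ∸ m) m)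

    [1+d] : ∀ m → m ℕ.≤ d → [ suc d ] ≡ [ d ∸ m ] + q^ (d ∸ m) * (1ℤ + (1ℤ + p) * [ m ])
    [1+d] m m≤d = trans (cong [_] (trans (cong suc (sym (ℕ.m∸n+n≡m m≤d))) (sym (ℕ.+-suc (d ∸ m) m)))) (trans ([+] (d ∸ m) (suc m)) (cong (λ w → [ d ∸ m ] + q^ (d ∸ m) * w) ([suc] m)))

    A-tri₁₁ : ∀ (f : ℕ → ℤ) x y → InX₁ x → InX₁ y → A (λ z → f (mm z y)) x ≡ tri (d ∸ mm x y) (mm x y) f
    A-tri₁₁ f x y (dx , nx) (dy , ny) = begin
      A (λ z → f (mm z y)) x ≡⟨ A≡A₁ _ x nx ⟩
      A₁ (λ z → f (mm z y)) x
        ≡⟨ cong₂ (λ a b → a - f m * [ suc d ] + b)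
             (∑-⟦⟧-cong (Coatom? 0S x) subspaces λ h _ → ∑-⟦⟧-cong (Up? h) subspaces λ { z (_ , nz) → cong f (mm₁₁ z y nz ny) })
             (∑-⟦⟧-cong (Coatom? 0S W) subspaces λ w c → cong f (mm₂₁ w y (proj₂ (coatom-down₁ x w dx nx c)) ny)) ⟩
      ∑S (λ h → ⟦ Coatom? 0S x h ⟧ * ∑S (λ z → ⟦ Up? h z ⟧ * f (dim (z ⋀ y) ∸ 1))) - f m * [ suc d ] + ∑S (λ w → ⟦ Coatom? 0S W w ⟧ * f (dim (w ⋀ y)))
        ≡⟨ cong₂ (λ a b → a - f m * [ suc d ] + b) (first₁ x y (λ e → f (e ∸ 1)) dx nx) (down-gen W y f) ⟩
      (down (gen f₁ (suc d) (dim y)) (suc d) (dim (x ⋀ y)) - gen f₁ d (dim (y ⋀ H)) (dim (W ⋀ y))) - f m * [ suc d ] + down f (dim W) (dim (W ⋀ y))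
        ≡⟨ cong₂ (λ a b → (down (gen f₁ (suc d) (dim y)) (suc d) (dim (x ⋀ y)) - gen f₁ d a (dim (W ⋀ y))) - f m * [ suc d ] + down f b (dim (W ⋀ y))) dyH dW ⟩
      (down (gen f₁ (suc d) (dim y)) (suc d) (dim (x ⋀ y)) - gen f₁ d d (dim (W ⋀ y))) - f m * [ suc d ] + down f d (dim (W ⋀ y))
        -- `gen f₁ d d e` and `down f d e` unfold to the same expression: the covers of W inside H,
        -- excluded from X₁, weigh as much as the hyperplanes of W, which are vertices of X₂. The
        -- two terms cancel and the count of the Grassmann graph remains.
        ≡⟨ l₀ (down (gen f₁ (suc d) (dim y)) (suc d) (dim (x ⋀ y))) (gen f₁ d d (dim (W ⋀ y))) (f m * [ suc d ]) ⟩
      down (gen f₁ (suc d) (dim y)) (suc d) (dim (x ⋀ y)) - f m * [ suc d ]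
        ≡⟨ cong₂ (λ a b → down (gen f₁ (suc d) a) (suc d) b - f m * [ suc d ]) dy exy ⟩
      down (gen f₁ (suc d) (suc d)) (suc d) (suc m) - f m * [ suc d ]
        ≡⟨ cong (λ w → [ i ] * ([ i ] * f (suc m) + ([ suc d ] - [ i ]) * f m) + ([ suc d ] - [ i ]) * ([ w ] * f m + ([ suc d ] - [ w ]) * f (m ∸ 1)) - f m * [ suc d ]) (ℕ.+-∸-assoc 1 m≤d) ⟩
      [ i ] * ([ i ] * f (suc m) + ([ suc d ] - [ i ]) * f m) + ([ suc d ] - [ i ]) * ([ suc i ] * f m + ([ suc d ] - [ suc i ]) * f (m ∸ 1)) - f m * [ suc d ]
        ≡⟨ s₁₁ p [ i ] [ m ] [ d ] [ suc d ] [ suc i ] (f (suc m)) (f m) (f (m ∸ 1)) ([d] m m≤d) ([1+d] m m≤d) ([suc] i) ⟩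
      _ ≡⟨ sym (tri-vals m f m≤d) ⟩
      tri i m f ∎
      where
      open ≡-Reasoning
      W = x ⋀ H
      m = mm x y
      i = d ∸ m
      f₁ : ℕ → ℤ
      f₁ e = f (e ∸ 1)
      m≤d : m ℕ.≤ d
      m≤d = mm≤d x y (inj₁ (dx , nx)) (inj₁ (dy , ny))
      dW : dim W ≡ d
      dW = ℕ.suc-injective (trans (sym (meet-H x nx)) dx)
      dyH : dim (y ⋀ H) ≡ d
      dyH = ℕ.suc-injective (trans (sym (meet-H y ny)) dy)
      exy : dim (x ⋀ y) ≡ suc m
      exy = trans (sym (ℕ.m+[n∸m]≡n (meet₁₁>0 x y dx dy))) (cong suc (sym (mm₁₁ x y nx ny)))
      l₀ : ∀ a b c → a - b - c + b ≡ a - c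
      l₀ = solve-∀

    private
      s₁₂ : ∀ p J y I i1 D0 D1 a b c → I ≡ 1ℤ + (1ℤ + p) * J → i1 ≡ 1ℤ + (1ℤ + p) * I → D0 ≡ I + (1ℤ + p * I) * y → D1 ≡ I + (1ℤ + p * I) * (1ℤ + (1ℤ + p) * y) →
        (i1 * (J * a + (D1 - J) * b) + (D1 - i1) * (I * b + (D1 - I) * c) - (J * a + (D0 - J) * b)) - b * D1 + (I * a + (D0 - I) * b) ≡
        I * I * a + (1ℤ + p) * ((1ℤ + p * I) * (1ℤ + p * I)) * y * (1ℤ + (1ℤ + p) * y) * c + ((1ℤ + p) * D0 * D1 - (1ℤ + p) * ((1ℤ + p * I) * (1ℤ + p * I)) * y * (1ℤ + (1ℤ + p) * y) - I * I) * b
      s₁₂ p J y _ _ _ _ a b c refl refl refl refl = l p J y a b c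
        where
        l : ∀ p J y a b c → let I = 1ℤ + (1ℤ + p) * J ; i1 = 1ℤ + (1ℤ + p) * (1ℤ + (1ℤ + p) * J) ; D0 = (1ℤ + (1ℤ + p) * J) + (1ℤ + p * (1ℤ + (1ℤ + p) * J)) * y ; D1 = (1ℤ + (1ℤ + p) * J) + (1ℤ + p * (1ℤ + (1ℤ + p) * J)) * (1ℤ + (1ℤ + p) * y) in
          (i1 * (J * a + (D1 - J) * b) + (D1 - i1) * (I * b + (D1 - I) * c) - (J * a + (D0 - J) * b)) - b * D1 + (I * a + (D0 - I) * b) ≡
          I * I * a + (1ℤ + p) * ((1ℤ + p * I) * (1ℤ + p * I)) * y * (1ℤ + (1ℤ + p) * y) * c + ((1ℤ + p) * D0 * D1 - (1ℤ + p) * ((1ℤ + p * I) * (1ℤ + p * I)) * y * (1ℤ + (1ℤ + p) * y) - I * I) * b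
        l = solve-∀

      s₂₁ : ∀ p J y I i1 D0 D1 D2 Dm a b c → I ≡ 1ℤ + (1ℤ + p) * J → i1 ≡ 1ℤ + (1ℤ + p) * I → D0 ≡ I + (1ℤ + p * I) * y → D1 ≡ I + (1ℤ + p * I) * (1ℤ + (1ℤ + p) * y) →
        D2 ≡ 1ℤ + (1ℤ + p) * D1 → Dm ≡ J + (1ℤ + p * J) * y →
        (J * (I * a + (D2 - I) * b) + (Dm - J) * (i1 * b + (D2 - i1) * c)) - b * Dm + (I * ((I * a + (D1 - I) * b) - (J * a + (D0 - J) * b)) + (D1 - I) * ((i1 * b + (D1 - i1) * c) - (I * b + (D0 - I) * c))) ≡
        I * I * a + (1ℤ + p) * ((1ℤ + p * I) * (1ℤ + p * I)) * y * (1ℤ + (1ℤ + p) * y) * c + ((1ℤ + p) * D0 * D1 - (1ℤ + p) * ((1ℤ + p * I) * (1ℤ + p * I)) * y * (1ℤ + (1ℤ + p) * y) - I * I) * b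
      s₂₁ p J y _ _ _ _ _ _ a b c refl refl refl refl refl refl = l p J y a b c
        where
        l : ∀ p J y a b c → let I = 1ℤ + (1ℤ + p) * J ; i1 = 1ℤ + (1ℤ + p) * (1ℤ + (1ℤ + p) * J) ; D0 = (1ℤ + (1ℤ + p) * J) + (1ℤ + p * (1ℤ + (1ℤ + p) * J)) * y ; D1 = (1ℤ + (1ℤ + p) * J) + (1ℤ + p * (1ℤ + (1ℤ + p) * J)) * (1ℤ + (1ℤ + p) * y) ;
                                  D2 = 1ℤ + (1ℤ + p) * ((1ℤ + (1ℤ + p) * J) + (1ℤ + p * (1ℤ + (1ℤ + p) * J)) * (1ℤ + (1ℤ + p) * y)) ; Dm = J + (1ℤ + p * J) * y in
          (J * (I * a + (D2 - I) * b) + (Dm - J) * (i1 * b + (D2 - i1) * c)) - b * Dm + (I * ((I * a + (D1 - I) * b) - (J * a + (D0 - J) * b)) + (D1 - I) * ((i1 * b + (D1 - i1) * c) - (I * b + (D0 - I) * c))) ≡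
          I * I * a + (1ℤ + p) * ((1ℤ + p * I) * (1ℤ + p * I)) * y * (1ℤ + (1ℤ + p) * y) * c + ((1ℤ + p) * D0 * D1 - (1ℤ + p) * ((1ℤ + p * I) * (1ℤ + p * I)) * y * (1ℤ + (1ℤ + p) * y) - I * I) * b
        l = solve-∀

      -- The variable k, standing for [d - 1 - m], cancels. It is left free because that difference
      -- is truncated when m = d.
      s₂₂ : ∀ p x z k y i1 D0 D1 D2 Dm a b c → y ≡ 1ℤ + (1ℤ + p) * z → i1 ≡ 1ℤ + (1ℤ + p) * x → D0 ≡ x + (1ℤ + p * x) * y → D1 ≡ x + (1ℤ + p * x) * (1ℤ + (1ℤ + p) * y) →
        D2 ≡ 1ℤ + (1ℤ + p) * D1 → Dm ≡ x + (1ℤ + p * x) * z →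
        (x * (x * a + (D2 - x) * b) + (Dm - x) * (i1 * b + (D2 - i1) * c)) - b * Dm + (x * ((k * a + (D1 - k) * b) - (k * a + (D0 - k) * b)) + (D1 - x) * ((x * b + (D1 - x) * c) - (x * b + (D0 - x) * c))) ≡
        x * x * a + (1ℤ + p) * ((1ℤ + p * x) * (1ℤ + p * x)) * y * (1ℤ + (1ℤ + p) * y) * c + ((1ℤ + p) * D0 * D1 - (1ℤ + p) * ((1ℤ + p * x) * (1ℤ + p * x)) * y * (1ℤ + (1ℤ + p) * y) - x * x) * b
      s₂₂ p x z k _ _ _ _ _ _ a b c refl refl refl refl refl refl = l p x z k a b c
        where
        l : ∀ p x z k a b c → let y = 1ℤ + (1ℤ + p) * z ; i1 = 1ℤ + (1ℤ + p) * x ; D0 = x + (1ℤ + p * x) * (1ℤ + (1ℤ + p) * z) ; D1 = x + (1ℤ + p * x) * (1ℤ + (1ℤ + p) * (1ℤ + (1ℤ + p) * z)) ;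
                                    D2 = 1ℤ + (1ℤ + p) * (x + (1ℤ + p * x) * (1ℤ + (1ℤ + p) * (1ℤ + (1ℤ + p) * z))) ; Dm = x + (1ℤ + p * x) * z in
          (x * (x * a + (D2 - x) * b) + (Dm - x) * (i1 * b + (D2 - i1) * c)) - b * Dm + (x * ((k * a + (D1 - k) * b) - (k * a + (D0 - k) * b)) + (D1 - x) * ((x * b + (D1 - x) * c) - (x * b + (D0 - x) * c))) ≡
          x * x * a + (1ℤ + p) * ((1ℤ + p * x) * (1ℤ + p * x)) * y * (1ℤ + (1ℤ + p) * y) * c + ((1ℤ + p) * D0 * D1 - (1ℤ + p) * ((1ℤ + p * x) * (1ℤ + p * x)) * y * (1ℤ + (1ℤ + p) * y) - x * x) * b
        l = solve-∀

    private
      vanish : ∀ (k a b : ℤ) → (k - k) * a ≡ (k - k) * b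
      vanish = solve-∀

      d∸1∸ : ∀ m → d ∸ 1 ∸ m ≡ d ∸ suc m
      d∸1∸ m = ℕ.∸-+-assoc d 1 m

      step-∸ : ∀ m → m ℕ.≤ d ∸ 1 → d ∸ m ≡ suc (d ∸ 1 ∸ m)
      step-∸ m le = trans (cong (_∸ m) (sym suc-pred-d)) (ℕ.+-∸-assoc 1 le)

      [d-1] : ∀ m → m ℕ.≤ d ∸ 1 → [ d ∸ 1 ] ≡ [ d ∸ 1 ∸ m ] + q^ (d ∸ 1 ∸ m) * [ m ]
      [d-1] m le = trans (cong [_] (sym (ℕ.m∸n+n≡m le))) ([+] (d ∸ 1 ∸ m) m)

    A-tri₁₂ : ∀ (f : ℕ → ℤ) x y → InX₁ x → InX₂ y → A (λ z → f (mm z y)) x ≡ tri (d ∸ mm x y) (mm x y) f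
    A-tri₁₂ f x y (dx , nx) (dy , py) = begin
      A (λ z → f (mm z y)) x ≡⟨ A≡A₁ _ x nx ⟩
      A₁ (λ z → f (mm z y)) x
        ≡⟨ cong₂ (λ a b → a - f m * [ suc d ] + b)
             (∑-⟦⟧-cong (Coatom? 0S x) subspaces λ h _ → ∑-⟦⟧-cong (Up? h) subspaces λ { z (_ , nz) → cong f (mm₁₂ z y nz py) })
             (∑-⟦⟧-cong (Coatom? 0S W) subspaces λ w c → cong f (mm₂₂ w y (proj₂ (coatom-down₁ x w dx nx c)) py)) ⟩
      ∑S (λ h → ⟦ Coatom? 0S x h ⟧ * ∑S (λ z → ⟦ Up? h z ⟧ * f (dim (z ⋀ y)))) - f m * [ suc d ] + ∑S (λ w → ⟦ Coatom? 0S W w ⟧ * f′ (dim (w ⋀ y)))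
        ≡⟨ cong₂ (λ a b → a - f m * [ suc d ] + b) (first₁ x y f dx nx) (down-gen W y f′) ⟩
      (down (gen f (suc d) (dim y)) (suc d) (dim (x ⋀ y)) - gen f d (dim (y ⋀ H)) (dim (W ⋀ y))) - f m * [ suc d ] + down f′ (dim W) (dim (W ⋀ y))
        ≡⟨ cong₂ (λ a b → (down (gen f (suc d) (dim y)) (suc d) a - gen f d (dim (y ⋀ H)) b) - f m * [ suc d ] + down f′ (dim W) b) exy eW ⟩
      (down (gen f (suc d) (dim y)) (suc d) m - gen f d (dim (y ⋀ H)) m) - f m * [ suc d ] + down f′ (dim W) m
        ≡⟨ cong₂ (λ a b → (down (gen f (suc d) a) (suc d) m - gen f d b m) - f m * [ suc d ] + down f′ (dim W) m) dy (trans (meet-⊆H y py) dy) ⟩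
      (down (gen f (suc d) (d ∸ 1)) (suc d) m - gen f d (d ∸ 1) m) - f m * [ suc d ] + down f′ (dim W) m
        ≡⟨ cong (λ a → (down (gen f (suc d) (d ∸ 1)) (suc d) m - gen f d (d ∸ 1) m) - f m * [ suc d ] + down f′ a m) dW ⟩
      (down (gen f (suc d) (d ∸ 1)) (suc d) m - gen f d (d ∸ 1) m) - f m * [ suc d ] + down f′ d m
        ≡⟨ cong₂ (λ a b → ([ suc d ∸ m ] * gen f (suc d) (d ∸ 1) m + a - gen f d (d ∸ 1) m) - f m * [ suc d ] + ([ i ] * f (suc m) + b)) (second m refl) (third m refl) ⟩
      ([ suc d ∸ m ] * gen f (suc d) (d ∸ 1) m + ([ suc d ] - [ suc d ∸ m ]) * ([ i ] * f m + ([ suc d ] - [ i ]) * f (m ∸ 1)) - gen f d (d ∸ 1) m) - f m * [ suc d ] + ([ i ] * f (suc m) + ([ d ] - [ i ]) * f m)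
        ≡⟨ cong (λ w → ([ w ] * gen f (suc d) (d ∸ 1) m + ([ suc d ] - [ w ]) * ([ i ] * f m + ([ suc d ] - [ i ]) * f (m ∸ 1)) - gen f d (d ∸ 1) m) - f m * [ suc d ] + ([ i ] * f (suc m) + ([ d ] - [ i ]) * f m)) (ℕ.+-∸-assoc 1 m≤d) ⟩
      ([ suc i ] * gen f (suc d) (d ∸ 1) m + ([ suc d ] - [ suc i ]) * ([ i ] * f m + ([ suc d ] - [ i ]) * f (m ∸ 1)) - gen f d (d ∸ 1) m) - f m * [ suc d ] + ([ i ] * f (suc m) + ([ d ] - [ i ]) * f m)
        ≡⟨ s₁₂ p [ j ] [ m ] [ i ] [ suc i ] [ d ] [ suc d ] (f (suc m)) (f m) (f (m ∸ 1)) (trans (cong [_] (step-∸ m m≤)) ([suc] j)) ([suc] i) ([d] m m≤d) ([1+d] m m≤d) ⟩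
      _ ≡⟨ sym (tri-vals m f m≤d) ⟩
      tri i m f ∎
      where
      open ≡-Reasoning
      W = x ⋀ H
      m = mm x y
      i = d ∸ m
      j = d ∸ 1 ∸ m
      f′ : ℕ → ℤ
      f′ e = f (suc e)
      m≤d : m ℕ.≤ d
      m≤d = mm≤d x y (inj₁ (dx , nx)) (inj₂ (dy , py))
      dW : dim W ≡ d
      dW = ℕ.suc-injective (trans (sym (meet-H x nx)) dx)
      exy : dim (x ⋀ y) ≡ m
      exy = sym (mm₁₂ x y nx py)
      m≤ : m ℕ.≤ d ∸ 1
      m≤ = subst₂ ℕ._≤_ exy dy (⋀-dimʳ x y)
      eW : dim (W ⋀ y) ≡ m
      eW = trans (dim-≈ {x = W ⋀ y} {x ⋀ y} (⋀-mono {W} {x} {y} {y} (⋀-lowerˡ x H) (⊆-refl {x = y}) ,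
        ⋀-greatest {x = W} {y} (x ⋀ y) (⋀-greatest {x = x} {H} (x ⋀ y) (⋀-lowerˡ x y) (λ v v∈ → py v (⋀-lowerʳ x y v v∈))) (⋀-lowerʳ x y))) exy
      -- At k = 0 the arguments `k ∸ 1` on the two sides do not correspond, but the common factor in
      -- front of them is zero.
      second : ∀ k → k ≡ m → ([ suc d ] - [ suc d ∸ k ]) * gen f (suc d) (d ∸ 1) (k ∸ 1) ≡ ([ suc d ] - [ suc d ∸ k ]) * ([ d ∸ k ] * f k + ([ suc d ] - [ d ∸ k ]) * f (k ∸ 1))
      second zero    _ = vanish [ suc d ] _ _
      second (suc k) _ = cong (λ w → ([ suc d ] - [ suc d ∸ suc k ]) * ([ w ] * f (suc k) + ([ suc d ] - [ w ]) * f k)) (d∸1∸ k)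
      third : ∀ k → k ≡ m → ([ d ] - [ d ∸ k ]) * f′ (k ∸ 1) ≡ ([ d ] - [ d ∸ k ]) * f k
      third zero    _ = vanish [ d ] _ _
      third (suc k) _ = refl

    private
      dim-coatom₂ : ∀ x h → dim x ≡ d ∸ 1 → Coatom 0S x h → dim H ≡ dim h ℕ.+ suc (suc d)
      dim-coatom₂ x h dx (_ , dh) = 2d≡ (dim h) (suc (suc d)) (trans (ℕ.+-suc (dim h) (suc d)) (trans (cong (ℕ._+ suc d) (trans dh dx)) (trans (ℕ.+-suc (d ∸ 1) d) (cong (ℕ._+ d) suc-pred-d))))

      co-in-gen : ∀ x y (f : ℕ → ℤ) → InX₂ x → co-in∑ x (λ z → f (dim (z ⋀ y))) ≡ down (gen f (suc (suc d)) (dim (y ⋀ H))) (d ∸ 1) (dim (x ⋀ y))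
      co-in-gen x y f (dx , px) = trans (∑-⟦⟧-cong (Coatom? 0S x) subspaces λ { h c@((_ , h⊆x) , _) →
          up-gen h H y f (suc (suc d)) (λ v v∈ → px v (h⊆x v v∈)) (dim-coatom₂ x h dx c) })
        (trans (down-gen x y (gen f (suc (suc d)) (dim (y ⋀ H)))) (cong (λ D → down (gen f (suc (suc d)) (dim (y ⋀ H))) D (dim (x ⋀ y))) dx))

      in-up-gen : ∀ x y (f : ℕ → ℤ) → InX₂ x → in-up∑ x (λ z → f (dim (z ⋀ y))) ≡
        gen (λ e → gen f (suc d) (dim y) e - gen f d (dim (y ⋀ H)) e) (suc d) (dim (y ⋀ H)) (dim (x ⋀ y))
      in-up-gen x y f (dx , px) = trans (∑-⟦⟧-cong (Between? x H 1) subspaces inner)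
        (up-gen x H y (λ e → gen f (suc d) (dim y) e - gen f d (dim (y ⋀ H)) e) (suc d) px (2d≡ (dim x) (suc d) (trans (cong (ℕ._+ suc d) dx) (trans (ℕ.+-suc (d ∸ 1) d) (cong (ℕ._+ d) suc-pred-d)))))
        where
        inner : ∀ w → Between x H 1 w → up∑ w (λ z → f (dim (z ⋀ y))) ≡ gen f (suc d) (dim y) (dim (w ⋀ y)) - gen f d (dim (y ⋀ H)) (dim (w ⋀ y))
        inner w ((_ , w⊆H) , dw) = trans (Up-split w _) (cong₂ _-_ (up-1S w y f (suc d) (N≡ (dim w) (suc d) (trans (cong (ℕ._+ suc d) dw′) (ℕ.+-suc d d))))
            (up-gen w H y f d w⊆H (2d≡ (dim w) d (cong (ℕ._+ d) dw′))))
          where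
          dw′ : dim w ≡ d
          dw′ = trans dw (trans (ℕ.+-comm (dim x) 1) (trans (cong suc dx) suc-pred-d))

    A-tri₂₁ : ∀ (f : ℕ → ℤ) x y → InX₂ x → InX₁ y → A (λ z → f (mm z y)) x ≡ tri (d ∸ mm x y) (mm x y) f
    A-tri₂₁ f x y (dx , px) (dy , ny) = begin
      A (λ z → f (mm z y)) x ≡⟨ A≡A₂ _ x px ⟩
      A₂ (λ z → f (mm z y)) x
        ≡⟨ cong₂ (λ a b → a - f m * [ d ∸ 1 ] + b)
             (∑-⟦⟧-cong (Coatom? 0S x) subspaces λ h _ → ∑-⟦⟧-cong (Between? h H 1) subspaces λ { z ((_ , z⊆H) , _) → cong f (mm₂₁ z y z⊆H ny) })
             (∑-⟦⟧-cong (Between? x H 1) subspaces λ w _ → ∑-⟦⟧-cong (Up? w) subspaces λ { z (_ , nz) → cong f (mm₁₁ z y nz ny) }) ⟩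
      co-in∑ x (λ z → f (dim (z ⋀ y))) - f m * [ d ∸ 1 ] + in-up∑ x (λ z → f₁ (dim (z ⋀ y)))
        ≡⟨ cong₂ (λ a b → a - f m * [ d ∸ 1 ] + b) (co-in-gen x y f (dx , px)) (in-up-gen x y f₁ (dx , px)) ⟩
      down (gen f D2 (dim (y ⋀ H))) (d ∸ 1) (dim (x ⋀ y)) - f m * [ d ∸ 1 ] + gen (λ e → gen f₁ (suc d) (dim y) e - gen f₁ d (dim (y ⋀ H)) e) (suc d) (dim (y ⋀ H)) (dim (x ⋀ y))
        ≡⟨ cong₂ (λ a b → down (gen f D2 a) (d ∸ 1) b - f m * [ d ∸ 1 ] + gen (λ e → gen f₁ (suc d) (dim y) e - gen f₁ d a e) (suc d) a b) dyH exy ⟩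
      down (gen f D2 d) (d ∸ 1) m - f m * [ d ∸ 1 ] + gen (λ e → gen f₁ (suc d) (dim y) e - gen f₁ d d e) (suc d) d m
        ≡⟨ cong (λ a → down (gen f D2 d) (d ∸ 1) m - f m * [ d ∸ 1 ] + gen (λ e → gen f₁ (suc d) a e - gen f₁ d d e) (suc d) d m) dy ⟩
      down (gen f D2 d) (d ∸ 1) m - f m * [ d ∸ 1 ] + gen (λ e → gen f₁ (suc d) (suc d) e - gen f₁ d d e) (suc d) d m
        ≡⟨ cong₂ (λ a w → [ j ] * gen f D2 d m + a - f m * [ d ∸ 1 ] +
             ([ i ] * (([ i ] * f (suc m) + ([ suc d ] - [ i ]) * f m) - ([ w ] * f (suc m) + ([ d ] - [ w ]) * f m)) + ([ suc d ] - [ i ]) * (gen f₁ (suc d) (suc d) m - gen f₁ d d m)))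
             (second m refl m≤) (sym (d∸1∸ m)) ⟩
      [ j ] * gen f D2 d m + ([ d ∸ 1 ] - [ j ]) * ([ suc i ] * f m + ([ D2 ] - [ suc i ]) * f (m ∸ 1)) - f m * [ d ∸ 1 ] +
        ([ i ] * (([ i ] * f (suc m) + ([ suc d ] - [ i ]) * f m) - ([ j ] * f (suc m) + ([ d ] - [ j ]) * f m)) + ([ suc d ] - [ i ]) * (gen f₁ (suc d) (suc d) m - gen f₁ d d m))
        ≡⟨ cong (λ w → [ j ] * gen f D2 d m + ([ d ∸ 1 ] - [ j ]) * ([ suc i ] * f m + ([ D2 ] - [ suc i ]) * f (m ∸ 1)) - f m * [ d ∸ 1 ] +
             ([ i ] * (([ i ] * f (suc m) + ([ suc d ] - [ i ]) * f m) - ([ j ] * f (suc m) + ([ d ] - [ j ]) * f m)) + ([ suc d ] - [ i ]) * (([ w ] * f m + ([ suc d ] - [ w ]) * f (m ∸ 1)) - gen f₁ d d m))) (ℕ.+-∸-assoc 1 m≤d) ⟩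
      [ j ] * gen f D2 d m + ([ d ∸ 1 ] - [ j ]) * ([ suc i ] * f m + ([ D2 ] - [ suc i ]) * f (m ∸ 1)) - f m * [ d ∸ 1 ] +
        ([ i ] * (([ i ] * f (suc m) + ([ suc d ] - [ i ]) * f m) - ([ j ] * f (suc m) + ([ d ] - [ j ]) * f m)) + ([ suc d ] - [ i ]) * (([ suc i ] * f m + ([ suc d ] - [ suc i ]) * f (m ∸ 1)) - gen f₁ d d m))
        ≡⟨ s₂₁ p [ j ] [ m ] [ i ] [ suc i ] [ d ] [ suc d ] [ D2 ] [ d ∸ 1 ] (f (suc m)) (f m) (f (m ∸ 1))
             (trans (cong [_] (step-∸ m m≤)) ([suc] j)) ([suc] i) ([d] m m≤d) ([1+d] m m≤d) ([suc] (suc d)) ([d-1] m m≤) ⟩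
      _ ≡⟨ sym (tri-vals m f m≤d) ⟩
      tri i m f ∎
      where
      open ≡-Reasoning
      m = mm x y
      i = d ∸ m
      j = d ∸ 1 ∸ m
      D2 = suc (suc d)
      f₁ : ℕ → ℤ
      f₁ e = f (e ∸ 1)
      m≤d : m ℕ.≤ d
      m≤d = mm≤d x y (inj₂ (dx , px)) (inj₁ (dy , ny))
      dyH : dim (y ⋀ H) ≡ d
      dyH = ℕ.suc-injective (trans (sym (meet-H y ny)) dy)
      exy : dim (x ⋀ y) ≡ m
      exy = sym (mm₂₁ x y px ny)
      m≤ : m ℕ.≤ d ∸ 1
      m≤ = subst₂ ℕ._≤_ exy dx (⋀-dimˡ x y)
      second : ∀ k → k ≡ m → k ℕ.≤ d ∸ 1 → ([ d ∸ 1 ] - [ d ∸ 1 ∸ k ]) * gen f D2 d (k ∸ 1) ≡ ([ d ∸ 1 ] - [ d ∸ 1 ∸ k ]) * ([ suc (d ∸ k) ] * f k + ([ D2 ] - [ suc (d ∸ k) ]) * f (k ∸ 1))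
      second zero    _ _  = vanish [ d ∸ 1 ] _ _
      second (suc k) _ le = cong (λ w → ([ d ∸ 1 ] - [ d ∸ 1 ∸ suc k ]) * ([ w ] * f (suc k) + ([ D2 ] - [ w ]) * f k))
        (trans (step-∸ k (ℕ.<⇒≤ le)) (cong suc (d∸1∸ k)))

    A-tri₂₂ : ∀ (f : ℕ → ℤ) x y → InX₂ x → InX₂ y → A (λ z → f (mm z y)) x ≡ tri (d ∸ mm x y) (mm x y) f
    A-tri₂₂ f x y (dx , px) (dy , py) = begin
      A (λ z → f (mm z y)) x ≡⟨ A≡A₂ _ x px ⟩
      A₂ (λ z → f (mm z y)) x
        ≡⟨ cong₂ (λ a b → a - f (mm x y) * [ d ∸ 1 ] + b)
             (∑-⟦⟧-cong (Coatom? 0S x) subspaces λ h _ → ∑-⟦⟧-cong (Between? h H 1) subspaces λ { z ((_ , z⊆H) , _) → cong f (mm₂₂ z y z⊆H py) })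
             (∑-⟦⟧-cong (Between? x H 1) subspaces λ w _ → ∑-⟦⟧-cong (Up? w) subspaces λ { z (_ , nz) → cong f (mm₁₂ z y nz py) }) ⟩
      co-in∑ x (λ z → f′ (dim (z ⋀ y))) - f (mm x y) * [ d ∸ 1 ] + in-up∑ x (λ z → f (dim (z ⋀ y)))
        ≡⟨ cong₂ (λ a b → a - f (mm x y) * [ d ∸ 1 ] + b) (co-in-gen x y f′ (dx , px)) (in-up-gen x y f (dx , px)) ⟩
      down (gen f′ D2 (dim (y ⋀ H))) (d ∸ 1) μ - f (mm x y) * [ d ∸ 1 ] + gen (λ e → gen f (suc d) (dim y) e - gen f d (dim (y ⋀ H)) e) (suc d) (dim (y ⋀ H)) μ
        ≡⟨ cong₂ (λ a b → down (gen f′ D2 a) (d ∸ 1) μ - f b * [ d ∸ 1 ] + gen (λ e → gen f (suc d) (dim y) e - gen f d a e) (suc d) a μ) dyH mμ ⟩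
      down (gen f′ D2 (d ∸ 1)) (d ∸ 1) μ - f m * [ d ∸ 1 ] + gen (λ e → gen f (suc d) (dim y) e - gen f d (d ∸ 1) e) (suc d) (d ∸ 1) μ
        ≡⟨ cong (λ a → down (gen f′ D2 (d ∸ 1)) (d ∸ 1) μ - f m * [ d ∸ 1 ] + gen (λ e → gen f (suc d) a e - gen f d (d ∸ 1) e) (suc d) (d ∸ 1) μ) dy ⟩
      down (gen f′ D2 (d ∸ 1)) (d ∸ 1) μ - f m * [ d ∸ 1 ] + gen (λ e → gen f (suc d) (d ∸ 1) e - gen f d (d ∸ 1) e) (suc d) (d ∸ 1) μ
        ≡⟨ cong (λ a → [ j ] * gen f′ D2 (d ∸ 1) μ + a - f m * [ d ∸ 1 ] + gen (λ e → gen f (suc d) (d ∸ 1) e - gen f d (d ∸ 1) e) (suc d) (d ∸ 1) μ) (second μ refl μ≤) ⟩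
      [ j ] * ([ j ] * f (suc m) + ([ D2 ] - [ j ]) * f m) + ([ d ∸ 1 ] - [ j ]) * ([ suc j ] * f m + ([ D2 ] - [ suc j ]) * f μ) - f m * [ d ∸ 1 ] +
        ([ j ] * (([ k ] * f (suc m) + ([ suc d ] - [ k ]) * f m) - ([ k ] * f (suc m) + ([ d ] - [ k ]) * f m)) + ([ suc d ] - [ j ]) * (([ j ] * f m + ([ suc d ] - [ j ]) * f μ) - ([ j ] * f m + ([ d ] - [ j ]) * f μ)))
        ≡⟨ s₂₂ p [ j ] [ μ ] [ k ] [ m ] [ suc j ] [ d ] [ suc d ] [ D2 ] [ d ∸ 1 ] (f (suc m)) (f m) (f μ) ([suc] μ) ([suc] j)
             (trans ([d] m m≤d) (cong (λ w → [ w ] + q^ w * [ m ]) i≡)) (trans ([1+d] m m≤d) (cong (λ w → [ w ] + q^ w * (1ℤ + (1ℤ + p) * [ m ])) i≡)) ([suc] (suc d)) ([d-1] μ μ≤) ⟩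
      _ ≡⟨ cong (λ w → [ w ] * [ w ] * f (suc m) + (1ℤ + p) * (q^ w * q^ w) * [ m ] * (1ℤ + (1ℤ + p) * [ m ]) * f μ +
             ((1ℤ + p) * [ d ] * [ suc d ] - (1ℤ + p) * (q^ w * q^ w) * [ m ] * (1ℤ + (1ℤ + p) * [ m ]) - [ w ] * [ w ]) * f m) (sym i≡) ⟩
      _ ≡⟨ sym (tri-vals m f m≤d) ⟩
      tri (d ∸ m) m f ≡⟨ cong (λ w → tri (d ∸ w) w f) (sym mμ) ⟩
      tri (d ∸ mm x y) (mm x y) f ∎
      where
      open ≡-Reasoning
      μ = dim (x ⋀ y)
      m = suc μ
      j = d ∸ 1 ∸ μ
      k = d ∸ 1 ∸ suc μ
      D2 = suc (suc d)
      f′ : ℕ → ℤ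
      f′ e = f (suc e)
      mμ : mm x y ≡ m
      mμ = mm₂₂ x y px py
      i≡ : d ∸ m ≡ j
      i≡ = sym (d∸1∸ μ)
      m≤d : m ℕ.≤ d
      m≤d = subst (ℕ._≤ d) mμ (mm≤d x y (inj₂ (dx , px)) (inj₂ (dy , py)))
      dyH : dim (y ⋀ H) ≡ d ∸ 1
      dyH = trans (meet-⊆H y py) dy
      μ≤ : μ ℕ.≤ d ∸ 1
      μ≤ = subst (μ ℕ.≤_) dx (⋀-dimˡ x y)
      second : ∀ e → e ≡ μ → e ℕ.≤ d ∸ 1 → ([ d ∸ 1 ] - [ d ∸ 1 ∸ e ]) * gen f′ D2 (d ∸ 1) (e ∸ 1) ≡ ([ d ∸ 1 ] - [ d ∸ 1 ∸ e ]) * ([ suc (d ∸ 1 ∸ e) ] * f (suc e) + ([ D2 ] - [ suc (d ∸ 1 ∸ e) ]) * f e)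
      second zero    _ _  = vanish [ d ∸ 1 ] _ _
      second (suc e) _ le = cong (λ w → ([ d ∸ 1 ] - [ d ∸ 1 ∸ suc e ]) * ([ w ] * f (suc (suc e)) + ([ D2 ] - [ w ]) * f (suc e))) (ℕ.+-∸-assoc 1 {d ∸ 1} {suc e} le)

    A-tri : ∀ (f : ℕ → ℤ) x y → InX x → InX y → A (λ z → f (mm z y)) x ≡ tri (d ∸ mm x y) (mm x y) f
    A-tri f x y (inj₁ px) (inj₁ py) = A-tri₁₁ f x y px py
    A-tri f x y (inj₁ px) (inj₂ py) = A-tri₁₂ f x y px py
    A-tri f x y (inj₂ px) (inj₁ py) = A-tri₂₁ f x y px py
    A-tri f x y (inj₂ px) (inj₂ py) = A-tri₂₂ f x y px py

    ψd>0 : ∀ s → s ℕ.≤ d → 0ℤ < ψ s d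
    ψd>0 s s≤d = pos*pos (fac>0 (d ∸ s)) (subst (λ w → 0ℤ < g s w) (ℕ.m+[n∸m]≡n s≤d) (g>0 s (d ∸ s)))

    open Spectral InX XS XS-InX d mm (λ x y _ _ → mm-sym x y) mm-refl mm≤d XS-complete ψ
      (λ s m m<s → trans (cong (fac (d ∸ s) *_) (g-low s m m<s)) (ℤ.*-zeroʳ (fac (d ∸ s))))
      (λ s _ → pos*pos (fac>0 (d ∸ s)) (subst (0ℤ <_) (sym (g-diag s)) (+<+ (s≤s z≤n))))
      (λ m → cong (fac d *_) (trans (g-0 m) (sym (g-0 0))))
      ψd>0 ψ-id θ θ-dec gap A A-cong A-+ A-* A-0
      (λ x y px py → trans (A-tri (ψ 0) x y px py) (tri-ψ₀ (d ∸ mm x y) (mm x y)))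
      (λ s x y s<d px py → trans (A-tri (ψ (suc s)) x y px py) (tri-ψ s (d ∸ mm x y) (mm x y) (ℕ.m∸n+n≡m (mm≤d x y px py)) s<d))
      public using (A-∑; φ; row-sum; ψ-pred; module Quadrature)

    -- Walks and the function `mm`.

    private
      dim+2σ : ∀ x → InX x → dim x ℕ.+ (σ x ℕ.+ σ x) ≡ suc d
      dim+2σ x (inj₁ (dx , nx)) = trans (cong₂ (λ a b → a ℕ.+ (b ℕ.+ b)) dx (σ₁ x nx)) (ℕ.+-identityʳ (suc d))
      dim+2σ x (inj₂ (dx , px)) = trans (cong₂ (λ a b → a ℕ.+ (b ℕ.+ b)) dx (σ₂ x px)) (trans (ℕ.+-comm (d ∸ 1) 2) (cong suc suc-pred-d))

      dim-meet : ∀ (x y : Sub) k → DimMeet x y k → dim (x ⋀ y) ≡ k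
      dim-meet x y k (b , li , len , spec) = trans (dim-≈ {x = x ⋀ y} {sub b li}
        ((λ v v∈ → proj₂ (spec v) (⋀-lowerˡ x y v v∈ , ⋀-lowerʳ x y v v∈)) , (λ v v∈ → ∈-⋀ x y (proj₁ (proj₁ (spec v) v∈)) (proj₂ (proj₁ (spec v) v∈))))) len

      -- z ⋀ y and x ⋀ z both lie in z, so their join does too, while their meet lies in x ⋀ y; the
      -- modular law does the rest.
      triangle : ∀ (x y z : Sub) → dim (z ⋀ y) ℕ.+ dim (x ⋀ z) ℕ.≤ dim z ℕ.+ dim (x ⋀ y)
      triangle x y z = ℕ.≤-trans (ℕ.≤-reflexive (modular (z ⋀ y) (x ⋀ z))) (ℕ.≤-trans (ℕ.+-mono-≤
        (dim-mono {x = (z ⋀ y) ⋀ (x ⋀ z)} {x ⋀ y} (⋀-greatest {x = x} {y} ((z ⋀ y) ⋀ (x ⋀ z)) (λ v v∈ → ⋀-lowerˡ x z v (⋀-lowerʳ (z ⋀ y) (x ⋀ z) v v∈)) (λ v v∈ → ⋀-lowerʳ z y v (⋀-lowerˡ (z ⋀ y) (x ⋀ z) v v∈))))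
        (dim-mono {x = (z ⋀ y) ⋁ (x ⋀ z)} {z} (⋁-least {x = z ⋀ y} {x ⋀ z} z (⋀-lowerˡ z y) (⋀-lowerʳ x z))))
        (ℕ.≤-reflexive (ℕ.+-comm (dim (x ⋀ y)) (dim z))))

      -- Adjacency fixes dim x + dim z in terms of the intersection dimension k, and dim + 2 σ is
      -- constant on vertices. Adding `triangle` to itself eliminates both dimensions and k, and
      -- leaves twice the desired inequality.
      mm-step : ∀ x y z → Adj x z → mm z y ℕ.≤ suc (mm x y)
      mm-step x y z (px , pz , k , mk , dk) = ℕ.≤-trans (ℕ.∸-monoˡ-≤ 1 (ℕ.+-monoˡ-≤ (σ y) main)) pred-le
        where
        a = dim (x ⋀ y)
        b = dim (z ⋀ y)
        pred-le : suc (a ℕ.+ σ x) ℕ.+ σ y ∸ 1 ℕ.≤ suc (a ℕ.+ σ x ℕ.+ σ y ∸ 1)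
        pred-le = ℕ.m≤n+m∸n (a ℕ.+ σ x ℕ.+ σ y) 1
        b+k : b ℕ.+ k ℕ.≤ dim z ℕ.+ a
        b+k = subst (λ w → b ℕ.+ w ℕ.≤ dim z ℕ.+ a) (dim-meet x z k mk) (triangle x y z)
        l₁ : ∀ b sz dx sx dz → 2 ℕ.* (b ℕ.+ sz) ℕ.+ (dx ℕ.+ (sx ℕ.+ sx) ℕ.+ dz) ≡ (b ℕ.+ b ℕ.+ (dx ℕ.+ dz)) ℕ.+ (sz ℕ.+ sz ℕ.+ (sx ℕ.+ sx))
        l₁ = solveℕ
        l₂ : ∀ b k → b ℕ.+ b ℕ.+ (2 ℕ.+ 2 ℕ.* k) ≡ 2 ℕ.+ ((b ℕ.+ k) ℕ.+ (b ℕ.+ k))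
        l₂ = solveℕ
        l₃ : ∀ a dz sz sx → 2 ℕ.+ ((dz ℕ.+ a) ℕ.+ (dz ℕ.+ a)) ℕ.+ (sz ℕ.+ sz ℕ.+ (sx ℕ.+ sx)) ≡ 2 ℕ.* suc (a ℕ.+ sx) ℕ.+ (dz ℕ.+ (sz ℕ.+ sz) ℕ.+ dz)
        l₃ = solveℕ
        doubled : 2 ℕ.* (b ℕ.+ σ z) ℕ.+ (suc d ℕ.+ dim z) ℕ.≤ 2 ℕ.* suc (a ℕ.+ σ x) ℕ.+ (suc d ℕ.+ dim z)
        doubled = begin
          2 ℕ.* (b ℕ.+ σ z) ℕ.+ (suc d ℕ.+ dim z) ≡⟨ cong (λ w → 2 ℕ.* (b ℕ.+ σ z) ℕ.+ (w ℕ.+ dim z)) (sym (dim+2σ x px)) ⟩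
          2 ℕ.* (b ℕ.+ σ z) ℕ.+ (dim x ℕ.+ (σ x ℕ.+ σ x) ℕ.+ dim z) ≡⟨ l₁ b (σ z) (dim x) (σ x) (dim z) ⟩
          (b ℕ.+ b ℕ.+ (dim x ℕ.+ dim z)) ℕ.+ (σ z ℕ.+ σ z ℕ.+ (σ x ℕ.+ σ x)) ≡⟨ cong (λ w → b ℕ.+ b ℕ.+ w ℕ.+ (σ z ℕ.+ σ z ℕ.+ (σ x ℕ.+ σ x))) dk ⟩
          (b ℕ.+ b ℕ.+ (2 ℕ.+ 2 ℕ.* k)) ℕ.+ (σ z ℕ.+ σ z ℕ.+ (σ x ℕ.+ σ x)) ≡⟨ cong (ℕ._+ (σ z ℕ.+ σ z ℕ.+ (σ x ℕ.+ σ x))) (l₂ b k) ⟩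
          2 ℕ.+ ((b ℕ.+ k) ℕ.+ (b ℕ.+ k)) ℕ.+ (σ z ℕ.+ σ z ℕ.+ (σ x ℕ.+ σ x)) ≤⟨ ℕ.+-monoˡ-≤ _ (ℕ.+-monoʳ-≤ 2 (ℕ.+-mono-≤ b+k b+k)) ⟩
          2 ℕ.+ ((dim z ℕ.+ a) ℕ.+ (dim z ℕ.+ a)) ℕ.+ (σ z ℕ.+ σ z ℕ.+ (σ x ℕ.+ σ x)) ≡⟨ l₃ a (dim z) (σ z) (σ x) ⟩
          2 ℕ.* suc (a ℕ.+ σ x) ℕ.+ (dim z ℕ.+ (σ z ℕ.+ σ z) ℕ.+ dim z) ≡⟨ cong (λ w → 2 ℕ.* suc (a ℕ.+ σ x) ℕ.+ (w ℕ.+ dim z)) (dim+2σ z pz) ⟩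
          2 ℕ.* suc (a ℕ.+ σ x) ℕ.+ (suc d ℕ.+ dim z) ∎
          where open ℕ.≤-Reasoning
        main : b ℕ.+ σ z ℕ.≤ suc (a ℕ.+ σ x)
        main = ℕ.*-cancelˡ-≤ 2 (ℕ.+-cancelʳ-≤ (suc d ℕ.+ dim z) _ _ doubled)

    -- Each edge of a walk raises d - `mm` by at most one. In this way width at most d - t becomes
    -- the condition t ≤ `mm` on pairs from Y.
    within⇒mm : ∀ {k x y} → WithinDist k x y → InX y → d ℕ.≤ mm x y ℕ.+ k
    within⇒mm {k} {x} {y} (here x≈y) py = ℕ.≤-trans (ℕ.≤-reflexive (sym (trans (mm-congˡ {x} {y} y x≈y) (mm-refl y py)))) (ℕ.m≤m+n (mm x y) k)
    within⇒mm {suc k} {x} {y} (step {z = z} adj w) py = ℕ.≤-trans (within⇒mm w py) (ℕ.≤-trans (ℕ.+-monoˡ-≤ k (mm-step x y z adj)) (ℕ.≤-reflexive (sym (ℕ.+-suc (mm x y) k))))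

  -- Families attaining the bound

  -- Truncation identifies 0 and 1; the positivity of `m ∸ 1`, available because t > 0, excludes
  -- that case.
  ∸1-≤ : ∀ m n → 0 ℕ.< m ∸ 1 → m ∸ 1 ℕ.≤ n ∸ 1 → m ℕ.≤ n
  ∸1-≤ (suc m) zero    0<m le = contradiction (ℕ.≤-trans 0<m le) λ ()
  ∸1-≤ (suc m) (suc n) _   le = s≤s le

  ∑-filter : ∀ {A : Set} {Q : A → Set} (Q? : ∀ x → Dec (Q x)) xs → ∑ xs (λ x → ⟦ Q? x ⟧) ≡ + length (filter Q? xs)
  ∑-filter Q? []       = refl
  ∑-filter Q? (x ∷ xs) with Q? x
  ... | yes _ = cong (λ s → 1ℤ + s) (∑-filter Q? xs)
  ... | no _  = trans (ℤ.+-identityˡ _) (∑-filter Q? xs)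

  find-or-none : ∀ {A : Set} {Q : A → Set} (Q? : ∀ x → Dec (Q x)) xs → (Σ A λ z → z ∈ xs × Q z) ⊎ (∀ z → z ∈ xs → ¬ Q z)
  find-or-none Q? [] = inj₂ λ _ ()
  find-or-none Q? (x ∷ xs) with Q? x | find-or-none Q? xs
  ... | yes qx | _ = inj₁ (x , here refl , qx)
  ... | no ¬qx | inj₁ (z , z∈ , qz) = inj₁ (z , there z∈ , qz)
  ... | no ¬qx | inj₂ none = inj₂ λ { z (here refl) → ¬qx ; z (there z∈) → none z z∈ }

  module Extremal {q : ℕ} (F : FiniteField q) (d : ℕ) (0<d : 0 ℕ.< d)
    (H : LinAlg.Subspace F (suc (2 ℕ.* d))) (dim-H : LinAlg.dim F H ≡ 2 ℕ.* d)
    (t′ r′ : ℕ) (t+r : suc t′ ℕ.+ suc r′ ≡ d) where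

    open Graph F d 0<d H dim-H

    t r : ℕ
    t = suc t′
    r = suc r′

    open Quadrature t r t+r using (bound; tight; design)

    -- The bound of the theorem: with r = d - t the upper index 2d + 1 - t is d + r + 1.
    M : ℤ
    M = g r (suc (d ℕ.+ r))

    private
      q^0 : q^ 0 ≡ 1ℤ
      q^0 = trans (cong (λ u → 1ℤ + p * u) [0]) (l p)
        where
        l : ∀ p → 1ℤ + p * 0ℤ ≡ 1ℤ
        l = solve-∀

      θ₀-gap : ∀ s k → s ℕ.+ suc k ≡ d → θ 0 - θ (suc s) ≡ [ suc s ] * [ suc (d ℕ.+ suc k) ]
      θ₀-gap s k e = trans (θ-gap 0 (suc s) (suc (d ℕ.+ suc k)) (trans (cong (λ w → 2 ℕ.* w ℕ.+ 2) (sym e)) (trans (l s k) (cong (λ w → suc s ℕ.+ suc (w ℕ.+ suc k)) e))))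
        (trans (cong (_* ([ suc s ] * [ suc (d ℕ.+ suc k) ])) q^0) (ℤ.*-identityˡ ([ suc s ] * [ suc (d ℕ.+ suc k) ])))
        where
        l : ∀ s k → 2 ℕ.* (s ℕ.+ suc k) ℕ.+ 2 ≡ suc s ℕ.+ suc (s ℕ.+ suc k ℕ.+ suc k)
        l = solveℕ

      -- Both the eigenvalue and the diagonal value of `ψ s` change by explicit brackets when s
      -- drops by one, and `absorb` collects their quotient into a Gaussian binomial. For s = t this
      -- identifies the spectral bound, row sum over diagonal value of `ψ t`, as M.
      φ₀ : ∀ k s → s ℕ.+ k ≡ d → φ s k 0 ≡ ψ s d * g k (suc (d ℕ.+ k))
      φ₀ zero s e = sym (trans (cong (λ w → ψ s d * w) (g-0 (suc (d ℕ.+ 0)))) (trans (ℤ.*-identityʳ (ψ s d))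
        (trans (cong (λ w → ψ w d) (trans (sym (ℕ.+-identityʳ s)) e)) (trans (cong (λ k → fac k * g d d) (ℕ.n∸n≡0 d)) (trans (ℤ.*-identityˡ (g d d)) (g-diag d))))))
      φ₀ (suc k) s e = begin
        (θ 0 - θ (suc s)) * φ (suc s) k 0 ≡⟨ cong₂ _*_ (θ₀-gap s k e) (φ₀ k (suc s) (trans (sym (ℕ.+-suc s k)) e)) ⟩
        [ suc s ] * [ suc (d ℕ.+ suc k) ] * (ψ (suc s) d * g k (suc (d ℕ.+ k))) ≡⟨ cong (λ w → [ suc s ] * [ suc (d ℕ.+ suc k) ] * (ψ (suc s) d * g k w)) (sym (ℕ.+-suc d k)) ⟩
        [ suc s ] * [ suc (d ℕ.+ suc k) ] * (ψ (suc s) d * g k (d ℕ.+ suc k)) ≡⟨ l [ suc s ] [ suc (d ℕ.+ suc k) ] (ψ (suc s) d) (g k (d ℕ.+ suc k)) ⟩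
        [ suc s ] * ψ (suc s) d * ([ suc (d ℕ.+ suc k) ] * g k (d ℕ.+ suc k)) ≡⟨ cong ([ suc s ] * ψ (suc s) d *_) (sym (absorb k (d ℕ.+ suc k))) ⟩
        [ suc s ] * ψ (suc s) d * ([ suc k ] * g (suc k) (suc (d ℕ.+ suc k))) ≡⟨ l′ [ suc s ] (ψ (suc s) d) [ suc k ] (g (suc k) (suc (d ℕ.+ suc k))) ⟩
        [ suc k ] * [ suc s ] * ψ (suc s) d * g (suc k) (suc (d ℕ.+ suc k)) ≡⟨ cong (_* g (suc k) (suc (d ℕ.+ suc k))) (sym (ψ-pred-d s k e)) ⟩
        ψ s d * g (suc k) (suc (d ℕ.+ suc k)) ∎
        where
        open ≡-Reasoning
        l : ∀ a b c x → a * b * (c * x) ≡ a * c * (b * x)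
        l = solve-∀
        l′ : ∀ a b c x → a * b * (c * x) ≡ c * a * b * x
        l′ = solve-∀

      φM : φ t r 0 ≡ ψ t d * M
      φM = φ₀ r t t+r

      t≤d : t ℕ.≤ d
      t≤d = subst (t ℕ.≤_) t+r (ℕ.m≤m+n t r)

    module Family (Y : List Sub) (Y-unique : S.Uniq Y) (Y-X : ∀ y → y ∈ Y → InX y)
      (Y-t : ∀ x y → x ∈ Y → y ∈ Y → t ℕ.≤ mm x y) where

      ℓ : ℤ
      ℓ = + length Y

      private
        Y-id : ∀ x → x ∈ Y → ∑ Y (λ y → ψ d (mm x y)) ≡ 1ℤ
        Y-id x x∈ = trans (∑-cong∈ Y λ y y∈ → ψd x y (Y-X x x∈) (Y-X y y∈))
          (trans (S.∑-hits x Y Y-unique) (⟦⟧-yes (S.hits? x Y) (S.∈⇒hits (≈-refl {x = x}) x∈)))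

      size-bound : ℓ ≤ M
      size-bound = bound Y Y-X Y-t Y-id M φM

      χ : Sub → ℤ
      χ z = ⟦ S.hits? z Y ⟧

      -- Local structure of a family that attains the bound.

      module Tight (ℓ≡M : ℓ ≡ M) where

        private
          design′ : ∀ x → x ∈ Y → (f : ℕ → ℤ) → φ t r 0 * ∑ Y (λ y → f (mm x y)) ≡ ℓ * ∑ XS (λ z → ψ t (mm x z) * f (mm z x))
          design′ = design Y Y-X Y-t (tight Y Y-X Y-t Y-id M φM ℓ≡M)

          M>0 : 0ℤ < M
          M>0 = subst (λ w → 0ℤ < g r w) (trans (ℕ.+-comm r (suc d)) refl) (g>0 r (suc d))

          ψt>0 : 0ℤ < ψ t d
          ψt>0 = ψd>0 t t≤d

          A-ψ-suc : ∀ s x y → s ℕ.< d → InX x → InX y → A (λ z → ψ (suc s) (mm z y)) x ≡ θ (suc s) * ψ (suc s) (mm x y) + ψ s (mm x y)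
          A-ψ-suc s x y s<d px py = trans (A-tri (ψ (suc s)) x y px py) (tri-ψ s (d ∸ mm x y) (mm x y) (ℕ.m∸n+n≡m (mm≤d x y px py)) s<d)

          d′ : ℕ
          d′ = d ∸ 1

          d′<d : d′ ℕ.< d
          d′<d = ℕ.≤-reflexive suc-pred-d

          -- On vertices χ is the sum of the functions `ψ d (mm · y)` over y ∈ Y, and A takes `ψ d`
          -- to θ d `ψ d` + `ψ d′`.
          Aχ-sum : ∀ x → x ∈ Y → A χ x ≡ θ d + ∑ Y (λ y → ψ d′ (mm x y))
          Aχ-sum x x∈ = begin
            A χ x
              ≡⟨ A-cong χ (λ z → ∑ Y (λ y → ψ d (mm z y) * 1ℤ)) x px (λ z pz → sym (trans (∑-cong∈ Y λ y y∈ → trans (ℤ.*-identityʳ (ψ d (mm z y))) (ψd z y pz (Y-X y y∈))) (S.∑-hits z Y Y-unique))) ⟩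
            A (λ z → ∑ Y (λ y → ψ d (mm z y) * 1ℤ)) x
              ≡⟨ A-∑ Y (λ _ → 1ℤ) (λ y z → ψ d (mm z y)) x ⟩
            ∑ Y (λ y → A (λ z → ψ d (mm z y)) x * 1ℤ)
              ≡⟨ ∑-cong∈ Y (λ y y∈ → trans (ℤ.*-identityʳ _) (subst (λ w → A (λ z → ψ w (mm z y)) x ≡ θ w * ψ w (mm x y) + ψ d′ (mm x y)) suc-pred-d (A-ψ-suc d′ x y d′<d px (Y-X y y∈)))) ⟩
            ∑ Y (λ y → θ d * ψ d (mm x y) + ψ d′ (mm x y))
              ≡⟨ trans (∑-+ Y _ _) (cong (λ u → u + ∑ Y (λ y → ψ d′ (mm x y))) (trans (∑-*ˡ Y (θ d) _) (trans (cong (θ d *_) (Y-id x x∈)) (ℤ.*-identityʳ (θ d))))) ⟩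
            θ d + ∑ Y (λ y → ψ d′ (mm x y)) ∎
            where
            open ≡-Reasoning
            px = Y-X x x∈

          -- By `ψ-pred` multiplication by `ψ d′` is A - θ d, so the sum is the diagonal value of (A
          -- - θ d) `ψ t`, known from the recursion.
          ψψ : ∀ x → InX x → ∑ XS (λ z → ψ t (mm x z) * ψ d′ (mm z x)) ≡ ψ t d * (θ t + [ suc r ] * [ t ] - θ d)
          ψψ x px = begin
            ∑ XS (λ z → ψ t (mm x z) * ψ d′ (mm z x))
              ≡⟨ ∑-cong XS (λ z → trans (ℤ.*-comm (ψ t (mm x z)) (ψ d′ (mm z x))) (cong₂ (λ a b → ψ d′ a * ψ t b) (mm-sym z x) (mm-sym x z))) ⟩
            ∑ XS (λ z → ψ d′ (mm x z) * ψ t (mm z x))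
              ≡⟨ ψ-pred d′ (ψ t) x x suc-pred-d px px ⟩
            A (λ z → ψ t (mm z x)) x - θ d * ψ t (mm x x)
              ≡⟨ cong (λ u → u - θ d * ψ t (mm x x)) (A-ψ-suc t′ x x t≤d px px) ⟩
            θ t * ψ t (mm x x) + ψ t′ (mm x x) - θ d * ψ t (mm x x)
              ≡⟨ cong (λ m → θ t * ψ t m + ψ t′ m - θ d * ψ t m) (mm-refl x px) ⟩
            θ t * ψ t d + ψ t′ d - θ d * ψ t d
              ≡⟨ cong (λ u → θ t * ψ t d + u - θ d * ψ t d) (ψ-pred-d t′ r (trans (ℕ.+-suc t′ r) t+r)) ⟩
            θ t * ψ t d + [ suc r ] * [ t ] * ψ t d - θ d * ψ t d
              ≡⟨ l (θ t) (ψ t d) ([ suc r ] * [ t ]) (θ d) ⟩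
            ψ t d * (θ t + [ suc r ] * [ t ] - θ d) ∎
            where
            open ≡-Reasoning
            l : ∀ a b c e → a * b + c * b - e * b ≡ b * (a + c - e)
            l = solve-∀

          θt : θ t + [ suc r ] * [ t ] ≡ (1ℤ + p) * [ r ] * [ suc d ]
          θt = trans (cong₂ (λ a b → (1ℤ + p) * a * [ suc d ] - [ t ] * b + [ suc r ] * [ t ]) [d]≡ [2d+2-t]) (l p [ r ] [ t ] [ suc d ] [ suc r ] ([suc] r))
            where
            [d]≡ : [ d ] ≡ [ r ] + (1ℤ + p * [ r ]) * [ t ]
            [d]≡ = trans (cong [_] (trans (sym t+r) (ℕ.+-comm t r))) ([+] r t)
            [2d+2-t] : [ 2 ℕ.* d ℕ.+ 2 ∸ t ] ≡ [ suc r ] + (1ℤ + p * [ suc r ]) * [ suc d ]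
            [2d+2-t] = trans (cong [_] (trans (cong (_∸ t) (trans (cong (λ w → w ℕ.+ (d ℕ.+ 0) ℕ.+ 2) (sym t+r)) (le t r d))) (ℕ.m+n∸m≡n t (suc r ℕ.+ suc d)))) ([+] (suc r) (suc d))
              where
              le : ∀ t r d → t ℕ.+ r ℕ.+ (d ℕ.+ 0) ℕ.+ 2 ≡ t ℕ.+ (suc r ℕ.+ suc d)
              le = solveℕ
            l : ∀ p x y D s → s ≡ 1ℤ + (1ℤ + p) * x → (1ℤ + p) * (x + (1ℤ + p * x) * y) * D - y * (s + (1ℤ + p * s) * D) + s * y ≡ (1ℤ + p) * x * D
            l p x y D _ refl = l′ p x y D
              where
              l′ : ∀ p x y D → (1ℤ + p) * (x + (1ℤ + p * x) * y) * D - y * ((1ℤ + (1ℤ + p) * x) + (1ℤ + p * (1ℤ + (1ℤ + p) * x)) * D) + (1ℤ + (1ℤ + p) * x) * y ≡ (1ℤ + p) * x * D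
              l′ = solve-∀

        -- every member of Y has as many neighbours in Y as in the extremal family
        Aχ : ∀ x → x ∈ Y → A χ x ≡ (1ℤ + p) * [ r ] * [ suc d ]
        Aχ x x∈ = trans (Aχ-sum x x∈) (trans (cong (λ u → θ d + u) nbrs) (trans (l (θ d) (θ t + [ suc r ] * [ t ])) θt))
          where
          l : ∀ a b → a + (b - a) ≡ b
          l = solve-∀
          nbrs : ∑ Y (λ y → ψ d′ (mm x y)) ≡ θ t + [ suc r ] * [ t ] - θ d
          nbrs = cancel-≡ (ψ t d * M) (pos*pos ψt>0 M>0) (begin
            ψ t d * M * ∑ Y (λ y → ψ d′ (mm x y)) ≡⟨ cong (_* ∑ Y (λ y → ψ d′ (mm x y))) (sym φM) ⟩
            φ t r 0 * ∑ Y (λ y → ψ d′ (mm x y)) ≡⟨ design′ x x∈ (ψ d′) ⟩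
            ℓ * ∑ XS (λ z → ψ t (mm x z) * ψ d′ (mm z x)) ≡⟨ cong₂ _*_ ℓ≡M (ψψ x (Y-X x x∈)) ⟩
            M * (ψ t d * (θ t + [ suc r ] * [ t ] - θ d)) ≡⟨ l′ M (ψ t d) (θ t + [ suc r ] * [ t ] - θ d) ⟩
            ψ t d * M * (θ t + [ suc r ] * [ t ] - θ d) ∎)
            where
            open ≡-Reasoning
            l′ : ∀ a b c → a * (b * c) ≡ b * a * c
            l′ = solve-∀

        far : Sub → ℤ
        far x = ∑ Y (λ y → ⟦ mm x y ℕ.≟ t ⟧)

        private
          -- [r]² ≤ [2r], and doubling stays below 1 + q [2r] = [2r + 1], which is at most
          -- [d + r + 1] since r ≤ d.
          2[r]²< : [ r ] * [ r ] + [ r ] * [ r ] < [ suc (d ℕ.+ r) ]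
          2[r]²< = ℤ.≤-<-trans (ℤ.+-mono-≤ ([*]≤[+] r r) ([*]≤[+] r r)) (ℤ.<-≤-trans twice ([]-mono-≤ {suc (r ℕ.+ r)} {suc (d ℕ.+ r)} (s≤s (ℕ.+-monoˡ-≤ r (subst (r ℕ.≤_) t+r (ℕ.m≤n+m r t))))))
            where
            X = [ r ℕ.+ r ]
            l₁ : ∀ a → 0ℤ + (a + a * 1ℤ) ≡ a + a
            l₁ = solve-∀
            l₂ : ∀ p a → 1ℤ + (a + a * p) ≡ 1ℤ + (1ℤ + p) * a
            l₂ = solve-∀
            twice : X + X < [ suc (r ℕ.+ r) ]
            twice = subst (X + X <_) (sym ([suc] (r ℕ.+ r))) (subst₂ _<_ (l₁ X) (l₂ p X) (ℤ.+-mono-<-≤ {0ℤ} {1ℤ} (+<+ (s≤s z≤n)) (ℤ.+-monoʳ-≤ X (scale-≤ X ([]≥0 (r ℕ.+ r)) 1≤p))))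

          -- Bonferroni: [m t] − [t+1] [m t+1] is at most the indicator of m = t
          bonferroni : ∀ m → ψ t m - [ suc t ] * ([ r ] * [ r ]) * ψ (suc t) m ≤ ψ t m * ⟦ m ℕ.≟ t ⟧
          bonferroni m = subst (_≤ ψ t m * ⟦ m ℕ.≟ t ⟧) (sym factored) (go (ℕ.<-cmp m t))
            where
            rt : d ∸ t ≡ r
            rt = trans (cong (_∸ t) (sym t+r)) (ℕ.m+n∸m≡n t r)
            rt′ : d ∸ suc t ≡ r′
            rt′ = trans (cong (_∸ suc t) (trans (sym t+r) (ℕ.+-suc t r′))) (ℕ.m+n∸m≡n (suc t) r′)
            l : ∀ b f x c y → b * b * f * x - c * (b * b) * (f * y) ≡ b * b * f * (x - c * y)
            l = solve-∀
            factored : ψ t m - [ suc t ] * ([ r ] * [ r ]) * ψ (suc t) m ≡ fac r * (g t m - [ suc t ] * g (suc t) m)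
            factored = trans (cong₂ (λ a b → fac a * g t m - [ suc t ] * ([ r ] * [ r ]) * (fac b * g (suc t) m)) rt rt′) (l [ r ] (fac r′) (g t m) [ suc t ] (g (suc t) m))
            go : _ → fac r * (g t m - [ suc t ] * g (suc t) m) ≤ ψ t m * ⟦ m ℕ.≟ t ⟧
            go (tri< m<t _ _) = ℤ.≤-reflexive (trans (cong₂ (λ a b → fac r * (a - [ suc t ] * b)) (g-low t m m<t) (g-low (suc t) m (ℕ.m≤n⇒m≤1+n m<t)))
              (trans (l₁ (fac r) [ suc t ]) (sym (trans (cong (λ a → fac (d ∸ t) * a * ⟦ m ℕ.≟ t ⟧) (g-low t m m<t)) (l₂ (fac (d ∸ t)) ⟦ m ℕ.≟ t ⟧)))))
              where
              l₁ : ∀ f c → f * (0ℤ - c * 0ℤ) ≡ 0ℤ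
              l₁ = solve-∀
              l₂ : ∀ f c → f * 0ℤ * c ≡ 0ℤ
              l₂ = solve-∀
            go (tri≈ _ refl _) = ℤ.≤-reflexive (trans (cong (λ b → fac r * (g t t - [ suc t ] * b)) (g-low (suc t) t ℕ.≤-refl))
              (trans (l₁ (fac r) (g t t) [ suc t ]) (sym (trans (cong (λ a → ψ t t * a) (⟦⟧-yes (t ℕ.≟ t) refl)) (trans (ℤ.*-identityʳ (ψ t t)) (cong (λ a → fac a * g t t) rt))))))
              where
              l₁ : ∀ f x c → f * (x - c * 0ℤ) ≡ f * x
              l₁ = solve-∀
            go (tri> _ m≢t t<m) = ℤ.≤-trans (subst (fac r * (g t m - [ suc t ] * g (suc t) m) ≤_) (ℤ.*-zeroʳ (fac r)) (scale-≤ (fac r) (ℤ.<⇒≤ (fac>0 r)) diff≤0))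
              (ℤ.≤-reflexive (sym (trans (cong (λ a → ψ t m * a) (⟦⟧-no (m ℕ.≟ t) m≢t)) (ℤ.*-zeroʳ (ψ t m)))))
              where
              a = m ∸ suc t
              t+a : t ℕ.+ suc a ≡ m
              t+a = trans (ℕ.+-suc t a) (ℕ.m+[n∸m]≡n t<m)
              shifted : [ suc t ] * g (suc t) m ≡ [ suc a ] * g t m
              shifted = subst (λ w → [ suc t ] * g (suc t) w ≡ [ suc a ] * g t w) t+a (shift t (suc a))
              -- By `shift` the subtracted term is [m - t] g t m, and [m - t] ≥ 1 above t.
              diff≤0 : g t m - [ suc t ] * g (suc t) m ≤ 0ℤ
              diff≤0 = ℤ.i≤j⇒i-j≤0 (subst (g t m ≤_) (sym shifted) (subst₂ _≤_ (ℤ.*-identityʳ (g t m)) (ℤ.*-comm (g t m) [ suc a ]) (scale-≤ (g t m) (g≥0 t m) (ℤ.i<j⇒suc[i]≤j ([]>0 a)))))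

        -- `design` with f the indicator of mm = t expresses `far x` through the sum of `ψ t` over
        -- the vertices on that level. By `bonferroni` and the row sums of ψ t and ψ (t + 1), D ·
        -- far x ≥ M (D - [r]²) with D = [d + r + 1], and D exceeds 2 [r]².
        many-far : ∀ x → x ∈ Y → M < far x + far x
        many-far x x∈ = cancel-< D D>0 (ℤ.<-≤-trans strict (subst (M * (D - [ r ] * [ r ]) + M * (D - [ r ] * [ r ]) ≤_) (sym (ℤ.*-distribˡ-+ D (far x) (far x))) (ℤ.+-mono-≤ main main)))
          where
          D Φ′ : ℤ
          D = [ suc (d ℕ.+ r) ]
          Φ′ = φ (suc t) r′ 0
          D>0 : 0ℤ < D
          D>0 = []>0 (d ℕ.+ r)
          t+r′ : suc t ℕ.+ r′ ≡ d
          t+r′ = trans (sym (ℕ.+-suc t r′)) t+r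
          px = Y-X x x∈
          Φ≡ : φ t r 0 ≡ [ suc t ] * D * Φ′
          Φ≡ = cong (_* Φ′) (θ₀-gap t r′ t+r)
          Φ′>0 : 0ℤ < Φ′
          Φ′>0 = subst (0ℤ <_) (sym (φ₀ r′ (suc t) t+r′)) (pos*pos (ψd>0 (suc t) (subst (suc t ℕ.≤_) t+r′ (ℕ.m≤m+n (suc t) r′)))
            (subst (λ w → 0ℤ < g r′ w) (ℕ.+-comm r′ (suc d)) (g>0 r′ (suc d))))
          lower : φ t r 0 - [ suc t ] * ([ r ] * [ r ]) * Φ′ ≤ ∑ XS (λ z → ψ t (mm x z) * ⟦ mm z x ℕ.≟ t ⟧)
          lower = subst (_≤ ∑ XS (λ z → ψ t (mm x z) * ⟦ mm z x ℕ.≟ t ⟧))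
            (trans (∑-- XS _ _) (cong₂ _-_ (row-sum r t x t+r px) (trans (∑-*ˡ XS ([ suc t ] * ([ r ] * [ r ])) _) (cong ([ suc t ] * ([ r ] * [ r ]) *_) (row-sum r′ (suc t) x t+r′ px)))))
            (∑-mono XS λ z _ → subst (λ w → ψ t (mm x z) - [ suc t ] * ([ r ] * [ r ]) * ψ (suc t) (mm x z) ≤ ψ t (mm x z) * ⟦ w ℕ.≟ t ⟧) (mm-sym x z) (bonferroni (mm x z)))
          K : ℤ
          K = [ suc t ] * Φ′
          K>0 : 0ℤ < K
          K>0 = pos*pos ([]>0 t) Φ′>0
          l₁ : ∀ s D f m r → m * (s * D * f - s * r * f) ≡ s * f * (m * (D - r))
          l₁ = solve-∀
          l₂ : ∀ s D f z → s * D * f * z ≡ s * f * (D * z)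
          l₂ = solve-∀
          main : M * (D - [ r ] * [ r ]) ≤ D * far x
          main = cancel-≤ K K>0 (subst₂ _≤_ (trans (cong (λ u → M * (u - [ suc t ] * ([ r ] * [ r ]) * Φ′)) Φ≡) (l₁ [ suc t ] D Φ′ M ([ r ] * [ r ])))
            (trans (trans (cong (_* ∑ XS (λ z → ψ t (mm x z) * ⟦ mm z x ℕ.≟ t ⟧)) (sym ℓ≡M)) (sym (design′ x x∈ (λ m → ⟦ m ℕ.≟ t ⟧)))) (trans (cong (_* far x) Φ≡) (l₂ [ suc t ] D Φ′ (far x))))
            (scale-≤ M (ℤ.<⇒≤ M>0) lower))
          l₃ : ∀ m D r → m * (D - (r + r)) ≡ m * (D - r) + m * (D - r) - D * m
          l₃ = solve-∀
          strict : D * M < M * (D - [ r ] * [ r ]) + M * (D - [ r ] * [ r ])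
          strict = 0<-⇒< (subst (0ℤ <_) (l₃ M D ([ r ] * [ r ])) (pos*pos M>0 (<⇒0<- 2[r]²<)))

        -- Two subfamilies that each contain more than half of Y intersect.
        far-common : ∀ x y → x ∈ Y → y ∈ Y → Σ Sub λ z → z ∈ Y × mm x z ≡ t × mm y z ≡ t
        far-common x y x∈ y∈ with find-or-none (λ z → (mm x z ℕ.≟ t) ×-dec (mm y z ℕ.≟ t)) Y
        ... | inj₁ found = found
        ... | inj₂ none = contradiction (ℤ.<-≤-trans (ℤ.+-mono-< (many-far x x∈) (many-far y y∈)) (subst₂ _≤_ (l (far x) (far y)) (cong₂ _+_ ℓ≡M ℓ≡M) (ℤ.+-mono-≤ at-most at-most))) (ℤ.<-irrefl refl)
          where
          l : ∀ a b → (a + b) + (a + b) ≡ (a + a) + (b + b)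
          l = solve-∀
          one : ∀ z → z ∈ Y → ⟦ mm x z ℕ.≟ t ⟧ + ⟦ mm y z ℕ.≟ t ⟧ ≤ 1ℤ
          one z z∈ with mm x z ℕ.≟ t | mm y z ℕ.≟ t
          ... | yes e₁ | yes e₂ = contradiction (e₁ , e₂) (none z z∈)
          ... | yes _  | no _   = ℤ.≤-refl
          ... | no _   | yes _  = ℤ.≤-refl
          ... | no _   | no _   = +≤+ z≤n
          at-most : far x + far y ≤ ℓ
          at-most = subst₂ _≤_ (∑-+ Y (λ z → ⟦ mm x z ℕ.≟ t ⟧) (λ z → ⟦ mm y z ℕ.≟ t ⟧)) (∑-1 Y) (∑-mono Y λ z z∈ → one z z∈)

        private
          member : ∀ {z} L → S.Hits z L → Σ Sub λ y → y ∈ L × z ≈S y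
          member (y ∷ L) (here e)  = y , here refl , e
          member {z} (y ∷ L) (there h) with member {z} L h
          ... | w , w∈ , e = w , there w∈ , e

          hit-mm : ∀ z w → S.Hits z Y → w ∈ Y → t ℕ.≤ mm z w
          hit-mm z w h w∈ with member {z} Y h
          ... | y , y∈ , e = subst (t ℕ.≤_) (sym (mm-congˡ {z} {y} w e)) (Y-t y w y∈ w∈)

          -- A neighbour z of x in Y either contains x ⋀ z₀ or lies below h ⋁ z₀, where h = x ⋀ z.
          blocked : ∀ x h z z₀ → z₀ ∈ Y → mm x z₀ ≡ t → σ x ≡ σ z → h ⊆S x → suc (dim h) ≡ dim x → h ⊆S z → dim z ≡ suc (dim h) →
            S.Hits z Y → ¬ ((x ⋀ z₀) ⊆S h) → z ⊆S (h ⋁ z₀)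
          blocked x h z z₀ z₀∈ mx σ≡ h⊆x dh h⊆z dz hz R⊈h with z ⊆? (h ⋁ z₀)
          ... | yes p = p
          -- Outside h ⋁ z₀ the space z would meet z₀ only as h does, in one dimension less than x
          -- does. But mm z z₀ ≥ t = mm x z₀, and with σ x = σ z this compares the dimensions the
          -- other way round.
          ... | no n  = contradiction (subst₂ ℕ._≤_ (sym (coatom-⊉ x h z₀ h⊆x dh R⊈h)) (cover-⊈ h z z₀ h⊆z dz n) larger) (ℕ.<⇒≱ ℕ.≤-refl)
            where
            larger : dim (x ⋀ z₀) ℕ.≤ dim (z ⋀ z₀)
            larger = ℕ.+-cancelʳ-≤ (σ x ℕ.+ σ z₀) _ _ (subst₂ ℕ._≤_ (ℕ.+-assoc (dim (x ⋀ z₀)) (σ x) (σ z₀)) (trans (cong (λ w → dim (z ⋀ z₀) ℕ.+ w ℕ.+ σ z₀) (sym σ≡)) (ℕ.+-assoc (dim (z ⋀ z₀)) (σ x) (σ z₀)))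
              (∸1-≤ _ _ (subst (0 ℕ.<_) (sym mx) (s≤s z≤n)) (subst (ℕ._≤ mm z z₀) (sym mx) (hit-mm z z₀ hz z₀∈))))

          sum-bound : ∀ {Q : Sub → Set} (Q? : ∀ z → Dec (Q z)) (h T : Sub) u → h ⊆S T → dim T ℕ.≤ dim h ℕ.+ u →
            (∀ z → Q z → S.Hits z Y → Between h T 1 z) → ∑S (λ z → ⟦ Q? z ⟧ * χ z) ≤ [ u ]
          sum-bound Q? h T u h⊆T dT inT = ℤ.≤-trans
            (∑-mono subspaces λ z _ → subst (_≤ ⟦ Between? h T 1 z ⟧) (⟦⟧-× (Q? z) (S.hits? z Y)) (⟦⟧-mono (Q? z ×-dec S.hits? z Y) (Between? h T 1 z) λ { (qz , hz) → inT z qz hz }))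
            (ℤ.≤-trans (ℤ.≤-reflexive (points h T (dim T ∸ dim h) h⊆T (sym (ℕ.m+[n∸m]≡n (dim-mono {x = h} {T} h⊆T)))))
              ([]-mono-≤ (subst (dim T ∸ dim h ℕ.≤_) (ℕ.m+n∸m≡n (dim h) u) (ℕ.∸-monoˡ-≤ (dim h) dT))))

          join-dim : ∀ (h z : Sub) u → dim z ≡ dim (h ⋀ z) ℕ.+ u → dim (h ⋁ z) ≡ dim h ℕ.+ u
          join-dim h z u e = ℕ.+-cancelˡ-≡ (dim (h ⋀ z)) _ _ (trans (sym (modular h z)) (trans (cong (dim h ℕ.+_) e) (le (dim h) (dim (h ⋀ z)) u)))
            where
            le : ∀ a b c → a ℕ.+ (b ℕ.+ c) ≡ b ℕ.+ (a ℕ.+ c)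
            le = solveℕ

          co-count : ∀ (R x : Sub) u α → R ⊆S x → dim x ≡ dim R ℕ.+ u → ∑S (λ h → ⟦ Coatom? 0S x h ⟧ * (⟦ R ⊆? h ⟧ * α)) ≡ [ u ] * α
          co-count R x u α R⊆x dx = trans (∑-cong subspaces λ h → trans (sym (ℤ.*-assoc ⟦ Coatom? 0S x h ⟧ ⟦ R ⊆? h ⟧ α)) (cong (_* α)
              (trans (sym (⟦⟧-× (Coatom? 0S x h) (R ⊆? h))) (⟦⟧-cong (Coatom? 0S x h ×-dec (R ⊆? h)) (Coatom? R x h)
                (λ { (((_ , h⊆x) , dh) , R⊆h) → (R⊆h , h⊆x) , dh }) (λ { ((R⊆h , h⊆x) , dh) → ((0S-⊆ h , h⊆x) , dh) , R⊆h })))))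
            (trans (∑-*ʳ subspaces α (λ h → ⟦ Coatom? R x h ⟧)) (cong (_* α) (coatoms R x u R⊆x dx)))

          -- Sums a table of local bounds: `a` for every hyperplane h of x, with surcharges α if h
          -- contains R₁ and β if it contains R₂. The numbers of hyperplanes concerned are [dim x],
          -- [u₁] and [u₂].
          co-bound : ∀ (x : Sub) (v : Sub → ℤ) (R₁ R₂ : Sub) u₁ u₂ a α β → R₁ ⊆S x → dim x ≡ dim R₁ ℕ.+ u₁ → R₂ ⊆S x → dim x ≡ dim R₂ ℕ.+ u₂ →
            (∀ h → Coatom 0S x h → v h ≤ a + ⟦ R₁ ⊆? h ⟧ * α + ⟦ R₂ ⊆? h ⟧ * β) →
            ∑S (λ h → ⟦ Coatom? 0S x h ⟧ * v h) ≤ [ dim x ] * a + [ u₁ ] * α + [ u₂ ] * β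
          co-bound x v R₁ R₂ u₁ u₂ a α β R₁⊆ d₁ R₂⊆ d₂ le = ℤ.≤-trans (∑-mono subspaces λ h _ → ⟦⟧*-mono (Coatom? 0S x h) (le h)) (ℤ.≤-reflexive (begin
            ∑S (λ h → ⟦ Coatom? 0S x h ⟧ * (a + ⟦ R₁ ⊆? h ⟧ * α + ⟦ R₂ ⊆? h ⟧ * β))
              ≡⟨ ∑-cong subspaces (λ h → l ⟦ Coatom? 0S x h ⟧ a (⟦ R₁ ⊆? h ⟧ * α) (⟦ R₂ ⊆? h ⟧ * β)) ⟩
            ∑S (λ h → ⟦ Coatom? 0S x h ⟧ * a + ⟦ Coatom? 0S x h ⟧ * (⟦ R₁ ⊆? h ⟧ * α) + ⟦ Coatom? 0S x h ⟧ * (⟦ R₂ ⊆? h ⟧ * β))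
              ≡⟨ trans (∑-+ subspaces _ _) (cong₂ _+_ (trans (∑-+ subspaces _ _) (cong₂ _+_ (trans (∑-*ʳ subspaces a (λ h → ⟦ Coatom? 0S x h ⟧)) (cong (_* a) (coatoms 0S x (dim x) (0S-⊆ x) refl))) (co-count R₁ x u₁ α R₁⊆ d₁))) (co-count R₂ x u₂ β R₂⊆ d₂)) ⟩
            [ dim x ] * a + [ u₁ ] * α + [ u₂ ] * β ∎))
            where
            open ≡-Reasoning
            l : ∀ c a x y → c * (a + x + y) ≡ c * a + c * x + c * y
            l = solve-∀

          D₁ D₀ R[] r₁ : ℤ
          D₁ = [ suc d ]
          D₀ = [ d ]
          R[] = [ r ]
          r₁ = [ suc r ]

          r<d : suc r ℕ.≤ d
          r<d = subst (suc r ℕ.≤_) t+r (s≤s (ℕ.m≤n+m r t′))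

          R≤r₁ : R[] ≤ r₁
          R≤r₁ = []-mono-≤ (ℕ.n≤1+n r)
          r₁≤D₀ : r₁ ≤ D₀
          r₁≤D₀ = []-mono-≤ r<d
          D₀≤D₁ : D₀ ≤ D₁
          D₀≤D₁ = []-mono-≤ (ℕ.n≤1+n d)
          r₁≤D₁ : r₁ ≤ D₁
          r₁≤D₁ = ℤ.≤-trans r₁≤D₀ D₀≤D₁
          R≤D₁ : R[] ≤ D₁
          R≤D₁ = ℤ.≤-trans R≤r₁ r₁≤D₁
          D₀≤pD₀ : D₀ ≤ p * D₀
          D₀≤pD₀ = subst₂ _≤_ (ℤ.*-identityʳ D₀) (ℤ.*-comm D₀ p) (scale-≤ D₀ ([]≥0 d) 1≤p)

          0≤- : ∀ {a b} → a ≤ b → 0ℤ ≤ b - a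
          0≤- = ℤ.i≤j⇒0≤j-i

          excess>0 : ∀ {a b c} → 0ℤ ≤ a → b ≤ c → 0ℤ < a + (c - b) + 1ℤ
          excess>0 {a} {b} {c} 0≤a b≤c = ℤ.+-mono-≤-< {0ℤ} {a + (c - b)} {0ℤ} {1ℤ} (ℤ.+-mono-≤ {0ℤ} {a} {0ℤ} 0≤a (0≤- b≤c)) (+<+ (s≤s z≤n))

          χ-self : ∀ x → x ∈ Y → χ x ≡ 1ℤ
          χ-self x x∈ = ⟦⟧-yes (S.hits? x Y) (S.∈⇒hits (≈-refl {x = x}) x∈)

          -- `B` bounds the walks from x through its hyperplanes back into Y within X₁. Of these D₁
          -- = [d + 1] end at x itself, while at most D₀ = [d] neighbours lie in X₂; the outcome
          -- would stay below the exact number of neighbours given by `Aχ`.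
          too-small₁ : ∀ x → x ∈ Y → InX₁ x → ∀ B → co-up∑ x χ ≤ B → 0ℤ < (1ℤ + p) * R[] * D₁ - (B - D₁ + D₀) → ⊥
          too-small₁ x x∈ (dx , nx) B le gap′ = ℤ.<-irrefl refl (ℤ.≤-<-trans (subst (_≤ B - D₁ + D₀) (trans (sym (A≡A₁ χ x nx)) (Aχ x x∈))
              (ℤ.+-mono-≤ (ℤ.+-mono-≤ le (ℤ.≤-reflexive (cong -_ (trans (cong (_* D₁) (χ-self x x∈)) (ℤ.*-identityˡ D₁))))) co≤)) (0<-⇒< gap′))
            where
            dW : dim (x ⋀ H) ≡ d
            dW = ℕ.suc-injective (trans (sym (meet-H x nx)) dx)
            co≤ : co∑ (x ⋀ H) χ ≤ D₀
            co≤ = ℤ.≤-trans (∑-mono subspaces λ h _ → subst (⟦ Coatom? 0S (x ⋀ H) h ⟧ * χ h ≤_) (ℤ.*-identityʳ ⟦ Coatom? 0S (x ⋀ H) h ⟧) (⟦⟧*-mono (Coatom? 0S (x ⋀ H) h) λ _ → ⟦⟧≤1 (S.hits? h Y)))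
              (ℤ.≤-reflexive (coatoms 0S (x ⋀ H) d (0S-⊆ (x ⋀ H)) dW))

          meet-dim₁₁ : ∀ x z → InX₁ x → InX₁ z → mm x z ≡ t → dim (x ⋀ z) ≡ suc t
          meet-dim₁₁ x z (dx , nx) (dz , nz) e = trans (sym (ℕ.m+[n∸m]≡n (meet₁₁>0 x z dx dz))) (cong suc (trans (sym (mm₁₁ x z nx nz)) e))

          meet-dim₁₂ : ∀ x z → InX₁ x → InX₂ z → mm x z ≡ t → dim (x ⋀ z) ≡ t
          meet-dim₁₂ x z (dx , nx) (dz , pz) e = trans (sym (mm₁₂ x z nx pz)) e

          any₁ : ∀ x h → InX₁ x → Coatom 0S x h → up∑ h χ ≤ D₁
          any₁ x h (dx , _) (_ , dh) = sum-bound (Up? h) h 1S (suc d) (⊆-1S h) (ℕ.≤-reflexive (trans dim-1S (trans (le d) (cong (ℕ._+ suc d) (sym (ℕ.suc-injective (trans dh dx))))))) (λ { z (b , _) _ → b })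
            where
            le : ∀ d → suc (2 ℕ.* d) ≡ d ℕ.+ suc d
            le = solveℕ

          up-blocked : ∀ x h z z₀ → InX₁ x → Coatom 0S x h → z₀ ∈ Y → mm x z₀ ≡ t → ¬ ((x ⋀ z₀) ⊆S h) → Up h z → S.Hits z Y → z ⊆S (h ⋁ z₀)
          up-blocked x h z z₀ (dx , nx) ((_ , h⊆x) , dh) z₀∈ m₀ R⊈h (((h⊆z , _) , dz) , nz) hz =
            blocked x h z z₀ z₀∈ m₀ (trans (σ₁ x nx) (sym (σ₁ z nz))) h⊆x dh h⊆z (trans dz (ℕ.+-comm (dim h) 1)) hz R⊈h

          -- By `blocked` the members of Y above h lie in h ⋁ z₀. As h meets z₀ in one dimension
          -- less than x does, that join has dimension u above h.
          near₁ : ∀ x h z₀ u → InX₁ x → Coatom 0S x h → z₀ ∈ Y → mm x z₀ ≡ t → ¬ ((x ⋀ z₀) ⊆S h) → suc (dim z₀) ≡ dim (x ⋀ z₀) ℕ.+ u → up∑ h χ ≤ [ u ]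
          near₁ x h z₀ u px c@((_ , h⊆x) , dh) z₀∈ m₀ R⊈h dz₀ = sum-bound (Up? h) h (h ⋁ z₀) u (⋁-upperˡ h z₀)
            (ℕ.≤-reflexive (join-dim h z₀ u (ℕ.suc-injective (trans dz₀ (cong (ℕ._+ u) (sym (coatom-⊉ x h z₀ h⊆x dh R⊈h)))))))
            (λ { z uz@(((h⊆z , _) , dz) , _) hz → (h⊆z , up-blocked x h z z₀ px c z₀∈ m₀ R⊈h uz hz) , dz })

          dim₁₁ : ∀ x z → InX₁ x → InX₁ z → mm x z ≡ t → suc (dim z) ≡ dim (x ⋀ z) ℕ.+ suc r
          dim₁₁ x z px pz e = trans (cong suc (trans (proj₁ pz) (cong suc (sym t+r)))) (trans (cong suc (sym (ℕ.+-suc t r))) (cong (ℕ._+ suc r) (sym (meet-dim₁₁ x z px pz e))))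

          dim₁₂ : ∀ x z → InX₁ x → InX₂ z → mm x z ≡ t → suc (dim z) ≡ dim (x ⋀ z) ℕ.+ r
          dim₁₂ x z px pz e = trans (cong suc (proj₁ pz)) (trans suc-pred-d (trans (sym t+r) (cong (ℕ._+ r) (sym (meet-dim₁₂ x z px pz e)))))

          dim-x₁ : ∀ x z → InX₁ x → InX₁ z → mm x z ≡ t → dim x ≡ dim (x ⋀ z) ℕ.+ r
          dim-x₁ x z px pz e = trans (proj₁ px) (trans (cong suc (sym t+r)) (cong (ℕ._+ r) (sym (meet-dim₁₁ x z px pz e))))

          dim-x₂ : ∀ x z → InX₁ x → InX₂ z → mm x z ≡ t → dim x ≡ dim (x ⋀ z) ℕ.+ suc r
          dim-x₂ x z px pz e = trans (proj₁ px) (trans (cong suc (sym t+r)) (trans (sym (ℕ.+-suc t r)) (cong (ℕ._+ suc r) (sym (meet-dim₁₂ x z px pz e)))))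

          join-dim₁₁ : ∀ x z → InX₁ x → InX₁ z → mm x z ≡ t → dim (x ⋁ z) ≡ d ℕ.+ suc r
          join-dim₁₁ x z px pz e = trans (join-dim x z r (trans (proj₁ pz) (trans (sym (proj₁ px)) (dim-x₁ x z px pz e)))) (trans (cong (ℕ._+ r) (proj₁ px)) (sym (ℕ.+-suc d r)))

          join-larger : ∀ (R₁ R₂ : Sub) → dim R₁ ≡ dim R₂ → ¬ (R₁ ≈S R₂) → suc (dim R₁) ℕ.≤ dim (R₁ ⋁ R₂)
          join-larger R₁ R₂ e ne with dim (R₁ ⋁ R₂) ℕ.≤? dim R₁
          ... | no nle = ℕ.≰⇒> nle
          ... | yes le = contradiction (⊆-dim⇒⊇ {x = R₂} {R₁} R₂⊆R₁ (ℕ.≤-reflexive e) , R₂⊆R₁) ne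
            where
            R₂⊆R₁ : R₂ ⊆S R₁
            R₂⊆R₁ v v∈ = ⊆-dim⇒⊇ {x = R₁} {R₁ ⋁ R₂} (⋁-upperˡ R₁ R₂) le v (⋁-upperʳ R₁ R₂ v v∈)

          ⊈-⋁ : ∀ (R₁ R₂ h : Sub) → ¬ ((R₁ ⋁ R₂) ⊆S h) → ¬ (R₁ ⊆S h) ⊎ ¬ (R₂ ⊆S h)
          ⊈-⋁ R₁ R₂ h n with R₁ ⊆? h
          ... | no n₁  = inj₁ n₁
          ... | yes p₁ = inj₂ λ p₂ → n (⋁-least {x = R₁} {R₂} h p₁ p₂)

          -- Two far members seen from a vertex of X₁.

          module _ (x : Sub) (x∈ : x ∈ Y) (px : InX₁ x) (z₁ z₂ : Sub) (z₁∈ : z₁ ∈ Y) (z₂∈ : z₂ ∈ Y) (m₁ : mm x z₁ ≡ t) (m₂ : mm x z₂ ≡ t) where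

            R₁ R₂ : Sub
            R₁ = x ⋀ z₁
            R₂ = x ⋀ z₂

            -- If the joins differ, they meet in dimension at most d + r. A hyperplane of x
            -- containing neither R₁ nor R₂ is restricted by both joins and leaves at most [r]
            -- members of Y; one containing R₂ only leaves [r + 1]; for the [r] hyperplanes above R₁
            -- the trivial [d + 1] is used. The total contradicts `Aχ`.
            same-join : InX₁ z₁ → InX₁ z₂ → (x ⋁ z₁) ≈S (x ⋁ z₂)
            same-join p₁ p₂ with (x ⋁ z₁) ≈? (x ⋁ z₂)
            ... | yes e = e
            ... | no ne = ⊥-elim (too-small₁ x x∈ px (D₁ * R[] + R[] * (D₁ - R[]) + R[] * (r₁ - R[])) (subst (λ w → co-up∑ x χ ≤ [ w ] * R[] + R[] * (D₁ - R[]) + R[] * (r₁ - R[])) (proj₁ px)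
                (co-bound x (λ h → up∑ h χ) R₁ R₂ r r R[] (D₁ - R[]) (r₁ - R[]) (⋀-lowerˡ x z₁) (dim-x₁ x z₁ px p₁ m₁) (⋀-lowerˡ x z₂) (dim-x₁ x z₂ px p₂ m₂) local))
                (subst (0ℤ <_) (sym (l p R[] D₀ D₁ r₁ ([suc] d) ([suc] r))) (excess>0 {(p - 1ℤ) * R[] * (D₁ - R[])} {R[]} {p * D₀} (nonneg*nonneg (nonneg*nonneg (0≤- 1≤p) ([]≥0 r)) (0≤- R≤D₁)) (ℤ.≤-trans R≤r₁ (ℤ.≤-trans r₁≤D₀ D₀≤pD₀)))))
              where
              S₁ S₂ : Sub
              S₁ = x ⋁ z₁
              S₂ = x ⋁ z₂
              l : ∀ p R D₀ D₁ r₁ → D₁ ≡ 1ℤ + (1ℤ + p) * D₀ → r₁ ≡ 1ℤ + (1ℤ + p) * R →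
                (1ℤ + p) * R * D₁ - (D₁ * R + R * (D₁ - R) + R * (r₁ - R) - D₁ + D₀) ≡ (p - 1ℤ) * R * (D₁ - R) + (p * D₀ - R) + 1ℤ
              l p R D₀ _ _ refl refl = l′ p R D₀
                where
                l′ : ∀ p R D₀ → (1ℤ + p) * R * (1ℤ + (1ℤ + p) * D₀) - ((1ℤ + (1ℤ + p) * D₀) * R + R * ((1ℤ + (1ℤ + p) * D₀) - R) + R * ((1ℤ + (1ℤ + p) * R) - R) - (1ℤ + (1ℤ + p) * D₀) + D₀) ≡ (p - 1ℤ) * R * ((1ℤ + (1ℤ + p) * D₀) - R) + (p * D₀ - R) + 1ℤ
                l′ = solve-∀
              meet≤ : dim (S₁ ⋀ S₂) ℕ.≤ d ℕ.+ r
              meet≤ with dim S₁ ℕ.≤? dim (S₁ ⋀ S₂)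
              ... | no nle = ℕ.≤-pred (subst (dim (S₁ ⋀ S₂) ℕ.<_) (trans (join-dim₁₁ x z₁ px p₁ m₁) (ℕ.+-suc d r)) (ℕ.≰⇒> nle))
              ... | yes le = contradiction (S₁⊆S₂ , ⊆-dim⇒⊇ {x = S₁} {S₂} S₁⊆S₂ (ℕ.≤-reflexive (trans (join-dim₁₁ x z₂ px p₂ m₂) (sym (join-dim₁₁ x z₁ px p₁ m₁))))) ne
                where
                S₁⊆S₂ : S₁ ⊆S S₂
                S₁⊆S₂ v v∈ = ⋀-lowerʳ S₁ S₂ v (⊆-dim⇒⊇ {x = S₁ ⋀ S₂} {S₁} (⋀-lowerˡ S₁ S₂) le v v∈)
              both : ∀ h → Coatom 0S x h → ¬ (R₁ ⊆S h) → ¬ (R₂ ⊆S h) → up∑ h χ ≤ R[]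
              both h c@((_ , h⊆x) , dh) n₁ n₂ = sum-bound (Up? h) h (S₁ ⋀ S₂) r
                (⋀-greatest {x = S₁} {S₂} h (λ v v∈ → ⋁-upperˡ x z₁ v (h⊆x v v∈)) (λ v v∈ → ⋁-upperˡ x z₂ v (h⊆x v v∈)))
                (subst (λ w → dim (S₁ ⋀ S₂) ℕ.≤ w ℕ.+ r) (sym (ℕ.suc-injective (trans dh (proj₁ px)))) meet≤)
                (λ { z uz@(((h⊆z , _) , dz) , _) hz → (h⊆z , ⋀-greatest {x = S₁} {S₂} z
                  (λ v v∈ → ⋁-least {x = h} {z₁} S₁ (λ w w∈ → ⋁-upperˡ x z₁ w (h⊆x w w∈)) (⋁-upperʳ x z₁) v (up-blocked x h z z₁ px c z₁∈ m₁ n₁ uz hz v v∈))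
                  (λ v v∈ → ⋁-least {x = h} {z₂} S₂ (λ w w∈ → ⋁-upperˡ x z₂ w (h⊆x w w∈)) (⋁-upperʳ x z₂) v (up-blocked x h z z₂ px c z₂∈ m₂ n₂ uz hz v v∈))) , dz })
              local : ∀ h → Coatom 0S x h → up∑ h χ ≤ R[] + ⟦ R₁ ⊆? h ⟧ * (D₁ - R[]) + ⟦ R₂ ⊆? h ⟧ * (r₁ - R[])
              local h c with R₁ ⊆? h | R₂ ⊆? h
              ... | yes _ | yes _ = ℤ.≤-trans (any₁ x h px c) (subst₂ _≤_ (ℤ.+-identityʳ D₁) (l₁ R[] D₁ (r₁ - R[])) (ℤ.+-monoʳ-≤ D₁ (0≤- R≤r₁)))
                where
                l₁ : ∀ a b e → b + e ≡ a + 1ℤ * (b - a) + 1ℤ * e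
                l₁ = solve-∀
              ... | yes _ | no _  = ℤ.≤-trans (any₁ x h px c) (ℤ.≤-reflexive (l₁ R[] D₁ (r₁ - R[])))
                where
                l₁ : ∀ a b e → b ≡ a + 1ℤ * (b - a) + 0ℤ * e
                l₁ = solve-∀
              ... | no n₁ | yes _ = ℤ.≤-trans (near₁ x h z₁ (suc r) px c z₁∈ m₁ n₁ (dim₁₁ x z₁ px p₁ m₁)) (ℤ.≤-reflexive (l₁ R[] (D₁ - R[]) r₁))
                where
                l₁ : ∀ a e b → b ≡ a + 0ℤ * e + 1ℤ * (b - a)
                l₁ = solve-∀
              ... | no n₁ | no n₂ = ℤ.≤-trans (both h c n₁ n₂) (ℤ.≤-reflexive (l₁ R[] (D₁ - R[]) (r₁ - R[])))
                where
                l₁ : ∀ a e b → a ≡ a + 0ℤ * e + 0ℤ * b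
                l₁ = solve-∀

            -- A far member of X₂ restricts more strongly: hyperplanes of x not above R₂ leave at
            -- most [r] members of Y. Those above R₂ but not above R₁ leave [r + 1], and only those
            -- above both can leave [d + 1]. The surcharges `D₁ - r₁` and `r₁ - R[]` bound this
            -- table from above.
            not-mixed : InX₁ z₁ → InX₂ z₂ → ⊥
            not-mixed p₁ p₂ = too-small₁ x x∈ px (D₁ * R[] + R[] * (D₁ - r₁) + r₁ * (r₁ - R[])) (subst (λ w → co-up∑ x χ ≤ [ w ] * R[] + R[] * (D₁ - r₁) + r₁ * (r₁ - R[])) (proj₁ px)
                (co-bound x (λ h → up∑ h χ) R₁ R₂ r (suc r) R[] (D₁ - r₁) (r₁ - R[]) (⋀-lowerˡ x z₁) (dim-x₁ x z₁ px p₁ m₁) (⋀-lowerˡ x z₂) (dim-x₂ x z₂ px p₂ m₂) local))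
                (subst (0ℤ <_) (sym (l p R[] D₀ D₁ r₁ ([suc] d) ([suc] r))) (excess>0 {(p - 1ℤ) * R[] * (D₁ - r₁)} {r₁} {p * D₀} (nonneg*nonneg (nonneg*nonneg (0≤- 1≤p) ([]≥0 r)) (0≤- r₁≤D₁)) (ℤ.≤-trans r₁≤D₀ D₀≤pD₀)))
              where
              l : ∀ p R D₀ D₁ r₁ → D₁ ≡ 1ℤ + (1ℤ + p) * D₀ → r₁ ≡ 1ℤ + (1ℤ + p) * R →
                (1ℤ + p) * R * D₁ - (D₁ * R + R * (D₁ - r₁) + r₁ * (r₁ - R) - D₁ + D₀) ≡ (p - 1ℤ) * R * (D₁ - r₁) + (p * D₀ - r₁) + 1ℤ
              l p R D₀ _ _ refl refl = l′ p R D₀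
                where
                l′ : ∀ p R D₀ → (1ℤ + p) * R * (1ℤ + (1ℤ + p) * D₀) - ((1ℤ + (1ℤ + p) * D₀) * R + R * ((1ℤ + (1ℤ + p) * D₀) - (1ℤ + (1ℤ + p) * R)) + (1ℤ + (1ℤ + p) * R) * ((1ℤ + (1ℤ + p) * R) - R) - (1ℤ + (1ℤ + p) * D₀) + D₀) ≡ (p - 1ℤ) * R * ((1ℤ + (1ℤ + p) * D₀) - (1ℤ + (1ℤ + p) * R)) + (p * D₀ - (1ℤ + (1ℤ + p) * R)) + 1ℤ
                l′ = solve-∀
              local : ∀ h → Coatom 0S x h → up∑ h χ ≤ R[] + ⟦ R₁ ⊆? h ⟧ * (D₁ - r₁) + ⟦ R₂ ⊆? h ⟧ * (r₁ - R[])
              local h c with R₁ ⊆? h | R₂ ⊆? h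
              ... | yes _ | yes _ = ℤ.≤-trans (any₁ x h px c) (ℤ.≤-reflexive (l₁ R[] D₁ r₁))
                where
                l₁ : ∀ a b e → b ≡ a + 1ℤ * (b - e) + 1ℤ * (e - a)
                l₁ = solve-∀
              ... | yes _ | no n₂ = ℤ.≤-trans (near₁ x h z₂ r px c z₂∈ m₂ n₂ (dim₁₂ x z₂ px p₂ m₂)) (subst₂ _≤_ (ℤ.+-identityʳ R[]) (l₁ R[] (D₁ - r₁) (r₁ - R[])) (ℤ.+-monoʳ-≤ R[] (0≤- r₁≤D₁)))
                where
                l₁ : ∀ a b e → a + b ≡ a + 1ℤ * b + 0ℤ * e
                l₁ = solve-∀
              ... | no n₁ | yes _ = ℤ.≤-trans (near₁ x h z₁ (suc r) px c z₁∈ m₁ n₁ (dim₁₁ x z₁ px p₁ m₁)) (ℤ.≤-reflexive (l₁ R[] (D₁ - r₁) r₁))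
                where
                l₁ : ∀ a e b → b ≡ a + 0ℤ * e + 1ℤ * (b - a)
                l₁ = solve-∀
              ... | no _  | no n₂ = ℤ.≤-trans (near₁ x h z₂ r px c z₂∈ m₂ n₂ (dim₁₂ x z₂ px p₂ m₂)) (ℤ.≤-reflexive (l₁ R[] (D₁ - r₁) (r₁ - R[])))
                where
                l₁ : ∀ a e b → a ≡ a + 0ℤ * e + 0ℤ * b
                l₁ = solve-∀

            -- Different meets of dimension t span J of dimension at least t + 1, so at most [r]
            -- hyperplanes of x contain J. Any other one misses R₁ or R₂ and leaves at most [r]
            -- members of Y, too few in total.
            same-meet₁ : InX₂ z₁ → InX₂ z₂ → R₁ ≈S R₂
            same-meet₁ p₁ p₂ with R₁ ≈? R₂
            ... | yes e = e
            ... | no ne = ⊥-elim (too-small₁ x x∈ px (D₁ * R[] + R[] * (D₁ - R[])) (ℤ.≤-trans (co-bound x (λ h → up∑ h χ) J J u u R[] (D₁ - R[]) 0ℤ J⊆ dJ J⊆ dJ local)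
                (subst (λ w → [ dim x ] * R[] + [ u ] * (D₁ - R[]) + [ u ] * 0ℤ ≤ [ w ] * R[] + R[] * (D₁ - R[])) (proj₁ px) (subst (_≤ [ dim x ] * R[] + R[] * (D₁ - R[])) (l₀ ([ dim x ] * R[]) ([ u ]) (D₁ - R[])) (ℤ.+-monoʳ-≤ ([ dim x ] * R[])
                  (subst₂ _≤_ (ℤ.*-comm (D₁ - R[]) [ u ]) (ℤ.*-comm (D₁ - R[]) R[]) (scale-≤ (D₁ - R[]) (0≤- R≤D₁) ([]-mono-≤ u≤r)))))))
                (subst (0ℤ <_) (sym (l p R[] D₀ D₁ ([suc] d))) (excess>0 {(p - 1ℤ) * R[] * D₁ + R[] * R[]} {0ℤ} {p * D₀} (ℤ.+-mono-≤ {0ℤ} {(p - 1ℤ) * R[] * D₁} {0ℤ} (nonneg*nonneg (nonneg*nonneg (0≤- 1≤p) ([]≥0 r)) ([]≥0 (suc d))) (nonneg*nonneg ([]≥0 r) ([]≥0 r))) (ℤ.≤-trans ([]≥0 d) D₀≤pD₀))))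
              where
              J : Sub
              J = R₁ ⋁ R₂
              J⊆ : J ⊆S x
              J⊆ = ⋁-least {x = R₁} {R₂} x (⋀-lowerˡ x z₁) (⋀-lowerˡ x z₂)
              u : ℕ
              u = dim x ∸ dim J
              dJ : dim x ≡ dim J ℕ.+ u
              dJ = sym (ℕ.m+[n∸m]≡n (dim-mono {x = J} {x} J⊆))
              larger : suc t ℕ.≤ dim J
              larger = subst (λ w → suc w ℕ.≤ dim J) (meet-dim₁₂ x z₁ px p₁ m₁) (join-larger R₁ R₂ (trans (meet-dim₁₂ x z₁ px p₁ m₁) (sym (meet-dim₁₂ x z₂ px p₂ m₂))) ne)
              u≤r : u ℕ.≤ r
              u≤r = subst (u ℕ.≤_) (trans (cong (_∸ suc t) (trans (proj₁ px) (cong suc (sym t+r)))) (ℕ.m+n∸m≡n t r)) (ℕ.∸-monoʳ-≤ (dim x) larger)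
              l₀ : ∀ a b e → a + b * e ≡ a + b * e + b * 0ℤ
              l₀ = solve-∀
              l : ∀ p R D₀ D₁ → D₁ ≡ 1ℤ + (1ℤ + p) * D₀ →
                (1ℤ + p) * R * D₁ - (D₁ * R + R * (D₁ - R) - D₁ + D₀) ≡ (p - 1ℤ) * R * D₁ + R * R + (p * D₀ - 0ℤ) + 1ℤ
              l p R D₀ _ refl = l′ p R D₀
                where
                l′ : ∀ p R D₀ → (1ℤ + p) * R * (1ℤ + (1ℤ + p) * D₀) - ((1ℤ + (1ℤ + p) * D₀) * R + R * ((1ℤ + (1ℤ + p) * D₀) - R) - (1ℤ + (1ℤ + p) * D₀) + D₀) ≡ (p - 1ℤ) * R * (1ℤ + (1ℤ + p) * D₀) + R * R + (p * D₀ - 0ℤ) + 1ℤ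
                l′ = solve-∀
              near : ∀ h → Coatom 0S x h → ¬ (R₁ ⊆S h) ⊎ ¬ (R₂ ⊆S h) → up∑ h χ ≤ R[]
              near h c (inj₁ n₁) = near₁ x h z₁ r px c z₁∈ m₁ n₁ (dim₁₂ x z₁ px p₁ m₁)
              near h c (inj₂ n₂) = near₁ x h z₂ r px c z₂∈ m₂ n₂ (dim₁₂ x z₂ px p₂ m₂)
              local : ∀ h → Coatom 0S x h → up∑ h χ ≤ R[] + ⟦ J ⊆? h ⟧ * (D₁ - R[]) + ⟦ J ⊆? h ⟧ * 0ℤ
              local h c with J ⊆? h
              ... | yes _ = ℤ.≤-trans (any₁ x h px c) (ℤ.≤-reflexive (l₁ R[] D₁))
                where
                l₁ : ∀ a b → b ≡ a + 1ℤ * (b - a) + 1ℤ * 0ℤ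
                l₁ = solve-∀
              ... | no n = ℤ.≤-trans (near h c (⊈-⋁ R₁ R₂ h n)) (ℤ.≤-reflexive (l₁ R[] (D₁ - R[])))
                where
                l₁ : ∀ a e → a ≡ a + 0ℤ * e + 0ℤ * 0ℤ
                l₁ = solve-∀

          -- Families inside H.

          module InsideH (all₂ : ∀ y → y ∈ Y → InX₂ y) where

            Dm D₂ R′ : ℤ
            Dm = [ d ∸ 1 ]
            D₂ = [ suc (suc d) ]
            R′ = [ r′ ]

            hit-⊆H : ∀ z → S.Hits z Y → z ⊆S H
            hit-⊆H z h v v∈ with member {z} Y h
            ... | y , y∈ , e = proj₂ (all₂ y y∈) v (proj₁ e v v∈)

            -- With Y inside H no neighbour comes from X₁, so the number of neighbours is
            -- `co-in∑ x χ` less the Dm = [d - 1] walks that return to x.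
            too-small₂ : ∀ x → x ∈ Y → ∀ B → co-in∑ x χ ≤ B → 0ℤ < (1ℤ + p) * R[] * D₁ - (B - Dm) → ⊥
            too-small₂ x x∈ B le gap′ = ℤ.<-irrefl refl (ℤ.≤-<-trans (subst (_≤ B - Dm) (trans value (Aχ x x∈)) (ℤ.+-monoˡ-≤ (- Dm) le)) (0<-⇒< gap′))
              where
              outside-0 : in-up∑ x χ ≡ 0ℤ
              outside-0 = trans (∑-cong subspaces λ w → trans (cong (⟦ Between? x H 1 w ⟧ *_)
                  (trans (∑-cong subspaces λ z → trans (⟦⟧*-cong (Up? w z) {b = 0ℤ} λ { (_ , nz) → ⟦⟧-no (S.hits? z Y) λ h → nz (hit-⊆H z h) }) (ℤ.*-zeroʳ ⟦ Up? w z ⟧)) (∑-0 subspaces)))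
                  (ℤ.*-zeroʳ ⟦ Between? x H 1 w ⟧)) (∑-0 subspaces)
              value : co-in∑ x χ - Dm ≡ A χ x
              value = sym (trans (A≡A₂ χ x (proj₂ (all₂ x x∈))) (trans (cong₂ (λ a b → co-in∑ x χ - a * Dm + b) (χ-self x x∈) outside-0) (l (co-in∑ x χ) Dm)))
                where
                l : ∀ a b → a - 1ℤ * b + 0ℤ ≡ a - b
                l = solve-∀

            meet-dim₂₂ : ∀ x z → x ∈ Y → z ∈ Y → mm x z ≡ t → dim (x ⋀ z) ≡ t′
            meet-dim₂₂ x z x∈ z∈ e = ℕ.suc-injective (trans (sym (mm₂₂ x z (proj₂ (all₂ x x∈)) (proj₂ (all₂ z z∈)))) e)

            d≡ : d ≡ t′ ℕ.+ suc r
            d≡ = trans (sym t+r) (sym (ℕ.+-suc t′ r))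

            any₂ : ∀ x h → x ∈ Y → Coatom 0S x h → in∑ h χ ≤ D₂
            any₂ x h x∈ ((_ , h⊆x) , dh) = sum-bound (Between? h H 1) h H (suc (suc d)) (λ v v∈ → proj₂ (all₂ x x∈) v (h⊆x v v∈))
              (ℕ.≤-reflexive (trans dim-H (trans (cong (d ℕ.+_) (ℕ.+-identityʳ d)) (sym (trans (ℕ.+-suc (dim h) (suc d)) (trans (cong (ℕ._+ suc d) (trans dh (proj₁ (all₂ x x∈)))) (trans (ℕ.+-suc (d ∸ 1) d) (cong (ℕ._+ d) suc-pred-d))))))))
              (λ z b _ → b)

            near₂ : ∀ x h z₀ → x ∈ Y → Coatom 0S x h → z₀ ∈ Y → mm x z₀ ≡ t → ¬ ((x ⋀ z₀) ⊆S h) → in∑ h χ ≤ r₁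
            near₂ x h z₀ x∈ ((_ , h⊆x) , dh) z₀∈ m₀ R⊈h = sum-bound (Between? h H 1) h (h ⋁ z₀) (suc r) (⋁-upperˡ h z₀)
              (ℕ.≤-reflexive (join-dim h z₀ (suc r) (ℕ.suc-injective (trans (cong suc (proj₁ (all₂ z₀ z₀∈))) (trans suc-pred-d (trans d≡ (cong (ℕ._+ suc r) (trans (sym (meet-dim₂₂ x z₀ x∈ z₀∈ m₀)) (sym (coatom-⊉ x h z₀ h⊆x dh R⊈h))))))))))
              (λ { z ((h⊆z , z⊆H) , dz) hz → (h⊆z , blocked x h z z₀ z₀∈ m₀ (trans (σ₂ x (proj₂ (all₂ x x∈))) (sym (σ₂ z z⊆H))) h⊆x dh h⊆z (trans dz (ℕ.+-comm (dim h) 1)) hz R⊈h) , dz })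

            D₀<D₁ : D₀ < D₁
            D₀<D₁ = 0<-⇒< (subst (0ℤ <_) (sym (trans (cong (_- D₀) ([suc] d)) (l p D₀))) (q^>0 d))
              where
              l : ∀ p a → 1ℤ + (1ℤ + p) * a - a ≡ 1ℤ + p * a
              l = solve-∀

            -- Different meets span J of dimension at least t inside x of dimension d - 1 = t + r′,
            -- so at most [r′] hyperplanes contain J; the others leave [r + 1] members each. The
            -- shortfall against `Aχ` is q · q^r′ · ([d + 1] - [r] [t]), positive because [r] [t] ≤
            -- [d] < [d + 1].
            same-meet₂ : ∀ x z₁ z₂ → x ∈ Y → z₁ ∈ Y → z₂ ∈ Y → mm x z₁ ≡ t → mm x z₂ ≡ t → (x ⋀ z₁) ≈S (x ⋀ z₂)
            same-meet₂ x z₁ z₂ x∈ z₁∈ z₂∈ m₁ m₂ with (x ⋀ z₁) ≈? (x ⋀ z₂)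
            ... | yes e = e
            ... | no ne = ⊥-elim (too-small₂ x x∈ (Dm * r₁ + R′ * (D₂ - r₁)) (ℤ.≤-trans (co-bound x (λ h → in∑ h χ) J J u u r₁ (D₂ - r₁) 0ℤ J⊆ dJ J⊆ dJ local)
                (subst (λ w → [ dim x ] * r₁ + [ u ] * (D₂ - r₁) + [ u ] * 0ℤ ≤ [ w ] * r₁ + R′ * (D₂ - r₁)) dx (subst (_≤ [ dim x ] * r₁ + R′ * (D₂ - r₁)) (l₀ ([ dim x ] * r₁) [ u ] (D₂ - r₁)) (ℤ.+-monoʳ-≤ ([ dim x ] * r₁)
                  (subst₂ _≤_ (ℤ.*-comm (D₂ - r₁) [ u ]) (ℤ.*-comm (D₂ - r₁) R′) (scale-≤ (D₂ - r₁) (0≤- r₁≤D₂) ([]-mono-≤ u≤r′)))))))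
                (subst (0ℤ <_) (sym (l p R′ R[] D₁ D₂ r₁ Dm [ t ] ([suc] r′) ([suc] (suc d)) ([suc] r) [dm])) (pos*pos (pos*pos q>0 (q^>0 r′)) (<⇒0<- (ℤ.≤-<-trans (subst (λ w → R[] * [ t ] ≤ [ w ]) (trans (ℕ.+-comm r t) t+r) ([*]≤[+] r t)) D₀<D₁)))))
              where
              Q₁ Q₂ J : Sub
              Q₁ = x ⋀ z₁
              Q₂ = x ⋀ z₂
              J = Q₁ ⋁ Q₂
              dx : dim x ≡ d ∸ 1
              dx = proj₁ (all₂ x x∈)
              J⊆ : J ⊆S x
              J⊆ = ⋁-least {x = Q₁} {Q₂} x (⋀-lowerˡ x z₁) (⋀-lowerˡ x z₂)
              u : ℕ
              u = dim x ∸ dim J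
              dJ : dim x ≡ dim J ℕ.+ u
              dJ = sym (ℕ.m+[n∸m]≡n (dim-mono {x = J} {x} J⊆))
              larger : t ℕ.≤ dim J
              larger = subst (λ w → suc w ℕ.≤ dim J) (meet-dim₂₂ x z₁ x∈ z₁∈ m₁) (join-larger Q₁ Q₂ (trans (meet-dim₂₂ x z₁ x∈ z₁∈ m₁) (sym (meet-dim₂₂ x z₂ x∈ z₂∈ m₂))) ne)
              d-1≡ : d ∸ 1 ≡ t ℕ.+ r′
              d-1≡ = ℕ.suc-injective (trans suc-pred-d (trans (sym t+r) (ℕ.+-suc t r′)))
              u≤r′ : u ℕ.≤ r′
              u≤r′ = subst (u ℕ.≤_) (trans (cong (_∸ t) (trans dx d-1≡)) (ℕ.m+n∸m≡n t r′)) (ℕ.∸-monoʳ-≤ (dim x) larger)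
              [dm] : Dm ≡ R′ + (1ℤ + p * R′) * [ t ]
              [dm] = trans (cong [_] (trans d-1≡ (ℕ.+-comm t r′))) ([+] r′ t)
              r₁≤D₂ : r₁ ≤ D₂
              r₁≤D₂ = ℤ.≤-trans r₁≤D₁ ([]-mono-≤ (ℕ.n≤1+n (suc d)))
              q>0 : 0ℤ < 1ℤ + p
              q>0 = ℤ.+-mono-< {0ℤ} {1ℤ} {0ℤ} (+<+ (s≤s z≤n)) p>0
              l₀ : ∀ a b e → a + b * e ≡ a + b * e + b * 0ℤ
              l₀ = solve-∀
              l : ∀ p R′ R D₁ D₂ r₁ Dm T → R ≡ 1ℤ + (1ℤ + p) * R′ → D₂ ≡ 1ℤ + (1ℤ + p) * D₁ → r₁ ≡ 1ℤ + (1ℤ + p) * R → Dm ≡ R′ + (1ℤ + p * R′) * T →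
                (1ℤ + p) * R * D₁ - (Dm * r₁ + R′ * (D₂ - r₁) - Dm) ≡ (1ℤ + p) * (1ℤ + p * R′) * (D₁ - R * T)
              l p R′ _ D₁ _ _ _ T refl refl refl refl = l′ p R′ D₁ T
                where
                l′ : ∀ p R′ D₁ T → let R = 1ℤ + (1ℤ + p) * R′ ; D₂ = 1ℤ + (1ℤ + p) * D₁ ; r₁ = 1ℤ + (1ℤ + p) * (1ℤ + (1ℤ + p) * R′) ; Dm = R′ + (1ℤ + p * R′) * T in
                  (1ℤ + p) * R * D₁ - (Dm * r₁ + R′ * (D₂ - r₁) - Dm) ≡ (1ℤ + p) * (1ℤ + p * R′) * (D₁ - R * T)
                l′ = solve-∀
              near : ∀ h → Coatom 0S x h → ¬ (Q₁ ⊆S h) ⊎ ¬ (Q₂ ⊆S h) → in∑ h χ ≤ r₁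
              near h c (inj₁ n₁) = near₂ x h z₁ x∈ c z₁∈ m₁ n₁
              near h c (inj₂ n₂) = near₂ x h z₂ x∈ c z₂∈ m₂ n₂
              local : ∀ h → Coatom 0S x h → in∑ h χ ≤ r₁ + ⟦ J ⊆? h ⟧ * (D₂ - r₁) + ⟦ J ⊆? h ⟧ * 0ℤ
              local h c with J ⊆? h
              ... | yes _ = ℤ.≤-trans (any₂ x h x∈ c) (ℤ.≤-reflexive (l₁ r₁ D₂))
                where
                l₁ : ∀ a b → b ≡ a + 1ℤ * (b - a) + 1ℤ * 0ℤ
                l₁ = solve-∀
              ... | no n = ℤ.≤-trans (near h c (⊈-⋁ Q₁ Q₂ h n)) (ℤ.≤-reflexive (l₁ r₁ (D₂ - r₁)))
                where
                l₁ : ∀ a e → a ≡ a + 0ℤ * e + 0ℤ * 0ℤ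
                l₁ = solve-∀

          -- No member of the family lies outside H.

          2d≡t : dim H ≡ t ℕ.+ (d ℕ.+ r)
          2d≡t = trans dim-H (trans (cong (λ w → w ℕ.+ (d ℕ.+ 0)) (sym t+r)) (le t r d))
            where
            le : ∀ t r d → t ℕ.+ r ℕ.+ (d ℕ.+ 0) ≡ t ℕ.+ (d ℕ.+ r)
            le = solveℕ

          -- `not-mixed` puts every far member into X₂, and `same-meet₁` makes it contain R, of
          -- dimension t. There are at most `g r′ (d + r)` such spaces, which is at most half of M
          -- by the Pascal rule, while `many-far` asks for more than half.
          few-far : ∀ x z → x ∈ Y → z ∈ Y → InX₁ x → InX₂ z → mm x z ≡ t → ⊥
          few-far x z x∈ z∈ px pz mz = ℤ.<-irrefl refl (ℤ.<-≤-trans (many-far x x∈) (ℤ.≤-trans (ℤ.+-mono-≤ far≤ far≤) double))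
            where
            Z : List Sub
            Z = filter (λ y → mm x y ℕ.≟ t) Y
            R : Sub
            R = x ⋀ z
            dR : dim R ≡ t
            dR = meet-dim₁₂ x z px pz mz
            n : ℕ
            n = d ℕ.+ r
            type₂ : ∀ y → y ∈ Y → mm x y ≡ t → InX₂ y
            type₂ y y∈ my with Y-X y y∈
            ... | inj₂ py = py
            ... | inj₁ py = ⊥-elim (not-mixed x x∈ px y z y∈ z∈ my mz py pz)
            in-star : ∀ y → y ∈ Y → mm x y ≡ t → Between R H r′ y
            in-star y y∈ my = ((λ v v∈ → ⋀-lowerʳ x y v (proj₁ (same-meet₁ x x∈ px z y z∈ y∈ mz my pz (type₂ y y∈ my)) v v∈)) , proj₂ (type₂ y y∈ my)) ,
              trans (proj₁ (type₂ y y∈ my)) (trans (ℕ.suc-injective (trans suc-pred-d (trans (sym t+r) (ℕ.+-suc t r′)))) (cong (ℕ._+ r′) (sym dR)))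
            far≤ : far x ≤ g r′ n
            far≤ = subst₂ _≤_ (sym (∑-filter (λ y → mm x y ℕ.≟ t) Y)) (count r′ R H n (λ v v∈ → proj₂ pz v (⋀-lowerʳ x z v v∈)) (trans 2d≡t (cong (ℕ._+ n) (sym dR))))
              (S.length≤∑ (Between? R H r′) Z subspaces (AllPairs.filter⁺ (λ y → mm x y ℕ.≟ t) Y-unique) subspaces-unique (λ {a} {b} → Between-resp {R} {H} {r′} {a} {b})
                (λ y y∈Z → subspaces-complete y , in-star y (proj₁ (∈-filter⁻ (λ y → mm x y ℕ.≟ t) {xs = Y} y∈Z)) (proj₂ (∈-filter⁻ (λ y → mm x y ℕ.≟ t) {xs = Y} y∈Z))))
            shifted : R[] * g r n ≡ D₁ * g r′ n
            shifted = subst (λ w → R[] * g r w ≡ D₁ * g r′ w) (trans (ℕ.+-suc r′ d) (ℕ.+-comm r d)) (shift r′ (suc d))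
            smaller : g r′ n ≤ g r n
            smaller = cancel-≤ R[] ([]>0 r′) (subst (R[] * g r′ n ≤_) (sym shifted) (subst₂ _≤_ (ℤ.*-comm (g r′ n) R[]) (ℤ.*-comm (g r′ n) D₁) (scale-≤ (g r′ n) (g≥0 r′ n) R≤D₁)))
            double : g r′ n + g r′ n ≤ M
            double = subst (g r′ n + g r′ n ≤_) (sym (pascal r′ n)) (ℤ.+-monoʳ-≤ (g r′ n) (ℤ.≤-trans smaller
              (subst₂ _≤_ (ℤ.*-identityʳ (g r n)) (ℤ.*-comm (g r n) (q^ r)) (scale-≤ (g r n) (g≥0 r n) (ℤ.i<j⇒suc[i]≤j (q^>0 r))))))

          -- All of Y lies in K = x + z and outside H. The (d + 1)-spaces in K number exactly M by
          -- the symmetry of Gaussian binomials, but those in K ∩ H have to be discarded, and they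
          -- exist since dim (K ∩ H) = d + 1 + r′. So Y has fewer than M members.
          not-dual-star : ∀ x z → x ∈ Y → z ∈ Y → InX₁ x → InX₁ z → mm x z ≡ t → ⊥
          not-dual-star x z x∈ z∈ px pz mz = ℤ.<-irrefl refl (ℤ.≤-<-trans (subst₂ _≤_ ℓ≡M total (S.length≤∑ Q? Y subspaces Y-unique subspaces-unique (λ {a} {b} → resp {a} {b}) (λ y y∈ → subspaces-complete y , inK y y∈)))
              (0<-⇒< (subst (0ℤ <_) (sym (l M (g (suc d) (suc d ℕ.+ r′)))) (g>0 (suc d) r′))))
            where
            K : Sub
            K = x ⋁ z
            Q : Sub → Set
            Q y = Between 0S K (suc d) y × ¬ (y ⊆S H)
            Q? : ∀ y → Dec (Q y)
            Q? y = Between? 0S K (suc d) y ×-dec ¬? (y ⊆? H)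
            l : ∀ a b → a - (a - b) ≡ b
            l = solve-∀
            resp : ∀ {a b} → a ≈S b → Q a → Q b
            resp {a} {b} (a⊆b , b⊆a) (((_ , a⊆K) , da) , na) = ((0S-⊆ b , λ v v∈ → a⊆K v (b⊆a v v∈)) , trans (sym (dim-≈ {x = a} {b} (a⊆b , b⊆a))) da) , λ b⊆H → na λ v v∈ → b⊆H v (a⊆b v v∈)
            inK : ∀ y → y ∈ Y → Q y
            -- A member w far from both x and y carries the join along: x + z = x + w seen from x,
            -- and w + x = w + y seen from w.
            inK y y∈ with far-common x y x∈ y∈
            ... | w , w∈ , mxw , myw = go (Y-X w w∈)
              where
              go : InX w → Q y
              go (inj₂ pw) = ⊥-elim (not-mixed x x∈ px z w z∈ w∈ mz mxw pz pw)
              go (inj₁ pw) = go′ (Y-X y y∈)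
                where
                mwx : mm w x ≡ t
                mwx = trans (mm-sym w x) mxw
                mwy : mm w y ≡ t
                mwy = trans (mm-sym w y) myw
                go′ : InX y → Q y
                go′ (inj₂ py) = ⊥-elim (not-mixed w w∈ pw x y x∈ y∈ mwx mwy px py)
                go′ (inj₁ (dy , ny)) = ((0S-⊆ y , λ v v∈ → proj₂ (same-join x x∈ px z w z∈ w∈ mz mxw pz pw) v
                  (⋁-least {x = w} {x} (x ⋁ w) (⋁-upperʳ x w) (⋁-upperˡ x w) v (proj₂ (same-join w w∈ pw x y x∈ y∈ mwx mwy px (dy , ny)) v (⋁-upperʳ w y v v∈)))) , dy) , ny
            dK : dim K ≡ suc d ℕ.+ r
            dK = trans (join-dim₁₁ x z px pz mz) (ℕ.+-suc d r)
            K⊈H : ¬ (K ⊆S H)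
            K⊈H K⊆H = proj₂ px λ v v∈ → K⊆H v (⋁-upperˡ x z v v∈)
            dKH : dim (K ⋀ H) ≡ suc d ℕ.+ r′
            dKH = ℕ.suc-injective (trans (sym (meet-H K K⊈H)) (trans dK (cong suc (ℕ.+-suc d r′))))
            pointwise : ∀ y → ⟦ Q? y ⟧ ≡ ⟦ Between? 0S K (suc d) y ⟧ - ⟦ Between? 0S (K ⋀ H) (suc d) y ⟧
            pointwise y = go (Between? 0S K (suc d) y) (y ⊆? H)
              where
              go : Dec (Between 0S K (suc d) y) → Dec (y ⊆S H) → ⟦ Q? y ⟧ ≡ ⟦ Between? 0S K (suc d) y ⟧ - ⟦ Between? 0S (K ⋀ H) (suc d) y ⟧
              go (yes b@((_ , y⊆K) , dy)) (yes y⊆H) = trans (⟦⟧-no (Q? y) λ { (_ , ny) → ny y⊆H }) (sym (cong₂ _-_ (⟦⟧-yes (Between? 0S K (suc d) y) b)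
                (⟦⟧-yes (Between? 0S (K ⋀ H) (suc d) y) ((0S-⊆ y , ⋀-greatest {x = K} {H} y y⊆K y⊆H) , dy))))
              go (yes b) (no ny) = trans (⟦⟧-yes (Q? y) (b , ny)) (sym (cong₂ _-_ (⟦⟧-yes (Between? 0S K (suc d) y) b)
                (⟦⟧-no (Between? 0S (K ⋀ H) (suc d) y) λ { ((_ , y⊆KH) , _) → ny λ v v∈ → ⋀-lowerʳ K H v (y⊆KH v v∈) })))
              go (no ¬b) _ = trans (⟦⟧-no (Q? y) λ { (b , _) → ¬b b }) (sym (cong₂ _-_ (⟦⟧-no (Between? 0S K (suc d) y) ¬b)
                (⟦⟧-no (Between? 0S (K ⋀ H) (suc d) y) λ { ((_ , y⊆KH) , dy) → ¬b ((0S-⊆ y , λ v v∈ → ⋀-lowerˡ K H v (y⊆KH v v∈)) , dy) })))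
            total : ∑S (λ y → ⟦ Q? y ⟧) ≡ M - g (suc d) (suc d ℕ.+ r′)
            total = trans (∑-cong subspaces pointwise) (trans (∑-- subspaces _ _) (cong₂ _-_
              (trans (count (suc d) 0S K (suc d ℕ.+ r) (0S-⊆ K) dK) (g-sym (suc d) r)) (count (suc d) 0S (K ⋀ H) (suc d ℕ.+ r′) (0S-⊆ (K ⋀ H)) dKH)))

          all₂ : ∀ x → x ∈ Y → InX₂ x
          all₂ x x∈ with Y-X x x∈
          ... | inj₂ px = px
          ... | inj₁ px with far-common x x x∈ x∈
          ...   | z , z∈ , mz , _ with Y-X z z∈
          ...     | inj₁ pz = ⊥-elim (not-dual-star x z x∈ z∈ px pz mz)
          ...     | inj₂ pz = ⊥-elim (few-far x z x∈ z∈ px pz mz)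

        -- u is the meet of one far pair. It lies in every member of Y by transport through common
        -- far members, so Y is contained in the star of u; that star has M members, hence it is all
        -- of Y.
        structure : ∀ y₀ → y₀ ∈ Y → Σ Sub λ u → u ⊆S H × dim u ≡ t′ × (∀ x → Any (x ≈S_) Y ⇔ (InX₂ x × u ⊆S x))
        structure y₀ y₀∈ with far-common y₀ y₀ y₀∈ y₀∈
        ... | z₀ , z₀∈ , m₀ , _ = u , u⊆H , du , λ x → mk⇔ (to x) (from x)
          where
          open InsideH all₂
          u : Sub
          u = y₀ ⋀ z₀
          du : dim u ≡ t′
          du = meet-dim₂₂ y₀ z₀ y₀∈ z₀∈ m₀
          u⊆H : u ⊆S H
          u⊆H v v∈ = proj₂ (all₂ y₀ y₀∈) v (⋀-lowerˡ y₀ z₀ v v∈)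
          u⊆ : ∀ y → y ∈ Y → u ⊆S y
          -- With w far from both y₀ and y, `same-meet₂` at y₀ and then at w gives y₀ ∩ z₀ = y₀ ∩ w
          -- = w ∩ y.
          u⊆ y y∈ v v∈ with far-common y₀ y y₀∈ y∈
          ... | w , w∈ , m₁ , m₂ = ⋀-lowerʳ w y v (proj₁ (same-meet₂ w y₀ y w∈ y₀∈ y∈ (trans (mm-sym w y₀) m₁) (trans (mm-sym w y) m₂)) v
                (proj₁ (⋀-comm y₀ w) v (proj₁ (same-meet₂ y₀ z₀ w y₀∈ z₀∈ w∈ m₀ m₁) v v∈)))
          d-1 : d ∸ 1 ≡ dim u ℕ.+ r
          d-1 = trans (ℕ.suc-injective (trans suc-pred-d (sym t+r))) (cong (ℕ._+ r) (sym du))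
          size : ℓ ≡ ∑S (λ y → ⟦ Between? u H r y ⟧)
          size = trans ℓ≡M (sym (count r u H (suc (d ℕ.+ r)) u⊆H (trans 2d≡t (trans (sym (ℕ.+-suc t′ (d ℕ.+ r))) (cong (ℕ._+ suc (d ℕ.+ r)) (sym du))))))
          to : ∀ x → Any (x ≈S_) Y → InX₂ x × u ⊆S x
          to x h with member {x} Y h
          ... | y , y∈ , (x⊆y , y⊆x) = (trans (dim-≈ {x = x} {y} (x⊆y , y⊆x)) (proj₁ (all₂ y y∈)) , λ v v∈ → proj₂ (all₂ y y∈) v (x⊆y v v∈)) , λ v v∈ → y⊆x v (u⊆ y y∈ v v∈)
          from : ∀ x → InX₂ x × u ⊆S x → Any (x ≈S_) Y
          from x ((dx , x⊆H) , u⊆x) with member {x} subspaces (subspaces-complete x)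
          ... | z , z∈ , x≈z = Any.map (λ {y} z≈y → ≈-trans {x = x} {z} {y} x≈z z≈y)
                (S.length≡∑⇒hits (Between? u H r) Y subspaces Y-unique subspaces-unique (λ {a} {b} → Between-resp {u} {H} {r} {a} {b})
                  (λ y y∈ → subspaces-complete y , ((u⊆ y y∈ , proj₂ (all₂ y y∈)) , trans (proj₁ (all₂ y y∈)) d-1)) size z z∈
                  (Between-resp {u} {H} {r} {x} {z} x≈z ((u⊆x , x⊆H) , trans dx d-1)))

      star-size : ∀ u → u ⊆S H → dim u ≡ t′ → (∀ x → Any (x ≈S_) Y ⇔ (InX₂ x × u ⊆S x)) → ℓ ≡ M
      star-size u u⊆H du char = sym (trans (sym (count r u H (suc (d ℕ.+ r)) u⊆H dH)) (trans (∑-cong subspaces λ z → sym (ℤ.*-identityʳ ⟦ Between? u H r z ⟧))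
        (trans (S.∑-reindex (Between? u H r) Y subspaces (λ _ → 1ℤ) Y-unique subspaces-unique (λ _ → refl) (λ {a} {b} → Between-resp {u} {H} {r} {a} {b})
          (λ y y∈ → subspaces-complete y , in-star y (Equivalence.to (char y) (S.∈⇒hits (≈-refl {x = y}) y∈)))
          (λ { z ((u⊆z , z⊆H) , dz) → Equivalence.from (char z) ((trans dz (sym d-1) , z⊆H) , u⊆z) })) (∑-1 Y))))
        where
        d-1 : d ∸ 1 ≡ dim u ℕ.+ r
        d-1 = trans (ℕ.suc-injective (trans suc-pred-d (sym t+r))) (cong (ℕ._+ r) (sym du))
        dH : dim H ≡ dim u ℕ.+ suc (d ℕ.+ r)
        dH = trans dim-H (trans (cong (λ w → w ℕ.+ (d ℕ.+ 0)) (sym t+r)) (trans (le t′ r d) (cong (ℕ._+ suc (d ℕ.+ r)) (sym du))))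
          where
          le : ∀ t′ r d → suc t′ ℕ.+ r ℕ.+ (d ℕ.+ 0) ≡ t′ ℕ.+ suc (d ℕ.+ r)
          le = solveℕ
        in-star : ∀ y → InX₂ y × u ⊆S y → Between u H r y
        in-star y ((dy , y⊆H) , u⊆y) = (u⊆y , y⊆H) , trans dy d-1

-- The theorem from the bound and the structure of extremal families.

open import Data.Nat using (ℕ; suc; _+_; _*_; _∸_; _≤_; _<_; z≤n; s≤s)
import Data.Nat.Properties as ℕ
open import Data.Nat.Tactic.RingSolver using (solve-∀)
import Data.Integer as ℤ
open import Data.Integer using (+_; drop‿+≤+)
import Data.Integer.Properties as ℤ
open import Data.List using (List; []; _∷_; length)
open import Data.List.Membership.Propositional using (_∈_)
open import Data.List.Relation.Unary.Any using (Any; here)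
open import Data.List.Relation.Unary.AllPairs using (AllPairs)
open import Data.Product using (Σ; _×_; _,_)
open import Relation.Nullary using (¬_; contradiction)
open import Relation.Binary.PropositionalEquality using (_≡_; _≢_; refl; sym; trans; cong; cong₂; subst; subst₂)
open import Function.Bundles using (_⇔_; mk⇔)

open TwistedGrassmann using (module Graph; module Extremal)

theorem3p1 : ∀ {q : ℕ} (F : FiniteField q) (d : ℕ) → 2 ≤ d →
    (H : LinAlg.Subspace F (suc (2 * d))) → LinAlg.dim F H ≡ 2 * d →
    let open LinAlg F in let open Twisted d H in
    (t : ℕ) → 0 < t → t < d →
    (Y : List (Subspace N)) → Y ≢ [] →
    AllPairs (λ a b → ¬ (a ≈S b)) Y →
    (∀ {x} → x ∈ Y → InX x) →
    (∀ {x y} → x ∈ Y → y ∈ Y → WithinDist (d ∸ t) x y) →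
    (length Y ≤ gauss q (suc (2 * d) ∸ t) (d ∸ t))
    × (length Y ≡ gauss q (suc (2 * d) ∸ t) (d ∸ t) ⇔
    Σ (Subspace N) λ u → u ⊆S H × dim u ≡ t ∸ 1 ×
    (∀ x → Any (λ y → x ≈S y) Y ⇔ (InX₂ x × u ⊆S x)))
theorem3p1 F d 2≤d H dim-H (suc t′) _ t<d [] Y≢[] = contradiction refl Y≢[]
theorem3p1 {q} F d 2≤d H dim-H (suc t′) _ t<d Y@(y₀ ∷ _) _ unique inX width =
  drop‿+≤+ (subst (λ w → + length Y ℤ.≤ w) M≡ size-bound) ,
  mk⇔ (λ e → Tight.structure (trans (cong +_ e) (sym M≡)) y₀ (here refl))
      (λ { (u , u⊆H , du , char) → ℤ.+-injective (trans (star-size u u⊆H du char) M≡) })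
  where
  -- `t<d` makes r = d - t a successor; r′ is its predecessor.
  r′ = d ∸ suc (suc t′)
  t+r : suc t′ + suc r′ ≡ d
  t+r = trans (ℕ.+-suc (suc t′) r′) (ℕ.m+[n∸m]≡n t<d)
  r≡ : d ∸ suc t′ ≡ suc r′
  r≡ = trans (cong (_∸ suc t′) (sym t+r)) (ℕ.m+n∸m≡n (suc t′) (suc r′))
  0<d : 0 < d
  0<d = ℕ.<-trans (s≤s z≤n) 2≤d
  open Graph F d 0<d H dim-H using (within⇒mm; mm)
  open Extremal F d 0<d H dim-H t′ r′ t+r
  far-enough : ∀ x y → x ∈ Y → y ∈ Y → suc t′ ≤ mm x y
  -- Width d - t gives d ≤ mm x y + (d - t), from which r = d - t is cancelled.
  far-enough x y x∈ y∈ = ℕ.+-cancelʳ-≤ (suc r′) (suc t′) (mm x y) (subst₂ _≤_ (sym t+r) (cong (λ w → mm x y + w) r≡) (within⇒mm (width x∈ y∈) (inX y∈)))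
  open Family Y unique (λ y → inX) far-enough
  M≡ : M ≡ + gauss q (suc (2 * d) ∸ suc t′) (d ∸ suc t′)
  -- Only one of the two copies of d in 2d + 1 is replaced by t + r, so that removing t leaves d + r
  -- + 1.
  M≡ = cong +_ (sym (cong₂ (gauss q) (trans (cong (_∸ suc t′) (trans (cong (λ w → suc (w + (d + 0))) (sym t+r)) (le (suc t′) (suc r′) d))) (ℕ.m+n∸m≡n (suc t′) (suc (d + suc r′)))) r≡))
    where
    le : ∀ t r d → suc (t + r + (d + 0)) ≡ t + suc (d + r)
    le = solve-∀
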